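{- Let $p$ be a prime with $p\equiv 3\pmod 4$, and let $E\subset P_3\subset \mathbb{F}_p^3$. (1) There are absolute constants $C,c>0$ such that if $|E|\ge C\,p^{\frac32-\frac14}$, then $|\prod(E)|\ge c\,p$. (2) Moreover, for any constants $C_1,c_1>0$ there is a constant $c_2>0$ such that if $|E|\le C_1 p^{5/4}$ and $\big|E\setminus\{(x_1,x_2,0)\colon (x_1,x_2)\in\mathbb{F}_p^2\}\big|\ge c_1|E|$, then $|\prod(E)|\ge c_2|E|^{2/3}$.
   Context: $\mathbb{F}_p$ is the prime field with $p$ elements. For $x,y\in\mathbb{F}_p^3$, $x\cdot y=x_1y_1+x_2y_2+x_3y_3$. For $E\subset\mathbb{F}_p^3$, $\prod(E):=\{x\cdot y\colon x,y\in E\}\subset \mathbb{F}_p$. The paraboloid is $P_3:=\{x\in\mathbb{F}_p^3\colon x_3=x_1^2+x_2^2\}$. -}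

module Defs where

open import Data.Nat as ℕ using (ℕ; zero; suc; NonZero)
open import Data.Nat.DivMod using (_%_; _mod_)
open import Data.Fin using (Fin; toℕ)
open import Data.Fin.Properties using () renaming (_≟_ to _≟ᶠ_)
open import Data.Product using (_×_; _,_)
open import Data.List using (List; length; filter; concatMap; map; allFin)
open import Data.List.Relation.Unary.Any using (any?)
open import Data.List.Relation.Unary.All using (All)
open import Data.List.Membership.Propositional using (_∈_)
open import Relation.Binary.PropositionalEquality using (_≡_; _≢_)
open import Relation.Nullary using (¬_)
open import Relation.Nullary.Decidable using (¬?)
open import Data.Integer using (+_)
open import Data.Rational using (ℚ; _/_; _*_)

-- Elements of 𝔽_p are represented by Fin p (canonical residues 0..p-1),
-- with arithmetic performed in ℕ and reduced modulo p.
Pt : ℕ → Set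
Pt p = Fin p × Fin p × Fin p

dot : (p : ℕ) → .{{NonZero p}} → Pt p → Pt p → Fin p
dot p (x₁ , x₂ , x₃) (y₁ , y₂ , y₃) =
  (toℕ x₁ ℕ.* toℕ y₁ ℕ.+ toℕ x₂ ℕ.* toℕ y₂ ℕ.+ toℕ x₃ ℕ.* toℕ y₃) mod p

InP3 : (p : ℕ) → .{{NonZero p}} → Pt p → Set
InP3 p (x₁ , x₂ , x₃) = toℕ x₃ ≡ (toℕ x₁ ℕ.* toℕ x₁ ℕ.+ toℕ x₂ ℕ.* toℕ x₂) % p

products : (p : ℕ) → .{{NonZero p}} → List (Pt p) → List (Fin p)
products p E = concatMap (λ x → map (λ y → dot p x y) E) E

prodSetSize : (p : ℕ) → .{{NonZero p}} → List (Pt p) → ℕ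
prodSetSize p E = length (filter (λ t → any? (λ s → t ≟ᶠ s) (products p E)) (allFin p))

offPlane : {p : ℕ} → List (Pt p) → List (Pt p)
offPlane {p} E = filter (λ x → ¬? (toℕ (Data.Product.proj₂ (Data.Product.proj₂ x)) ℕ.≟ 0)) E

ℕ→ℚ : ℕ → ℚ
ℕ→ℚ n = + n / 1

_^4 : ℚ → ℚ
q ^4 = q * q * q * q

_^3 : ℚ → ℚ
q ^3 = q * q * q

{-# OPTIONS --safe #-}

-- Write the points of E as (b , |b|²) with b in 𝔽_p², and let N be their number. For fixed b ≠ 0 and
-- a = - b / (2 |b|²), two points c and c' give the same product with b iff |a - c| = |a - c'|, so by
-- Cauchy-Schwarz it is enough to bound the number of triples (a , b , c) with a on the bisector of b and c.
-- Pairs (b , c) lying together on a generalized circle with at least 2 √N of the points contribute O(N²). For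
-- the others the triples are counted as incidences of points with weighted bisectors, and everything comes
-- down to the energy of the bisectors: the number of pairs of segments of a common length exchanged by a
-- reflection. As -1 is not a square, 𝔽_p² is the field K = 𝔽_p(i), and a segment becomes a vector of K²; two
-- segments are exchanged by a reflection only if these vectors are orthogonal for a symplectic form over 𝔽_p.
-- Such vectors correspond to crossing null lines in the space of symmetric 2 × 2 matrices. If there are too
-- many crossings, a polynomial of low degree vanishing on all lines, and the second order conditions at the
-- crossings along one line, force the lines crossing it to belong to a regulus; the corresponding points
-- then lie on a circle, which the removal of the rich circles excludes.
module Submission where

open import Defs
open import Algebra.Bundles using (CommutativeRing)
import Algebra.Properties.Group as GroupProperties
import Algebra.Properties.Ring as RingProperties
import Algebra.Properties.Semiring.Mult.TCOptimised as SemiringMult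
import Algebra.Solver.Ring as RingSolver
open import Algebra.Solver.Ring.AlmostCommutativeRing using (AlmostCommutativeRing; fromCommutativeRing; _-Raw-AlmostCommutative⟶_)
open import Algebra.Structures using (IsCommutativeRing)
open import Data.Empty using (⊥; ⊥-elim)
open import Data.Fin.Base using (Fin; toℕ)
import Data.Fin.Properties as Finₚ
open import Data.Integer.Base as ℤ using (ℤ; -[1+_]) renaming (+_ to pos)
import Data.Integer.Properties as ℤₚ
open import Data.List.Base using (List; []; _∷_; length; map; filter; cartesianProduct; cartesianProductWith; _++_; take; deduplicate; allFin)
import Data.List.Membership.DecPropositional as DecMembership
open import Data.List.Membership.Propositional using (_∈_; find)
open import Data.List.Membership.Propositional.Properties
  using (∈-allFin; ∈-cartesianProduct⁺; ∈-cartesianProduct⁻; ∈-cartesianProductWith⁺; ∈-concat⁺′; ∈-deduplicate⁺; ∈-deduplicate⁻; ∈-filter⁺; ∈-filter⁻; ∈-length; ∈-map⁺; ∈-map⁻; ∈-++⁺ˡ; ∈-++⁺ʳ; ∈-++⁻)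
import Data.List.Properties as Listₚ
open import Data.List.Relation.Unary.All as All using (All; []; _∷_)
import Data.List.Relation.Unary.All.Properties as Allₚ
open import Data.List.Relation.Unary.AllPairs using ([]; _∷_)
open import Data.List.Relation.Unary.Any as Any using (Any; here; there; any?)
import Data.List.Relation.Unary.Unique.DecPropositional.Properties as DecUniqueₚ
open import Data.List.Relation.Unary.Unique.Propositional using (Unique)
import Data.List.Relation.Unary.Unique.Propositional.Properties as Uniqueₚ
open import Data.Maybe.Base using (Maybe; just; nothing)
open import Data.Nat as ℕ using (ℕ; zero; suc; z≤n; s≤s; z<s; NonZero; _⊔_; _∸_; _%_; _^_)
open import Data.Nat.Coprimality using (coprime-Bézout; prime⇒coprime)
open import Data.Nat.Divisibility using (_∣_; divides; n∣m⇒m%n≡0; m%n≡0⇒n∣m; ∣m∣n⇒∣m+n; ∣m+n∣m⇒∣n; m∣m*n; n∣m*n)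
open import Data.Nat.DivMod using (_mod_; m%n%n≡m%n; %-distribˡ-+; %-distribˡ-*; m<n⇒m%n≡m; m%n<n)
open import Data.Nat.GCD using (module Bézout)
open import Data.Nat.Induction using (<-rec)
open import Data.Nat.Primality using (Prime)
import Data.Nat.Properties as ℕₚ
open import Data.Nat.Solver using (module +-*-Solver)
open import Data.Nat.Tactic.RingSolver using (solve-∀)
open import Data.Product using (_×_; _,_; proj₁; proj₂; Σ; ∃)
open import Data.Product.Properties using (≡-dec)
open import Data.Sum using (_⊎_; inj₁; inj₂)
open import Data.Unit using (⊤; tt)
open import Data.Vec.Base as Vec using (Vec; []; _∷_)
import Data.Vec.Properties as Vecₚ
open import Relation.Binary.Definitions using (DecidableEquality; tri<; tri≈; tri>)
open import Relation.Binary.PropositionalEquality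
open import Relation.Nullary using (¬_; Dec; yes; no)
open import Relation.Nullary.Decidable using (¬?; _×-dec_; _⊎-dec_; _→-dec_)
open import Relation.Unary using (Decidable)
open ℕₚ using (module ≤-Reasoning; *-mono-≤; *-monoʳ-≤; *-monoˡ-≤; +-mono-≤; +-monoʳ-≤; +-monoˡ-≤; +-suc; <-trans; <⇒≢; <⇒≤; m∸n+n≡m; m≤m+n; m≤m⊔n; m≤n*m; m≤n+m; m≤n⇒m≤1+n; m≤n⇒m⊓n≡m; m≤n⊔m; n≤0⇒n≡0; n≤1+n; pred-mono-≤; ≤-<-trans; ≤-pred; ≤-refl; ≤-reflexive; ≤-trans; ≮⇒≥; ≰⇒>; ⊔-lub)

-- The pin `a` comes from completing a square: |a - c|² - |a|² is the product of the points over b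
-- and c divided by |b|². The exponents come from a self-improving estimate. Let T count the triples
-- with |a - b| = |a - c|. Sorted by the length ρ of the segments, the energy of the bisectors is
-- about the sum of n(ρ)^(3/2), with n(ρ) the number of segments of length ρ; by Cauchy-Schwarz this
-- sum is at most N (N T₀)^(1/2) N^(1/2) up to a constant, where T₀ counts the triples with a among
-- the points themselves. If T₀ ≤ T, this gives T² = O(N² (N³ T)^(1/2)), that is T³ = O(N⁷). The
-- estimate is therefore set up for any list of N apexes and applied to the pins or to the points,
-- whichever has more triples. The obstacle is the characteristic: polynomials of degree about
-- n(ρ)^(1/2) must have degree below p. Two circles of equal radius share at most two points, so
-- n(ρ) = O(N^(3/2)), and N = O(p^(5/4)) keeps the degree at O(p^(15/16)). Larger sets are thinned
-- to this size, and small p is absorbed by the constants.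

record FiniteField : Set₁ where
  infixl 6 _+_
  infixl 7 _*_
  infix 8 -_ _⁻¹
  infix 4 _≟_
  field
    F : Set
    _+_ _*_ : F → F → F
    -_ : F → F
    0# 1# : F
    isCommutativeRing : IsCommutativeRing _≡_ _+_ _*_ -_ 0# 1#
    _≟_ : DecidableEquality F
    _⁻¹ : F → F
    *-inverse : ∀ x → x ≢ 0# → x * x ⁻¹ ≡ 1#
    elements : List F
    elements-complete : ∀ x → x ∈ elements
    elements-unique : Unique elements
  commutativeRing : CommutativeRing _ _
  commutativeRing = record { isCommutativeRing = isCommutativeRing }
  open SemiringMult (CommutativeRing.semiring commutativeRing) public using () renaming (_×_ to _·_)
  order : ℕ
  order = length elements
  field
    characteristic : ∀ n → 0 ℕ.< n → n ℕ.< order → n · 1# ≢ 0#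
    anisotropic : ∀ x y → x * x + y * y ≡ 0# → x ≡ 0#
    order≥7 : 7 ℕ.≤ order

-- Field arithmetic, with a ring solver over integer coefficients.

module FieldTheory (𝔽 : FiniteField) where
  open FiniteField 𝔽 public
  open CommutativeRing commutativeRing public using
    ( +-assoc; +-comm; +-identityˡ; +-identityʳ; -‿inverseˡ; -‿inverseʳ; *-assoc; *-comm
    ; *-identityˡ; *-identityʳ; distribˡ; distribʳ; zeroˡ; zeroʳ; semiring; ring)
  open RingProperties ring using (-‿+-comm; -‿involutive; -‿distribˡ-*; -‿distribʳ-*; -0#≈0#)
  open SemiringMult semiring using (×-homo-+; ×1-homo-*; 1+×)

  private
    ⟦_⟧ℤ : ℤ → F
    ⟦ pos n ⟧ℤ = n · 1#
    ⟦ -[1+ n ] ⟧ℤ = - (suc n · 1#)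

    -⟦⟧ : ∀ i → ⟦ ℤ.- i ⟧ℤ ≡ - ⟦ i ⟧ℤ
    -⟦⟧ (pos zero) = sym -0#≈0#
    -⟦⟧ (pos (suc n)) = refl
    -⟦⟧ -[1+ n ] = sym (-‿involutive _)

    cancel-1 : ∀ a b → a + - b ≡ (1# + a) + - (1# + b)
    cancel-1 a b = sym (trans (cong₂ _+_ (+-comm 1# a) (sym (-‿+-comm 1# b)))
      (trans (+-assoc a 1# _) (cong (_+_ a) (trans (sym (+-assoc 1# _ _)) (trans (cong (_+ - b) (-‿inverseʳ 1#)) (+-identityˡ _))))))

    ⊖-homo : ∀ m n → ⟦ m ℤ.⊖ n ⟧ℤ ≡ m · 1# + - (n · 1#)
    ⊖-homo zero zero = trans (sym (-‿inverseʳ 0#)) refl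
    ⊖-homo zero (suc n) = sym (+-identityˡ _)
    ⊖-homo (suc m) zero = sym (trans (cong (_+_ (suc m · 1#)) -0#≈0#) (+-identityʳ _))
    ⊖-homo (suc m) (suc n) = trans (cong ⟦_⟧ℤ (ℤₚ.[1+m]⊖[1+n]≡m⊖n m n)) (trans (⊖-homo m n)
      (trans (cancel-1 _ _) (sym (cong₂ (λ a b → a + - b) (1+× m 1#) (1+× n 1#)))))

    +-homo : ∀ i j → ⟦ i ℤ.+ j ⟧ℤ ≡ ⟦ i ⟧ℤ + ⟦ j ⟧ℤ
    +-homo (pos m) (pos n) = ×-homo-+ 1# m n
    +-homo (pos m) -[1+ n ] = ⊖-homo m (suc n)
    +-homo -[1+ m ] (pos n) = trans (⊖-homo n (suc m)) (+-comm _ _)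
    +-homo -[1+ m ] -[1+ n ] = trans (cong -_ (trans (cong (_· 1#) (cong suc (sym (+-suc m n)))) (×-homo-+ 1# (suc m) (suc n)))) (sym (-‿+-comm _ _))

    *-homo : ∀ i j → ⟦ i ℤ.* j ⟧ℤ ≡ ⟦ i ⟧ℤ * ⟦ j ⟧ℤ
    *-homo (pos m) (pos n) = trans (cong ⟦_⟧ℤ (sym (ℤₚ.pos-* m n))) (×1-homo-* m n)
    *-homo (pos m) -[1+ n ] = trans (cong ⟦_⟧ℤ (trans (sym (ℤₚ.neg-distribʳ-* (pos m) (pos (suc n)))) refl))
      (trans (-⟦⟧ (pos m ℤ.* pos (suc n))) (trans (cong -_ (*-homo (pos m) (pos (suc n)))) (-‿distribʳ-* _ _)))
    *-homo -[1+ m ] (pos n) = trans (cong ⟦_⟧ℤ (trans (sym (ℤₚ.neg-distribˡ-* (pos (suc m)) (pos n))) refl))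
      (trans (-⟦⟧ (pos (suc m) ℤ.* pos n)) (trans (cong -_ (*-homo (pos (suc m)) (pos n))) (-‿distribˡ-* _ _)))
    *-homo -[1+ m ] -[1+ n ] = trans (×1-homo-* (suc m) (suc n))
      (trans (sym (-‿involutive _)) (trans (cong -_ (-‿distribˡ-* _ _)) (-‿distribʳ-* _ _)))

    almost : AlmostCommutativeRing _ _
    almost = fromCommutativeRing commutativeRing

    morphism : CommutativeRing.rawRing ℤₚ.+-*-commutativeRing -Raw-AlmostCommutative⟶ almost
    morphism = record
      { ⟦_⟧ = ⟦_⟧ℤ ; +-homo = +-homo ; *-homo = *-homo ; -‿homo = -⟦⟧
      ; 0-homo = refl ; 1-homo = refl }

    coeff≟ : ∀ i j → Maybe (⟦ i ⟧ℤ ≡ ⟦ j ⟧ℤ)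
    coeff≟ i j with i ℤₚ.≟ j
    ... | yes e = just (cong ⟦_⟧ℤ e)
    ... | no _ = nothing

  open RingSolver (CommutativeRing.rawRing ℤₚ.+-*-commutativeRing) almost morphism coeff≟ public
    using (Polynomial; solve; _:=_; _:+_; _:*_; _:-_; :-_; con)

  κ : ∀ {n} → ℕ → Polynomial n
  κ n = con (pos n)

  infixl 6 _-_
  _-_ : F → F → F
  x - y = x + - y

  sq : F → F
  sq x = x * x

  x-x≡0 : ∀ {x y} → x ≡ y → x - y ≡ 0#
  x-x≡0 {x} refl = -‿inverseʳ x

  ≡-by-difference : ∀ {x y} → x - y ≡ 0# → x ≡ y
  ≡-by-difference {x} {y} e = trans (solve 2 (λ x y → x := y :+ (x :- y)) refl x y) (trans (cong (y +_) e) (+-identityʳ y))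

  cong₃ : ∀ (g : F → F → F → F) {x y z x' y' z'} → x ≡ x' → y ≡ y' → z ≡ z' → g x y z ≡ g x' y' z'
  cong₃ g refl refl refl = refl

  -- Certificates of ideal membership: a consequence of polynomial equations is proved by exhibiting
  -- cofactors of the equations and checking one identity with `solve`. Most geometric computations
  -- below have this form.
  combine₁ : ∀ {a b} c {l r} → l ≡ r → a ≡ b + c * (l - r) → a ≡ b
  combine₁ {b = b} c h e = trans e (trans (cong (λ z → b + c * z) (x-x≡0 h)) (trans (cong (b +_) (zeroʳ c)) (+-identityʳ b)))

  combine₂ : ∀ {a b} c {l r} c' {l' r'} → l ≡ r → l' ≡ r' → a ≡ b + c * (l - r) + c' * (l' - r') → a ≡ b
  combine₂ c c' h h' e = combine₁ c h (combine₁ c' h' e)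

  combine₃ : ∀ {a b} c {l r} c' {l' r'} c″ {l″ r″} → l ≡ r → l' ≡ r' → l″ ≡ r″ →
    a ≡ b + c * (l - r) + c' * (l' - r') + c″ * (l″ - r″) → a ≡ b
  combine₃ c c' c″ h h' h″ e = combine₂ c c' h h' (combine₁ c″ h″ e)

  *-cancelˡ-0 : ∀ {x y} → x ≢ 0# → x * y ≡ 0# → y ≡ 0#
  *-cancelˡ-0 {x} {y} x≢0 e =
    trans (sym (*-identityˡ y)) (trans (cong (_* y) (sym (trans (*-comm _ _) (*-inverse x x≢0))))
      (trans (*-assoc _ _ _) (trans (cong (x ⁻¹ *_) e) (zeroʳ _))))

  *-cancelˡ : ∀ {x y z} → x ≢ 0# → x * y ≡ x * z → y ≡ z
  *-cancelˡ {x} {y} {z} x≢0 e = ≡-by-difference (*-cancelˡ-0 x≢0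
    (trans (solve 3 (λ x y z → x :* (y :- z) := x :* y :- x :* z) refl x y z) (x-x≡0 e)))

  no-zero-divisors : ∀ {x y} → x * y ≡ 0# → x ≡ 0# ⊎ y ≡ 0#
  no-zero-divisors {x} e with x ≟ 0#
  ... | yes x≡0 = inj₁ x≡0
  ... | no x≢0 = inj₂ (*-cancelˡ-0 x≢0 e)

  *-≢0 : ∀ {x y} → x ≢ 0# → y ≢ 0# → x * y ≢ 0#
  *-≢0 x≢0 y≢0 e = y≢0 (*-cancelˡ-0 x≢0 e)

  sq≡0 : ∀ {x} → x * x ≡ 0# → x ≡ 0#
  sq≡0 e with no-zero-divisors e
  ... | inj₁ q = q
  ... | inj₂ q = q

  sq+sq≡0 : ∀ {x y} → x * x + y * y ≡ 0# → x ≡ 0# × y ≡ 0#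
  sq+sq≡0 {x} {y} e = anisotropic x y e , anisotropic y x (trans (+-comm _ _) e)

  2# : F
  2# = 1# + 1#

  1≢0 : 1# ≢ 0#
  1≢0 = characteristic 1 z<s (≤-trans (s≤s (s≤s z≤n)) order≥7)

  2≢0 : 2# ≢ 0#
  2≢0 = characteristic 2 z<s (≤-trans (s≤s (s≤s (s≤s z≤n))) order≥7)

  difference≢0 : ∀ {x y} → x ≢ y → x - y ≢ 0#
  difference≢0 n e = n (≡-by-difference e)

  suc-· : ∀ n → suc n · 1# ≡ 1# + n · 1#
  suc-· n = 1+× n 1#

-- Polynomials as expressions: degrees, derivatives and roots below the characteristic.

module Polynomials (𝔽 : FiniteField) where
  open FieldTheory 𝔽
  open import Data.Nat using (_≤_; _<_)
  infixl 6 _⊕_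
  infixl 7 _⊗_

  -- Expressions rather than coefficients: products, derivatives and restrictions to lines are then
  -- immediate. Different expressions may have the same values; `D-vanishes` shows that derivatives
  -- depend only on the values while the sizes are at most `order`.
  data Poly (V : Set) : Set where
    𝟘 : Poly V
    cst : F → Poly V
    var : V → Poly V
    _⊕_ _⊗_ : Poly V → Poly V → Poly V

  eval : {V : Set} → (V → F) → Poly V → F
  eval ρ 𝟘 = 0#
  eval ρ (cst c) = c
  eval ρ (var v) = ρ v
  eval ρ (e ⊕ f) = eval ρ e + eval ρ f
  eval ρ (e ⊗ f) = eval ρ e * eval ρ f

  -- The direction `d` is a constant vector, so iterating gives the Hessian and the third
  -- derivatives in prescribed directions.
  ∂ : {V : Set} → (V → F) → Poly V → Poly V
  ∂ d 𝟘 = 𝟘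
  ∂ d (cst c) = 𝟘
  ∂ d (var v) = cst (d v)
  ∂ d (e ⊕ f) = ∂ d e ⊕ ∂ d f
  ∂ d (e ⊗ f) = ∂ d e ⊗ f ⊕ e ⊗ ∂ d f

  -- The degree is shifted by one, so that 0 is the degree of the zero polynomial
  -- and the size of a product of sizes m + 1 and n + 1 is m + n + 1.
  sizeProduct : ℕ → ℕ → ℕ
  sizeProduct zero n = 0
  sizeProduct (suc m) zero = 0
  sizeProduct (suc m) (suc n) = suc (m ℕ.+ n)

  size : {V : Set} → Poly V → ℕ
  size 𝟘 = 0
  size (cst c) = 1
  size (var v) = 2
  size (e ⊕ f) = size e ⊔ size f
  size (e ⊗ f) = sizeProduct (size e) (size f)

  sizeProduct-mono : ∀ {a b c d} → a ≤ b → c ≤ d → sizeProduct a c ≤ sizeProduct b d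
  sizeProduct-mono z≤n _ = z≤n
  sizeProduct-mono {suc a} (s≤s _) z≤n = z≤n
  sizeProduct-mono (s≤s p) (s≤s q) = s≤s (+-mono-≤ p q)

  sizeProduct≤+ : ∀ a b → sizeProduct a b ≤ a ℕ.+ b
  sizeProduct≤+ zero b = z≤n
  sizeProduct≤+ (suc a) zero = z≤n
  sizeProduct≤+ (suc a) (suc b) = s≤s (+-monoʳ-≤ a (n≤1+n b))

  size-⊗ : ∀ {V : Set} (e f : Poly V) {a b} → size e ≤ a → size f ≤ b → size (e ⊗ f) ≤ a ℕ.+ b
  size-⊗ e f p q = ≤-trans (sizeProduct≤+ (size e) (size f)) (+-mono-≤ p q)

  sizeProduct-predˡ : ∀ a b → sizeProduct (ℕ.pred a) b ≤ ℕ.pred (sizeProduct a b)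
  sizeProduct-predˡ zero b = z≤n
  sizeProduct-predˡ (suc zero) b = z≤n
  sizeProduct-predˡ (suc (suc a)) zero = z≤n
  sizeProduct-predˡ (suc (suc a)) (suc b) = ≤-refl

  sizeProduct-predʳ : ∀ a b → sizeProduct a (ℕ.pred b) ≤ ℕ.pred (sizeProduct a b)
  sizeProduct-predʳ zero b = z≤n
  sizeProduct-predʳ (suc a) zero = z≤n
  sizeProduct-predʳ (suc a) (suc zero) = z≤n
  sizeProduct-predʳ (suc a) (suc (suc b)) = ≤-reflexive (sym (+-suc a b))

  size-∂ : ∀ {V : Set} d (e : Poly V) → size (∂ d e) ≤ ℕ.pred (size e)
  size-∂ d 𝟘 = z≤n
  size-∂ d (cst c) = z≤n
  size-∂ d (var v) = ≤-refl
  size-∂ d (e ⊕ f) = ⊔-lub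
    (≤-trans (size-∂ d e) (pred-mono-≤ (m≤m⊔n (size e) (size f))))
    (≤-trans (size-∂ d f) (pred-mono-≤ (m≤n⊔m (size e) (size f))))
  size-∂ d (e ⊗ f) = ⊔-lub
    (≤-trans (sizeProduct-mono (size-∂ d e) (≤-refl {size f})) (sizeProduct-predˡ (size e) (size f)))
    (≤-trans (sizeProduct-mono (≤-refl {size e}) (size-∂ d f)) (sizeProduct-predʳ (size e) (size f)))

  size-∂≤ : ∀ {V : Set} d (e : Poly V) → size (∂ d e) ≤ size e
  size-∂≤ d e = ≤-trans (size-∂ d e) ℕₚ.pred[n]≤n

  ∂-comm : ∀ {V : Set} ρ d d' (e : Poly V) → eval ρ (∂ d (∂ d' e)) ≡ eval ρ (∂ d' (∂ d e))
  ∂-comm ρ d d' 𝟘 = refl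
  ∂-comm ρ d d' (cst c) = refl
  ∂-comm ρ d d' (var v) = refl
  ∂-comm ρ d d' (e ⊕ f) = cong₂ _+_ (∂-comm ρ d d' e) (∂-comm ρ d d' f)
  ∂-comm ρ d d' (e ⊗ f) = trans (cong₂ (λ x y → (x * eval ρ f + eval ρ (∂ d' e) * eval ρ (∂ d f)) + (eval ρ (∂ d e) * eval ρ (∂ d' f) + eval ρ e * y))
      (∂-comm ρ d d' e) (∂-comm ρ d d' f))
    (solve 8 (λ x f a b c g e y → (x :* f :+ a :* b) :+ (c :* g :+ e :* y) := (x :* f :+ c :* g) :+ (a :* b :+ e :* y)) refl _ _ _ _ _ _ _ _)

  ∂-linear : ∀ {V : Set} ρ α β (d d' d″ : V → F) → (∀ v → d v ≡ α * d' v + β * d″ v) → ∀ (e : Poly V) →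
    eval ρ (∂ d e) ≡ α * eval ρ (∂ d' e) + β * eval ρ (∂ d″ e)
  ∂-linear ρ α β d d' d″ h 𝟘 = solve 2 (λ α β → κ 0 := α :* κ 0 :+ β :* κ 0) refl α β
  ∂-linear ρ α β d d' d″ h (cst c) = solve 2 (λ α β → κ 0 := α :* κ 0 :+ β :* κ 0) refl α β
  ∂-linear ρ α β d d' d″ h (var v) = h v
  ∂-linear ρ α β d d' d″ h (e ⊕ f) = trans (cong₂ _+_ (∂-linear ρ α β d d' d″ h e) (∂-linear ρ α β d d' d″ h f))
    (solve 6 (λ α β a b c d → (α :* a :+ β :* b) :+ (α :* c :+ β :* d) := α :* (a :+ c) :+ β :* (b :+ d)) refl _ _ _ _ _ _)
  ∂-linear ρ α β d d' d″ h (e ⊗ f) = trans (cong₂ (λ x y → x * eval ρ f + eval ρ e * y) (∂-linear ρ α β d d' d″ h e) (∂-linear ρ α β d d' d″ h f))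
    (solve 8 (λ α β a b c d e f → (α :* a :+ β :* b) :* f :+ e :* (α :* c :+ β :* d) := α :* (a :* f :+ e :* c) :+ β :* (b :* f :+ e :* d)) refl _ _ _ _ _ _ _ _)

  Poly₁ : Set
  Poly₁ = Poly ⊤

  infix 30 _at_
  _at_ : Poly₁ → F → F
  e at t = eval (λ _ → t) e

  D : Poly₁ → Poly₁
  D = ∂ (λ _ → 1#)

  X : Poly₁
  X = var tt

  restrict : {V : Set} → (V → F) → (V → F) → Poly V → Poly₁
  restrict s d 𝟘 = 𝟘
  restrict s d (cst c) = cst c
  restrict s d (var v) = cst (s v) ⊕ cst (d v) ⊗ X
  restrict s d (e ⊕ f) = restrict s d e ⊕ restrict s d f
  restrict s d (e ⊗ f) = restrict s d e ⊗ restrict s d f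

  restrict-at : ∀ {V : Set} s d (e : Poly V) t → restrict s d e at t ≡ eval (λ v → s v + d v * t) e
  restrict-at s d 𝟘 t = refl
  restrict-at s d (cst c) t = refl
  restrict-at s d (var v) t = refl
  restrict-at s d (e ⊕ f) t = cong₂ _+_ (restrict-at s d e t) (restrict-at s d f t)
  restrict-at s d (e ⊗ f) t = cong₂ _*_ (restrict-at s d e t) (restrict-at s d f t)

  D-restrict : ∀ {V : Set} s d (e : Poly V) t → D (restrict s d e) at t ≡ restrict s d (∂ d e) at t
  D-restrict s d 𝟘 t = refl
  D-restrict s d (cst c) t = refl
  D-restrict s d (var v) t = solve 2 (λ c t → κ 0 :+ (κ 0 :* t :+ c :* κ 1) := c) refl (d v) t
  D-restrict s d (e ⊕ f) t = cong₂ _+_ (D-restrict s d e t) (D-restrict s d f t)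
  D-restrict s d (e ⊗ f) t = cong₂ (λ x y → x * restrict s d f at t + restrict s d e at t * y) (D-restrict s d e t) (D-restrict s d f t)

  size-restrict : ∀ {V : Set} s d (e : Poly V) → size (restrict s d e) ≡ size e
  size-restrict s d 𝟘 = refl
  size-restrict s d (cst c) = refl
  size-restrict s d (var v) = refl
  size-restrict s d (e ⊕ f) = cong₂ _⊔_ (size-restrict s d e) (size-restrict s d f)
  size-restrict s d (e ⊗ f) = cong₂ sizeProduct (size-restrict s d e) (size-restrict s d f)

  horner : List F → F → F
  horner [] t = 0#
  horner (c ∷ cs) t = c + t * horner cs t

  horner' : List F → F → F
  horner' [] t = 0#
  horner' (c ∷ cs) t = horner cs t + t * horner' cs t

  addL : List F → List F → List F
  addL [] ys = ys
  addL (x ∷ xs) [] = x ∷ xs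
  addL (x ∷ xs) (y ∷ ys) = x + y ∷ addL xs ys

  mulL : List F → List F → List F
  mulL [] ys = []
  mulL (x ∷ xs) [] = []
  mulL (x ∷ xs) ys@(_ ∷ _) = addL (map (x *_) ys) (0# ∷ mulL xs ys)

  horner-add : ∀ xs ys t → horner (addL xs ys) t ≡ horner xs t + horner ys t
  horner-add [] ys t = sym (+-identityˡ _)
  horner-add (x ∷ xs) [] t = sym (+-identityʳ _)
  horner-add (x ∷ xs) (y ∷ ys) t = trans (cong (λ z → x + y + t * z) (horner-add xs ys t))
    (solve 5 (λ x y t a b → x :+ y :+ t :* (a :+ b) := x :+ t :* a :+ (y :+ t :* b)) refl _ _ _ _ _)

  horner'-add : ∀ xs ys t → horner' (addL xs ys) t ≡ horner' xs t + horner' ys t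
  horner'-add [] ys t = sym (+-identityˡ _)
  horner'-add (x ∷ xs) [] t = sym (+-identityʳ _)
  horner'-add (x ∷ xs) (y ∷ ys) t = trans (cong₂ (λ w z → w + t * z) (horner-add xs ys t) (horner'-add xs ys t))
    (solve 5 (λ c d t a b → c :+ d :+ t :* (a :+ b) := c :+ t :* a :+ (d :+ t :* b)) refl _ _ _ _ _)

  horner-scale : ∀ c xs t → horner (map (c *_) xs) t ≡ c * horner xs t
  horner-scale c [] t = sym (zeroʳ c)
  horner-scale c (x ∷ xs) t = trans (cong (λ z → c * x + t * z) (horner-scale c xs t))
    (solve 4 (λ c x t a → c :* x :+ t :* (c :* a) := c :* (x :+ t :* a)) refl _ _ _ _)

  horner'-scale : ∀ c xs t → horner' (map (c *_) xs) t ≡ c * horner' xs t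
  horner'-scale c [] t = sym (zeroʳ c)
  horner'-scale c (x ∷ xs) t = trans (cong₂ (λ w z → w + t * z) (horner-scale c xs t) (horner'-scale c xs t))
    (solve 4 (λ c x t a → c :* x :+ t :* (c :* a) := c :* (x :+ t :* a)) refl _ _ _ _)

  horner-mul : ∀ xs ys t → horner (mulL xs ys) t ≡ horner xs t * horner ys t
  horner-mul [] ys t = sym (zeroˡ _)
  horner-mul (x ∷ xs) [] t = sym (zeroʳ _)
  horner-mul (x ∷ xs) ys@(_ ∷ _) t = trans (horner-add (map (x *_) ys) (0# ∷ mulL xs ys) t)
    (trans (cong₂ (λ w z → w + (0# + t * z)) (horner-scale x ys t) (horner-mul xs ys t))
      (solve 4 (λ x t a b → x :* b :+ (κ 0 :+ t :* (a :* b)) := (x :+ t :* a) :* b) refl x t (horner xs t) (horner ys t)))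

  horner'-mul : ∀ xs ys t → horner' (mulL xs ys) t ≡ horner' xs t * horner ys t + horner xs t * horner' ys t
  horner'-mul [] ys t = solve 2 (λ a b → κ 0 := κ 0 :* a :+ κ 0 :* b) refl (horner ys t) (horner' ys t)
  horner'-mul (x ∷ xs) [] t = solve 2 (λ a b → κ 0 := a :* κ 0 :+ b :* κ 0) refl (horner' (x ∷ xs) t) (horner (x ∷ xs) t)
  horner'-mul (x ∷ xs) ys@(_ ∷ _) t = trans (horner'-add (map (x *_) ys) (0# ∷ mulL xs ys) t)
    (trans (cong₂ _+_ (horner'-scale x ys t) (cong₂ (λ w z → w + t * z) (horner-mul xs ys t) (horner'-mul xs ys t)))
      (solve 6 (λ x t a a' b b' → x :* b' :+ (a :* b :+ t :* (a' :* b :+ a :* b')) := (a :+ t :* a') :* b :+ (x :+ t :* a) :* b') refl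
        x t (horner xs t) (horner' xs t) (horner ys t) (horner' ys t)))

  length-add : ∀ xs ys → length (addL xs ys) ≡ length xs ⊔ length ys
  length-add [] ys = refl
  length-add (x ∷ xs) [] = refl
  length-add (x ∷ xs) (y ∷ ys) = cong suc (length-add xs ys)

  length-scale : ∀ c (xs : List F) → length (map (c *_) xs) ≡ length xs
  length-scale c [] = refl
  length-scale c (x ∷ xs) = cong suc (length-scale c xs)

  length-mul : ∀ xs ys → length (mulL xs ys) ≤ sizeProduct (length xs) (length ys)
  length-mul [] ys = z≤n
  length-mul (x ∷ xs) [] = z≤n
  length-mul (x ∷ xs) ys@(_ ∷ ys') = ≤-trans (≤-reflexive (length-add (map (x *_) ys) (0# ∷ mulL xs ys)))
    (⊔-lub (≤-trans (≤-reflexive (length-scale x ys)) (s≤s (m≤n+m (length ys') (length xs))))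
      (s≤s (≤-trans (length-mul xs ys) (bound (length xs)))))
    where
    bound : ∀ m → sizeProduct m (suc (length ys')) ≤ m ℕ.+ length ys'
    bound zero = z≤n
    bound (suc m) = ≤-refl

  coefficients : Poly₁ → List F
  coefficients 𝟘 = []
  coefficients (cst c) = c ∷ []
  coefficients (var v) = 0# ∷ 1# ∷ []
  coefficients (e ⊕ f) = addL (coefficients e) (coefficients f)
  coefficients (e ⊗ f) = mulL (coefficients e) (coefficients f)

  length-coefficients : ∀ e → length (coefficients e) ≤ size e
  length-coefficients 𝟘 = z≤n
  length-coefficients (cst c) = ≤-refl
  length-coefficients (var v) = ≤-refl
  length-coefficients (e ⊕ f) = ≤-trans (≤-reflexive (length-add (coefficients e) (coefficients f)))
    (ℕₚ.⊔-mono-≤ (length-coefficients e) (length-coefficients f))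
  length-coefficients (e ⊗ f) = ≤-trans (length-mul (coefficients e) (coefficients f))
    (sizeProduct-mono (length-coefficients e) (length-coefficients f))

  at-coefficients : ∀ e t → e at t ≡ horner (coefficients e) t
  at-coefficients 𝟘 t = refl
  at-coefficients (cst c) t = solve 2 (λ c t → c := c :+ t :* κ 0) refl c t
  at-coefficients (var v) t = solve 1 (λ t → t := κ 0 :+ t :* (κ 1 :+ t :* κ 0)) refl t
  at-coefficients (e ⊕ f) t = trans (cong₂ _+_ (at-coefficients e t) (at-coefficients f t)) (sym (horner-add (coefficients e) (coefficients f) t))
  at-coefficients (e ⊗ f) t = trans (cong₂ _*_ (at-coefficients e t) (at-coefficients f t)) (sym (horner-mul (coefficients e) (coefficients f) t))

  D-coefficients : ∀ e t → D e at t ≡ horner' (coefficients e) t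
  D-coefficients 𝟘 t = refl
  D-coefficients (cst c) t = solve 1 (λ t → κ 0 := κ 0 :+ t :* κ 0) refl t
  D-coefficients (var v) t = solve 1 (λ t → κ 1 := κ 1 :+ t :* κ 0 :+ t :* (κ 0 :+ t :* κ 0)) refl t
  D-coefficients (e ⊕ f) t = trans (cong₂ _+_ (D-coefficients e t) (D-coefficients f t)) (sym (horner'-add (coefficients e) (coefficients f) t))
  D-coefficients (e ⊗ f) t = trans (cong₂ _+_ (cong₂ _*_ (D-coefficients e t) (at-coefficients f t)) (cong₂ _*_ (at-coefficients e t) (D-coefficients f t)))
    (sym (horner'-mul (coefficients e) (coefficients f) t))

  quotient : F → List F → List F
  quotient r [] = []
  quotient r (c ∷ cs) = addL cs (map (r *_) (quotient r cs))

  length-quotient : ∀ r c cs → length (quotient r (c ∷ cs)) ≤ length cs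
  length-quotient r c [] = z≤n
  length-quotient r c cs@(c' ∷ cs') = ≤-trans (≤-reflexive (length-add cs (map (r *_) (quotient r cs))))
    (⊔-lub ≤-refl (≤-trans (≤-reflexive (length-scale r (quotient r cs))) (m≤n⇒m≤1+n (length-quotient r c' cs'))))

  horner-quotient : ∀ r xs t → horner xs t ≡ horner xs r + (t - r) * horner (quotient r xs) t
  horner-quotient r [] t = solve 2 (λ r t → κ 0 := κ 0 :+ (t :- r) :* κ 0) refl r t
  horner-quotient r (c ∷ cs) t = trans (cong (λ z → c + t * z) (horner-quotient r cs t))
    (trans (solve 5 (λ c t r a q → c :+ t :* (a :+ (t :- r) :* q) := c :+ r :* a :+ (t :- r) :* ((a :+ (t :- r) :* q) :+ r :* q)) refl
       c t r (horner cs r) (horner (quotient r cs) t))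
     (cong (λ z → c + r * horner cs r + (t - r) * z)
       (sym (trans (horner-add cs (map (r *_) (quotient r cs)) t) (cong₂ _+_ (horner-quotient r cs t) (horner-scale r (quotient r cs) t))))))

  -- Synthetic division by t - r shortens the list by one, and the other roots pass to the quotient
  -- because t - r does not vanish there.
  vanishes-by-roots : ∀ rs → Unique rs → ∀ xs → length xs ≤ length rs → All (λ r → horner xs r ≡ 0#) rs → ∀ t → horner xs t ≡ 0#
  vanishes-by-roots rs u [] _ _ t = refl
  vanishes-by-roots (r ∷ rs) (r∉ ∷ u) xs@(c ∷ cs) (s≤s l) (z ∷ zs) t =
    trans (horner-quotient r xs t) (trans (cong₂ (λ a b → a + (t - r) * b) z
      (vanishes-by-roots rs u (quotient r xs) (≤-trans (length-quotient r c cs) l) (roots rs r∉ zs) t))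
      (trans (+-identityˡ _) (zeroʳ _)))
    where
    roots : ∀ rs → All (λ y → r ≢ y) rs → All (λ y → horner xs y ≡ 0#) rs → All (λ y → horner (quotient r xs) y ≡ 0#) rs
    roots [] [] [] = []
    roots (y ∷ ys) (r≢y ∷ ns) (e ∷ es) = *-cancelˡ-0 (difference≢0 (λ q → r≢y (sym q)))
      (trans (sym (trans (horner-quotient r xs y) (trans (cong (_+ (y - r) * horner (quotient r xs) y) z) (+-identityˡ _)))) e) ∷ roots ys ns es

  at-vanishes-by-roots : ∀ rs → Unique rs → ∀ e → size e ≤ length rs → All (λ r → e at r ≡ 0#) rs → ∀ t → e at t ≡ 0#
  at-vanishes-by-roots rs u e l zs t = trans (at-coefficients e t)
    (vanishes-by-roots rs u (coefficients e) (≤-trans (length-coefficients e) l) (All.map (λ {r} z → trans (sym (at-coefficients e r)) z) zs) t)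

  remove-one : ∀ {A : Set} {x : A} {xs} → Unique xs → x ∈ xs → Σ (List A) λ ys → Unique ys × length xs ≡ suc (length ys) × All (x ≢_) ys × All (_∈ xs) ys
  remove-one {xs = x ∷ xs} (n ∷ u) (here refl) = xs , u , refl , n , All.tabulate there
  remove-one {xs = y ∷ xs} (n ∷ u) (there i) with remove-one u i
  ... | ys , uy , l , ny , m = y ∷ ys , All.map (λ q → All.lookup n q) m ∷ uy , cong suc l , (λ e → All.lookup n i (sym e)) ∷ ny , here refl ∷ All.map there m

  nonzeros : List F
  nonzeros = proj₁ (remove-one elements-unique (elements-complete 0#))

  nonzeros-unique : Unique nonzeros
  nonzeros-unique = proj₁ (proj₂ (remove-one elements-unique (elements-complete 0#)))

  length-nonzeros : order ≡ suc (length nonzeros)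
  length-nonzeros = proj₁ (proj₂ (proj₂ (remove-one elements-unique (elements-complete 0#))))

  nonzeros-≢0 : All (0# ≢_) nonzeros
  nonzeros-≢0 = proj₁ (proj₂ (proj₂ (proj₂ (remove-one elements-unique (elements-complete 0#)))))

  vanishes-off-0 : ∀ e → size e < order → (∀ t → t ≢ 0# → e at t ≡ 0#) → ∀ t → e at t ≡ 0#
  vanishes-off-0 e l h = at-vanishes-by-roots nonzeros nonzeros-unique e (≤-pred (≤-trans l (≤-reflexive length-nonzeros)))
    (All.map (λ {r} n → h r (λ q → n (sym q))) nonzeros-≢0)

  -- The value at 0 gives the constant term; the remaining factor then vanishes at the `order` - 1
  -- nonzero points, which is enough for its length.
  vanishing-coefficients : ∀ xs → length xs ≤ order → (∀ t → horner xs t ≡ 0#) → All (_≡ 0#) xs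
  vanishing-coefficients [] _ h = []
  vanishing-coefficients (c ∷ cs) l h = c≡0 ∷ vanishing-coefficients cs (≤-trans (n≤1+n _) l)
    (vanishes-by-roots nonzeros nonzeros-unique cs (≤-pred (≤-trans l (≤-reflexive length-nonzeros)))
      (All.map (λ {r} n → *-cancelˡ-0 (λ q → n (sym q)) (trans (sym (trans (cong (_+ r * horner cs r) c≡0) (+-identityˡ _))) (h r))) nonzeros-≢0))
    where
    c≡0 : c ≡ 0#
    c≡0 = trans (solve 2 (λ c a → c := c :+ κ 0 :* a) refl c (horner cs 0#)) (h 0#)

  horner-zeros : ∀ {xs} → All (_≡ 0#) xs → ∀ t → horner xs t ≡ 0#
  horner-zeros [] t = refl
  horner-zeros (refl ∷ zs) t = trans (cong (λ z → 0# + t * z) (horner-zeros zs t)) (trans (+-identityˡ _) (zeroʳ t))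

  horner'-zeros : ∀ {xs} → All (_≡ 0#) xs → ∀ t → horner' xs t ≡ 0#
  horner'-zeros [] t = refl
  horner'-zeros (refl ∷ zs) t = trans (cong₂ (λ w z → w + t * z) (horner-zeros zs t) (horner'-zeros zs t)) (trans (+-identityˡ _) (zeroʳ t))

  -- The bound is sharp: t ^ p - t has size p + 1, vanishes everywhere and has derivative -1.
  D-vanishes : ∀ e → size e ≤ order → (∀ t → e at t ≡ 0#) → ∀ t → D e at t ≡ 0#
  D-vanishes e l h t = trans (D-coefficients e t) (horner'-zeros (vanishing-coefficients (coefficients e)
    (≤-trans (length-coefficients e) l) (λ t → trans (sym (at-coefficients e t)) (h t))) t)

  -- The coefficients of k f + t f', in which the i-th coefficient of f is multiplied by k + i. For
  -- k = 1 this is the derivative of t f, and the multipliers are invertible as long as they stay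
  -- below `order`.
  weighted : ℕ → List F → List F
  weighted k [] = []
  weighted k (c ∷ cs) = k · 1# * c ∷ weighted (suc k) cs

  length-weighted : ∀ k cs → length (weighted k cs) ≡ length cs
  length-weighted k [] = refl
  length-weighted k (c ∷ cs) = cong suc (length-weighted (suc k) cs)

  horner-weighted : ∀ k cs t → horner (weighted k cs) t ≡ k · 1# * horner cs t + t * horner' cs t
  horner-weighted k [] t = solve 2 (λ k t → κ 0 := k :* κ 0 :+ t :* κ 0) refl (k · 1#) t
  horner-weighted k (c ∷ cs) t = trans (cong (λ z → k · 1# * c + t * z) (trans (horner-weighted (suc k) cs t) (cong (λ z → z * horner cs t + t * horner' cs t) (suc-· k))))
    (solve 5 (λ k c t a b → k :* c :+ t :* ((κ 1 :+ k) :* a :+ t :* b) := k :* (c :+ t :* a) :+ t :* (a :+ t :* b)) refl (k · 1#) c t (horner cs t) (horner' cs t))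

  weighted-zeros : ∀ k cs → 0 < k → k ℕ.+ length cs ≤ order → All (_≡ 0#) (weighted k cs) → All (_≡ 0#) cs
  weighted-zeros k [] _ _ [] = []
  weighted-zeros k (c ∷ cs) 0<k l (z ∷ zs) =
    *-cancelˡ-0 (characteristic k 0<k (≤-trans (≤-trans (m≤m+n (suc k) (length cs)) (≤-reflexive (sym (+-suc k (length cs))))) l)) z
    ∷ weighted-zeros (suc k) cs z<s (≤-trans (≤-reflexive (sym (+-suc k (length cs)))) l) zs

  D-zero⇒constant : ∀ e → size e ≤ order → (∀ t → D e at t ≡ 0#) → ∀ t → e at t ≡ e at 0#
  D-zero⇒constant e l h t = trans (at-coefficients e t) (trans (constant (coefficients e) (≤-trans (length-coefficients e) l) (λ t → trans (sym (D-coefficients e t)) (h t))) (sym (at-coefficients e 0#)))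
    where
    constant : ∀ cs → length cs ≤ order → (∀ t → horner' cs t ≡ 0#) → horner cs t ≡ horner cs 0#
    constant [] _ _ = refl
    constant (c ∷ cs) l h = cong (c +_) (trans (cong (t *_) (horner-zeros zs t)) (trans (zeroʳ t) (sym (zeroˡ _))))
      where
      zs : All (_≡ 0#) cs
      zs = weighted-zeros 1 cs z<s l (vanishing-coefficients (weighted 1 cs) (≤-trans (≤-reflexive (length-weighted 1 cs)) (≤-trans (n≤1+n _) l))
        (λ t → trans (horner-weighted 1 cs t) (trans (cong (_+ t * horner' cs t) (*-identityˡ _)) (h t))))

  fromList : List F → Poly₁
  fromList [] = 𝟘
  fromList (c ∷ cs) = cst c ⊕ X ⊗ fromList cs

  size-fromList : ∀ cs → size (fromList cs) ≤ length cs
  size-fromList [] = z≤n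
  size-fromList (c ∷ cs) = ⊔-lub (s≤s z≤n) (≤-trans (sizeProduct-mono (≤-refl {2}) (size-fromList cs)) (bound (length cs)))
    where
    bound : ∀ n → sizeProduct 2 n ≤ suc n
    bound zero = z≤n
    bound (suc n) = ≤-refl

  horner″ : List F → F → F
  horner″ [] t = 0#
  horner″ (c ∷ cs) t = 2# * horner' cs t + t * horner″ cs t

  fromList-at : ∀ cs t → fromList cs at t ≡ horner cs t
  fromList-at [] t = refl
  fromList-at (c ∷ cs) t = cong (λ z → c + t * z) (fromList-at cs t)

  D-fromList : ∀ cs t → D (fromList cs) at t ≡ horner' cs t
  D-fromList [] t = refl
  D-fromList (c ∷ cs) t = trans (cong₂ (λ w z → 0# + (1# * w + t * z)) (fromList-at cs t) (D-fromList cs t))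
    (solve 3 (λ t a b → κ 0 :+ (κ 1 :* a :+ t :* b) := a :+ t :* b) refl t (horner cs t) (horner' cs t))

  DD-fromList : ∀ cs t → D (D (fromList cs)) at t ≡ horner″ cs t
  DD-fromList [] t = refl
  DD-fromList (c ∷ cs) t = trans (cong₂ (λ w z → 0# + ((0# * fromList cs at t + 1# * w) + (1# * w + t * z))) (D-fromList cs t) (DD-fromList cs t))
    (solve 4 (λ t f a b → κ 0 :+ ((κ 0 :* f :+ κ 1 :* a) :+ (κ 1 :* a :+ t :* b)) := κ 2 :* a :+ t :* b) refl t (fromList cs at t) (horner' cs t) (horner″ cs t))

  -- The numerator of (B / A)″ · A³.
  wronskian : (a a' a″ b b' b″ : F) → F
  wronskian a a' a″ b b' b″ = b″ * a * a - 2# * b' * a' * a - b * a″ * a + 2# * b * a' * a'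

  W : Poly₁ → Poly₁ → F → F
  W A B t = wronskian (A at t) (D A at t) (D (D A) at t) (B at t) (D B at t) (D (D B) at t)

  module Affine (A : Poly₁) where
    -- t ^ (2 - e) times the Wronskian of A and t ^ e g.
    shifted : ℕ → List F → Poly₁
    shifted e g = cst (ε * (ε - 1#)) ⊗ G ⊗ A ⊗ A
      ⊕ X ⊗ cst (2# * ε) ⊗ D G ⊗ A ⊗ A ⊕ X ⊗ cst (- (2# * ε)) ⊗ G ⊗ D A ⊗ A
      ⊕ X ⊗ X ⊗ D (D G) ⊗ A ⊗ A ⊕ X ⊗ X ⊗ cst (- 2#) ⊗ D G ⊗ D A ⊗ A
      ⊕ X ⊗ X ⊗ cst (- 1#) ⊗ G ⊗ D (D A) ⊗ A ⊕ X ⊗ X ⊗ cst 2# ⊗ G ⊗ D A ⊗ D A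
      where
      ε = e · 1#
      G = fromList g

    shiftedF : (ε t a a' a″ g g' g″ : F) → F
    shiftedF ε t a a' a″ g g' g″ = ε * (ε - 1#) * g * a * a
      + t * (2# * ε) * g' * a * a + t * (- (2# * ε)) * g * a' * a
      + t * t * g″ * a * a + t * t * (- 2#) * g' * a' * a
      + t * t * (- 1#) * g * a″ * a + t * t * 2# * g * a' * a'

    shifted-at : ∀ e g t → shifted e g at t ≡ shiftedF (e · 1#) t (A at t) (D A at t) (D (D A) at t) (horner g t) (horner' g t) (horner″ g t)
    shifted-at e g t = cong₃ (shiftedF (e · 1#) t (A at t) (D A at t) (D (D A) at t)) (fromList-at g t) (D-fromList g t) (DD-fromList g t)

    -- t ^ e (t k) and t ^ (e + 1) k are the same function, and the normalizing powers t ^ (2 - e)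
    -- and t ^ (1 - e) differ by t.
    shifted-step : ∀ e cs t → shifted e (0# ∷ cs) at t ≡ t * shifted (suc e) cs at t
    shifted-step e cs t = trans (shifted-at e (0# ∷ cs) t) (trans (trans
      (solve 8 (λ ε t a a' a″ k k' k″ → let g = κ 0 :+ t :* k ; g' = k :+ t :* k' ; g″ = κ 2 :* k' :+ t :* k″ ; ϵ = κ 1 :+ ε in
        ε :* (ε :- κ 1) :* g :* a :* a
          :+ t :* (κ 2 :* ε) :* g' :* a :* a :+ t :* (:- (κ 2 :* ε)) :* g :* a' :* a
          :+ t :* t :* g″ :* a :* a :+ t :* t :* (:- κ 2) :* g' :* a' :* a
          :+ t :* t :* (:- κ 1) :* g :* a″ :* a :+ t :* t :* κ 2 :* g :* a' :* a'
        := t :* (ϵ :* (ϵ :- κ 1) :* k :* a :* a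
          :+ t :* (κ 2 :* ϵ) :* k' :* a :* a :+ t :* (:- (κ 2 :* ϵ)) :* k :* a' :* a
          :+ t :* t :* k″ :* a :* a :+ t :* t :* (:- κ 2) :* k' :* a' :* a
          :+ t :* t :* (:- κ 1) :* k :* a″ :* a :+ t :* t :* κ 2 :* k :* a' :* a')) refl
        (e · 1#) t (A at t) (D A at t) (D (D A) at t) (horner cs t) (horner' cs t) (horner″ cs t))
      (cong (λ ϵ → t * shiftedF ϵ t (A at t) (D A at t) (D (D A) at t) (horner cs t) (horner' cs t) (horner″ cs t)) (sym (suc-· e))))
      (cong (t *_) (sym (shifted-at (suc e) cs t))))

    size-shifted : ∀ e g {a} → size A ≤ a → size (shifted e g) ≤ 5 ℕ.+ length g ℕ.+ a ℕ.+ a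
    size-shifted e g {a} l = ⊔-lub (⊔-lub (⊔-lub (⊔-lub (⊔-lub (⊔-lub
        (four (cst (ε * (ε - 1#))) G A A (s≤s z≤n) lG l l)
        (four (X ⊗ cst (2# * ε)) (D G) A A 2≤5 lG' l l))
        (four (X ⊗ cst (- (2# * ε))) G (D A) A 2≤5 lG l' l))
        (four (X ⊗ X) (D (D G)) A A 3≤5 lG″ l l))
        (four (X ⊗ X ⊗ cst (- 2#)) (D G) (D A) A 3≤5 lG' l' l))
        (four (X ⊗ X ⊗ cst (- 1#)) G (D (D A)) A 3≤5 lG l″ l))
        (four (X ⊗ X ⊗ cst 2#) G (D A) (D A) 3≤5 lG l' l')
      where
      ε = e · 1#
      G = fromList g
      3≤5 : 3 ≤ 5
      3≤5 = s≤s (s≤s (s≤s z≤n))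
      2≤5 : 2 ≤ 5
      2≤5 = s≤s (s≤s z≤n)
      lG = size-fromList g
      lG' = ≤-trans (size-∂≤ _ G) lG
      lG″ = ≤-trans (size-∂≤ _ (D G)) lG'
      l' = ≤-trans (size-∂≤ _ A) l
      l″ = ≤-trans (size-∂≤ _ (D A)) l'
      four : ∀ (c u v w : Poly₁) → size c ≤ 5 → size u ≤ length g → size v ≤ a → size w ≤ a →
        size (c ⊗ u ⊗ v ⊗ w) ≤ 5 ℕ.+ length g ℕ.+ a ℕ.+ a
      four c u v w lc lu lv lw = size-⊗ (c ⊗ u ⊗ v) w (size-⊗ (c ⊗ u) v (size-⊗ c u lc lu) lv) lw

    module _ {a} (sizeA : size A ≤ a) (A₀≢0 : A at 0# ≢ 0#) where
      -- Power series at 0 for a linear equation of second order: the lowest coefficient c of t ^ e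
      -- (c + ...) satisfies e (e - 1) A(0)² c = 0, hence vanishes for 2 ≤ e < `order`. Then a
      -- factor t is cancelled and e increases; the size bound carries the equation over to t = 0
      -- after each cancellation.
      propagate : ∀ g e → 2 ≤ e → e ℕ.+ length g ≤ order → 5 ℕ.+ length g ℕ.+ a ℕ.+ a < order →
        (∀ t → shifted e g at t ≡ 0#) → ∀ t → horner g t ≡ 0#
      propagate [] e _ _ _ h t = refl
      propagate (c ∷ cs) (suc zero) (s≤s ())
      propagate (c ∷ cs) e@(suc (suc e')) 2≤e l s h t =
        trans (cong₂ (λ w z → w + t * z) c≡0 (propagate cs (suc e) (m≤n⇒m≤1+n 2≤e) (≤-trans (≤-reflexive (sym (+-suc e (length cs)))) l)
          (≤-trans (n≤1+n _) s)
          (vanishes-off-0 (shifted (suc e) cs) (<-trans (s≤s (size-shifted (suc e) cs sizeA)) s)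
            (λ t t≢0 → *-cancelˡ-0 t≢0 (trans (sym (shifted-step e cs t)) (h' t)))) t))
          (trans (+-identityˡ _) (zeroʳ t))
        where
        c≡0 : c ≡ 0#
        c≡0 = *-cancelˡ-0 (*-≢0 (*-≢0 ε≢0 ε-1≢0) (*-≢0 A₀≢0 A₀≢0)) (trans (trans
          (solve 8 (λ ε a a' a″ c k k' k″ → ε :* (ε :- κ 1) :* (a :* a) :* c := let t = κ 0 ; g = c :+ t :* k ; g' = k :+ t :* k' ; g″ = κ 2 :* k' :+ t :* k″ in
            ε :* (ε :- κ 1) :* g :* a :* a
              :+ t :* (κ 2 :* ε) :* g' :* a :* a :+ t :* (:- (κ 2 :* ε)) :* g :* a' :* a
              :+ t :* t :* g″ :* a :* a :+ t :* t :* (:- κ 2) :* g' :* a' :* a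
              :+ t :* t :* (:- κ 1) :* g :* a″ :* a :+ t :* t :* κ 2 :* g :* a' :* a') refl
            (e · 1#) (A at 0#) (D A at 0#) (D (D A) at 0#) c (horner cs 0#) (horner' cs 0#) (horner″ cs 0#))
          (sym (shifted-at e (c ∷ cs) 0#))) (h 0#))
          where
          e<order : e < order
          e<order = ≤-trans (≤-trans (m≤m+n (suc e) (length cs)) (≤-reflexive (sym (+-suc e (length cs))))) l
          ε≢0 : e · 1# ≢ 0#
          ε≢0 = characteristic e z<s e<order
          ε-1≢0 : e · 1# - 1# ≢ 0#
          ε-1≢0 q = characteristic (suc e') z<s (≤-trans (n≤1+n _) e<order)
            (trans (trans (solve 1 (λ y → y := κ 1 :+ y :- κ 1) refl (suc e' · 1#)) (cong (_- 1#) (sym (suc-· (suc e'))))) q)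
        h' : ∀ t → shifted e (0# ∷ cs) at t ≡ 0#
        h' t = subst (λ c → shifted e (c ∷ cs) at t ≡ 0#) c≡0 (h t)

      -- 0 and 1 are the indicial exponents, where e (e - 1) = 0, so the first two coefficients have
      -- to be known to vanish.
      propagate₂ : ∀ hs → length hs ≤ order → 5 ℕ.+ length hs ℕ.+ a ℕ.+ a < order →
        horner hs 0# ≡ 0# → horner' hs 0# ≡ 0# → (∀ t → shifted 0 hs at t ≡ 0#) → ∀ t → horner hs t ≡ 0#
      propagate₂ [] _ _ _ _ _ t = refl
      propagate₂ (c ∷ []) _ _ z _ _ t = trans (cong (c +_) (trans (zeroʳ t) (sym (zeroʳ 0#)))) z
      propagate₂ (c₀ ∷ c₁ ∷ g) l s z₀ z₁ h t = trans (cong₂ (λ w z → w + t * z) c₀≡0 (trans (cong₂ (λ w z → w + t * z) c₁≡0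
          (propagate g 2 ≤-refl l (≤-trans (n≤1+n _) s') h₂ t)) (trans (+-identityˡ _) (zeroʳ t)))) (trans (+-identityˡ _) (zeroʳ t))
        where
        c₀≡0 : c₀ ≡ 0#
        c₀≡0 = trans (solve 2 (λ c a → c := c :+ κ 0 :* a) refl c₀ (horner (c₁ ∷ g) 0#)) z₀
        c₁≡0 : c₁ ≡ 0#
        c₁≡0 = trans (solve 3 (λ c a b → c := (c :+ κ 0 :* a) :+ κ 0 :* b) refl c₁ (horner g 0#) (horner' (c₁ ∷ g) 0#)) z₁
        s' : suc (5 ℕ.+ length g ℕ.+ a ℕ.+ a) < order
        s' = ≤-trans (n≤1+n _) s
        h₁ : ∀ t → shifted 1 (c₁ ∷ g) at t ≡ 0#
        h₁ = vanishes-off-0 (shifted 1 (c₁ ∷ g)) (≤-<-trans (size-shifted 1 (c₁ ∷ g) sizeA) s')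
          (λ t t≢0 → *-cancelˡ-0 t≢0 (trans (sym (shifted-step 0 (c₁ ∷ g) t)) (subst (λ c → shifted 0 (c ∷ c₁ ∷ g) at t ≡ 0#) c₀≡0 (h t))))
        h₂ : ∀ t → shifted 2 g at t ≡ 0#
        h₂ = vanishes-off-0 (shifted 2 g) (≤-<-trans (size-shifted 2 g sizeA) (≤-trans (n≤1+n _) s'))
          (λ t t≢0 → *-cancelˡ-0 t≢0 (trans (sym (shifted-step 1 g t)) (subst (λ c → shifted 1 (c ∷ g) at t ≡ 0#) c₁≡0 (h₁ t))))

      -- If the second derivative of B / A vanishes identically, then B / A is affine; the bound on the
      -- degrees is what excludes functions of t ^ p.
      ratio-affine : ∀ B → size B ≤ a → 8 ℕ.+ a ℕ.+ a ℕ.+ a < order → B at 0# ≡ 0# → (∀ t → W A B t ≡ 0#) →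
        ∃ λ α → ∀ t → B at t + α * t * A at t ≡ 0#
      ratio-affine B sizeB s B₀≡0 w = α , λ t → trans (trans (sym (at-h t)) (at-coefficients h t))
          (propagate₂ hs (≤-trans lhs (≤-trans (≤-trans (+-monoˡ-≤ a {3} {8} (s≤s (s≤s (s≤s z≤n)))) (≤-trans (m≤m+n _ a) (m≤m+n _ a))) (<⇒≤ s)))
            (≤-<-trans (s≤s (s≤s (s≤s (s≤s (s≤s (+-monoˡ-≤ a (+-monoˡ-≤ a lhs))))))) s)
            (trans (sym (at-coefficients h 0#)) h₀≡0) (trans (sym (D-coefficients h 0#)) h₀'≡0) shifted≡0 t)
        where
        -- This choice makes `h` vanish to second order at 0; adding a multiple of t A to B leaves
        -- the Wronskian unchanged.
        α = - (D B at 0# * (A at 0#) ⁻¹)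
        h = B ⊕ cst α ⊗ X ⊗ A
        hs = coefficients h
        at-h : ∀ t → h at t ≡ B at t + α * t * A at t
        at-h t = refl
        size-h : size h ≤ 3 ℕ.+ a
        size-h = ⊔-lub (≤-trans sizeB (m≤n+m a 3)) (size-⊗ (cst α ⊗ X) A (n≤1+n 2) sizeA)
        lhs : length hs ≤ 3 ℕ.+ a
        lhs = ≤-trans (length-coefficients h) size-h
        h₀≡0 : h at 0# ≡ 0#
        h₀≡0 = trans (solve 3 (λ α b a → b :+ α :* κ 0 :* a := b) refl α (B at 0#) (A at 0#)) B₀≡0
        h₀'≡0 : D h at 0# ≡ 0#
        h₀'≡0 = trans (solve 5 (λ b' i α a a' → b' :+ (((κ 0 :* κ 0 :+ α :* κ 1) :* a) :+ (α :* κ 0) :* a') := b' :+ α :* a) refl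
            (D B at 0#) ((A at 0#) ⁻¹) α (A at 0#) (D A at 0#))
          (trans (solve 3 (λ b' i a → b' :+ (:- (b' :* i)) :* a := κ 0 :+ (:- b') :* (a :* i :- κ 1)) refl (D B at 0#) ((A at 0#) ⁻¹) (A at 0#))
            (combine₁ (- (D B at 0#)) (*-inverse _ A₀≢0) refl))
        -- `h` and its coefficient form have equal values, hence equal second derivatives, since the
        -- sizes do not exceed `order`.
        difference = h ⊕ cst (- 1#) ⊗ fromList hs
        size-difference : size difference ≤ order
        size-difference = ⊔-lub (≤-trans size-h (≤-trans (n≤1+n _) bound))
          (≤-trans (size-⊗ (cst (- 1#)) (fromList hs) ≤-refl (≤-trans (size-fromList hs) lhs)) bound)
          where
          bound : 4 ℕ.+ a ≤ order
          bound = ≤-trans (≤-trans (+-monoˡ-≤ a {4} {8} (s≤s (s≤s (s≤s (s≤s z≤n))))) (≤-trans (m≤m+n _ a) (m≤m+n _ a))) (<⇒≤ s)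
        difference-at : ∀ t → difference at t ≡ 0#
        difference-at t = trans (cong₂ (λ x y → x + - 1# * y) (at-coefficients h t) (fromList-at hs t)) (solve 1 (λ x → x :+ :- κ 1 :* x := κ 0) refl (horner hs t))
        DD-difference : ∀ t → D (D difference) at t ≡ 0#
        DD-difference = D-vanishes (D difference) (≤-trans (size-∂≤ _ difference) size-difference) (D-vanishes difference size-difference difference-at)
        DD-h : ∀ t → horner″ hs t ≡ D (D h) at t
        DD-h t = trans (sym (DD-fromList hs t)) (sym (trans (solve 4 (λ x y z w → x := y :+ (x :+ (κ 0 :* z :+ κ 0 :* w :+ (κ 0 :* w :+ :- κ 1 :* y)))) refl
            (D (D h) at t) (D (D (fromList hs)) at t) (fromList hs at t) (D (fromList hs) at t))
          (trans (cong (D (D (fromList hs)) at t +_) (DD-difference t)) (+-identityʳ _))))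
        shifted≡0 : ∀ t → shifted 0 hs at t ≡ 0#
        shifted≡0 t = trans (shifted-at 0 hs t) (trans (cong₃ (shiftedF 0# t a₀ a₁ a₂) (sym (at-coefficients h t)) (sym (D-coefficients h t)) (DD-h t))
          (trans (solve 8 (λ t α a a' a″ b b' b″ →
              let g = b :+ α :* t :* a
                  g' = b' :+ ((κ 0 :* t :+ α :* κ 1) :* a :+ α :* t :* a')
                  g″ = b″ :+ (((κ 0 :* t :+ κ 0 :* κ 1) :+ (κ 0 :* κ 1 :+ α :* κ 0)) :* a :+ (κ 0 :* t :+ α :* κ 1) :* a' :+ ((κ 0 :* t :+ α :* κ 1) :* a' :+ α :* t :* a″))
                  ε = κ 0 in
              ε :* (ε :- κ 1) :* g :* a :* a
                :+ t :* (κ 2 :* ε) :* g' :* a :* a :+ t :* (:- (κ 2 :* ε)) :* g :* a' :* a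
                :+ t :* t :* g″ :* a :* a :+ t :* t :* (:- κ 2) :* g' :* a' :* a
                :+ t :* t :* (:- κ 1) :* g :* a″ :* a :+ t :* t :* κ 2 :* g :* a' :* a'
              := t :* t :* (b″ :* a :* a :- κ 2 :* b' :* a' :* a :- b :* a″ :* a :+ κ 2 :* b :* a' :* a')) refl
              t α a₀ a₁ a₂ (B at t) (D B at t) (D (D B) at t))
            (trans (cong (t * t *_) (w t)) (zeroʳ _))))
          where
          a₀ = A at t
          a₁ = D A at t
          a₂ = D (D A) at t

-- Interpolation: a polynomial in three variables through given points, by linear algebra.

module Interpolation (𝔽 : FiniteField) where
  open FieldTheory 𝔽
  open import Data.Nat using (_≤_; _<_)
  open Polynomials 𝔽

  inner : ∀ {n} → Vec F n → Vec F n → F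
  inner [] [] = 0#
  inner (x ∷ xs) (y ∷ ys) = x * y + inner xs ys

  zeros : ∀ n → Vec F n
  zeros n = Vec.replicate n 0#

  dot-zeros : ∀ {n} (xs : Vec F n) → inner xs (zeros n) ≡ 0#
  dot-zeros [] = refl
  dot-zeros (x ∷ xs) = trans (cong₂ _+_ (zeroʳ x) (dot-zeros xs)) (+-identityˡ _)

  axpy : ∀ {n} → F → Vec F n → Vec F n → Vec F n
  axpy k [] [] = []
  axpy k (x ∷ xs) (y ∷ ys) = x + k * y ∷ axpy k xs ys

  dot-axpy : ∀ {n} k (xs ys zs : Vec F n) → inner (axpy k xs ys) zs ≡ inner xs zs + k * inner ys zs
  dot-axpy k [] [] [] = solve 1 (λ k → κ 0 := κ 0 :+ k :* κ 0) refl k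
  dot-axpy k (x ∷ xs) (y ∷ ys) (z ∷ zs) = trans (cong ((x + k * y) * z +_) (dot-axpy k xs ys zs))
    (solve 6 (λ k x y z a b → (x :+ k :* y) :* z :+ (a :+ k :* b) := x :* z :+ a :+ k :* (y :* z :+ b)) refl k x y z (inner xs zs) (inner ys zs))

  -- `covers` expresses that `rows` is the pivot row together with `others` in some order, in the
  -- form in which it is used.
  record Pivot {n} (rows : List (Vec F (suc n))) : Set₁ where
    constructor pivot
    field
      head : F
      tail : Vec F n
      others : List (Vec F (suc n))
      head≢0 : head ≢ 0#
      count : length rows ≡ suc (length others)
      covers : ∀ (P : Vec F (suc n) → Set) → P (head ∷ tail) → All P others → All P rows

  find-pivot : ∀ {n} (rows : List (Vec F (suc n))) → All (λ r → Vec.head r ≡ 0#) rows ⊎ Pivot rows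
  find-pivot [] = inj₁ []
  find-pivot ((x ∷ xs) ∷ rows) with x ≟ 0#
  ... | no x≢0 = inj₂ (pivot x xs rows x≢0 refl (λ P p ps → p ∷ ps))
  ... | yes x≡0 with find-pivot rows
  ...   | inj₁ zs = inj₁ (x≡0 ∷ zs)
  ...   | inj₂ (pivot h t os h≢0 c cov) = inj₂ (pivot h t ((x ∷ xs) ∷ os) h≢0 (cong suc c) (λ { P p (q ∷ qs) → q ∷ cov P p qs }))

  -- Gaussian elimination on the first column. Without a pivot the first unit vector is a solution;
  -- with one, the smaller system has one row and one unknown less.
  underdetermined : ∀ n (rows : List (Vec F n)) → length rows < n → Σ (Vec F n) λ cs → cs ≢ zeros n × All (λ r → inner r cs ≡ 0#) rows
  underdetermined (suc n) rows l with find-pivot rows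
  ... | inj₁ zs = 1# ∷ zeros n , (λ e → 1≢0 (cong Vec.head e)) , All.map (λ { {x ∷ xs} refl → trans (cong₂ _+_ (zeroˡ 1#) (dot-zeros xs)) (+-identityˡ _) }) zs
  ... | inj₂ (pivot h t os h≢0 c cov) with underdetermined n (map eliminate os)
                (≤-trans (s≤s (≤-reflexive (length-map' os))) (≤-pred (≤-trans (s≤s (≤-reflexive (sym c))) l)))
    where
    eliminate : Vec F (suc n) → Vec F n
    eliminate (x ∷ xs) = axpy (- (x * h ⁻¹)) xs t
    length-map' : ∀ os → length (map eliminate os) ≡ length os
    length-map' [] = refl
    length-map' (o ∷ os) = cong suc (length-map' os)
  ...   | cs , cs≢0 , zs = - (h ⁻¹ * inner t cs) ∷ cs , (λ e → cs≢0 (cong Vec.tail e)) ,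
          cov _ (trans (solve 3 (λ h i d → h :* (:- (i :* d)) :+ d := κ 0 :+ (:- d) :* (h :* i :- κ 1)) refl h (h ⁻¹) (inner t cs)) (combine₁ (- inner t cs) (*-inverse h h≢0) refl))
            (All.map (λ { {x ∷ xs} e → trans (trans (solve 4 (λ x i d a → x :* (:- (i :* d)) :+ a := a :+ (:- (x :* i)) :* d) refl x (h ⁻¹) (inner t cs) (inner xs cs)) (sym (dot-axpy _ xs t cs))) e })
              (Allₚ.map⁻ zs))

  data Axis : Set where
    axis₁ axis₂ axis₃ : Axis

  _[_↦_] : (Axis → F) → Axis → F → Axis → F
  (ρ [ axis₁ ↦ t ]) axis₁ = t
  (ρ [ axis₂ ↦ t ]) axis₂ = t
  (ρ [ axis₃ ↦ t ]) axis₃ = t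
  (ρ [ _ ↦ t ]) v = ρ v

  update-same : ∀ ρ x t → (ρ [ x ↦ t ]) x ≡ t
  update-same ρ axis₁ t = refl
  update-same ρ axis₂ t = refl
  update-same ρ axis₃ t = refl

  update-other : ∀ ρ x t v → v ≢ x → (ρ [ x ↦ t ]) v ≡ ρ v
  update-other ρ axis₁ t axis₁ n = ⊥-elim (n refl)
  update-other ρ axis₁ t axis₂ n = refl
  update-other ρ axis₁ t axis₃ n = refl
  update-other ρ axis₂ t axis₁ n = refl
  update-other ρ axis₂ t axis₂ n = ⊥-elim (n refl)
  update-other ρ axis₂ t axis₃ n = refl
  update-other ρ axis₃ t axis₁ n = refl
  update-other ρ axis₃ t axis₂ n = refl
  update-other ρ axis₃ t axis₃ n = ⊥-elim (n refl)

  eval-ext : ∀ {V : Set} {ρ ρ' : V → F} → (∀ v → ρ v ≡ ρ' v) → ∀ e → eval ρ e ≡ eval ρ' e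
  eval-ext h 𝟘 = refl
  eval-ext h (cst c) = refl
  eval-ext h (var v) = h v
  eval-ext h (e ⊕ f) = cong₂ _+_ (eval-ext h e) (eval-ext h f)
  eval-ext h (e ⊗ f) = cong₂ _*_ (eval-ext h e) (eval-ext h f)

  -- A space of polynomials with a vector of coefficients; `row ρ` is evaluation at `ρ` as a linear
  -- functional. `faithful` turns a nonzero vector into a nonzero function, and `Ignores` keeps
  -- track of the variables that may still be adjoined.
  record Family : Set₁ where
    field
      dimension bound : ℕ
      poly : Vec F dimension → Poly Axis
      row : (Axis → F) → Vec F dimension
      eval-poly : ∀ ρ cs → eval ρ (poly cs) ≡ inner (row ρ) cs
      size-poly : ∀ cs → size (poly cs) ≤ bound
      faithful : ∀ cs → (∀ ρ → eval ρ (poly cs) ≡ 0#) → cs ≡ zeros dimension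
      Ignores : Axis → Set
      ignores : ∀ x → Ignores x → ∀ ρ ρ' → (∀ v → v ≢ x → ρ v ≡ ρ' v) → ∀ cs → eval ρ (poly cs) ≡ eval ρ' (poly cs)

  constants : Family
  constants = record
    { dimension = 1 ; bound = 1
    ; poly = λ cs → cst (Vec.head cs)
    ; row = λ _ → 1# ∷ []
    ; eval-poly = λ { ρ (c ∷ []) → solve 1 (λ c → c := κ 1 :* c :+ κ 0) refl c }
    ; size-poly = λ _ → ≤-refl
    ; faithful = λ { (c ∷ []) h → cong (_∷ []) (h (λ _ → 0#)) }
    ; Ignores = λ _ → ⊤
    ; ignores = λ _ _ _ _ _ _ → refl
    }

  dot-++ : ∀ {m n} (r : Vec F m) (r' : Vec F n) cs → inner (r Vec.++ r') cs ≡ inner r (Vec.take m cs) + inner r' (Vec.drop m cs)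
  dot-++ [] r' cs = sym (+-identityˡ _)
  dot-++ (x ∷ r) r' (c ∷ cs) = trans (cong (x * c +_) (dot-++ r r' cs)) (sym (+-assoc _ _ _))

  dot-scale : ∀ {n} k (xs ys : Vec F n) → inner (Vec.map (k *_) xs) ys ≡ k * inner xs ys
  dot-scale k [] [] = sym (zeroʳ k)
  dot-scale k (x ∷ xs) (y ∷ ys) = trans (cong (k * x * y +_) (dot-scale k xs ys))
    (solve 4 (λ k x y a → k :* x :* y :+ k :* a := k :* (x :* y :+ a)) refl k x y (inner xs ys))

  zeros-++ : ∀ m n → zeros m Vec.++ zeros n ≡ zeros (m ℕ.+ n)
  zeros-++ zero n = refl
  zeros-++ (suc m) n = cong (0# ∷_) (zeros-++ m n)

  -- Adjoins the powers of `x` with exponent below `e`. Faithfulness is tested along the axis `x`,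
  -- where the values form a polynomial with `e` coefficients and `e` is at most `order`.
  module Extend (𝓕 : Family) (x : Axis) (ig : Family.Ignores 𝓕 x) where
    open Family 𝓕
    polyₑ : ∀ e → Vec F (e ℕ.* dimension) → Poly Axis
    polyₑ zero cs = 𝟘
    polyₑ (suc e) cs = poly (Vec.take dimension cs) ⊕ var x ⊗ polyₑ e (Vec.drop dimension cs)

    rowₑ : ∀ e → (Axis → F) → Vec F (e ℕ.* dimension)
    rowₑ zero ρ = []
    rowₑ (suc e) ρ = row ρ Vec.++ Vec.map (ρ x *_) (rowₑ e ρ)

    eval-polyₑ : ∀ e ρ cs → eval ρ (polyₑ e cs) ≡ inner (rowₑ e ρ) cs
    eval-polyₑ zero ρ [] = refl
    eval-polyₑ (suc e) ρ cs = trans (cong₂ (λ a b → a + ρ x * b) (eval-poly ρ _) (eval-polyₑ e ρ _))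
      (sym (trans (dot-++ (row ρ) _ cs) (cong (inner (row ρ) (Vec.take dimension cs) +_) (dot-scale (ρ x) (rowₑ e ρ) _))))

    size-polyₑ : ∀ e cs → size (polyₑ e cs) ≤ e ℕ.+ bound
    size-polyₑ zero cs = z≤n
    size-polyₑ (suc e) cs = ⊔-lub (≤-trans (size-poly _) (m≤n+m bound (suc e)))
      (≤-trans (sizeProduct-mono (≤-refl {2}) (size-polyₑ e _)) (two (e ℕ.+ bound)))
      where
      two : ∀ n → sizeProduct 2 n ≤ suc n
      two zero = z≤n
      two (suc n) = ≤-refl

    slices : ∀ e → Vec F (e ℕ.* dimension) → (Axis → F) → List F
    slices zero cs ρ = []
    slices (suc e) cs ρ = eval ρ (poly (Vec.take dimension cs)) ∷ slices e (Vec.drop dimension cs) ρ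

    length-slices : ∀ e cs ρ → length (slices e cs ρ) ≡ e
    length-slices zero cs ρ = refl
    length-slices (suc e) cs ρ = cong suc (length-slices e _ ρ)

    eval-slices : ∀ e cs ρ t → eval (ρ [ x ↦ t ]) (polyₑ e cs) ≡ horner (slices e cs ρ) t
    eval-slices zero cs ρ t = refl
    eval-slices (suc e) cs ρ t = cong₂ _+_ (ignores x ig _ _ (update-other ρ x t) _) (cong₂ _*_ (update-same ρ x t) (eval-slices e _ ρ t))

    zeroes : ∀ e cs → (∀ ρ → All (_≡ 0#) (slices e cs ρ)) → cs ≡ zeros (e ℕ.* dimension)
    zeroes zero [] h = refl
    zeroes (suc e) cs h = trans (sym (Vecₚ.take++drop≡id dimension cs))
      (trans (cong₂ Vec._++_ (faithful _ (λ ρ → All.head (h ρ))) (zeroes e _ (λ ρ → All.tail (h ρ)))) (zeros-++ dimension (e ℕ.* dimension)))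

    extend : ∀ e → e ≤ order → Family
    extend e e≤ = record
      { dimension = e ℕ.* dimension ; bound = e ℕ.+ bound ; poly = polyₑ e ; row = rowₑ e
      ; eval-poly = eval-polyₑ e ; size-poly = size-polyₑ e
      ; faithful = λ cs h → zeroes e cs (λ ρ → vanishing-coefficients (slices e cs ρ) (≤-trans (≤-reflexive (length-slices e cs ρ)) e≤)
          (λ t → trans (sym (eval-slices e cs ρ t)) (h _)))
      ; Ignores = λ y → y ≢ x × Ignores y
      ; ignores = λ y (y≢x , iy) ρ ρ' h → ignoresₑ e y y≢x iy ρ ρ' h
      }
      where
      ignoresₑ : ∀ e y → y ≢ x → Ignores y → ∀ ρ ρ' → (∀ v → v ≢ y → ρ v ≡ ρ' v) → ∀ cs → eval ρ (polyₑ e cs) ≡ eval ρ' (polyₑ e cs)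
      ignoresₑ zero y y≢x iy ρ ρ' h cs = refl
      ignoresₑ (suc e) y y≢x iy ρ ρ' h cs = cong₂ _+_ (ignores y iy ρ ρ' h _) (cong₂ _*_ (h x (λ q → y≢x (sym q))) (ignoresₑ e y y≢x iy ρ ρ' h _))

  module _ (e : ℕ) (e≤ : e ≤ order) where
    private
      f₁ = Extend.extend constants axis₁ tt e e≤
      f₂ = Extend.extend f₁ axis₂ ((λ ()) , tt) e e≤
      f₃ = Extend.extend f₂ axis₃ ((λ ()) , (λ ()) , tt) e e≤

    -- Degree below `e` in each of three variables leaves e³ free coefficients against one linear
    -- condition per point.
    interpolate : ∀ (ρs : List (Axis → F)) → length ρs < e ℕ.* (e ℕ.* (e ℕ.* 1)) →
      Σ (Poly Axis) λ f → size f ≤ e ℕ.+ (e ℕ.+ (e ℕ.+ 1)) × ¬ (∀ ρ → eval ρ f ≡ 0#) × All (λ ρ → eval ρ f ≡ 0#) ρs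
    interpolate ρs l with underdetermined (Family.dimension f₃) (map (Family.row f₃) ρs) (≤-trans (s≤s (≤-reflexive (length-map' ρs))) l)
      where
      length-map' : ∀ ρs → length (map (Family.row f₃) ρs) ≡ length ρs
      length-map' [] = refl
      length-map' (_ ∷ ρs) = cong suc (length-map' ρs)
    ... | cs , cs≢0 , zs = Family.poly f₃ cs , Family.size-poly f₃ cs , (λ h → cs≢0 (Family.faithful f₃ cs h)) ,
      All.map (λ {ρ} z → trans (Family.eval-poly f₃ ρ cs) z) (Allₚ.map⁻ zs)

-- Second and third derivatives of a surface along null lines.

module Surfaces (𝔽 : FiniteField) where
  open FieldTheory 𝔽
  open import Data.Nat using (_≤_; _<_)
  open Polynomials 𝔽
  open Interpolation 𝔽

  F² F³ : Set
  F² = F × F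
  F³ = F × F × F

  -- (a , b , c) is the symmetric matrix with rows (a , b) and (b , c).
  coord : F³ → Axis → F
  coord (a , b , c) axis₁ = a
  coord (a , b , c) axis₂ = b
  coord (a , b , c) axis₃ = c

  move : F³ → F³ → F → F³
  move (a , b , c) (d₁ , d₂ , d₃) t = a + d₁ * t , b + d₂ * t , c + d₃ * t

  -- The rank one matrix n nᵀ, a null vector of the determinant form; `polar n m` is its
  -- polarization n mᵀ + m nᵀ.
  square : F² → F³
  square (n₁ , n₂) = n₁ * n₁ , n₁ * n₂ , n₂ * n₂

  polar : F² → F² → F³
  polar (n₁ , n₂) (m₁ , m₂) = 2# * (n₁ * m₁) , n₁ * m₂ + n₂ * m₁ , 2# * (n₂ * m₂)

  infix 5 _∧_
  _∧_ : F² → F² → F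
  (a₁ , a₂) ∧ (b₁ , b₂) = a₁ * b₂ - a₂ * b₁

  value : F³ → Poly Axis → F
  value S e = eval (coord S) e

  ∂ₛ : F³ → Poly Axis → Poly Axis
  ∂ₛ d = ∂ (coord d)

  line : F³ → F³ → Poly Axis → Poly₁
  line S d = restrict (coord S) (coord d)

  coord-move : ∀ S d t v → coord S v + coord d v * t ≡ coord (move S d t) v
  coord-move S d t axis₁ = refl
  coord-move S d t axis₂ = refl
  coord-move S d t axis₃ = refl

  line-at : ∀ S d e t → line S d e at t ≡ value (move S d t) e
  line-at S d e t = trans (restrict-at (coord S) (coord d) e t) (eval-ext (coord-move S d t) e)

  D-line : ∀ S d e t → D (line S d e) at t ≡ value (move S d t) (∂ₛ d e)
  D-line S d e t = trans (D-restrict (coord S) (coord d) e t) (line-at S d (∂ₛ d e) t)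

  size-line : ∀ S d e {δ} → size e ≤ δ → size (line S d e) ≤ δ
  size-line S d e l = ≤-trans (≤-reflexive (size-restrict (coord S) (coord d) e)) l

  move-0 : ∀ S d → move S d 0# ≡ S
  move-0 (a , b , c) (d₁ , d₂ , d₃) = cong₂ _,_ (z a d₁) (cong₂ _,_ (z b d₂) (z c d₃))
    where
    z : ∀ x y → x + y * 0# ≡ x
    z = solve 2 (λ x y → x :+ y :* κ 0 := x) refl

  move-move : ∀ S d t u → move (move S d t) d u ≡ move S d (t + u)
  move-move (a , b , c) (d₁ , d₂ , d₃) t u = cong₂ _,_ (z a d₁) (cong₂ _,_ (z b d₂) (z c d₃))
    where
    z : ∀ x y → x + y * t + y * u ≡ x + y * (t + u)
    z x y = solve 4 (λ x y t u → x :+ y :* t :+ y :* u := x :+ y :* (t :+ u)) refl x y t u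

  D-cong : ∀ e e' → size e ≤ order → size e' < order → (∀ t → e at t ≡ e' at t) → ∀ t → D e at t ≡ D e' at t
  D-cong e e' l l' h t = trans (solve 3 (λ x y z → x := y :+ (x :+ (κ 0 :* z :+ (:- κ 1) :* y))) refl (D e at t) (D e' at t) (e' at t))
      (trans (cong (D e' at t +_) (D-vanishes (e ⊕ cst (- 1#) ⊗ e') (⊔-lub l (≤-trans (size-⊗ (cst (- 1#)) e' ≤-refl ≤-refl) l'))
        (λ t → trans (cong (_+ - 1# * e' at t) (h t)) (solve 1 (λ x → x :+ (:- κ 1) :* x := κ 0) refl (e' at t))) t)) (+-identityʳ _))

  DD-line : ∀ S d e → size e < order → ∀ t → D (D (line S d e)) at t ≡ value (move S d t) (∂ₛ d (∂ₛ d e))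
  DD-line S d e l t = trans (D-cong (D (line S d e)) (line S d (∂ₛ d e))
      (≤-trans (size-∂≤ _ (line S d e)) (size-line S d e (<⇒≤ l)))
      (≤-<-trans (size-line S d (∂ₛ d e) (size-∂≤ _ e)) l)
      (λ t → trans (D-line S d e t) (sym (line-at S d (∂ₛ d e) t))) t) (D-line S d (∂ₛ d e) t)

  ∂-cong : ∀ S d e e' → size e ≤ order → size e' < order → (∀ S → value S e ≡ value S e') → value S (∂ₛ d e) ≡ value S (∂ₛ d e')
  ∂-cong S d e e' l l' h = trans (back e) (trans (D-cong (line S d e) (line S d e') (size-line S d e l)
      (≤-<-trans (size-line S d e' ≤-refl) l') (λ t → trans (line-at S d e t) (trans (h _) (sym (line-at S d e' t)))) 0#) (sym (back e')))
    where
    back : ∀ e → value S (∂ₛ d e) ≡ D (line S d e) at 0#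
    back e = trans (cong (λ S → value S (∂ₛ d e)) (sym (move-0 S d))) (sym (D-line S d e 0#))

  ∂-linear₃ : ∀ S α β γ d d₁ d₂ d₃ → (∀ v → coord d v ≡ α * coord d₁ v + β * coord d₂ v + γ * coord d₃ v) → ∀ e →
    value S (∂ₛ d e) ≡ α * value S (∂ₛ d₁ e) + β * value S (∂ₛ d₂ e) + γ * value S (∂ₛ d₃ e)
  ∂-linear₃ S α β γ d d₁ d₂ d₃ h e =
    trans (∂-linear (coord S) 1# γ (coord d) mid (coord d₃) (λ v → trans (h v) (cong (_+ γ * coord d₃ v) (sym (*-identityˡ _)))) e)
      (cong (_+ γ * value S (∂ₛ d₃ e)) (trans (*-identityˡ _) (∂-linear (coord S) α β mid (coord d₁) (coord d₂) (λ v → refl) e)))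
    where
    mid : Axis → F
    mid v = α * coord d₁ v + β * coord d₂ v

  combination : F → F² → F → F² → F²
  combination α (n₁ , n₂) β (m₁ , m₂) = α * n₁ + β * m₁ , α * n₂ + β * m₂

  square-combination : ∀ α n β m v → coord (square (combination α n β m)) v ≡
    α * α * coord (square n) v + α * β * coord (polar n m) v + β * β * coord (square m) v
  square-combination α (n₁ , n₂) β (m₁ , m₂) axis₁ = solve 4 (λ α β n m → (α :* n :+ β :* m) :* (α :* n :+ β :* m) := α :* α :* (n :* n) :+ α :* β :* (κ 2 :* (n :* m)) :+ β :* β :* (m :* m)) refl α β n₁ m₁
  square-combination α (n₁ , n₂) β (m₁ , m₂) axis₂ = solve 6 (λ α β n m n' m' → (α :* n :+ β :* m) :* (α :* n' :+ β :* m') := α :* α :* (n :* n') :+ α :* β :* (n :* m' :+ n' :* m) :+ β :* β :* (m :* m')) refl α β n₁ m₁ n₂ m₂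
  square-combination α (n₁ , n₂) β (m₁ , m₂) axis₃ = solve 4 (λ α β n m → (α :* n :+ β :* m) :* (α :* n :+ β :* m) := α :* α :* (n :* n) :+ α :* β :* (κ 2 :* (n :* m)) :+ β :* β :* (m :* m)) refl α β n₂ m₂

  polar-combination : ∀ α n β m v → coord (polar (combination α m β n) m) v ≡ 2# * α * coord (square m) v + β * coord (polar n m) v + 0# * coord (square m) v
  polar-combination α (n₁ , n₂) β (m₁ , m₂) axis₁ = solve 4 (λ α β n m → κ 2 :* ((α :* m :+ β :* n) :* m) := κ 2 :* α :* (m :* m) :+ β :* (κ 2 :* (n :* m)) :+ κ 0 :* (m :* m)) refl α β n₁ m₁
  polar-combination α (n₁ , n₂) β (m₁ , m₂) axis₂ = solve 6 (λ α β n m n' m' → (α :* m :+ β :* n) :* m' :+ (α :* m' :+ β :* n') :* m := κ 2 :* α :* (m :* m') :+ β :* (n :* m' :+ n' :* m) :+ κ 0 :* (m :* m')) refl α β n₁ m₁ n₂ m₂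
  polar-combination α (n₁ , n₂) β (m₁ , m₂) axis₃ = solve 4 (λ α β n m → κ 2 :* ((α :* m :+ β :* n) :* m) := κ 2 :* α :* (m :* m) :+ β :* (κ 2 :* (n :* m)) :+ κ 0 :* (m :* m)) refl α β n₂ m₂

  Contains : Poly Axis → F³ → F³ → Set
  Contains f S d = ∀ t → value (move S d t) f ≡ 0#

  Contains-∂ : ∀ f S d → size f ≤ order → Contains f S d → Contains (∂ₛ d f) S d
  Contains-∂ f S d l h t = trans (sym (D-line S d f t)) (D-vanishes (line S d f) (size-line S d f l) (λ t → trans (line-at S d f t) (h t)) t)

  Contains-move : ∀ f S d t → Contains f S d → Contains f (move S d t) d
  Contains-move f S d t h u = trans (cong (λ S → value S f) (move-move S d t u)) (h (t + u))

  Contains-at : ∀ f S d → Contains f S d → value S f ≡ 0#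
  Contains-at f S d h = trans (cong (λ S → value S f) (sym (move-0 S d))) (h 0#)

  Contains-∂-at : ∀ f S d → size f ≤ order → Contains f S d → value S (∂ₛ d f) ≡ 0#
  Contains-∂-at f S d l h = Contains-at (∂ₛ d f) S d (Contains-∂ f S d l h)

  Contains-∂∂-at : ∀ f S d → size f ≤ order → Contains f S d → value S (∂ₛ d (∂ₛ d f)) ≡ 0#
  Contains-∂∂-at f S d l h = Contains-∂-at (∂ₛ d f) S d (≤-trans (size-∂≤ _ f) l) (Contains-∂ f S d l h)

  module _ (f : Poly Axis) {δ} (sizef : size f ≤ δ) where
    size∂ : ∀ d → size (∂ₛ d f) ≤ δ
    size∂ d = ≤-trans (size-∂≤ _ f) sizef
    size∂∂ : ∀ d d' → size (∂ₛ d (∂ₛ d' f)) ≤ δ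
    size∂∂ d d' = ≤-trans (size-∂≤ _ (∂ₛ d' f)) (size∂ d')

    -- Along the line through S in the direction square n, the tangent plane contains one more null direction,
    -- square (A m - B n); E is the second derivative of f in that direction.
    module Second (S : F³) (n m : F²) where
      A B E : Poly₁
      A = line S (square n) (∂ₛ (polar n m) f)
      B = line S (square n) (∂ₛ (square m) f)
      second : F³ → F³ → Poly₁
      second d d' = line S (square n) (∂ₛ d (∂ₛ d' f))
      -- Expansion of the Hessian with `square (A m - B n)` = A² `square m` - A B `polar n m` + B²
      -- `square n`. The term with B⁴ is left out: it is the second derivative along the line
      -- itself, which vanishes when the surface contains the line.
      E = A ⊗ A ⊗ A ⊗ A ⊗ second (square m) (square m)
        ⊕ cst (- 2#) ⊗ A ⊗ A ⊗ A ⊗ B ⊗ second (polar n m) (square m)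
        ⊕ A ⊗ A ⊗ B ⊗ B ⊗ (second (polar n m) (polar n m) ⊕ cst 2# ⊗ second (square n) (square m))
        ⊕ cst (- 2#) ⊗ A ⊗ B ⊗ B ⊗ B ⊗ second (square n) (polar n m)

      size-E : size E ≤ δ ℕ.+ δ ℕ.+ δ ℕ.+ δ ℕ.+ (1 ℕ.+ δ)
      size-E = ⊔-lub (⊔-lub (⊔-lub
        (size-⊗ (A ⊗ A ⊗ A ⊗ A) (second (square m) (square m)) (four A A A A lA lA lA lA) (m≤n⇒m≤1+n (l₂ _ _)))
        (five A A A B (polar n m) (square m) lA lA lA lB))
        (size-⊗ (A ⊗ A ⊗ B ⊗ B) (second (polar n m) (polar n m) ⊕ cst 2# ⊗ second (square n) (square m)) (four A A B B lA lA lB lB)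
          (⊔-lub (m≤n⇒m≤1+n (l₂ _ _)) (size-⊗ (cst 2#) (second (square n) (square m)) ≤-refl (l₂ _ _)))))
        (five A B B B (square n) (polar n m) lA lB lB lB)
        where
        lA : size A ≤ δ
        lA = size-line S _ (∂ₛ (polar n m) f) (size∂ _)
        lB : size B ≤ δ
        lB = size-line S _ (∂ₛ (square m) f) (size∂ _)
        l₂ : ∀ d d' → size (second d d') ≤ δ
        l₂ d d' = size-line S _ (∂ₛ d (∂ₛ d' f)) (size∂∂ d d')
        four : ∀ a b c d → size a ≤ δ → size b ≤ δ → size c ≤ δ → size d ≤ δ → size (a ⊗ b ⊗ c ⊗ d) ≤ δ ℕ.+ δ ℕ.+ δ ℕ.+ δ
        four a b c d la lb lc ld = size-⊗ (a ⊗ b ⊗ c) d (size-⊗ (a ⊗ b) c (size-⊗ a b la lb) lc) ld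
        five : ∀ a b c d p q → size a ≤ δ → size b ≤ δ → size c ≤ δ → size d ≤ δ →
          size (cst (- 2#) ⊗ a ⊗ b ⊗ c ⊗ d ⊗ second p q) ≤ δ ℕ.+ δ ℕ.+ δ ℕ.+ δ ℕ.+ (1 ℕ.+ δ)
        five a b c d p q la lb lc ld = ≤-trans
          (size-⊗ (cst (- 2#) ⊗ a ⊗ b ⊗ c ⊗ d) (second p q) (size-⊗ (cst (- 2#) ⊗ a ⊗ b ⊗ c) d (size-⊗ (cst (- 2#) ⊗ a ⊗ b) c (size-⊗ (cst (- 2#) ⊗ a) b (size-⊗ (cst (- 2#)) a ≤-refl la) lb) lc) ld) (l₂ p q))
          (≤-reflexive (sym (+-suc _ δ)))

      Eval : (a b zz yz yy xz xy : F) → F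
      Eval a b zz yz yy xz xy = a * a * a * a * zz + (- 2#) * a * a * a * b * yz + a * a * b * b * (yy + 2# * xz) + (- 2#) * a * b * b * b * xy

      -- Both lines lie in the surface, so the first derivatives along them vanish and α A + β B =
      -- 0. Hence β (A m - B n) = A (α n + β m), and β⁴ E is A⁴ times the second derivative along
      -- the crossing line, which is 0.
      E-at-crossing : size f ≤ order → ∀ t α β → β ≢ 0# → let a = combination α n β m in
        Contains f S (square n) → Contains f (move S (square n) t) (square a) → E at t ≡ 0#
      E-at-crossing l t α β β≢0 cn ca = *-cancelˡ-0 (*-≢0 (*-≢0 β≢0 β≢0) (*-≢0 β≢0 β≢0))
        (trans (cong (β * β * (β * β) *_) E-value)
          (combine₃ (a₀ * a₀ * a₀ * a₀) cofactor (- (a₀ * a₀ * a₀ * a₀ * (α * α * α * α))) hess tang xx≡0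
            (solve 10 (λ α β a b zz yz yy xz xy xx →
              β :* β :* (β :* β) :* (a :* a :* a :* a :* zz :+ (:- κ 2) :* a :* a :* a :* b :* yz :+ a :* a :* b :* b :* (yy :+ κ 2 :* xz) :+ (:- κ 2) :* a :* b :* b :* b :* xy)
              := κ 0 :+ a :* a :* a :* a :* ((α :* α :* (α :* α :* xx :+ α :* β :* xy :+ β :* β :* xz) :+ α :* β :* (α :* α :* xy :+ α :* β :* yy :+ β :* β :* yz) :+ β :* β :* (α :* α :* xz :+ α :* β :* yz :+ β :* β :* zz)) :- κ 0)
                :+ ((:- κ 2) :* a :* a :* a :* β :* β :* β :* yz :+ a :* a :* β :* β :* (yy :+ κ 2 :* xz) :* (β :* b :- α :* a) :+ (:- κ 2) :* a :* β :* xy :* (β :* b :* (β :* b) :- β :* b :* (α :* a) :+ α :* a :* (α :* a))) :* ((α :* a :+ β :* b) :- κ 0)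
                :+ (:- (a :* a :* a :* a :* (α :* α :* α :* α))) :* (xx :- κ 0)) refl α β a₀ b₀ zz yz yy xz xy xx)))
        where
        a = combination α n β m
        S' = move S (square n) t
        nn = square n
        nm = polar n m
        mm = square m
        val : F³ → F³ → F
        val d d' = value S' (∂ₛ d (∂ₛ d' f))
        a₀ = value S' (∂ₛ nm f)
        b₀ = value S' (∂ₛ mm f)
        zz = val mm mm
        yz = val nm mm
        yy = val nm nm
        xz = val nn mm
        xy = val nn nm
        xx = val nn nn
        cofactor = (- 2#) * a₀ * a₀ * a₀ * β * β * β * yz + a₀ * a₀ * β * β * (yy + 2# * xz) * (β * b₀ - α * a₀) + (- 2#) * a₀ * β * xy * (β * b₀ * (β * b₀) - β * b₀ * (α * a₀) + α * a₀ * (α * a₀))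
        E-value : E at t ≡ Eval a₀ b₀ zz yz yy xz xy
        E-value rewrite line-at S nn (∂ₛ nm f) t | line-at S nn (∂ₛ mm f) t | line-at S nn (∂ₛ mm (∂ₛ mm f)) t | line-at S nn (∂ₛ nm (∂ₛ mm f)) t
          | line-at S nn (∂ₛ nm (∂ₛ nm f)) t | line-at S nn (∂ₛ nn (∂ₛ mm f)) t | line-at S nn (∂ₛ nn (∂ₛ nm f)) t = refl
        cn' : Contains f S' nn
        cn' = Contains-move f S nn t cn
        x≡0 : value S' (∂ₛ nn f) ≡ 0#
        x≡0 = Contains-∂-at f S' nn l cn'
        xx≡0 : xx ≡ 0#
        xx≡0 = Contains-∂∂-at f S' nn l cn'
        ∂a : ∀ e → value S' (∂ₛ (square a) e) ≡ α * α * value S' (∂ₛ nn e) + α * β * value S' (∂ₛ nm e) + β * β * value S' (∂ₛ mm e)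
        ∂a = ∂-linear₃ S' (α * α) (α * β) (β * β) (square a) nn nm mm (square-combination α n β m)
        tang : α * a₀ + β * b₀ ≡ 0#
        tang = *-cancelˡ-0 β≢0 (trans (solve 4 (λ α β a b → β :* (α :* a :+ β :* b) := α :* α :* κ 0 :+ α :* β :* a :+ β :* β :* b) refl α β a₀ b₀)
          (trans (cong (λ z → α * α * z + α * β * a₀ + β * β * b₀) (sym x≡0)) (trans (sym (∂a f)) (Contains-∂-at f S' (square a) l ca))))
        swap : ∀ d → value S' (∂ₛ d (∂ₛ (square a) f)) ≡ α * α * val nn d + α * β * val nm d + β * β * val mm d
        swap d = trans (∂-comm (coord S') (coord d) (coord (square a)) f) (∂a (∂ₛ d f))
        comm : ∀ d d' → val d d' ≡ val d' d
        comm d d' = ∂-comm (coord S') (coord d) (coord d') f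
        hess : α * α * (α * α * xx + α * β * xy + β * β * xz) + α * β * (α * α * xy + α * β * yy + β * β * yz) + β * β * (α * α * xz + α * β * yz + β * β * zz) ≡ 0#
        hess = trans (cong₃ (λ x y z → α * α * x + α * β * y + β * β * z)
            (sym (trans (swap nn) (cong₂ (λ p q → α * α * xx + α * β * p + β * β * q) (comm nm nn) (comm mm nn))))
            (sym (trans (swap nm) (cong (λ q → α * α * xy + α * β * yy + β * β * q) (comm mm nm))))
            (sym (swap mm)))
          (trans (sym (∂a (∂ₛ (square a) f)))
            (Contains-∂∂-at f S' (square a) l ca))

    wronskian-cong : ∀ {a a' a″ b b' b″ p p' p″ q q' q″} → a ≡ p → a' ≡ p' → a″ ≡ p″ → b ≡ q → b' ≡ q' → b″ ≡ q″ →
      wronskian a a' a″ b b' b″ ≡ wronskian p p' p″ q q' q″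
    wronskian-cong refl refl refl refl refl refl = refl

    module _ (l : size f < order) where
      -- At a crossing of the lines in the directions square n and square m, the derivative of E along the former
      -- is, up to a power of A, the Wronskian of the latter.
      wronskian-at-crossing : ∀ S₀ n m t → let S = move S₀ (square m) t in
        Contains f S₀ (square m) → Contains f S (square n) →
        D (Second.E S n m) at 0# ≡ 0# →
        W (line S₀ (square m) (∂ₛ (polar n m) f)) (line S₀ (square m) (∂ₛ (square n) f)) t ≡ 0#
      wronskian-at-crossing S₀ n m t cm cn dE =
        trans W-value (split (no-zero-divisors (trans (sym dE-value) dE)))
        where
        l≤ = <⇒≤ l
        S = move S₀ (square m) t
        nn = square n
        nm = polar n m
        mm = square m
        open Second S n m
        a b₁ a₁ b₂ : F
        a = value S (∂ₛ nm f)
        b₁ = value S (∂ₛ mm (∂ₛ nn f))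
        a₁ = value S (∂ₛ mm (∂ₛ nm f))
        b₂ = value S (∂ₛ mm (∂ₛ mm (∂ₛ nn f)))
        a₂ = value S (∂ₛ mm (∂ₛ mm (∂ₛ nm f)))
        cm' : Contains f S mm
        cm' = Contains-move f S₀ mm t cm
        W-value : W (line S₀ mm (∂ₛ nm f)) (line S₀ mm (∂ₛ nn f)) t ≡ a * (a * b₂ - 2# * b₁ * a₁)
        W-value = trans (wronskian-cong (line-at S₀ mm (∂ₛ nm f) t) (D-line S₀ mm (∂ₛ nm f) t) (DD-line S₀ mm (∂ₛ nm f) (≤-<-trans (size-∂≤ _ f) l) t)
            (trans (line-at S₀ mm (∂ₛ nn f) t) (Contains-∂-at f S nn l≤ cn)) (D-line S₀ mm (∂ₛ nn f) t) (DD-line S₀ mm (∂ₛ nn f) (≤-<-trans (size-∂≤ _ f) l) t))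
          (solve 5 (λ a a₁ a₂ b₁ b₂ → b₂ :* a :* a :- κ 2 :* b₁ :* a₁ :* a :- κ 0 :* a₂ :* a :+ κ 2 :* κ 0 :* a₁ :* a₁ := a :* (a :* b₂ :- κ 2 :* b₁ :* a₁)) refl
              a a₁ a₂ b₁ b₂)
        at-S : ∀ e → line S nn e at 0# ≡ value S e
        at-S e = trans (line-at S nn e 0#) (cong (λ S → value S e) (move-0 S nn))
        D-S : ∀ e → D (line S nn e) at 0# ≡ value S (∂ₛ nn e)
        D-S e = trans (D-line S nn e 0#) (cong (λ S → value S (∂ₛ nn e)) (move-0 S nn))
        -- At the crossing B vanishes because the second line lies in the surface. So the terms of E
        -- with B² and B³ do not contribute to the derivative, and the term with B contributes only
        -- through B'. Exchanging the order of differentiation turns B' and the derivative of the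
        -- Hessian entry into derivatives along the second line.
        B₀≡0 : B at 0# ≡ 0#
        B₀≡0 = trans (at-S (∂ₛ mm f)) (Contains-∂-at f S mm l≤ cm')
        third : value S (∂ₛ nn (∂ₛ mm (∂ₛ mm f))) ≡ b₂
        third = trans (∂-comm (coord S) (coord nn) (coord mm) (∂ₛ mm f))
          (∂-cong S mm (∂ₛ nn (∂ₛ mm f)) (∂ₛ mm (∂ₛ nn f)) (≤-trans (size-∂≤ _ (∂ₛ mm f)) (≤-trans (size-∂≤ _ f) l≤))
            (≤-<-trans (size-∂≤ _ (∂ₛ nn f)) (≤-<-trans (size-∂≤ _ f) l)) (λ S → ∂-comm (coord S) (coord nn) (coord mm) f))
        factor : ∀ p q → q at 0# ≡ 0# → D (p ⊗ q) at 0# ≡ p at 0# * D q at 0#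
        factor p q z = trans (cong (λ y → D p at 0# * y + p at 0# * D q at 0#) z) (trans (cong (_+ p at 0# * D q at 0#) (zeroʳ _)) (+-identityˡ _))
        factor₁ : ∀ p y → D (p ⊗ B ⊗ y) at 0# ≡ p at 0# * D B at 0# * y at 0#
        factor₁ p y = trans (cong (λ b → (D p at 0# * b + p at 0# * D B at 0#) * y at 0# + p at 0# * b * D y at 0#) B₀≡0)
          (solve 5 (λ p p' b' y y' → (p' :* κ 0 :+ p :* b') :* y :+ p :* κ 0 :* y' := p :* b' :* y) refl (p at 0#) (D p at 0#) (D B at 0#) (y at 0#) (D y at 0#))
        factor₂ : ∀ p y → D (p ⊗ B ⊗ B ⊗ y) at 0# ≡ 0#
        factor₂ p y = trans (cong (λ b → ((D p at 0# * b + p at 0# * D B at 0#) * b + p at 0# * b * D B at 0#) * y at 0# + p at 0# * b * b * D y at 0#) B₀≡0)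
          (solve 5 (λ p p' b' y y' → ((p' :* κ 0 :+ p :* b') :* κ 0 :+ p :* κ 0 :* b') :* y :+ p :* κ 0 :* κ 0 :* y' := κ 0) refl (p at 0#) (D p at 0#) (D B at 0#) (y at 0#) (D y at 0#))
        factor₃ : ∀ p y → D (p ⊗ B ⊗ B ⊗ B ⊗ y) at 0# ≡ 0#
        factor₃ p y = trans (cong (λ z → z * y at 0# + (p ⊗ B ⊗ B ⊗ B) at 0# * D y at 0#) (factor₂ p B))
          (trans (cong (λ b → 0# * y at 0# + p at 0# * b * b * b * D y at 0#) B₀≡0)
            (solve 3 (λ p y y' → κ 0 :* y :+ p :* κ 0 :* κ 0 :* κ 0 :* y' := κ 0) refl (p at 0#) (y at 0#) (D y at 0#)))
        A₀ : A at 0# ≡ a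
        A₀ = at-S (∂ₛ nm f)
        dE-value : D E at 0# ≡ a * a * a * (a * b₂ - 2# * b₁ * a₁)
        dE-value = trans (cong₂ _+_ (cong₂ _+_ (cong₂ _+_
            (trans (factor (A ⊗ A ⊗ A ⊗ A) (second mm mm) (trans (at-S (∂ₛ mm (∂ₛ mm f))) (Contains-∂∂-at f S mm l≤ cm')))
              (cong₂ (λ x y → x * x * x * x * y) A₀ (trans (D-S (∂ₛ mm (∂ₛ mm f))) third)))
            (trans (factor₁ (cst (- 2#) ⊗ A ⊗ A ⊗ A) (second nm mm))
              (cong₃ (λ x y z → - 2# * x * x * x * y * z) A₀ (trans (D-S (∂ₛ mm f)) (∂-comm (coord S) (coord nn) (coord mm) f))
                (trans (at-S (∂ₛ nm (∂ₛ mm f))) (∂-comm (coord S) (coord nm) (coord mm) f)))))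
            (factor₂ (A ⊗ A) (second nm nm ⊕ cst 2# ⊗ second nn mm)))
            (factor₃ (cst (- 2#) ⊗ A) (second nn nm)))
          (solve 4 (λ a a₁ b₁ b₂ → a :* a :* a :* a :* b₂ :+ :- κ 2 :* a :* a :* a :* b₁ :* a₁ :+ κ 0 :+ κ 0 := a :* a :* a :* (a :* b₂ :- κ 2 :* b₁ :* a₁)) refl a a₁ b₁ b₂)
        split : a * a * a ≡ 0# ⊎ a * b₂ - 2# * b₁ * a₁ ≡ 0# → a * (a * b₂ - 2# * b₁ * a₁) ≡ 0#
        split (inj₂ z) = trans (cong (a *_) z) (zeroʳ a)
        split (inj₁ z) = trans (cong (_* (a * b₂ - 2# * b₁ * a₁)) a≡0) (zeroˡ _)
          where
          a≡0 : a ≡ 0#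
          a≡0 with no-zero-divisors z
          ... | inj₁ q = sq≡0 q
          ... | inj₂ q = q

      -- The Wronskian is unchanged, up to a factor, when the complementary direction is changed.
      wronskian-change : ∀ S₀ n m α β → β ≢ 0# → let a = combination α m β n in Contains f S₀ (square m) → ∀ t →
        W (line S₀ (square m) (∂ₛ (polar a m) f)) (line S₀ (square m) (∂ₛ (square a) f)) t ≡ 0# →
        W (line S₀ (square m) (∂ₛ (polar n m) f)) (line S₀ (square m) (∂ₛ (square n) f)) t ≡ 0#
      wronskian-change S₀ n m α β β≢0 cm t w = *-cancelˡ-0 (*-≢0 (*-≢0 β≢0 β≢0) (*-≢0 β≢0 β≢0)) (trans (sym W-scale) w)
        where
        l≤ = <⇒≤ l
        a = combination α m β n
        A B A' B' A″ B″ : Poly₁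
        A = line S₀ (square m) (∂ₛ (polar n m) f)
        B = line S₀ (square m) (∂ₛ (square n) f)
        A' = line S₀ (square m) (∂ₛ (polar a m) f)
        B' = line S₀ (square m) (∂ₛ (square a) f)
        -- The ratio B / A is replaced by α + β B / A and A by β A, so the Wronskian, (B / A)″ A³,
        -- is multiplied by β⁴.
        A″ = cst β ⊗ A
        B″ = cst (α * β) ⊗ A ⊕ cst (β * β) ⊗ B
        small : ∀ d → size (line S₀ (square m) (∂ₛ d f)) < order
        small d = ≤-<-trans (size-line S₀ (square m) (∂ₛ d f) (size-∂≤ _ f)) l
        cst-size : ∀ c e → size e < order → size (cst c ⊗ e) < order
        cst-size c e q = ≤-<-trans (bound (size e)) q
          where
          bound : ∀ k → sizeProduct 1 k ≤ k
          bound zero = z≤n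
          bound (suc k) = ≤-refl
        smallA″ : size A″ < order
        smallA″ = cst-size β A (small _)
        smallB″ : size B″ < order
        smallB″ = ⊔-lub (cst-size (α * β) A (small _)) (cst-size (β * β) B (small _))
        m≡0 : ∀ t → value (move S₀ (square m) t) (∂ₛ (square m) f) ≡ 0#
        m≡0 t = Contains-∂-at f _ _ l≤ (Contains-move f S₀ (square m) t cm)
        A-eq : ∀ t → A' at t ≡ A″ at t
        A-eq t = trans (line-at S₀ (square m) (∂ₛ (polar a m) f) t)
          (trans (∂-linear₃ _ (2# * α) β 0# _ (square m) (polar n m) (square m) (polar-combination α n β m) f)
            (trans (cong₂ (λ x y → 2# * α * x + β * y + 0# * x) (m≡0 t) (sym (line-at S₀ (square m) (∂ₛ (polar n m) f) t)))
              (solve 3 (λ α β x → κ 2 :* α :* κ 0 :+ β :* x :+ κ 0 :* κ 0 := β :* x) refl α β (A at t))))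
        polar-sym : ∀ n m v → coord (polar n m) v ≡ coord (polar m n) v
        polar-sym (n₁ , n₂) (m₁ , m₂) axis₁ = cong (2# *_) (*-comm n₁ m₁)
        polar-sym (n₁ , n₂) (m₁ , m₂) axis₂ = solve 4 (λ n₁ n₂ m₁ m₂ → n₁ :* m₂ :+ n₂ :* m₁ := m₁ :* n₂ :+ m₂ :* n₁) refl n₁ n₂ m₁ m₂
        polar-sym (n₁ , n₂) (m₁ , m₂) axis₃ = cong (2# *_) (*-comm n₂ m₂)
        B-eq : ∀ t → B' at t ≡ B″ at t
        B-eq t = trans (line-at S₀ (square m) (∂ₛ (square a) f) t)
          (trans (∂-linear₃ _ (α * α) (α * β) (β * β) _ (square m) (polar n m) (square n)
              (λ v → trans (square-combination α m β n v) (cong (λ z → α * α * coord (square m) v + α * β * z + β * β * coord (square n) v) (polar-sym m n v))) f)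
            (trans (cong₃ (λ x y z → α * α * x + α * β * y + β * β * z) (m≡0 t) (sym (line-at S₀ (square m) (∂ₛ (polar n m) f) t)) (sym (line-at S₀ (square m) (∂ₛ (square n) f) t)))
              (solve 4 (λ α β x y → α :* α :* κ 0 :+ α :* β :* x :+ β :* β :* y := α :* β :* x :+ β :* β :* y) refl α β (A at t) (B at t))))
        DA-eq : ∀ t → D A' at t ≡ D A″ at t
        DA-eq = D-cong A' A″ (<⇒≤ (small _)) smallA″ A-eq
        DB-eq : ∀ t → D B' at t ≡ D B″ at t
        DB-eq = D-cong B' B″ (<⇒≤ (small _)) smallB″ B-eq
        DDA-eq : ∀ t → D (D A') at t ≡ D (D A″) at t
        DDA-eq = D-cong (D A') (D A″) (≤-trans (size-∂≤ _ A') (<⇒≤ (small _))) (≤-<-trans (size-∂≤ _ A″) smallA″) DA-eq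
        DDB-eq : ∀ t → D (D B') at t ≡ D (D B″) at t
        DDB-eq = D-cong (D B') (D B″) (≤-trans (size-∂≤ _ B') (<⇒≤ (small _))) (≤-<-trans (size-∂≤ _ B″) smallB″) DB-eq
        W-scale : W A' B' t ≡ β * β * (β * β) * W A B t
        W-scale = trans (wronskian-cong (A-eq t)
            (trans (DA-eq t) (solve 3 (λ β a a' → κ 0 :* a :+ β :* a' := β :* a') refl β (A at t) (D A at t)))
            (trans (DDA-eq t) (solve 4 (λ β a a' a″ → (κ 0 :* a :+ κ 0 :* a') :+ (κ 0 :* a' :+ β :* a″) := β :* a″) refl β (A at t) (D A at t) (D (D A) at t)))
            (B-eq t)
            (trans (DB-eq t) (solve 6 (λ γ ϵ a a' b b' → (κ 0 :* a :+ γ :* a') :+ (κ 0 :* b :+ ϵ :* b') := γ :* a' :+ ϵ :* b') refl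
              (α * β) (β * β) (A at t) (D A at t) (B at t) (D B at t)))
            (trans (DDB-eq t) (solve 8 (λ γ ϵ a a' a″ b b' b″ → ((κ 0 :* a :+ κ 0 :* a') :+ (κ 0 :* a' :+ γ :* a″)) :+ ((κ 0 :* b :+ κ 0 :* b') :+ (κ 0 :* b' :+ ϵ :* b″)) := γ :* a″ :+ ϵ :* b″) refl
              (α * β) (β * β) (A at t) (D A at t) (D (D A) at t) (B at t) (D B at t) (D (D B) at t))))
          (solve 8 (λ α β a a' a″ b b' b″ →
            let p = β :* a ; p' = β :* a' ; p″ = β :* a″
                γ = α :* β ; ϵ = β :* β
                q = γ :* a :+ ϵ :* b ; q' = γ :* a' :+ ϵ :* b' ; q″ = γ :* a″ :+ ϵ :* b″ in
            q″ :* p :* p :- κ 2 :* q' :* p' :* p :- q :* p″ :* p :+ κ 2 :* q :* p' :* p'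
            := β :* β :* (β :* β) :* (b″ :* a :* a :- κ 2 :* b' :* a' :* a :- b :* a″ :* a :+ κ 2 :* b :* a' :* a')) refl
            α β (A at t) (D A at t) (D (D A) at t) (B at t) (D B at t) (D (D B) at t))

-- Null lines of symmetric matrices as vectors of F⁴.

module NullLines (𝔽 : FiniteField) where
  open FieldTheory 𝔽
  open import Data.Nat using (_≤_; _<_)
  open Polynomials 𝔽
  open Interpolation 𝔽
  open Surfaces 𝔽

  F⁴ : Set
  F⁴ = F × F × F × F

  -- The line of (w , y) is the set of symmetric matrices S with S w = y.
  On : F⁴ → F³ → Set
  On (w₁ , w₂ , y₁ , y₂) (a , b , c) = a * w₁ + b * w₂ ≡ y₁ × b * w₁ + c * w₂ ≡ y₂

  -- For w ≠ 0 the symmetric matrices killing w are the multiples of n nᵀ with n orthogonal to w,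
  -- which is why the lines are null.
  direction : F⁴ → F²
  direction (w₁ , w₂ , _) = w₂ , - w₁

  tangent : F⁴ → F³
  tangent ℓ = square (direction ℓ)

  Proper : F⁴ → Set
  Proper (w₁ , w₂ , _) = w₁ ≢ 0# ⊎ w₂ ≢ 0#

  proper : ∀ ℓ m → direction ℓ ∧ m ≢ 0# → Proper ℓ
  proper (w₁ , w₂ , _) (m₁ , m₂) h with w₁ ≟ 0# | w₂ ≟ 0#
  ... | no w₁≢0 | _ = inj₁ w₁≢0
  ... | yes _ | no w₂≢0 = inj₂ w₂≢0
  ... | yes refl | yes refl = ⊥-elim (h (solve 2 (λ m₁ m₂ → κ 0 :* m₂ :- (:- κ 0) :* m₁ := κ 0) refl m₁ m₂))

  ∧-antisym : ∀ a b → a ∧ b ≡ - (b ∧ a)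
  ∧-antisym (a₁ , a₂) (b₁ , b₂) = solve 4 (λ a₁ a₂ b₁ b₂ → a₁ :* b₂ :- a₂ :* b₁ := :- (b₁ :* a₂ :- b₂ :* a₁)) refl a₁ a₂ b₁ b₂

  ∧-≢0-sym : ∀ a b → a ∧ b ≢ 0# → b ∧ a ≢ 0#
  ∧-≢0-sym a b h e = h (trans (∧-antisym a b) (trans (cong -_ e) (solve 0 (:- κ 0 := κ 0) refl)))

  -- The diagonal entries of the tangent are w₂² and w₁²; the parameter is read off from one that is
  -- nonzero.
  parameter : F⁴ → F³ → F³ → F
  parameter (w₁ , w₂ , _) (a , _ , c) (a' , _ , c') with w₁ ≟ 0#
  ... | yes _ = (a' - a) * (w₂ ⁻¹ * w₂ ⁻¹)
  ... | no _ = (c' - c) * (w₁ ⁻¹ * w₁ ⁻¹)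

  move-parameter : ∀ ℓ S S' → Proper ℓ → On ℓ S → On ℓ S' → S' ≡ move S (tangent ℓ) (parameter ℓ S S')
  move-parameter ℓ@(w₁ , w₂ , y₁ , y₂) (a , b , c) (a' , b' , c') pr (e₁ , e₂) (e₁' , e₂') with w₁ ≟ 0#
  ... | no w₁≢0 = cong₂ _,_ aa (cong₂ _,_ bb cc)
    where
    i = w₁ ⁻¹
    t = (c' - c) * (i * i)
    inv : w₁ * i ≡ 1#
    inv = *-inverse w₁ w₁≢0
    cc : c' ≡ c + (- w₁) * (- w₁) * t
    cc = combine₁ (- ((c' - c) * (w₁ * i + 1#))) inv (solve 4 (λ c' c w i → c' := c :+ (:- w) :* (:- w) :* ((c' :- c) :* (i :* i)) :+ (:- ((c' :- c) :* (w :* i :+ κ 1))) :* (w :* i :- κ 1)) refl c' c w₁ i)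
    bb : b' ≡ b + w₂ * (- w₁) * t
    bb = *-cancelˡ w₁≢0 (combine₃ 1# (- 1#) (- w₂) e₂' e₂ cc
      (solve 8 (λ b' b c' c w₁ w₂ y t → w₁ :* b' := w₁ :* (b :+ w₂ :* (:- w₁) :* t) :+ κ 1 :* (b' :* w₁ :+ c' :* w₂ :- y) :+ (:- κ 1) :* (b :* w₁ :+ c :* w₂ :- y)
        :+ (:- w₂) :* (c' :- (c :+ (:- w₁) :* (:- w₁) :* t))) refl b' b c' c w₁ w₂ y₂ t))
    aa : a' ≡ a + w₂ * w₂ * t
    aa = *-cancelˡ w₁≢0 (combine₃ 1# (- 1#) (- w₂) e₁' e₁ bb
      (solve 8 (λ b' b c' c w₁ w₂ y t → w₁ :* c' := w₁ :* (c :+ w₂ :* w₂ :* t) :+ κ 1 :* (c' :* w₁ :+ b' :* w₂ :- y) :+ (:- κ 1) :* (c :* w₁ :+ b :* w₂ :- y)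
        :+ (:- w₂) :* (b' :- (b :+ w₂ :* (:- w₁) :* t))) refl b' b a' a w₁ w₂ y₁ t))
  move-parameter ℓ@(w₁ , w₂ , y₁ , y₂) (a , b , c) (a' , b' , c') (inj₁ w₁≢0) _ _ | yes w₁≡0 = ⊥-elim (w₁≢0 w₁≡0)
  move-parameter ℓ@(w₁ , w₂ , y₁ , y₂) (a , b , c) (a' , b' , c') (inj₂ w₂≢0) (e₁ , e₂) (e₁' , e₂') | yes refl = cong₂ _,_ aa (cong₂ _,_ bb cc)
    where
    i = w₂ ⁻¹
    t = (a' - a) * (i * i)
    inv : w₂ * i ≡ 1#
    inv = *-inverse w₂ w₂≢0
    aa : a' ≡ a + w₂ * w₂ * t
    aa = combine₁ (- ((a' - a) * (w₂ * i + 1#))) inv (solve 4 (λ c' c w i → c' := c :+ w :* w :* ((c' :- c) :* (i :* i)) :+ (:- ((c' :- c) :* (w :* i :+ κ 1))) :* (w :* i :- κ 1)) refl a' a w₂ i)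
    bb : b' ≡ b + w₂ * (- 0#) * t
    bb = *-cancelˡ w₂≢0 (combine₂ 1# (- 1#) e₁' e₁
      (solve 7 (λ a' a b' b w y t → w :* b' := w :* (b :+ w :* (:- κ 0) :* t) :+ κ 1 :* (a' :* κ 0 :+ b' :* w :- y) :+ (:- κ 1) :* (a :* κ 0 :+ b :* w :- y)) refl a' a b' b w₂ y₁ t))
    cc : c' ≡ c + (- 0#) * (- 0#) * t
    cc = *-cancelˡ w₂≢0 (combine₂ 1# (- 1#) e₂' e₂
      (solve 7 (λ a' a b' b w y t → w :* b' := w :* (b :+ (:- κ 0) :* (:- κ 0) :* t) :+ κ 1 :* (a' :* κ 0 :+ b' :* w :- y) :+ (:- κ 1) :* (a :* κ 0 :+ b :* w :- y)) refl b' b c' c w₂ y₂ t))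

  base : F⁴ → F³
  base (w₁ , w₂ , y₁ , y₂) with w₁ ≟ 0#
  ... | no _ = (y₁ - y₂ * w₁ ⁻¹ * w₂) * w₁ ⁻¹ , y₂ * w₁ ⁻¹ , 0#
  ... | yes _ = 0# , y₁ * w₂ ⁻¹ , (y₂ - y₁ * w₂ ⁻¹ * w₁) * w₂ ⁻¹

  on-base : ∀ ℓ → Proper ℓ → On ℓ (base ℓ)
  on-base ℓ@(w₁ , w₂ , y₁ , y₂) pr with w₁ ≟ 0#
  ... | no w₁≢0 = combine₁ (y₁ - y₂ * i * w₂) inv (solve 5 (λ y₁ y₂ i w₁ w₂ → (y₁ :- y₂ :* i :* w₂) :* i :* w₁ :+ y₂ :* i :* w₂ := y₁ :+ (y₁ :- y₂ :* i :* w₂) :* (w₁ :* i :- κ 1)) refl y₁ y₂ i w₁ w₂)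
      , combine₁ y₂ inv (solve 4 (λ y i w w₂ → y :* i :* w :+ κ 0 :* w₂ := y :+ y :* (w :* i :- κ 1)) refl y₂ i w₁ w₂)
    where
    i = w₁ ⁻¹
    inv : w₁ * i ≡ 1#
    inv = *-inverse w₁ w₁≢0
  on-base ℓ@(w₁ , w₂ , y₁ , y₂) (inj₁ w₁≢0) | yes w₁≡0 = ⊥-elim (w₁≢0 w₁≡0)
  on-base ℓ@(w₁ , w₂ , y₁ , y₂) (inj₂ w₂≢0) | yes w₁≡0 =
      combine₁ y₁ inv (solve 4 (λ y i w w₂ → κ 0 :* w₂ :+ y :* i :* w := y :+ y :* (w :* i :- κ 1)) refl y₁ i w₂ w₁)
      , combine₁ (y₂ - y₁ * i * w₁) inv (solve 5 (λ y₁ y₂ i w₁ w₂ → y₁ :* i :* w₁ :+ (y₂ :- y₁ :* i :* w₁) :* i :* w₂ := y₂ :+ (y₂ :- y₁ :* i :* w₁) :* (w₂ :* i :- κ 1)) refl y₁ y₂ i w₁ w₂)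
    where
    i = w₂ ⁻¹
    inv : w₂ * i ≡ 1#
    inv = *-inverse w₂ w₂≢0

  decompose : ∀ a n m → n ∧ m ≢ 0# → a ≡ combination ((a ∧ m) * (n ∧ m) ⁻¹) n ((n ∧ a) * (n ∧ m) ⁻¹) m
  decompose (a₁ , a₂) (n₁ , n₂) (m₁ , m₂) h = cong₂ _,_
      (combine₁ (- a₁) (*-inverse _ h) (solve 7 (λ a₁ a₂ n₁ n₂ m₁ m₂ i → a₁ := (a₁ :* m₂ :- a₂ :* m₁) :* i :* n₁ :+ (n₁ :* a₂ :- n₂ :* a₁) :* i :* m₁ :+ (:- a₁) :* ((n₁ :* m₂ :- n₂ :* m₁) :* i :- κ 1)) refl a₁ a₂ n₁ n₂ m₁ m₂ _))
      (combine₁ (- a₂) (*-inverse _ h) (solve 7 (λ a₁ a₂ n₁ n₂ m₁ m₂ i → a₂ := (a₁ :* m₂ :- a₂ :* m₁) :* i :* n₂ :+ (n₁ :* a₂ :- n₂ :* a₁) :* i :* m₂ :+ (:- a₂) :* ((n₁ :* m₂ :- n₂ :* m₁) :* i :- κ 1)) refl a₁ a₂ n₁ n₂ m₁ m₂ _))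

  ⁻¹-≢0 : ∀ {x} → x ≢ 0# → x ⁻¹ ≢ 0#
  ⁻¹-≢0 {x} h e = 1≢0 (trans (sym (*-inverse x h)) (trans (cong (x *_) e) (zeroʳ x)))

  -- square n, square m and polar n m form a basis of the space of directions.
  gradient-polar : ∀ f S n m d → n ∧ m ≢ 0# → value S (∂ₛ (square n) f) ≡ 0# → value S (∂ₛ (square m) f) ≡ 0# →
    value S (∂ₛ (polar n m) f) ≡ 0# → value S (∂ₛ d f) ≡ 0#
  gradient-polar f S n@(n₁ , n₂) m@(m₁ , m₂) d@(d₁ , d₂ , d₃) h zn zm zp =
    trans (∂-linear₃ S (x * (i * i)) (z * (i * i)) (y * (i * i)) d (square n) (square m) (polar n m) span f)
      (trans (cong₃ (λ p q r → x * (i * i) * p + z * (i * i) * q + y * (i * i) * r) zn zm zp)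
        (solve 3 (λ x y z → x :* κ 0 :+ y :* κ 0 :+ z :* κ 0 := κ 0) refl _ _ _))
    where
    i = (n ∧ m) ⁻¹
    x = d₁ * (m₂ * m₂) - 2# * d₂ * (m₁ * m₂) + d₃ * (m₁ * m₁)
    z = d₁ * (n₂ * n₂) - 2# * d₂ * (n₁ * n₂) + d₃ * (n₁ * n₁)
    y = - (d₁ * (n₂ * m₂) - d₂ * (n₁ * m₂ + n₂ * m₁) + d₃ * (n₁ * m₁))
    δ = n ∧ m
    rescale : ∀ {u v} → δ * δ * u ≡ v → u ≡ i * i * v
    rescale {u} {v} e = *-cancelˡ (*-≢0 h h) (trans e (combine₁ (- (v * (δ * i + 1#))) (*-inverse δ h)
      (solve 3 (λ δ i v → v := δ :* δ :* (i :* i :* v) :+ (:- (v :* (δ :* i :+ κ 1))) :* (δ :* i :- κ 1)) refl δ i v)))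
    distribute : ∀ p q r → i * i * (x * p + z * q + y * r) ≡ x * (i * i) * p + z * (i * i) * q + y * (i * i) * r
    distribute p q r = solve 7 (λ i x y z p q r → i :* i :* (x :* p :+ z :* q :+ y :* r) := x :* (i :* i) :* p :+ z :* (i :* i) :* q :+ y :* (i :* i) :* r) refl i x y z p q r
    span : ∀ v → coord d v ≡ x * (i * i) * coord (square n) v + z * (i * i) * coord (square m) v + y * (i * i) * coord (polar n m) v
    span axis₁ = trans (rescale (solve 7 (λ d₁ d₂ d₃ n₁ n₂ m₁ m₂ → (n₁ :* m₂ :- n₂ :* m₁) :* (n₁ :* m₂ :- n₂ :* m₁) :* d₁
      := (d₁ :* (m₂ :* m₂) :- κ 2 :* d₂ :* (m₁ :* m₂) :+ d₃ :* (m₁ :* m₁)) :* (n₁ :* n₁) :+ (d₁ :* (n₂ :* n₂) :- κ 2 :* d₂ :* (n₁ :* n₂) :+ d₃ :* (n₁ :* n₁)) :* (m₁ :* m₁)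
        :+ (:- (d₁ :* (n₂ :* m₂) :- d₂ :* (n₁ :* m₂ :+ n₂ :* m₁) :+ d₃ :* (n₁ :* m₁))) :* (κ 2 :* (n₁ :* m₁))) refl d₁ d₂ d₃ n₁ n₂ m₁ m₂)) (distribute _ _ _)
    span axis₂ = trans (rescale (solve 7 (λ d₁ d₂ d₃ n₁ n₂ m₁ m₂ → (n₁ :* m₂ :- n₂ :* m₁) :* (n₁ :* m₂ :- n₂ :* m₁) :* d₂
      := (d₁ :* (m₂ :* m₂) :- κ 2 :* d₂ :* (m₁ :* m₂) :+ d₃ :* (m₁ :* m₁)) :* (n₁ :* n₂) :+ (d₁ :* (n₂ :* n₂) :- κ 2 :* d₂ :* (n₁ :* n₂) :+ d₃ :* (n₁ :* n₁)) :* (m₁ :* m₂)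
        :+ (:- (d₁ :* (n₂ :* m₂) :- d₂ :* (n₁ :* m₂ :+ n₂ :* m₁) :+ d₃ :* (n₁ :* m₁))) :* (n₁ :* m₂ :+ n₂ :* m₁)) refl d₁ d₂ d₃ n₁ n₂ m₁ m₂)) (distribute _ _ _)
    span axis₃ = trans (rescale (solve 7 (λ d₁ d₂ d₃ n₁ n₂ m₁ m₂ → (n₁ :* m₂ :- n₂ :* m₁) :* (n₁ :* m₂ :- n₂ :* m₁) :* d₃
      := (d₁ :* (m₂ :* m₂) :- κ 2 :* d₂ :* (m₁ :* m₂) :+ d₃ :* (m₁ :* m₁)) :* (n₂ :* n₂) :+ (d₁ :* (n₂ :* n₂) :- κ 2 :* d₂ :* (n₁ :* n₂) :+ d₃ :* (n₁ :* n₁)) :* (m₂ :* m₂)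
        :+ (:- (d₁ :* (n₂ :* m₂) :- d₂ :* (n₁ :* m₂ :+ n₂ :* m₁) :+ d₃ :* (n₁ :* m₁))) :* (κ 2 :* (n₂ :* m₂))) refl d₁ d₂ d₃ n₁ n₂ m₁ m₂)) (distribute _ _ _)

search : ∀ {A : Set} {P : A → Set} → Decidable P → ∀ xs → All P xs ⊎ Σ A λ x → x ∈ xs × ¬ P x
search P? [] = inj₁ []
search P? (x ∷ xs) with P? x
... | no ¬p = inj₂ (x , here refl , ¬p)
... | yes p with search P? xs
...   | inj₁ ps = inj₁ (p ∷ ps)
...   | inj₂ (y , i , ¬p) = inj₂ (y , there i , ¬p)

unique-map : ∀ {A B : Set} (f : A → B) xs → Unique xs → (∀ {x y} → x ∈ xs → y ∈ xs → f x ≡ f y → x ≡ y) → Unique (map f xs)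
unique-map f [] _ _ = []
unique-map f (x ∷ xs) (n ∷ u) inj = fresh xs n (λ i → inj (here refl) (there i)) ∷ unique-map f xs u (λ i j → inj (there i) (there j))
  where
  fresh : ∀ ys → All (x ≢_) ys → (∀ {y} → y ∈ ys → f x ≡ f y → x ≡ y) → All (f x ≢_) (map f ys)
  fresh [] _ _ = []
  fresh (y ∷ ys) (n ∷ ns) h = (λ e → n (h (here refl) e)) ∷ fresh ys ns (λ i → h (there i))

length-partition : ∀ {A : Set} {P : A → Set} (P? : Decidable P) xs → length (filter P? xs) ℕ.+ length (filter (λ x → ¬? (P? x)) xs) ≡ length xs
length-partition P? [] = refl
length-partition P? (x ∷ xs) with P? x
... | yes _ = cong suc (length-partition P? xs)
... | no _ = trans (+-suc _ _) (cong suc (length-partition P? xs))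

length-cartesianProductWith : ∀ {A B C : Set} (f : A → B → C) xs ys → length (cartesianProductWith f xs ys) ≡ length xs ℕ.* length ys
length-cartesianProductWith f [] ys = refl
length-cartesianProductWith f (x ∷ xs) ys = trans (Listₚ.length-++ (map (f x) ys)) (cong₂ ℕ._+_ (Listₚ.length-map (f x) ys) (length-cartesianProductWith f xs ys))

-- Bounds for `size`: of the polynomial found by `interpolate`, and of `Second.E`, whose terms have
-- four first derivatives, one second derivative and at most a constant factor.
box-degree crossing-degree : ℕ → ℕ
box-degree e = e ℕ.+ (e ℕ.+ (e ℕ.+ 1))
crossing-degree e = box-degree e ℕ.+ box-degree e ℕ.+ box-degree e ℕ.+ box-degree e ℕ.+ (1 ℕ.+ box-degree e)

-- Two families of null lines with many crossings contain a large part of a regulus.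

module CrossingLines (𝔽 : FiniteField) where
  open FieldTheory 𝔽
  open import Data.Nat using (_≤_; _<_)
  open Polynomials 𝔽
  open Interpolation 𝔽
  open Surfaces 𝔽
  open NullLines 𝔽

  unit₁ unit₂ unit₃ : F³
  unit₁ = 1# , 0# , 0#
  unit₂ = 0# , 1# , 0#
  unit₃ = 0# , 0# , 1#

  axes : List F³
  axes = unit₁ ∷ unit₂ ∷ unit₃ ∷ []

  points : List F³
  points = cartesianProduct elements (cartesianProduct elements elements)

  points-complete : ∀ S → S ∈ points
  points-complete (a , b , c) = ∈-cartesianProduct⁺ (elements-complete a) (∈-cartesianProduct⁺ (elements-complete b) (elements-complete c))

  Singular : Poly Axis → F³ × F³ → F × F³ → Set
  Singular f (S , d) (t , e) = value (move S d t) (∂ₛ e f) ≡ 0#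

  size-0 : ∀ (f : Poly Axis) → size f ≡ 0 → ∀ ρ → eval ρ f ≡ 0#
  size-0 𝟘 _ ρ = refl
  size-0 (f ⊕ g) s ρ = trans (cong₂ _+_ (size-0 f (n≤0⇒n≡0 (≤-trans (m≤m⊔n _ (size g)) (≤-reflexive s))) ρ) (size-0 g (n≤0⇒n≡0 (≤-trans (m≤n⊔m (size f) _) (≤-reflexive s))) ρ)) (+-identityˡ 0#)
  size-0 (f ⊗ g) s ρ with size f in eqf | size g in eqg
  ... | zero | _ = trans (cong (_* eval ρ g) (size-0 f eqf ρ)) (zeroˡ _)
  ... | suc _ | zero = trans (cong (eval ρ f *_) (size-0 g eqg ρ)) (zeroʳ _)
  size-0 (f ⊗ g) () ρ | suc _ | suc _

  flat⇒constant : ∀ f → size f ≤ order → (∀ S → All (λ e → value S (∂ₛ e f) ≡ 0#) axes) → ∀ S S' → value S' f ≡ value S f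
  flat⇒constant f l h S@(a , b , c) S'@(a' , b' , c') =
    trans (cong (λ S → value S f) (sym move-1)) (trans (sym (line-at S d f 1#)) (trans
      (D-zero⇒constant (line S d f) (size-line S d f l) (λ t → trans (D-line S d f t) (flat (move S d t))) 1#)
      (trans (line-at S d f 0#) (cong (λ S → value S f) (move-0 S d)))))
    where
    d = a' - a , b' - b , c' - c
    move-1 : move S d 1# ≡ S'
    move-1 = cong₂ _,_ (z a a') (cong₂ _,_ (z b b') (z c c'))
      where
      z : ∀ x y → x + (y - x) * 1# ≡ y
      z = solve 2 (λ x y → x :+ (y :- x) :* κ 1 := y) refl
    flat : ∀ S → value S (∂ₛ d f) ≡ 0#
    flat S with h S
    ... | z₁ ∷ z₂ ∷ z₃ ∷ [] = trans (∂-linear₃ S _ _ _ d unit₁ unit₂ unit₃ (λ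
        { axis₁ → solve 3 (λ x y z → x := x :* κ 1 :+ y :* κ 0 :+ z :* κ 0) refl (a' - a) (b' - b) (c' - c)
        ; axis₂ → solve 3 (λ x y z → y := x :* κ 0 :+ y :* κ 1 :+ z :* κ 0) refl (a' - a) (b' - b) (c' - c)
        ; axis₃ → solve 3 (λ x y z → z := x :* κ 0 :+ y :* κ 0 :+ z :* κ 1) refl (a' - a) (b' - b) (c' - c) }) f)
      (trans (cong₂ _+_ (cong₂ (λ p q → (a' - a) * p + (b' - b) * q) z₁ z₂) (cong ((c' - c) *_) z₃))
        (solve 3 (λ x y z → x :* κ 0 :+ y :* κ 0 :+ z :* κ 0 := κ 0) refl (a' - a) (b' - b) (c' - c)))

  value-coord : ∀ ρ f → eval ρ f ≡ value (ρ axis₁ , ρ axis₂ , ρ axis₃) f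
  value-coord ρ f = eval-ext (λ { axis₁ → refl ; axis₂ → refl ; axis₃ → refl }) f

  -- Differentiate while all first derivatives vanish on the lines; as the degree is less than p, this stops
  -- before the polynomial becomes zero.
  regular : ∀ k (lines : List (F³ × F³)) ℓ₀ → ℓ₀ ∈ lines → ∀ f {δ} → size f ≤ k → size f ≤ δ → δ ≤ order → ¬ (∀ S → value S f ≡ 0#) →
    (∀ {S d} → (S , d) ∈ lines → Contains f S d) →
    Σ (Poly Axis) λ g → size g ≤ δ × (∀ {S d} → (S , d) ∈ lines → Contains g S d) ×
      Σ (F³ × F³) λ ℓ → ℓ ∈ lines × Σ (F × F³) λ te → ¬ Singular g ℓ te
  regular k lines ℓ₀ i₀ f lk lδ lo f≢0 cont with search (λ (ℓ , te) → value (move (proj₁ ℓ) (proj₂ ℓ) (proj₁ te)) (∂ₛ (proj₂ te) f) ≟ 0#)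
      (cartesianProduct lines (cartesianProduct elements axes))
  ... | inj₂ ((ℓ , te) , i , ns) = f , lδ , cont , ℓ , ℓ∈ , te , ns
    where
    ℓ∈ = proj₁ (∈-cartesianProduct⁻ lines (cartesianProduct elements axes) i)
  regular zero lines ℓ₀ i₀ f lk lδ lo f≢0 cont | inj₁ sing = ⊥-elim (f≢0 (λ S → size-0 f (n≤0⇒n≡0 lk) (coord S)))
  regular (suc k) lines ℓ₀ i₀ f {δ} lk lδ lo f≢0 cont | inj₁ sing with search (λ (S , e) → value S (∂ₛ e f) ≟ 0#) (cartesianProduct points axes)
  ... | inj₂ ((S , e) , i , nz) = regular k lines ℓ₀ i₀ (∂ₛ e f) (≤-trans (size-∂ _ f) (pred-mono-≤ lk)) (≤-trans (size-∂≤ _ f) lδ) lo (λ z → nz (z S))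
      (λ ℓ∈ t → All.lookup sing (∈-cartesianProduct⁺ ℓ∈ (∈-cartesianProduct⁺ (elements-complete t) e∈)))
    where
    e∈ = proj₂ (∈-cartesianProduct⁻ points axes i)
  ... | inj₁ flat = ⊥-elim (f≢0 (λ S → trans (flat⇒constant f (≤-trans lδ lo)
        (λ S → All.tabulate (λ e∈ → All.lookup flat (∈-cartesianProduct⁺ (points-complete S) e∈))) (move (proj₁ ℓ₀) (proj₂ ℓ₀) 0#) S) (cont i₀ 0#)))

  -- Vanishing at δ points of a line forces vanishing on the whole line, so δ conditions per line
  -- suffice against e³ coefficients. `regular` then trades the polynomial for a derivative that is
  -- nonsingular somewhere on the lines.
  surface : ∀ e → let δ = box-degree e in ∀ (lines : List (F³ × F³)) ℓ₀ → ℓ₀ ∈ lines → δ ≤ order →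
    length lines ℕ.* δ < e ℕ.* (e ℕ.* (e ℕ.* 1)) →
    Σ (Poly Axis) λ g → size g ≤ δ × (∀ {S d} → (S , d) ∈ lines → Contains g S d) ×
      Σ (F³ × F³) λ ℓ → ℓ ∈ lines × Σ (F × F³) λ te → ¬ Singular g ℓ te
  surface e lines ℓ₀ i₀ δ≤ few with interpolate e (≤-trans (m≤m+n e _) δ≤) grid
      (≤-trans (s≤s (≤-reflexive (trans (length-cartesianProductWith _ lines ts) (cong (length lines ℕ.*_) length-ts)))) few)
    where
    δ = box-degree e
    ts : List F
    ts = take δ elements
    length-ts : length ts ≡ δ
    length-ts = trans (Listₚ.length-take δ elements) (m≤n⇒m⊓n≡m δ≤)
    grid : List (Axis → F)
    grid = cartesianProductWith (λ ℓ t → coord (move (proj₁ ℓ) (proj₂ ℓ) t)) lines ts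
  ... | f , sizef , f≢0 , zs = regular δ lines ℓ₀ i₀ f sizef sizef δ≤ (λ h → f≢0 (λ ρ → trans (value-coord ρ f) (h _))) cont
    where
    δ = box-degree e
    cont : ∀ {S d} → (S , d) ∈ lines → Contains f S d
    cont {S} {d} i t = trans (sym (line-at S d f t)) (at-vanishes-by-roots (take δ elements) (Uniqueₚ.take⁺ δ elements-unique) (line S d f)
      (≤-trans (size-line S d f sizef) (≤-reflexive (sym (trans (Listₚ.length-take δ elements) (m≤n⇒m⊓n≡m δ≤)))))
      (All.tabulate (λ {t} t∈ → trans (line-at S d f t) (All.lookup zs (∈-cartesianProductWith⁺ _ i t∈)))) t)

  -- `separated-x` and `separated-y` say that distinct lines of one family cross a given line of the
  -- other at distinct points. With the degrees this gives `s` distinct roots on each line. One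
  -- index type serves both families because both come from the same segments.
  record Configuration (s : ℕ) : Set₁ where
    field
      I : Set
      Xs Ys : List I
      Xs-unique : Unique Xs
      Ys-unique : Unique Ys
      px py : I → F⁴
      R : I → I → Set
      R? : ∀ i j → Dec (R i j)
      cross : I → I → F³
      transversal : ∀ {i j} → R i j → direction (px i) ∧ direction (py j) ≢ 0#
      on-x : ∀ {i j} → R i j → On (px i) (cross i j)
      on-y : ∀ {i j} → R i j → On (py j) (cross i j)
      separated-x : ∀ {i i' j} → i ∈ Xs → i' ∈ Xs → R i j → R i' j → cross i j ≡ cross i' j → i ≡ i'
      separated-y : ∀ {i j j'} → j ∈ Ys → j' ∈ Ys → R i j → R i j' → cross i j ≡ cross i j' → j ≡ j'
      degree-x : ∀ {i} → i ∈ Xs → s ≤ length (filter (R? i) Ys)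
      degree-y : ∀ {j} → j ∈ Ys → s ≤ length (filter (λ i → R? i j) Xs)
      origin : I
      origin∈ : origin ∈ Xs

  scale-add : F → F⁴ → F → F⁴ → F⁴
  scale-add β (a , b , c , d) t (a' , b' , c' , d') = β * (a + t * a') , β * (b + t * b') , β * (c + t * c') , β * (d + t * d')

  module _ {s} (𝓒 : Configuration s) where
    open Configuration 𝓒

    private
      neighbour-x : ∀ {i j} → j ∈ filter (R? i) Ys → j ∈ Ys × R i j
      neighbour-x {i} = ∈-filter⁻ (R? i)
      neighbour-y : ∀ {i j} → i ∈ filter (λ i → R? i j) Xs → i ∈ Xs × R i j
      neighbour-y {i} {j} = ∈-filter⁻ (λ i → R? i j)

      proper-x : ∀ {i j} → R i j → Proper (px i)
      proper-x {i} {j} r = proper (px i) (direction (py j)) (transversal r)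
      proper-y : ∀ {i j} → R i j → Proper (py j)
      proper-y {i} {j} r = proper (py j) (direction (px i)) (∧-≢0-sym (direction (px i)) _ (transversal r))

    members : ∀ {A : Set} (xs : List A) → 0 < length xs → ∃ λ x → x ∈ xs
    members (x ∷ xs) _ = x , here refl

    module Parameters where
      ts-x : I → F³ → List F
      ts-x i S = map (λ j → parameter (px i) S (cross i j)) (filter (R? i) Ys)
      ts-y : I → F³ → List F
      ts-y j S = map (λ i → parameter (py j) S (cross i j)) (filter (λ i → R? i j) Xs)

      at-x : ∀ {i j} S → On (px i) S → R i j → cross i j ≡ move S (tangent (px i)) (parameter (px i) S (cross i j))
      at-x {i} {j} S o r = move-parameter (px i) S (cross i j) (proper-x r) o (on-x r)
      at-y : ∀ {i j} S → On (py j) S → R i j → cross i j ≡ move S (tangent (py j)) (parameter (py j) S (cross i j))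
      at-y {i} {j} S o r = move-parameter (py j) S (cross i j) (proper-y r) o (on-y r)

      unique-x : ∀ i S → On (px i) S → Unique (ts-x i S)
      unique-x i S o = unique-map _ _ (Uniqueₚ.filter⁺ (R? i) Ys-unique) λ {j} {j'} a b e →
        let (j∈ , r) = neighbour-x a ; (j'∈ , r') = neighbour-x b in
        separated-y j∈ j'∈ r r' (trans (at-x S o r) (trans (cong (move S _) e) (sym (at-x S o r'))))
      unique-y : ∀ j S → On (py j) S → Unique (ts-y j S)
      unique-y j S o = unique-map _ _ (Uniqueₚ.filter⁺ (λ i → R? i j) Xs-unique) λ {i} {i'} a b e →
        let (i∈ , r) = neighbour-y a ; (i'∈ , r') = neighbour-y b in
        separated-x i∈ i'∈ r r' (trans (at-y S o r) (trans (cong (move S _) e) (sym (at-y S o r'))))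

      -- The crossings on the line have at least `s` distinct parameters, more than the degree of
      -- `q`.
      vanish-x : ∀ {i} S → i ∈ Xs → On (px i) S → ∀ q → size q ≤ s → (∀ {j} → j ∈ Ys → R i j → q at parameter (px i) S (cross i j) ≡ 0#) → ∀ t → q at t ≡ 0#
      vanish-x {i} S i∈ o q l h = at-vanishes-by-roots (ts-x i S) (unique-x i S o) q
        (≤-trans l (≤-trans (degree-x i∈) (≤-reflexive (sym (Listₚ.length-map (λ j → parameter (px i) S (cross i j)) (filter (R? i) Ys))))))
        (Allₚ.map⁺ (All.tabulate (λ a → h (proj₁ (neighbour-x a)) (proj₂ (neighbour-x a)))))
      vanish-y : ∀ {j} S → j ∈ Ys → On (py j) S → ∀ q → size q ≤ s → (∀ {i} → i ∈ Xs → R i j → q at parameter (py j) S (cross i j) ≡ 0#) → ∀ t → q at t ≡ 0#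
      vanish-y {j} S j∈ o q l h = at-vanishes-by-roots (ts-y j S) (unique-y j S o) q
        (≤-trans l (≤-trans (degree-y j∈) (≤-reflexive (sym (Listₚ.length-map (λ i → parameter (py j) S (cross i j)) (filter (λ i → R? i j) Xs))))))
        (Allₚ.map⁺ (All.tabulate (λ a → h (proj₁ (neighbour-y a)) (proj₂ (neighbour-y a)))))
    open Parameters

    module _ (e : ℕ) (few : (length Xs ℕ.+ length Ys) ℕ.* box-degree e < e ℕ.* (e ℕ.* (e ℕ.* 1)))
        (M≤s : crossing-degree e ≤ s) (M≤order : 9 ℕ.+ crossing-degree e ≤ order) where
      private
        δ₀ M : ℕ
        δ₀ = box-degree e
        M = crossing-degree e
        δ≤M : δ₀ ≤ M
        δ≤M = ≤-trans (n≤1+n _) (m≤n+m (1 ℕ.+ δ₀) _)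
        δ<order : δ₀ < order
        δ<order = ≤-trans (s≤s (≤-trans δ≤M (m≤n+m M 8))) M≤order
        δ≤order : δ₀ ≤ order
        δ≤order = <⇒≤ δ<order
        δ≤s : δ₀ ≤ s
        δ≤s = ≤-trans δ≤M M≤s
        s>0 : 0 < s
        s>0 = ≤-trans (s≤s z≤n) (≤-trans (m≤n+m (1 ℕ.+ δ₀) (δ₀ ℕ.+ δ₀ ℕ.+ δ₀ ℕ.+ δ₀)) M≤s)

        crossing-x : ∀ {i} → i ∈ Xs → ∃ λ j → j ∈ Ys × R i j
        crossing-x i∈ = let (j , j∈) = members _ (≤-trans s>0 (degree-x i∈)) in j , neighbour-x j∈
        crossing-y : ∀ {j} → j ∈ Ys → ∃ λ i → i ∈ Xs × R i j
        crossing-y j∈ = let (i , i∈) = members _ (≤-trans s>0 (degree-y j∈)) in i , neighbour-y i∈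

        based : F⁴ → F³ × F³
        based ℓ = base ℓ , tangent ℓ
        lines : List (F³ × F³)
        lines = map (λ i → based (px i)) Xs ++ map (λ j → based (py j)) Ys
        length-lines : length lines ≡ length Xs ℕ.+ length Ys
        length-lines = trans (Listₚ.length-++ (map (λ i → based (px i)) Xs)) (cong₂ ℕ._+_ (Listₚ.length-map _ Xs) (Listₚ.length-map _ Ys))
        module Body (f : Poly Axis) (sizef : size f ≤ δ₀) (cont : ∀ {S d} → (S , d) ∈ lines → Contains f S d)
            (ℓ : F³ × F³) (ℓ∈ : ℓ ∈ lines) (t₀ : F) (d₀ : F³) (irregular : ¬ Singular f ℓ (t₀ , d₀)) where
          sizef< : size f < order
          sizef< = ≤-<-trans sizef δ<order
          sizef≤ : size f ≤ order
          sizef≤ = <⇒≤ sizef<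
          size∂f : ∀ S d d' → size (line S d (∂ₛ d' f)) ≤ δ₀
          size∂f S d d' = size-line S d (∂ₛ d' f) (≤-trans (size-∂≤ _ f) sizef)

          contains : ∀ ℓ S → Proper ℓ → based ℓ ∈ lines → On ℓ S → Contains f S (tangent ℓ)
          contains ℓ S pr i o = subst (λ S → Contains f S (tangent ℓ)) (sym (move-parameter ℓ (base ℓ) S pr (on-base ℓ pr) o))
            (Contains-move f (base ℓ) (tangent ℓ) _ (cont i))
          contains-x : ∀ {i j} S → i ∈ Xs → R i j → On (px i) S → Contains f S (tangent (px i))
          contains-x {i} S i∈ r = contains (px i) S (proper-x r) (∈-++⁺ˡ (∈-map⁺ _ i∈))
          contains-y : ∀ {i j} S → j ∈ Ys → R i j → On (py j) S → Contains f S (tangent (py j))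
          contains-y {i} {j} S j∈ r = contains (py j) S (proper-y r) (∈-++⁺ʳ (map (λ i → based (px i)) Xs) (∈-map⁺ _ j∈))

          -- Every line of the second family through the given x-line provides a root of E, after
          -- writing its direction in the basis n, m.
          E-vanishes : ∀ {i j} → i ∈ Xs → j ∈ Ys → R i j → ∀ t → Second.E f sizef (cross i j) (direction (px i)) (direction (py j)) at t ≡ 0#
          E-vanishes {i} {j} i∈ j∈ r = vanish-x S i∈ (on-x r) (Second.E f sizef S n m) (≤-trans (Second.size-E f sizef S n m) M≤s) (λ {j'} j'∈ r' →
              let a = direction (py j') ; t = parameter (px i) S (cross i j') ; eq = decompose a n m (transversal r) ; α = (a ∧ m) * (n ∧ m) ⁻¹ ; β = (n ∧ a) * (n ∧ m) ⁻¹ in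
              Second.E-at-crossing f sizef S n m sizef≤ t α β (*-≢0 (transversal r') (⁻¹-≢0 (transversal r)))
                (contains-x S i∈ r (on-x r))
                (subst (λ S' → Contains f S' (square (combination α n β m))) (at-x S (on-x r) r') (subst (λ a → Contains f (cross i j') (square a)) eq (contains-y (cross i j') j'∈ r' (on-y r')))))
            where
            S = cross i j
            n = direction (px i)
            m = direction (py j)

          wronskianP : Poly₁ → Poly₁ → Poly₁
          wronskianP A B = D (D B) ⊗ A ⊗ A ⊕ cst (- 2#) ⊗ D B ⊗ D A ⊗ A ⊕ cst (- 1#) ⊗ B ⊗ D (D A) ⊗ A ⊕ cst 2# ⊗ B ⊗ D A ⊗ D A
          wronskianP-at : ∀ A B t → wronskianP A B at t ≡ W A B t
          wronskianP-at A B t = solve 6 (λ a a' a″ b b' b″ → b″ :* a :* a :+ (:- κ 2) :* b' :* a' :* a :+ (:- κ 1) :* b :* a″ :* a :+ κ 2 :* b :* a' :* a'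
            := b″ :* a :* a :- κ 2 :* b' :* a' :* a :- b :* a″ :* a :+ κ 2 :* b :* a' :* a') refl (A at t) (D A at t) (D (D A) at t) (B at t) (D B at t) (D (D B) at t)
          size-wronskianP : ∀ A B → size A ≤ δ₀ → size B ≤ δ₀ → size (wronskianP A B) ≤ 1 ℕ.+ δ₀ ℕ.+ δ₀ ℕ.+ δ₀
          size-wronskianP A B lA lB = ⊔-lub (⊔-lub (⊔-lub
              (≤-trans (size-⊗ (D (D B) ⊗ A) A (size-⊗ (D (D B)) A lB″ lA) lA) (n≤1+n _))
              (three (cst (- 2#)) (D B) (D A) A ≤-refl lB' lA' lA))
              (three (cst (- 1#)) B (D (D A)) A ≤-refl lB lA″ lA))
              (three (cst 2#) B (D A) (D A) ≤-refl lB lA' lA')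
            where
            lA' = ≤-trans (size-∂≤ _ A) lA
            lA″ = ≤-trans (size-∂≤ _ (D A)) lA'
            lB' = ≤-trans (size-∂≤ _ B) lB
            lB″ = ≤-trans (size-∂≤ _ (D B)) lB'
            three : ∀ k a b c → size k ≤ 1 → size a ≤ δ₀ → size b ≤ δ₀ → size c ≤ δ₀ → size (k ⊗ a ⊗ b ⊗ c) ≤ 1 ℕ.+ δ₀ ℕ.+ δ₀ ℕ.+ δ₀
            three k a b c lk la lb lc = size-⊗ (k ⊗ a ⊗ b) c (size-⊗ (k ⊗ a) b (size-⊗ k a lk la) lb) lc

          module OnLine {i₀ j} (i₀∈ : i₀ ∈ Xs) (j∈ : j ∈ Ys) (r₀ : R i₀ j) where
            S₀ = cross i₀ j
            n = direction (px i₀)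
            m = direction (py j)
            A = line S₀ (square m) (∂ₛ (polar n m) f)
            B = line S₀ (square m) (∂ₛ (square n) f)
            m∧n : m ∧ n ≢ 0#
            m∧n = ∧-≢0-sym n m (transversal r₀)
            α β τ : I → F
            α i = (direction (px i) ∧ n) * (m ∧ n) ⁻¹
            β i = (m ∧ direction (px i)) * (m ∧ n) ⁻¹
            τ i = parameter (py j) S₀ (cross i j)
            decomposed : ∀ i → direction (px i) ≡ combination (α i) m (β i) n
            decomposed i = decompose (direction (px i)) m n m∧n
            β≢0 : ∀ {i} → R i j → β i ≢ 0#
            β≢0 {i} r = *-≢0 (∧-≢0-sym (direction (px i)) m (transversal r)) (⁻¹-≢0 m∧n)
            located : ∀ {i} → R i j → cross i j ≡ move S₀ (square m) (τ i)
            located r = at-y S₀ (on-y r₀) r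
            contains-m : Contains f S₀ (square m)
            contains-m = contains-y S₀ j∈ r₀ (on-y r₀)

            -- `E` vanishes identically on each x-line, so its derivative at the crossing does too.
            -- This gives the Wronskian with respect to the direction of that x-line;
            -- `wronskian-change` then passes to the fixed complementary direction n.
            W-at-crossing : ∀ {i} → i ∈ Xs → R i j → W A B (τ i) ≡ 0#
            W-at-crossing {i} i∈ r = wronskian-change f sizef sizef< S₀ n m (α i) (β i) (β≢0 r) contains-m (τ i)
                (subst (λ a → W (line S₀ (square m) (∂ₛ (polar a m) f)) (line S₀ (square m) (∂ₛ (square a) f)) (τ i) ≡ 0#) (decomposed i)
                  (wronskian-at-crossing f sizef sizef< S₀ (direction (px i)) m (τ i) contains-m
                    (subst (λ S → Contains f S (tangent (px i))) (located r) (contains-x (cross i j) i∈ r (on-x r)))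
                    (D-vanishes (Second.E f sizef _ (direction (px i)) m)
                      (≤-trans (Second.size-E f sizef _ (direction (px i)) m) (≤-trans (m≤n+m M 9) M≤order))
                      (λ t → subst (λ S → Second.E f sizef S (direction (px i)) m at t ≡ 0#) (located r) (E-vanishes i∈ j∈ r t)) 0#)))

            W-vanishes : ∀ t → W A B t ≡ 0#
            W-vanishes t = trans (sym (wronskianP-at A B t)) (vanish-y S₀ j∈ (on-y r₀) (wronskianP A B)
              (≤-trans (size-wronskianP A B (size∂f _ _ _) (size∂f _ _ _)) (≤-trans bound M≤s))
              (λ i∈ r → trans (wronskianP-at A B _) (W-at-crossing i∈ r)) t)
              where
              bound : 1 ℕ.+ δ₀ ℕ.+ δ₀ ℕ.+ δ₀ ≤ M
              bound = ≤-trans (s≤s (m≤m+n (δ₀ ℕ.+ δ₀ ℕ.+ δ₀) _)) (≤-trans (≤-reflexive (sym (+-suc (δ₀ ℕ.+ δ₀ ℕ.+ δ₀) δ₀)))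
                (≤-trans (+-monoˡ-≤ (1 ℕ.+ δ₀) (m≤m+n (δ₀ ℕ.+ δ₀ ℕ.+ δ₀) δ₀)) ≤-refl))

            module _ (A₀≢0 : A at 0# ≢ 0#) where
              B₀≡0 : B at 0# ≡ 0#
              B₀≡0 = trans (line-at S₀ (square m) (∂ₛ (square n) f) 0#) (trans (cong (λ S → value S (∂ₛ (square n) f)) (move-0 S₀ (square m)))
                (Contains-∂-at f S₀ (square n) sizef≤ (contains-x S₀ i₀∈ r₀ (on-x r₀))))

              affine : ∃ λ κ → ∀ t → B at t + κ * t * A at t ≡ 0#
              affine = Affine.ratio-affine A (size∂f _ _ _) A₀≢0 B (size∂f _ _ _) (≤-trans (s≤s (s≤s bound)) M≤order) B₀≡0 W-vanishes
                where
                bound : 7 ℕ.+ δ₀ ℕ.+ δ₀ ℕ.+ δ₀ ≤ 7 ℕ.+ M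
                bound = +-monoʳ-≤ 7 (≤-trans (m≤m+n (δ₀ ℕ.+ δ₀ ℕ.+ δ₀) δ₀) (m≤m+n (δ₀ ℕ.+ δ₀ ℕ.+ δ₀ ℕ.+ δ₀) _))

              k : F
              k = proj₁ affine

              -- Tangency gives α A + β B = 0 and `affine` gives B = - k t A. So the direction of
              -- the crossing line, up to a factor, turns linearly with the position of the
              -- crossing.
              slope : ∀ {i} → i ∈ Xs → R i j → A at τ i ≢ 0# → α i ≡ β i * (k * τ i)
              slope {i} i∈ r A≢0 = *-cancelˡ A≢0 (combine₂ 1# (- β i) tangency (proj₂ affine (τ i))
                (solve 6 (λ α β a b k t → a :* α := a :* (β :* (k :* t)) :+ κ 1 :* ((α :* a :+ β :* b) :- κ 0) :+ (:- β) :* ((b :+ k :* t :* a) :- κ 0)) refl (α i) (β i) (A at τ i) (B at τ i) k (τ i)))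
                where
                S = move S₀ (square m) (τ i)
                polar-sym : ∀ n m v → coord (polar n m) v ≡ coord (polar m n) v
                polar-sym (n₁ , n₂) (m₁ , m₂) axis₁ = cong (2# *_) (*-comm n₁ m₁)
                polar-sym (n₁ , n₂) (m₁ , m₂) axis₂ = solve 4 (λ n₁ n₂ m₁ m₂ → n₁ :* m₂ :+ n₂ :* m₁ := m₁ :* n₂ :+ m₂ :* n₁) refl n₁ n₂ m₁ m₂
                polar-sym (n₁ , n₂) (m₁ , m₂) axis₃ = cong (2# *_) (*-comm n₂ m₂)
                expanded : 0# ≡ α i * α i * 0# + α i * β i * A at τ i + β i * β i * B at τ i
                expanded = trans (sym (Contains-∂-at f S (square (combination (α i) m (β i) n)) sizef≤
                    (subst (λ a → Contains f S (square a)) (decomposed i) (subst (λ S → Contains f S (tangent (px i))) (located r) (contains-x (cross i j) i∈ r (on-x r))))))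
                  (trans (∂-linear₃ S (α i * α i) (α i * β i) (β i * β i) _ (square m) (polar n m) (square n)
                      (λ v → trans (square-combination (α i) m (β i) n v) (cong (λ z → α i * α i * coord (square m) v + α i * β i * z + β i * β i * coord (square n) v) (polar-sym m n v))) f)
                    (cong₃ (λ x y z → α i * α i * x + α i * β i * y + β i * β i * z) (Contains-∂-at f S (square m) sizef≤ (Contains-move f S₀ (square m) (τ i) contains-m))
                      (sym (line-at S₀ (square m) (∂ₛ (polar n m) f) (τ i))) (sym (line-at S₀ (square m) (∂ₛ (square n) f) (τ i)))))
                tangency : α i * A at τ i + β i * B at τ i ≡ 0#
                tangency = *-cancelˡ-0 (β≢0 r) (trans (solve 4 (λ α β a b → β :* (α :* a :+ β :* b) := α :* α :* κ 0 :+ α :* β :* a :+ β :* β :* b) refl (α i) (β i) (A at τ i) (B at τ i)) (sym expanded))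

              rotate : F² → F²
              rotate (x , y) = - y , x
              apply : F³ → F² → F²
              apply (a , b , c) (x , y) = a * x + b * y , b * x + c * y
              pair : F² → F² → F⁴
              pair (a , b) (c , d) = a , b , c , d
              plus : F² → F² → F²
              plus (a , b) (c , d) = a + c , b + d
              times : F → F² → F²
              times c (a , b) = c * a , c * b

              -- `rotate` recovers w from the direction, so by `slope` w is proportional to rotate n
              -- + t k rotate m, while y = (S₀ + t m mᵀ) w. The term in t² contains m mᵀ applied to
              -- rotate m, which is 0, so (w , y) is linear in t.
              u v : F⁴
              u = pair (rotate n) (apply S₀ (rotate n))
              v = pair (times k (rotate m)) (plus (times k (apply S₀ (rotate m))) (apply (square m) (rotate n)))

              on-regulus : ∀ {i} → i ∈ Xs → R i j → A at τ i ≢ 0# → px i ≡ scale-add (β i) u (τ i) v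
              on-regulus {i} i∈ r A≢0 = point (px i) n m S₀ (subst (λ α → direction (px i) ≡ combination α m (β i) n) (slope i∈ r A≢0) (decomposed i))
                  (subst (On (px i)) (located r) (on-x r))
                where
                point : ∀ ℓ n m S → direction ℓ ≡ combination (β i * (k * τ i)) m (β i) n → On ℓ (move S (square m) (τ i)) →
                  ℓ ≡ scale-add (β i) (pair (rotate n) (apply S (rotate n))) (τ i) (pair (times k (rotate m)) (plus (times k (apply S (rotate m))) (apply (square m) (rotate n))))
                point (w₁ , w₂ , y₁ , y₂) (n₁ , n₂) (m₁ , m₂) (a , b , c) d (o₁ , o₂) =
                  cong₂ _,_ ww₁ (cong₂ _,_ ww₂ (cong₂ _,_
                    (trans (sym o₁) (trans (cong₂ (λ p q → (a + m₁ * m₁ * t) * p + (b + m₁ * m₂ * t) * q) ww₁ ww₂)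
                      (solve 10 (λ a b c t g n₁ n₂ m₁ m₂ k → (a :+ m₁ :* m₁ :* t) :* (g :* (:- n₂ :+ t :* (k :* :- m₂))) :+ (b :+ m₁ :* m₂ :* t) :* (g :* (n₁ :+ t :* (k :* m₁)))
                        := g :* ((a :* :- n₂ :+ b :* n₁) :+ t :* (k :* (a :* :- m₂ :+ b :* m₁) :+ (m₁ :* m₁ :* :- n₂ :+ m₁ :* m₂ :* n₁)))) refl a b c t g n₁ n₂ m₁ m₂ k)))
                    (trans (sym o₂) (trans (cong₂ (λ p q → (b + m₁ * m₂ * t) * p + (c + m₂ * m₂ * t) * q) ww₁ ww₂)
                      (solve 10 (λ a b c t g n₁ n₂ m₁ m₂ k → (b :+ m₁ :* m₂ :* t) :* (g :* (:- n₂ :+ t :* (k :* :- m₂))) :+ (c :+ m₂ :* m₂ :* t) :* (g :* (n₁ :+ t :* (k :* m₁)))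
                        := g :* ((b :* :- n₂ :+ c :* n₁) :+ t :* (k :* (b :* :- m₂ :+ c :* m₁) :+ (m₁ :* m₂ :* :- n₂ :+ m₂ :* m₂ :* n₁)))) refl a b c t g n₁ n₂ m₁ m₂ k)))))
                  where
                  t g : F
                  t = τ i
                  g = β i
                  ww₁ : w₁ ≡ g * (- n₂ + t * (k * - m₂))
                  ww₁ = trans (solve 1 (λ w → w := :- (:- w)) refl w₁) (trans (cong -_ (cong proj₂ d))
                    (solve 5 (λ g k t m n → :- (g :* (k :* t) :* m :+ g :* n) := g :* (:- n :+ t :* (k :* :- m))) refl g k t m₂ n₂))
                  ww₂ : w₂ ≡ g * (n₁ + t * (k * m₁))
                  ww₂ = trans (cong proj₁ d) (solve 5 (λ g k t m n → g :* (k :* t) :* m :+ g :* n := g :* (n :+ t :* (k :* m))) refl g k t m₁ n₁)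

              good : List I
              good = filter (λ i → ¬? (A at τ i ≟ 0#)) (filter (λ i → R? i j) Xs)

              -- The discarded crossings are distinct zeros of A on the line. More than δ₀ of them
              -- would make A vanish identically, against A(0) ≠ 0.
              many : s ≤ δ₀ ℕ.+ length good
              many = ≤-trans (degree-y j∈) (≤-trans (≤-reflexive (sym (length-partition (λ i → A at τ i ≟ 0#) ns))) (+-monoˡ-≤ (length good) bad))
                where
                ns = filter (λ i → R? i j) Xs
                bad : length (filter (λ i → A at τ i ≟ 0#) ns) ≤ δ₀
                bad = ≮⇒≥ (λ l → A₀≢0 (at-vanishes-by-roots (map τ (filter (λ i → A at τ i ≟ 0#) ns))
                  (unique-map τ _ (Uniqueₚ.filter⁺ (λ i → A at τ i ≟ 0#) (Uniqueₚ.filter⁺ (λ i → R? i j) Xs-unique)) (λ a b eq →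
                    let (i∈ , r) = neighbour-y (proj₁ (∈-filter⁻ (λ i → A at τ i ≟ 0#) {xs = ns} a)) ; (i'∈ , r') = neighbour-y (proj₁ (∈-filter⁻ (λ i → A at τ i ≟ 0#) {xs = ns} b)) in
                    separated-x i∈ i'∈ r r' (trans (located r) (trans (cong (move S₀ (square m)) eq) (sym (located r'))))))
                  A (≤-trans (size∂f _ _ _) (≤-trans (<⇒≤ l) (≤-reflexive (sym (Listₚ.length-map τ (filter (λ i → A at τ i ≟ 0#) ns))))))
                  (Allₚ.map⁺ (All.tabulate (λ a → proj₂ (∈-filter⁻ (λ i → A at τ i ≟ 0#) {xs = ns} a)))) 0#))

          -- A derivative that vanished at all crossings of a line would vanish on the line, so a
          -- nonsingular point somewhere on it can be traded for a nonsingular crossing.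
          regular-crossing : Σ I λ i → Σ I λ j → i ∈ Xs × j ∈ Ys × R i j × Σ F³ λ d → value (cross i j) (∂ₛ d f) ≢ 0#
          regular-crossing with ∈-++⁻ (map (λ i → based (px i)) Xs) ℓ∈
          ... | inj₁ ℓ∈x with ∈-map⁻ _ ℓ∈x
          ...     | i , i∈ , refl with search (λ j → value (cross i j) (∂ₛ d₀ f) ≟ 0#) (filter (R? i) Ys)
          ...       | inj₂ (j , j∈ , nz) = i , j , i∈ , proj₁ (neighbour-x j∈) , proj₂ (neighbour-x j∈) , d₀ , nz
          ...       | inj₁ zs = ⊥-elim (irregular (trans (sym (line-at (base (px i)) (tangent (px i)) (∂ₛ d₀ f) t₀))
                        (vanish-x (base (px i)) i∈ (on-base (px i) pr) (line (base (px i)) (tangent (px i)) (∂ₛ d₀ f)) (≤-trans (size∂f _ _ _) δ≤s)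
                          (λ j∈ r → trans (line-at (base (px i)) (tangent (px i)) (∂ₛ d₀ f) _) (trans (cong (λ S → value S (∂ₛ d₀ f)) (sym (at-x (base (px i)) (on-base (px i) pr) r))) (All.lookup zs (∈-filter⁺ (R? i) j∈ r)))) t₀)))
            where
            pr : Proper (px i)
            pr = let (_ , _ , r) = crossing-x i∈ in proper-x r
          regular-crossing | inj₂ ℓ∈y with ∈-map⁻ _ ℓ∈y
          ...     | j , j∈ , refl with search (λ i → value (cross i j) (∂ₛ d₀ f) ≟ 0#) (filter (λ i → R? i j) Xs)
          ...       | inj₂ (i , i∈ , nz) = i , j , proj₁ (neighbour-y i∈) , j∈ , proj₂ (neighbour-y i∈) , d₀ , nz
          ...       | inj₁ zs = ⊥-elim (irregular (trans (sym (line-at (base (py j)) (tangent (py j)) (∂ₛ d₀ f) t₀))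
                        (vanish-y (base (py j)) j∈ (on-base (py j) pr) (line (base (py j)) (tangent (py j)) (∂ₛ d₀ f)) (≤-trans (size∂f _ _ _) δ≤s)
                          (λ i∈ r → trans (line-at (base (py j)) (tangent (py j)) (∂ₛ d₀ f) _) (trans (cong (λ S → value S (∂ₛ d₀ f)) (sym (at-y (base (py j)) (on-base (py j) pr) r))) (All.lookup zs (∈-filter⁺ (λ i → R? i j) i∈ r)))) t₀)))
            where
            pr : Proper (py j)
            pr = let (_ , _ , r) = crossing-y j∈ in proper-y r

          regulusᵇ : Σ I λ j → j ∈ Ys × Σ F⁴ λ u → Σ F⁴ λ v → Σ (List I) λ is → Unique is × s ≤ δ₀ ℕ.+ length is ×
            All (λ i → i ∈ Xs × R i j × Σ F λ β → Σ F λ t → β ≢ 0# × px i ≡ scale-add β u t v) is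
          regulusᵇ with regular-crossing
          ... | i₀ , j , i₀∈ , j∈ , r₀ , d , nz = j , j∈ , u A₀≢0 , v A₀≢0 , good A₀≢0 ,
                Uniqueₚ.filter⁺ (λ i → ¬? (A at τ i ≟ 0#)) (Uniqueₚ.filter⁺ (λ i → R? i j) Xs-unique) , many A₀≢0 ,
                All.tabulate (λ a → let (a' , A≢0) = ∈-filter⁻ (λ i → ¬? (A at τ i ≟ 0#)) {xs = filter (λ i → R? i j) Xs} a ; (i∈ , r) = neighbour-y a' in
                  i∈ , r , _ , _ , β≢0 r , on-regulus A₀≢0 i∈ r A≢0)
            where
            open OnLine i₀∈ j∈ r₀
            -- At a crossing the derivatives along both lines vanish, so at a regular one the
            -- derivative along `polar n m` cannot.
            A₀≢0 : A at 0# ≢ 0#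
            A₀≢0 z = nz (gradient-polar f S₀ n m d (transversal r₀) (Contains-∂-at f S₀ (square n) sizef≤ (contains-x S₀ i₀∈ r₀ (on-x r₀))) (Contains-∂-at f S₀ (square m) sizef≤ contains-m)
              (trans (sym (trans (line-at S₀ (square m) (∂ₛ (polar n m) f) 0#) (cong (λ S → value S (∂ₛ (polar n m) f)) (move-0 S₀ (square m))))) z))

      -- In F⁴ a regulus appears through the span of two vectors: its lines are the u + t v up to
      -- scalars. The deficit δ₀ pays for the crossings at which A vanishes.
      regulus : Σ I λ j → j ∈ Ys × Σ F⁴ λ u → Σ F⁴ λ v → Σ (List I) λ is → Unique is × s ≤ δ₀ ℕ.+ length is ×
        All (λ i → i ∈ Xs × R i j × Σ F λ β → Σ F λ t → β ≢ 0# × px i ≡ scale-add β u t v) is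
      regulus = conclude (surface e lines (based (px origin)) (∈-++⁺ˡ (∈-map⁺ (λ i → based (px i)) origin∈)) δ≤order (≤-trans (s≤s (≤-reflexive (cong (ℕ._* δ₀) length-lines))) few))
        where
        conclude : (Σ (Poly Axis) λ g → size g ≤ δ₀ × (∀ {S d} → (S , d) ∈ lines → Contains g S d) ×
          Σ (F³ × F³) λ ℓ → ℓ ∈ lines × Σ (F × F³) λ te → ¬ Singular g ℓ te) → _
        conclude (f , sizef , cont , ℓ , ℓ∈ , (t , d) , irregular) = Body.regulusᵇ f sizef cont ℓ ℓ∈ t d irregular

-- Double counting with sums over lists and indicator functions.

module FiniteSums where
  open import Data.Nat hiding (_≟_)
  open import Data.Nat.Properties hiding (_≟_)
  open ≤-Reasoning

  module _ {A : Set} where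
    ∑ : List A → (A → ℕ) → ℕ
    ∑ [] f = 0
    ∑ (x ∷ xs) f = f x + ∑ xs f

    ∑-cong : ∀ xs {f g : A → ℕ} → (∀ {x} → x ∈ xs → f x ≡ g x) → ∑ xs f ≡ ∑ xs g
    ∑-cong [] h = refl
    ∑-cong (x ∷ xs) h = cong₂ _+_ (h (here refl)) (∑-cong xs (λ i → h (there i)))

    ∑-mono : ∀ xs {f g : A → ℕ} → (∀ {x} → x ∈ xs → f x ≤ g x) → ∑ xs f ≤ ∑ xs g
    ∑-mono [] h = z≤n
    ∑-mono (x ∷ xs) h = +-mono-≤ (h (here refl)) (∑-mono xs (λ i → h (there i)))

    ∑-+ : ∀ xs (f g : A → ℕ) → ∑ xs (λ x → f x + g x) ≡ ∑ xs f + ∑ xs g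
    ∑-+ [] f g = refl
    ∑-+ (x ∷ xs) f g = trans (cong (f x + g x +_) (∑-+ xs f g)) (interchange (f x) (g x) (∑ xs f) (∑ xs g))
      where
      interchange : ∀ a b c d → a + b + (c + d) ≡ a + c + (b + d)
      interchange = solve-∀

    ∑-+₄ : ∀ xs (f g h k : A → ℕ) → ∑ xs (λ x → f x + g x + h x + k x) ≡ ∑ xs f + ∑ xs g + ∑ xs h + ∑ xs k
    ∑-+₄ xs f g h k = trans (∑-+ xs (λ x → f x + g x + h x) k) (cong (_+ ∑ xs k)
      (trans (∑-+ xs (λ x → f x + g x) h) (cong (_+ ∑ xs h) (∑-+ xs f g))))

    ∑-*ˡ : ∀ xs c (f : A → ℕ) → ∑ xs (λ x → c * f x) ≡ c * ∑ xs f
    ∑-*ˡ [] c f = sym (*-zeroʳ c)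
    ∑-*ˡ (x ∷ xs) c f = trans (cong (c * f x +_) (∑-*ˡ xs c f)) (sym (*-distribˡ-+ c (f x) (∑ xs f)))

    ∑-*ʳ : ∀ xs c (f : A → ℕ) → ∑ xs (λ x → f x * c) ≡ ∑ xs f * c
    ∑-*ʳ [] c f = refl
    ∑-*ʳ (x ∷ xs) c f = trans (cong (f x * c +_) (∑-*ʳ xs c f)) (sym (*-distribʳ-+ c (f x) (∑ xs f)))

    ∑-const : ∀ (xs : List A) c → ∑ xs (λ _ → c) ≡ length xs * c
    ∑-const [] c = refl
    ∑-const (x ∷ xs) c = cong (c +_) (∑-const xs c)

    ∑-zero : ∀ (xs : List A) → ∑ xs (λ _ → 0) ≡ 0
    ∑-zero xs = trans (∑-const xs 0) (*-zeroʳ (length xs))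

    ∑-≤-const : ∀ xs {f : A → ℕ} c → (∀ {x} → x ∈ xs → f x ≤ c) → ∑ xs f ≤ length xs * c
    ∑-≤-const xs c h = ≤-trans (∑-mono xs h) (≤-reflexive (∑-const xs c))

    ∑-++ : ∀ xs ys (f : A → ℕ) → ∑ (xs ++ ys) f ≡ ∑ xs f + ∑ ys f
    ∑-++ [] ys f = refl
    ∑-++ (x ∷ xs) ys f = trans (cong (f x +_) (∑-++ xs ys f)) (sym (+-assoc (f x) _ _))

    term≤∑ : ∀ {xs x} (f : A → ℕ) → x ∈ xs → f x ≤ ∑ xs f
    term≤∑ {x ∷ xs} f (here refl) = m≤m+n (f x) _
    term≤∑ {y ∷ xs} f (there i) = ≤-trans (term≤∑ f i) (m≤n+m _ (f y))

  ∑-map : ∀ {A B : Set} (g : A → B) xs (f : B → ℕ) → ∑ (map g xs) f ≡ ∑ xs (λ x → f (g x))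
  ∑-map g [] f = refl
  ∑-map g (x ∷ xs) f = cong (f (g x) +_) (∑-map g xs f)

  ∑-swap : ∀ {A B : Set} (xs : List A) (ys : List B) (f : A → B → ℕ) → ∑ xs (λ x → ∑ ys (f x)) ≡ ∑ ys (λ y → ∑ xs (λ x → f x y))
  ∑-swap [] ys f = sym (∑-zero ys)
  ∑-swap (x ∷ xs) ys f = trans (cong (∑ ys (f x) +_) (∑-swap xs ys f)) (sym (∑-+ ys (f x) (λ y → ∑ xs (λ x → f x y))))

  ∑-cartesianProduct : ∀ {A B : Set} (xs : List A) (ys : List B) (f : A × B → ℕ) → ∑ (cartesianProduct xs ys) f ≡ ∑ xs (λ x → ∑ ys (λ y → f (x , y)))
  ∑-cartesianProduct [] ys f = refl
  ∑-cartesianProduct (x ∷ xs) ys f = trans (∑-++ (map (x ,_) ys) (cartesianProduct xs ys) f) (cong₂ _+_ (∑-map (x ,_) ys f) (∑-cartesianProduct xs ys f))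

  𝟙 : ∀ {P : Set} → Dec P → ℕ
  𝟙 (yes _) = 1
  𝟙 (no _) = 0

  𝟙≤1 : ∀ {P : Set} (d : Dec P) → 𝟙 d ≤ 1
  𝟙≤1 (yes _) = ≤-refl
  𝟙≤1 (no _) = z≤n

  𝟙-yes : ∀ {P : Set} (d : Dec P) → P → 𝟙 d ≡ 1
  𝟙-yes (yes _) _ = refl
  𝟙-yes (no ¬p) p = ⊥-elim (¬p p)

  𝟙-no : ∀ {P : Set} (d : Dec P) → ¬ P → 𝟙 d ≡ 0
  𝟙-no (yes p) ¬p = ⊥-elim (¬p p)
  𝟙-no (no _) _ = refl

  𝟙-mono : ∀ {P Q : Set} (d : Dec P) (e : Dec Q) → (P → Q) → 𝟙 d ≤ 𝟙 e
  𝟙-mono (yes p) e h = ≤-reflexive (sym (𝟙-yes e (h p)))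
  𝟙-mono (no _) e h = z≤n

  𝟙-cong : ∀ {P Q : Set} (d : Dec P) (e : Dec Q) → (P → Q) → (Q → P) → 𝟙 d ≡ 𝟙 e
  𝟙-cong d e h k = ≤-antisym (𝟙-mono d e h) (𝟙-mono e d k)

  𝟙-≤ : ∀ {P : Set} (d : Dec P) {n} → (P → 1 ≤ n) → 𝟙 d ≤ n
  𝟙-≤ (yes p) h = h p
  𝟙-≤ (no _) h = z≤n

  𝟙*-≤ : ∀ {P : Set} (d : Dec P) {m n} → (P → m ≤ n) → 𝟙 d * m ≤ n
  𝟙*-≤ (yes p) {m} h = ≤-trans (≤-reflexive (+-identityʳ m)) (h p)
  𝟙*-≤ (no _) h = z≤n

  𝟙-square : ∀ {P : Set} (d : Dec P) → 𝟙 d * 𝟙 d ≡ 𝟙 d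
  𝟙-square (yes _) = refl
  𝟙-square (no _) = refl

  module _ {A : Set} where
    length-filter-∑ : ∀ {P : A → Set} (P? : Decidable P) xs → length (filter P? xs) ≡ ∑ xs (λ x → 𝟙 (P? x))
    length-filter-∑ P? [] = refl
    length-filter-∑ P? (x ∷ xs) with P? x
    ... | yes _ = cong suc (length-filter-∑ P? xs)
    ... | no _ = length-filter-∑ P? xs

    ∑-filter : ∀ {P : A → Set} (P? : Decidable P) xs f → ∑ (filter P? xs) f ≡ ∑ xs (λ x → 𝟙 (P? x) * f x)
    ∑-filter P? [] f = refl
    ∑-filter P? (x ∷ xs) f with P? x
    ... | yes _ = cong₂ _+_ (sym (+-identityʳ (f x))) (∑-filter P? xs f)
    ... | no _ = ∑-filter P? xs f

    ∑-none : ∀ xs (f : A → ℕ) → (∀ {x} → x ∈ xs → f x ≡ 0) → ∑ xs f ≡ 0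
    ∑-none xs f h = trans (∑-cong xs h) (∑-zero xs)

    ∑-at-most-one : ∀ {P : A → Set} (P? : Decidable P) {xs} → Unique xs → (∀ {x y} → x ∈ xs → y ∈ xs → P x → P y → x ≡ y) → ∑ xs (λ x → 𝟙 (P? x)) ≤ 1
    ∑-at-most-one P? {[]} u h = z≤n
    ∑-at-most-one P? {x ∷ xs} (n ∷ u) h with P? x
    ... | yes p = ≤-reflexive (cong suc (∑-none xs _ (λ {y} i → 𝟙-no (P? y) (λ q → All.lookup n i (h (here refl) (there i) p q)))))
    ... | no _ = ∑-at-most-one P? u (λ i j → h (there i) (there j))

    ∑-at-most-two : ∀ {P : A → Set} (P? : Decidable P) {xs} → Unique xs →
      (∀ {x y z} → x ∈ xs → y ∈ xs → z ∈ xs → P x → P y → P z → x ≢ y → x ≢ z → y ≢ z → ⊥) → ∑ xs (λ x → 𝟙 (P? x)) ≤ 2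
    ∑-at-most-two P? {[]} u h = z≤n
    ∑-at-most-two P? {x ∷ xs} (n ∷ u) h with P? x
    ... | no _ = ∑-at-most-two P? u (λ i j k → h (there i) (there j) (there k))
    ... | yes p = s≤s (∑-at-most-one' P? u (λ i j q r y≢z → h (here refl) (there i) (there j) p q r (All.lookup n i) (All.lookup n j) y≢z))
      where
      ∑-at-most-one' : ∀ {P : A → Set} (P? : Decidable P) {xs} → Unique xs → (∀ {x y} → x ∈ xs → y ∈ xs → P x → P y → x ≢ y → ⊥) → ∑ xs (λ x → 𝟙 (P? x)) ≤ 1
      ∑-at-most-one' P? {[]} u h = z≤n
      ∑-at-most-one' P? {x ∷ xs} (n ∷ u) h with P? x
      ... | yes p = ≤-reflexive (cong suc (∑-none xs _ (λ {y} i → 𝟙-no (P? y) (λ q → h (here refl) (there i) p q (All.lookup n i)))))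
      ... | no _ = ∑-at-most-one' P? u (λ i j → h (there i) (there j))

    ∑-exactly-one : ∀ {P : A → Set} (P? : Decidable P) {xs x} → Unique xs → x ∈ xs → P x → (∀ {y} → y ∈ xs → P y → x ≡ y) → ∑ xs (λ x → 𝟙 (P? x)) ≡ 1
    ∑-exactly-one P? {xs} {x} u i p h = ≤-antisym (∑-at-most-one P? u (λ j k q r → trans (sym (h j q)) (h k r)))
      (≤-trans (≤-reflexive (sym (𝟙-yes (P? x) p))) (term≤∑ (λ x → 𝟙 (P? x)) i))

    ∑-average : ∀ xs (f : A → ℕ) → 0 < length xs → Σ A λ x → x ∈ xs × length xs * f x ≤ ∑ xs f
    ∑-average (x ∷ []) f _ = x , here refl , ≤-refl
    ∑-average (x ∷ xs@(_ ∷ _)) f _ with ∑-average xs f (s≤s z≤n)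
    ... | y , i , l with ≤-total (f x) (f y)
    ...   | inj₁ fx≤ = x , here refl , +-monoʳ-≤ (f x) (≤-trans (*-monoʳ-≤ (length xs) fx≤) l)
    ...   | inj₂ fy≤ = y , there i , +-mono-≤ fy≤ l

  2ab≤a²+b² : ∀ a b → 2 * (a * b) ≤ a * a + b * b
  2ab≤a²+b² a b with ≤-total a b
  ... | inj₁ a≤b = subst (λ b → 2 * (a * b) ≤ a * a + b * b) (m+[n∸m]≡n a≤b) (le a (b ∸ a))
    where
    eq : ∀ a c → a * a + (a + c) * (a + c) ≡ 2 * (a * (a + c)) + c * c
    eq = solve-∀
    le : ∀ a c → 2 * (a * (a + c)) ≤ a * a + (a + c) * (a + c)
    le a c = ≤-trans (m≤m+n _ (c * c)) (≤-reflexive (sym (eq a c)))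
  ... | inj₂ b≤a = subst (λ a → 2 * (a * b) ≤ a * a + b * b) (m+[n∸m]≡n b≤a) (le b (a ∸ b))
    where
    eq : ∀ b c → (b + c) * (b + c) + b * b ≡ 2 * ((b + c) * b) + c * c
    eq = solve-∀
    le : ∀ b c → 2 * ((b + c) * b) ≤ (b + c) * (b + c) + b * b
    le b c = ≤-trans (m≤m+n _ (c * c)) (≤-reflexive (sym (eq b c)))

  module _ {A : Set} where
    ∑-*-∑ : ∀ {B : Set} (xs : List A) (ys : List B) f g → ∑ xs f * ∑ ys g ≡ ∑ xs (λ x → ∑ ys (λ y → f x * g y))
    ∑-*-∑ xs ys f g = trans (sym (∑-*ʳ xs (∑ ys g) f)) (∑-cong xs (λ {x} _ → sym (∑-*ˡ ys (f x) g)))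

    cauchy-schwarz : ∀ (xs : List A) (f g : A → ℕ) →
      ∑ xs (λ x → f x * g x) * ∑ xs (λ x → f x * g x) ≤ ∑ xs (λ x → f x * f x) * ∑ xs (λ x → g x * g x)
    cauchy-schwarz xs f g = *-cancelˡ-≤ 2 (begin
      2 * (∑ xs fg * ∑ xs fg) ≡⟨ cong (2 *_) (∑-*-∑ xs xs fg fg) ⟩
      2 * ∑ xs (λ x → ∑ xs (λ y → fg x * fg y)) ≡⟨ ∑-*ˡ xs 2 _ ⟨
      ∑ xs (λ x → 2 * ∑ xs (λ y → fg x * fg y)) ≡⟨ ∑-cong xs (λ _ → sym (∑-*ˡ xs 2 _)) ⟩
      ∑ xs (λ x → ∑ xs (λ y → 2 * (fg x * fg y))) ≤⟨ ∑-mono xs (λ {x} _ → ∑-mono xs (λ {y} _ → pointwise (f x) (g x) (f y) (g y))) ⟩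
      ∑ xs (λ x → ∑ xs (λ y → f x * f x * (g y * g y) + g x * g x * (f y * f y))) ≡⟨ ∑-cong xs (λ _ → ∑-+ xs _ _) ⟩
      ∑ xs (λ x → ∑ xs (λ y → f x * f x * (g y * g y)) + ∑ xs (λ y → g x * g x * (f y * f y))) ≡⟨ ∑-+ xs _ _ ⟩
      ∑ xs (λ x → ∑ xs (λ y → f x * f x * (g y * g y))) + ∑ xs (λ x → ∑ xs (λ y → g x * g x * (f y * f y)))
        ≡⟨ cong₂ _+_ (sym (∑-*-∑ xs xs ff gg)) (sym (∑-*-∑ xs xs gg ff)) ⟩
      ∑ xs ff * ∑ xs gg + ∑ xs gg * ∑ xs ff ≡⟨ double (∑ xs ff) (∑ xs gg) ⟩
      2 * (∑ xs ff * ∑ xs gg) ∎)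
      where
      fg ff gg : A → ℕ
      fg x = f x * g x
      ff x = f x * f x
      gg x = g x * g x
      double : ∀ a b → a * b + b * a ≡ 2 * (a * b)
      double = solve-∀
      regroup₁ : ∀ a b c d → 2 * (a * b * (c * d)) ≡ 2 * ((a * d) * (b * c))
      regroup₁ = solve-∀
      regroup₂ : ∀ a b c d → (a * d) * (a * d) + (b * c) * (b * c) ≡ a * a * (d * d) + b * b * (c * c)
      regroup₂ = solve-∀
      pointwise : ∀ a b c d → 2 * (a * b * (c * d)) ≤ a * a * (d * d) + b * b * (c * c)
      pointwise a b c d = ≤-trans (≤-reflexive (regroup₁ a b c d)) (≤-trans (2ab≤a²+b² (a * d) (b * c)) (≤-reflexive (regroup₂ a b c d)))

    square-∑ : ∀ (xs : List A) (f : A → ℕ) → ∑ xs f * ∑ xs f ≤ length xs * ∑ xs (λ x → f x * f x)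
    square-∑ xs f = begin
      ∑ xs f * ∑ xs f ≡⟨ cong₂ _*_ (∑-cong xs (λ {x} _ → sym (*-identityˡ (f x)))) (∑-cong xs (λ {x} _ → sym (*-identityˡ (f x)))) ⟩
      ∑ xs (λ x → 1 * f x) * ∑ xs (λ x → 1 * f x) ≤⟨ cauchy-schwarz xs (λ _ → 1) f ⟩
      ∑ xs (λ _ → 1) * ∑ xs (λ x → f x * f x) ≡⟨ cong (_* ∑ xs (λ x → f x * f x)) (trans (∑-const xs 1) (*-identityʳ (length xs))) ⟩
      length xs * ∑ xs (λ x → f x * f x) ∎

  ∑-two : ∀ {A : Set} {P : A → Set} (P? : Decidable P) {xs x y} → x ∈ xs → y ∈ xs → x ≢ y → P x → P y → 2 ≤ ∑ xs (λ x → 𝟙 (P? x))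
  ∑-two P? (here refl) (here refl) n _ _ = ⊥-elim (n refl)
  ∑-two P? {x ∷ xs} (here refl) (there j) n p q = +-mono-≤ (≤-reflexive (sym (𝟙-yes (P? x) p))) (≤-trans (≤-reflexive (sym (𝟙-yes (P? _) q))) (term≤∑ (λ z → 𝟙 (P? z)) j))
  ∑-two P? {x ∷ xs} (there i) (here refl) n p q = +-mono-≤ (≤-reflexive (sym (𝟙-yes (P? x) q))) (≤-trans (≤-reflexive (sym (𝟙-yes (P? _) p))) (term≤∑ (λ z → 𝟙 (P? z)) i))
  ∑-two P? {x ∷ xs} (there i) (there j) n p q = ≤-trans (∑-two P? i j n p q) (m≤n+m _ (𝟙 (P? x)))

  -- With u and v at least a (a - 1) and b (b - 1): the larger number alone suffices if a ≠ b, and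
  -- a² ≤ 2 a (a - 1) if a = b ≥ 2. The disjunction excludes a = b = 1.
  product≤excess : ∀ a b u v → (2 ≤ a ⊎ 2 ≤ b) → a * a ≤ a + u → b * b ≤ b + v → a * b ≤ u + v
  product≤excess a b u v big ha hb with <-cmp a b
  ... | tri< a<b _ _ = ≤-trans (+-cancelˡ-≤ b _ _ (≤-trans (≤-trans (+-monoʳ-≤ b (≤-reflexive (*-comm a b))) (≤-trans (≤-reflexive (sym (*-suc b a))) (*-monoʳ-≤ b a<b))) hb)) (m≤n+m v u)
  ... | tri> _ _ b<a = ≤-trans (+-cancelˡ-≤ a _ _ (≤-trans (≤-trans (≤-reflexive (sym (*-suc a b))) (*-monoʳ-≤ a b<a)) ha)) (m≤m+n u v)
  ... | tri≈ _ refl _ = +-cancelˡ-≤ (a + a) _ _ (begin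
      a + a + a * a ≤⟨ +-monoˡ-≤ (a * a) (≤-trans (≤-reflexive (cong (a +_) (sym (+-identityʳ a)))) (*-monoˡ-≤ a (two big))) ⟩
      a * a + a * a ≤⟨ +-mono-≤ ha hb ⟩
      a + u + (a + v) ≡⟨ interchange a u a v ⟩
      a + a + (u + v) ∎)
    where
    two : 2 ≤ a ⊎ 2 ≤ a → 2 ≤ a
    two (inj₁ h) = h
    two (inj₂ h) = h
    interchange : ∀ a u b v → a + u + (b + v) ≡ a + b + (u + v)
    interchange = solve-∀

  module _ {I P : Set} (_≟ᴵ_ : DecidableEquality I) (Z : List I) (unique-Z : Unique Z) (points : List P) (unique-points : Unique points) where

    -- Second moments of an incidence relation in which two objects have at most one common
    -- incidence. It serves for null lines through a matrix and, with pins in place of lines, for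
    -- pins on a line of the plane.
    module Pencil (X : I → P → Set) (X? : ∀ i S → Dec (X i S)) (adj : I → I → Set) (adj? : ∀ i j → Dec (adj i j))
        (meet-once : ∀ {i i' S S'} → i ∈ Z → i' ∈ Z → S ∈ points → S' ∈ points → i ≢ i' → X i S → X i' S → X i S' → X i' S' → S ≡ S')
        (meet : ∀ {i i' S} → X i S → X i' S → adj i i') where
      multiplicity excess : P → ℕ
      multiplicity S = ∑ Z (λ i → 𝟙 (X? i S))
      excess S = ∑ Z (λ i → ∑ Z (λ i' → 𝟙 (¬? (i ≟ᴵ i')) * (𝟙 (X? i S) * 𝟙 (X? i' S))))
      adjacencies : ℕ
      adjacencies = ∑ Z (λ i → ∑ Z (λ i' → 𝟙 (¬? (i ≟ᴵ i') ×-dec adj? i i')))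

      square-multiplicity : ∀ S → multiplicity S * multiplicity S ≤ multiplicity S + excess S
      square-multiplicity S = begin
        multiplicity S * multiplicity S ≡⟨ ∑-*-∑ Z Z _ _ ⟩
        ∑ Z (λ i → ∑ Z (λ i' → 𝟙 (X? i S) * 𝟙 (X? i' S))) ≤⟨ ∑-mono Z (λ {i} _ → ∑-mono Z (λ {i'} _ → split i i')) ⟩
        ∑ Z (λ i → ∑ Z (λ i' → 𝟙 (X? i S) * 𝟙 (i ≟ᴵ i') + 𝟙 (¬? (i ≟ᴵ i')) * (𝟙 (X? i S) * 𝟙 (X? i' S)))) ≡⟨ trans (∑-cong Z (λ _ → ∑-+ Z _ _)) (∑-+ Z _ _) ⟩
        ∑ Z (λ i → ∑ Z (λ i' → 𝟙 (X? i S) * 𝟙 (i ≟ᴵ i'))) + excess S ≤⟨ +-monoˡ-≤ (excess S) (∑-mono Z (λ {i} _ → diagonal i)) ⟩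
        multiplicity S + excess S ∎
        where
        split : ∀ i i' → 𝟙 (X? i S) * 𝟙 (X? i' S) ≤ 𝟙 (X? i S) * 𝟙 (i ≟ᴵ i') + 𝟙 (¬? (i ≟ᴵ i')) * (𝟙 (X? i S) * 𝟙 (X? i' S))
        split i i' with i ≟ᴵ i'
        ... | yes _ = ≤-trans (*-monoʳ-≤ (𝟙 (X? i S)) (𝟙≤1 (X? i' S))) (m≤m+n _ 0)
        ... | no _ = ≤-trans (≤-reflexive (sym (+-identityʳ _))) (m≤n+m _ (𝟙 (X? i S) * 0))
        diagonal : ∀ i → ∑ Z (λ i' → 𝟙 (X? i S) * 𝟙 (i ≟ᴵ i')) ≤ 𝟙 (X? i S)
        diagonal i = ≤-trans (≤-reflexive (∑-*ˡ Z (𝟙 (X? i S)) _)) (≤-trans (*-monoʳ-≤ (𝟙 (X? i S)) (∑-at-most-one (λ i' → i ≟ᴵ i') unique-Z (λ _ _ p q → trans (sym p) q))) (≤-reflexive (*-identityʳ _)))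

      total-excess : ∑ points excess ≤ adjacencies
      total-excess = begin
        ∑ points excess ≡⟨ trans (∑-swap points Z _) (∑-cong Z (λ _ → ∑-swap points Z _)) ⟩
        ∑ Z (λ i → ∑ Z (λ i' → ∑ points (λ S → 𝟙 (¬? (i ≟ᴵ i')) * (𝟙 (X? i S) * 𝟙 (X? i' S))))) ≤⟨ ∑-mono Z (λ i∈ → ∑-mono Z (λ i'∈ → once i∈ i'∈)) ⟩
        adjacencies ∎
        where
        once : ∀ {i i'} → i ∈ Z → i' ∈ Z → ∑ points (λ S → 𝟙 (¬? (i ≟ᴵ i')) * (𝟙 (X? i S) * 𝟙 (X? i' S))) ≤ 𝟙 (¬? (i ≟ᴵ i') ×-dec adj? i i')
        once {i} {i'} i∈ i'∈ with i ≟ᴵ i'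
        ... | yes _ = ≤-reflexive (∑-zero points)
        ... | no i≢i' with adj? i i'
        ...   | yes _ = ≤-trans (∑-mono points (λ {S} _ → both S)) (∑-at-most-one (λ S → X? i S ×-dec X? i' S) unique-points (λ S∈ S'∈ (a , b) (c , d) → meet-once i∈ i'∈ S∈ S'∈ i≢i' a b c d))
          where
          both : ∀ S → 1 * (𝟙 (X? i S) * 𝟙 (X? i' S)) ≤ 𝟙 (X? i S ×-dec X? i' S)
          both S with X? i S | X? i' S
          ... | yes _ | yes _ = ≤-refl
          ... | yes _ | no _ = z≤n
          ... | no _ | _ = z≤n
        ...   | no ¬adj = ≤-reflexive (∑-none points _ (λ {S} _ → none S))
          where
          none : ∀ S → 1 * (𝟙 (X? i S) * 𝟙 (X? i' S)) ≡ 0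
          none S with X? i S | X? i' S
          ... | yes a | yes b = ⊥-elim (¬adj (meet a b))
          ... | yes _ | no _ = refl
          ... | no _ | _ = refl

    module Concurrency
        (X Y : I → P → Set) (X? : ∀ i S → Dec (X i S)) (Y? : ∀ i S → Dec (Y i S)) (adjX adjY : I → I → Set) (adjX? : ∀ i j → Dec (adjX i j)) (adjY? : ∀ i j → Dec (adjY i j))
        (X-once : ∀ {i i' S S'} → i ∈ Z → i' ∈ Z → S ∈ points → S' ∈ points → i ≢ i' → X i S → X i' S → X i S' → X i' S' → S ≡ S') (X-meet : ∀ {i i' S} → X i S → X i' S → adjX i i')
        (Y-once : ∀ {i i' S S'} → i ∈ Z → i' ∈ Z → S ∈ points → S' ∈ points → i ≢ i' → Y i S → Y i' S → Y i S' → Y i' S' → S ≡ S') (Y-meet : ∀ {i i' S} → Y i S → Y i' S → adjY i i') where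
      module PX = Pencil X X? adjX adjX? X-once X-meet
      module PY = Pencil Y Y? adjY adjY? Y-once Y-meet

      Multiple : P → Set
      Multiple S = 2 ≤ PX.multiplicity S ⊎ 2 ≤ PY.multiplicity S
      multiple? : ∀ S → Dec (Multiple S)
      multiple? S = (2 ≤? PX.multiplicity S) ⊎-dec (2 ≤? PY.multiplicity S)

      -- C marks pairs of lines which cross at a point on a third line.
      concurrent-pairs : (C : I → I → Set) (C? : ∀ i j → Dec (C i j)) → (∀ {i j} → i ∈ Z → j ∈ Z → C i j → Σ P λ S → S ∈ points × X i S × Y j S × Multiple S) →
        ∑ Z (λ i → ∑ Z (λ j → 𝟙 (C? i j))) ≤ PX.adjacencies + PY.adjacencies
      concurrent-pairs C C? witness = begin
        ∑ Z (λ i → ∑ Z (λ j → 𝟙 (C? i j))) ≤⟨ ∑-mono Z (λ i∈ → ∑-mono Z (λ j∈ → located i∈ j∈)) ⟩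
        ∑ Z (λ i → ∑ Z (λ j → ∑ points (λ S → 𝟙 (multiple? S) * (𝟙 (X? i S) * 𝟙 (Y? j S)))))
          ≡⟨ trans (∑-cong Z (λ _ → ∑-swap Z points _)) (∑-swap Z points _) ⟩
        ∑ points (λ S → ∑ Z (λ i → ∑ Z (λ j → 𝟙 (multiple? S) * (𝟙 (X? i S) * 𝟙 (Y? j S)))))
          ≡⟨ ∑-cong points (λ {S} _ → trans (∑-cong Z (λ _ → ∑-*ˡ Z (𝟙 (multiple? S)) _)) (trans (∑-*ˡ Z (𝟙 (multiple? S)) _) (cong (𝟙 (multiple? S) *_) (sym (∑-*-∑ Z Z _ _))))) ⟩
        ∑ points (λ S → 𝟙 (multiple? S) * (PX.multiplicity S * PY.multiplicity S))
          ≤⟨ ∑-mono points (λ {S} _ → 𝟙*-≤ (multiple? S) (λ m → product≤excess _ _ _ _ m (PX.square-multiplicity S) (PY.square-multiplicity S))) ⟩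
        ∑ points (λ S → PX.excess S + PY.excess S) ≡⟨ ∑-+ points _ _ ⟩
        ∑ points PX.excess + ∑ points PY.excess ≤⟨ +-mono-≤ PX.total-excess PY.total-excess ⟩
        PX.adjacencies + PY.adjacencies ∎
        where
        located : ∀ {i j} → i ∈ Z → j ∈ Z → 𝟙 (C? i j) ≤ ∑ points (λ S → 𝟙 (multiple? S) * (𝟙 (X? i S) * 𝟙 (Y? j S)))
        located {i} {j} i∈ j∈ = 𝟙-≤ (C? i j) (λ c → let (S , S∈ , x , y , m) = witness i∈ j∈ c in
          ≤-trans (≤-reflexive (sym (cong₂ _*_ (𝟙-yes (multiple? S) m) (cong₂ _*_ (𝟙-yes (X? i S) x) (𝟙-yes (Y? j S) y)))))
            (term≤∑ (λ S → 𝟙 (multiple? S) * (𝟙 (X? i S) * 𝟙 (Y? j S))) S∈))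

open FiniteSums

-- Pruning a bipartite graph to large minimum degree.

record Extraction {A : Set} (xs : List A) (x : A) : Set where
  constructor extraction
  field
    rest : List A
    ∑-rest : ∀ f → ∑ xs f ≡ f x ℕ.+ ∑ rest f
    length-rest : length xs ≡ suc (length rest)
    unique-rest : Unique xs → Unique rest
    rest⊆ : ∀ {y} → y ∈ rest → y ∈ xs

extract : ∀ {A : Set} {x : A} {xs} → x ∈ xs → Extraction xs x
extract {x = x} {x ∷ xs} (here refl) = extraction xs (λ f → refl) refl (λ { (_ ∷ u) → u }) there
extract {x = x} {y ∷ xs} (there i) with extract i
... | extraction r s l u sub = extraction (y ∷ r)
  (λ f → trans (cong (f y ℕ.+_) (s f)) (trans (sym (ℕₚ.+-assoc (f y) (f x) _)) (trans (cong (ℕ._+ ∑ r f) (ℕₚ.+-comm (f y) (f x))) (ℕₚ.+-assoc (f x) (f y) _))))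
  (cong suc l) (λ { (n ∷ v) → All.tabulate (λ j → All.lookup n (sub j)) ∷ u v })
  (λ { (here e) → here e ; (there j) → there (sub j) })

module Pruning {I : Set} (R : I → I → Set) (R? : ∀ i j → Dec (R i j)) (s : ℕ) where
  edges : List I → List I → ℕ
  edges xs ys = ∑ xs (λ i → ∑ ys (λ j → 𝟙 (R? i j)))

  record Pruned (xs ys : List I) : Set where
    field
      xs' ys' : List I
      unique-x : Unique xs → Unique xs'
      unique-y : Unique ys → Unique ys'
      sub-x : ∀ {i} → i ∈ xs' → i ∈ xs
      sub-y : ∀ {i} → i ∈ ys' → i ∈ ys
      shorter-x : length xs' ℕ.≤ length xs
      shorter-y : length ys' ℕ.≤ length ys
      degree-x : ∀ {i} → i ∈ xs' → s ℕ.≤ length (filter (R? i) ys')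
      degree-y : ∀ {j} → j ∈ ys' → s ℕ.≤ length (filter (λ i → R? i j) xs')
      member : Σ I (_∈ xs')

  -- Deleting a vertex of degree below `s` removes fewer than `s` edges, so the number of edges
  -- stays above `s` times the number of vertices; in particular edges remain. `k` bounds the number
  -- of deletions.
  prune : ∀ k xs ys → length xs ℕ.+ length ys ℕ.≤ k → s ℕ.* (length xs ℕ.+ length ys) ℕ.< edges xs ys → Pruned xs ys
  prune k xs ys lk many with search (λ i → s ℕₚ.≤? ∑ ys (λ j → 𝟙 (R? i j))) xs
  prune zero (x ∷ xs) ys () many | inj₂ _
  prune (suc k) xs ys lk many | inj₂ (x , x∈ , small) with extract x∈
  ... | extraction r sumr lr ur subr = record
    { xs' = xs' ; ys' = ys' ; unique-x = λ u → unique-x (ur u) ; unique-y = unique-y ; sub-x = λ i → subr (sub-x i) ; sub-y = sub-y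
    ; shorter-x = ≤-trans shorter-x (≤-trans (n≤1+n _) (≤-reflexive (sym lr))) ; shorter-y = shorter-y
    ; degree-x = degree-x ; degree-y = degree-y ; member = member }
    where
    open ≤-Reasoning
    still-many : s ℕ.* (length r ℕ.+ length ys) ℕ.< edges r ys
    still-many = ℕₚ.+-cancelˡ-< s _ _ (begin-strict
        s ℕ.+ s ℕ.* (length r ℕ.+ length ys) ≡⟨ ℕₚ.*-suc s _ ⟨
        s ℕ.* (suc (length r) ℕ.+ length ys) ≡⟨ cong (λ l → s ℕ.* (l ℕ.+ length ys)) (sym lr) ⟩
        s ℕ.* (length xs ℕ.+ length ys) <⟨ many ⟩
        edges xs ys ≡⟨ sumr _ ⟩
        ∑ ys (λ j → 𝟙 (R? x j)) ℕ.+ edges r ys ≤⟨ +-monoˡ-≤ _ (<⇒≤ (≰⇒> small)) ⟩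
        s ℕ.+ edges r ys ∎)
    open Pruned (prune k r ys (≤-pred (≤-trans (≤-reflexive (cong (ℕ._+ length ys) (sym lr))) lk))
      still-many)

  prune k xs ys lk many | inj₁ dx with search (λ j → s ℕₚ.≤? ∑ xs (λ i → 𝟙 (R? i j))) ys
  ... | inj₁ dy = record
    { xs' = xs ; ys' = ys ; unique-x = λ u → u ; unique-y = λ u → u ; sub-x = λ i → i ; sub-y = λ i → i ; shorter-x = ≤-refl ; shorter-y = ≤-refl
    ; degree-x = λ i∈ → ≤-trans (All.lookup dx i∈) (≤-reflexive (sym (length-filter-∑ (R? _) ys)))
    ; degree-y = λ j∈ → ≤-trans (All.lookup dy j∈) (≤-reflexive (sym (length-filter-∑ (λ i → R? i _) xs)))
    ; member = nonempty xs (≤-<-trans z≤n many) }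
    where
    nonempty : ∀ xs → 0 ℕ.< edges xs ys → Σ I (_∈ xs)
    nonempty (x ∷ _) _ = x , here refl
  prune zero xs (y ∷ ys) lk many | inj₁ dx | inj₂ _ = ⊥-elim (absurd (length xs) lk)
    where
    absurd : ∀ a {b} → a ℕ.+ suc b ℕ.≤ 0 → ⊥
    absurd zero ()
    absurd (suc a) ()
  prune (suc k) xs ys lk many | inj₁ dx | inj₂ (y , y∈ , small) with extract y∈
  ... | extraction r sumr lr ur subr = record
    { xs' = xs' ; ys' = ys' ; unique-x = unique-x ; unique-y = λ u → unique-y (ur u) ; sub-x = sub-x ; sub-y = λ i → subr (sub-y i)
    ; shorter-x = shorter-x ; shorter-y = ≤-trans shorter-y (≤-trans (n≤1+n _) (≤-reflexive (sym lr)))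
    ; degree-x = degree-x ; degree-y = degree-y ; member = member }
    where
    open ≤-Reasoning
    still-many : s ℕ.* (length xs ℕ.+ length r) ℕ.< edges xs r
    still-many = ℕₚ.+-cancelˡ-< s _ _ (begin-strict
        s ℕ.+ s ℕ.* (length xs ℕ.+ length r) ≡⟨ ℕₚ.*-suc s _ ⟨
        s ℕ.* suc (length xs ℕ.+ length r) ≡⟨ cong (s ℕ.*_) (trans (sym (+-suc (length xs) _)) (cong (length xs ℕ.+_) (sym lr))) ⟩
        s ℕ.* (length xs ℕ.+ length ys) <⟨ many ⟩
        edges xs ys ≡⟨ ∑-cong xs (λ _ → sumr _) ⟩
        ∑ xs (λ i → 𝟙 (R? i y) ℕ.+ ∑ r (λ j → 𝟙 (R? i j))) ≡⟨ ∑-+ xs _ _ ⟩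
        ∑ xs (λ i → 𝟙 (R? i y)) ℕ.+ edges xs r ≤⟨ +-monoˡ-≤ _ (<⇒≤ (≰⇒> small)) ⟩
        s ℕ.+ edges xs r ∎)
    open Pruned (prune k xs r (≤-pred (≤-trans (≤-reflexive (trans (sym (+-suc (length xs) _)) (cong (length xs ℕ.+_) (sym lr)))) lk))
      still-many)

-- Linear maps from K² to null lines, depending on two parameters.

module Twisting (𝔽 : FiniteField) where
  open FieldTheory 𝔽
  open import Data.Nat using (_≤_; _<_)
  open Polynomials 𝔽
  open Interpolation 𝔽
  open Surfaces 𝔽
  open NullLines 𝔽
  open CrossingLines 𝔽

  root-count : ∀ k cs → length cs ≤ suc k → length cs ≤ order → ¬ All (_≡ 0#) cs → ∑ elements (λ t → 𝟙 (horner cs t ≟ 0#)) ≤ k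
  root-count k cs l l' nz = ≮⇒≥ (λ k< → nz (vanishing-coefficients cs l' (vanishes-by-roots (filter (λ t → horner cs t ≟ 0#) elements)
    (Uniqueₚ.filter⁺ (λ t → horner cs t ≟ 0#) elements-unique) cs
    (≤-trans l (≤-trans k< (≤-reflexive (sym (length-filter-∑ (λ t → horner cs t ≟ 0#) elements)))))
    (All.tabulate (λ i → proj₂ (∈-filter⁻ (λ t → horner cs t ≟ 0#) {xs = elements} i))))))

  scale : F → F⁴ → F⁴
  scale k (a , b , c , d) = k * a , k * b , k * c , k * d

  0⁴ : F⁴
  0⁴ = 0# , 0# , 0# , 0#

  Parallel : F⁴ → F⁴ → Set
  Parallel a b = Σ F λ k → b ≡ scale k a

  _≟⁴_ : DecidableEquality F⁴
  (a , b , c , d) ≟⁴ (a' , b' , c' , d') with a ≟ a' | b ≟ b' | c ≟ c' | d ≟ d'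
  ... | yes refl | yes refl | yes refl | yes refl = yes refl
  ... | no n | _ | _ | _ = no (λ { refl → n refl })
  ... | yes _ | no n | _ | _ = no (λ { refl → n refl })
  ... | yes _ | yes _ | no n | _ = no (λ { refl → n refl })
  ... | yes _ | yes _ | yes _ | no n = no (λ { refl → n refl })

  parallel? : ∀ a b → Dec (Parallel a b)
  parallel? a b with search (λ k → ¬? (b ≟⁴ scale k a)) elements
  ... | inj₁ none = no (λ (k , e) → All.lookup none (elements-complete k) e)
  ... | inj₂ (k , _ , e) with b ≟⁴ scale k a
  ...   | yes q = yes (k , q)
  ...   | no q = ⊥-elim (e q)

  tuple : ∀ {a b c d a' b' c' d' : F} → a ≡ a' → b ≡ b' → c ≡ c' → d ≡ d' → (a , b , c , d) ≡ (a' , b' , c' , d')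
  tuple refl refl refl refl = refl

  -- With F⁴ read as pairs of elements of K = F [ i ], this is the real part of the K-determinant.
  pairing : F⁴ → F⁴ → F
  pairing (p , q , r , s) (p' , q' , r' , s') = (p * r' - q * s') - (r * p' - s * q')

  symplectic : F⁴ → F⁴ → F
  symplectic (w₁ , w₂ , y₁ , y₂) (w₁' , w₂' , y₁' , y₂') = w₁ * y₁' + w₂ * y₂' - (w₁' * y₁ + w₂' * y₂)

  -- Preserves the symplectic form. Two independent orthogonal vectors span a Lagrangian plane,
  -- which is the graph of a symmetric matrix only if the w-parts are independent; the parameter τ
  -- is there to move the plane off the exceptional position.
  chart : F → F⁴ → F⁴
  chart τ (w₁ , w₂ , y₁ , y₂) = w₁ + τ * y₁ , w₂ + τ * y₂ , y₁ , y₂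

  -- Adds θ + i θ² times the second K-coordinate to the first, which preserves the K-determinant.
  -- The multiplier runs over a parabola so that its real and imaginary parts have separate
  -- coefficients in `family`.
  shear : F → F⁴ → F⁴
  shear θ (p , q , r , s) = p + θ * r - θ * θ * s , q + θ * s + θ * θ * r , r , s

  -- Two different identifications with F⁴: the symplectic form between a `left` and a `right`
  -- vector is `pairing`. Orthogonality thus becomes meeting of lines of opposite families, while
  -- meeting within a family is governed by another form, which varies with θ.
  left right : F⁴ → F⁴
  left (p , q , r , s) = p , r , q , s
  right (p , q , r , s) = s , - q , r , - p

  twistˣ twistʸ : F → F → F⁴ → F⁴
  twistˣ θ τ z = chart τ (left (shear θ z))
  twistʸ θ τ z = chart τ (right (shear θ z))

  symplectic-chart : ∀ τ a b → symplectic (chart τ a) (chart τ b) ≡ symplectic a b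
  symplectic-chart τ (a , b , c , d) (a' , b' , c' , d') = solve 9 (λ τ a b c d a' b' c' d' →
    (a :+ τ :* c) :* c' :+ (b :+ τ :* d) :* d' :- ((a' :+ τ :* c') :* c :+ (b' :+ τ :* d') :* d) := a :* c' :+ b :* d' :- (a' :* c :+ b' :* d)) refl τ a b c d a' b' c' d'

  symplectic-twist : ∀ θ τ a b → symplectic (twistˣ θ τ a) (twistʸ θ τ b) ≡ pairing a b
  symplectic-twist θ τ a@(p , q , r , s) b@(p' , q' , r' , s') = trans (symplectic-chart τ (left (shear θ a)) (right (shear θ b)))
    (solve 9 (λ θ p q r s p' q' r' s' →
      let ξ = p :+ θ :* r :- θ :* θ :* s ; η = q :+ θ :* s :+ θ :* θ :* r ; ξ' = p' :+ θ :* r' :- θ :* θ :* s' ; η' = q' :+ θ :* s' :+ θ :* θ :* r' in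
      ξ :* r' :+ r :* :- ξ' :- (s' :* η :+ (:- η') :* s) := (p :* r' :- q :* s') :- (r :* p' :- s :* q')) refl θ p q r s p' q' r' s')

  -- The symplectic form of two vectors twisted in the same way, as a polynomial in θ. Two lines of
  -- one family can meet only at its roots.
  family : F⁴ → F⁴ → List F
  family (p , q , r , s) (p' , q' , r' , s') = (p * q' - p' * q + z) ∷ (p * s' + r * q' - (p' * s + r' * q)) ∷ (p * r' - s * q' - (p' * r - s' * q) + z) ∷ 0# ∷ z ∷ []
    where z = r * s' - r' * s

  symplectic-left : ∀ θ τ a b → symplectic (twistˣ θ τ a) (twistˣ θ τ b) ≡ horner (family a b) θ
  symplectic-left θ τ a@(p , q , r , s) b@(p' , q' , r' , s') = trans (symplectic-chart τ (left (shear θ a)) (left (shear θ b)))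
    (solve 9 (λ θ p q r s p' q' r' s' →
      let ξ = p :+ θ :* r :- θ :* θ :* s ; η = q :+ θ :* s :+ θ :* θ :* r ; ξ' = p' :+ θ :* r' :- θ :* θ :* s' ; η' = q' :+ θ :* s' :+ θ :* θ :* r' ; z = r :* s' :- r' :* s in
      ξ :* η' :+ r :* s' :- (ξ' :* η :+ r' :* s) := (p :* q' :- p' :* q :+ z) :+ θ :* ((p :* s' :+ r :* q' :- (p' :* s :+ r' :* q)) :+ θ :* ((p :* r' :- s :* q' :- (p' :* r :- s' :* q) :+ z) :+ θ :* (κ 0 :+ θ :* (z :+ θ :* κ 0))))) refl
      θ p q r s p' q' r' s')

  symplectic-right : ∀ θ τ a b → symplectic (twistʸ θ τ a) (twistʸ θ τ b) ≡ - horner (family a b) θ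
  symplectic-right θ τ a@(p , q , r , s) b@(p' , q' , r' , s') = trans (trans (symplectic-chart τ (right (shear θ a)) (right (shear θ b)))
    (solve 8 (λ p q r s p' q' r' s' → s :* r' :+ (:- q) :* :- p' :- (s' :* r :+ (:- q') :* :- p) := :- (p :* q' :+ r :* s' :- (p' :* q :+ r' :* s))) refl
      (proj₁ (shear θ a)) (proj₁ (proj₂ (shear θ a))) r s (proj₁ (shear θ b)) (proj₁ (proj₂ (shear θ b))) r' s'))
    (cong -_ (trans (sym (symplectic-chart τ (left (shear θ a)) (left (shear θ b)))) (symplectic-left θ τ a b)))

  quotient-by-norm : ∀ {x n m y i} → n * i ≡ 1# → x * n ≡ m * y → x ≡ m * i * y
  quotient-by-norm {x} {n} {m} {y} {i} inv e = combine₂ (- x) i inv e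
    (solve 5 (λ x n m y i → x := m :* i :* y :+ (:- x) :* (n :* i :- κ 1) :+ i :* (x :* n :- m :* y)) refl x n m y i)

  proportional₁ : ∀ {p q p' q' i} → (p * p + q * q) * i ≡ 1# → p * q' - q * p' ≡ 0# → p' ≡ (p * p' + q * q') * i * p
  proportional₁ {p} {q} {p'} {q'} inv e = quotient-by-norm inv (combine₁ (- q) e
    (solve 4 (λ p q p' q' → p' :* (p :* p :+ q :* q) := (p :* p' :+ q :* q') :* p :+ (:- q) :* (p :* q' :- q :* p' :- κ 0)) refl p q p' q'))

  proportional₂ : ∀ {p q p' q' i} → (p * p + q * q) * i ≡ 1# → p * q' - q * p' ≡ 0# → q' ≡ (p * p' + q * q') * i * q
  proportional₂ {p} {q} {p'} {q'} inv e = quotient-by-norm inv (combine₁ p e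
    (solve 4 (λ p q p' q' → q' :* (p :* p :+ q :* q) := (p :* p' :+ q :* q') :* q :+ p :* (p :* q' :- q :* p' :- κ 0)) refl p q p' q'))

  sum-of-squares≢0 : ∀ {p q} → ¬ (p ≡ 0# × q ≡ 0#) → p * p + q * q ≢ 0#
  sum-of-squares≢0 h e = h (sq+sq≡0 e)

  -- Over K the coefficients say that conj(a₁) b₁ and conj(a₂) b₂ are real and that conj(a₂) b₁ = a₁
  -- conj(b₂). So the real factor between two corresponding coordinates, the first of which is
  -- nonzero, is also the factor of the others.
  family-parallel : ∀ a b → a ≢ 0⁴ → All (_≡ 0#) (family a b) → Parallel a b
  family-parallel (p , q , r , s) (p' , q' , r' , s') a≢0 (z₀ ∷ z₁ ∷ z₂ ∷ _ ∷ z₄ ∷ []) = go (p ≟ 0#) (q ≟ 0#)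
    where
    pq : p * q' - p' * q ≡ 0#
    pq = combine₂ 1# (- 1#) z₀ z₄ (solve 2 (λ x z → x := κ 0 :+ κ 1 :* (x :+ z :- κ 0) :+ (:- κ 1) :* (z :- κ 0)) refl _ _)
    z₂' : p * r' - s * q' - (p' * r - s' * q) ≡ 0#
    z₂' = combine₂ 1# (- 1#) z₂ z₄ (solve 2 (λ x z → x := κ 0 :+ κ 1 :* (x :+ z :- κ 0) :+ (:- κ 1) :* (z :- κ 0)) refl _ _)
    generic : ¬ (p ≡ 0# × q ≡ 0#) → Parallel (p , q , r , s) (p' , q' , r' , s')
    generic h = (p * p' + q * q') * (p * p + q * q) ⁻¹ , tuple
        (quotient-by-norm inv (combine₁ (- q) pq (solve 4 (λ p q p' q' → p' :* (p :* p :+ q :* q) := (p :* p' :+ q :* q') :* p :+ (:- q) :* (p :* q' :- p' :* q :- κ 0)) refl p q p' q')))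
        (quotient-by-norm inv (combine₁ p pq (solve 4 (λ p q p' q' → q' :* (p :* p :+ q :* q) := (p :* p' :+ q :* q') :* q :+ p :* (p :* q' :- p' :* q :- κ 0)) refl p q p' q')))
        (quotient-by-norm inv (combine₃ p (- q) s z₂' z₁ pq (solve 8 (λ p q r s p' q' r' s' → r' :* (p :* p :+ q :* q) := (p :* p' :+ q :* q') :* r
          :+ p :* (p :* r' :- s :* q' :- (p' :* r :- s' :* q) :- κ 0) :+ (:- q) :* (p :* s' :+ r :* q' :- (p' :* s :+ r' :* q) :- κ 0) :+ s :* (p :* q' :- p' :* q :- κ 0)) refl p q r s p' q' r' s')))
        (quotient-by-norm inv (combine₃ p q (- r) z₁ z₂' pq (solve 8 (λ p q r s p' q' r' s' → s' :* (p :* p :+ q :* q) := (p :* p' :+ q :* q') :* s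
          :+ p :* (p :* s' :+ r :* q' :- (p' :* s :+ r' :* q) :- κ 0) :+ q :* (p :* r' :- s :* q' :- (p' :* r :- s' :* q) :- κ 0) :+ (:- r) :* (p :* q' :- p' :* q :- κ 0)) refl p q r s p' q' r' s')))
      where
      inv : (p * p + q * q) * (p * p + q * q) ⁻¹ ≡ 1#
      inv = *-inverse _ (sum-of-squares≢0 h)
    go : Dec (p ≡ 0#) → Dec (q ≡ 0#) → Parallel (p , q , r , s) (p' , q' , r' , s')
    go (no n) _ = generic (λ e → n (proj₁ e))
    go (yes _) (no n) = generic (λ e → n (proj₂ e))
    go (yes refl) (yes refl) = (r * r' + s * s') * (r * r + s * s) ⁻¹ , tuple
        (quotient-by-norm inv (combine₂ (- s) (- r) z₁ z₂' (solve 6 (λ r s p' q' r' s' → p' :* (r :* r :+ s :* s) := (r :* r' :+ s :* s') :* κ 0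
          :+ (:- s) :* (κ 0 :* s' :+ r :* q' :- (p' :* s :+ r' :* κ 0) :- κ 0) :+ (:- r) :* (κ 0 :* r' :- s :* q' :- (p' :* r :- s' :* κ 0) :- κ 0)) refl r s p' q' r' s')))
        (quotient-by-norm inv (combine₂ r (- s) z₁ z₂' (solve 6 (λ r s p' q' r' s' → q' :* (r :* r :+ s :* s) := (r :* r' :+ s :* s') :* κ 0
          :+ r :* (κ 0 :* s' :+ r :* q' :- (p' :* s :+ r' :* κ 0) :- κ 0) :+ (:- s) :* (κ 0 :* r' :- s :* q' :- (p' :* r :- s' :* κ 0) :- κ 0)) refl r s p' q' r' s')))
        (quotient-by-norm inv (combine₁ (- s) z₄ (solve 4 (λ p q p' q' → p' :* (p :* p :+ q :* q) := (p :* p' :+ q :* q') :* p :+ (:- q) :* (p :* q' :- p' :* q :- κ 0)) refl r s r' s')))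
        (quotient-by-norm inv (combine₁ r z₄ (solve 4 (λ p q p' q' → q' :* (p :* p :+ q :* q) := (p :* p' :+ q :* q') :* q :+ p :* (p :* q' :- p' :* q :- κ 0)) refl r s r' s')))
      where
      inv : (r * r + s * s) * (r * r + s * s) ⁻¹ ≡ 1#
      inv = *-inverse _ (sum-of-squares≢0 (λ { (refl , refl) → a≢0 refl }))

  chart-wedge : F⁴ → F⁴ → List F
  chart-wedge (w₁ , w₂ , y₁ , y₂) (w₁' , w₂' , y₁' , y₂') = (w₁ * w₂' - w₂ * w₁') ∷ (w₁ * y₂' - w₂ * y₁' + (y₁ * w₂' - y₂ * w₁')) ∷ (y₁ * y₂' - y₂ * y₁') ∷ []

  wedge : F⁴ → F⁴ → F
  wedge (w₁ , w₂ , _) (w₁' , w₂' , _) = w₁ * w₂' - w₂ * w₁'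

  wedge-chart : ∀ τ a b → wedge (chart τ a) (chart τ b) ≡ horner (chart-wedge a b) τ
  wedge-chart τ (a , b , c , d) (a' , b' , c' , d') = solve 9 (λ τ a b c d a' b' c' d' →
    (a :+ τ :* c) :* (b' :+ τ :* d') :- (b :+ τ :* d) :* (a' :+ τ :* c') := (a :* b' :- b :* a') :+ τ :* ((a :* d' :- b :* c' :+ (c :* b' :- d :* a')) :+ τ :* ((c :* d' :- d :* c') :+ τ :* κ 0))) refl τ a b c d a' b' c' d'

  -- This needs that -1 is not a square.
  chart-wedge-parallel : ∀ a b → a ≢ 0⁴ → symplectic a b ≡ 0# → All (_≡ 0#) (chart-wedge a b) → Parallel a b
  chart-wedge-parallel (w₁ , w₂ , y₁ , y₂) (w₁' , w₂' , y₁' , y₂') a≢0 ω (z₀ ∷ z₁ ∷ z₂ ∷ []) = go (w₁ ≟ 0#) (w₂ ≟ 0#)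
    where
    Goal : Set
    Goal = Parallel (w₁ , w₂ , y₁ , y₂) (w₁' , w₂' , y₁' , y₂')
    -- k |w|² = w · w'; the remainder y' - k y is killed by both products with w.
    generic : ¬ (w₁ ≡ 0# × w₂ ≡ 0#) → Goal
    generic h = k , tuple ew₁ ew₂ ey₁ ey₂
      where
      n = w₁ * w₁ + w₂ * w₂
      n≢0 : n ≢ 0#
      n≢0 = sum-of-squares≢0 h
      inv : n * n ⁻¹ ≡ 1#
      inv = *-inverse n n≢0
      k = (w₁ * w₁' + w₂ * w₂') * n ⁻¹
      ew₁ : w₁' ≡ k * w₁
      ew₁ = proportional₁ inv z₀
      ew₂ : w₂' ≡ k * w₂
      ew₂ = proportional₂ inv z₀
      dot≡0 : w₁ * (y₁' - k * y₁) + w₂ * (y₂' - k * y₂) ≡ 0#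
      dot≡0 = combine₃ 1# y₁ y₂ ω ew₁ ew₂ (solve 9 (λ k w₁ w₂ y₁ y₂ w₁' w₂' y₁' y₂' → w₁ :* (y₁' :- k :* y₁) :+ w₂ :* (y₂' :- k :* y₂)
        := κ 0 :+ κ 1 :* (w₁ :* y₁' :+ w₂ :* y₂' :- (w₁' :* y₁ :+ w₂' :* y₂) :- κ 0) :+ y₁ :* (w₁' :- k :* w₁) :+ y₂ :* (w₂' :- k :* w₂)) refl k w₁ w₂ y₁ y₂ w₁' w₂' y₁' y₂')
      wedge≡0 : w₁ * (y₂' - k * y₂) - w₂ * (y₁' - k * y₁) ≡ 0#
      wedge≡0 = combine₃ 1# y₂ (- y₁) z₁ ew₁ ew₂ (solve 9 (λ k w₁ w₂ y₁ y₂ w₁' w₂' y₁' y₂' → w₁ :* (y₂' :- k :* y₂) :- w₂ :* (y₁' :- k :* y₁)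
        := κ 0 :+ κ 1 :* (w₁ :* y₂' :- w₂ :* y₁' :+ (y₁ :* w₂' :- y₂ :* w₁') :- κ 0) :+ y₂ :* (w₁' :- k :* w₁) :+ (:- y₁) :* (w₂' :- k :* w₂)) refl k w₁ w₂ y₁ y₂ w₁' w₂' y₁' y₂')
      ey₁ : y₁' ≡ k * y₁
      ey₁ = ≡-by-difference (*-cancelˡ-0 n≢0 (combine₂ w₁ (- w₂) dot≡0 wedge≡0 (solve 4 (λ w₁ w₂ a b → (w₁ :* w₁ :+ w₂ :* w₂) :* a := κ 0 :+ w₁ :* (w₁ :* a :+ w₂ :* b :- κ 0) :+ (:- w₂) :* (w₁ :* b :- w₂ :* a :- κ 0)) refl w₁ w₂ (y₁' - k * y₁) (y₂' - k * y₂))))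
      ey₂ : y₂' ≡ k * y₂
      ey₂ = ≡-by-difference (*-cancelˡ-0 n≢0 (combine₂ w₂ w₁ dot≡0 wedge≡0 (solve 4 (λ w₁ w₂ a b → (w₁ :* w₁ :+ w₂ :* w₂) :* b := κ 0 :+ w₂ :* (w₁ :* a :+ w₂ :* b :- κ 0) :+ w₁ :* (w₁ :* b :- w₂ :* a :- κ 0)) refl w₁ w₂ (y₁' - k * y₁) (y₂' - k * y₂))))
    go : Dec (w₁ ≡ 0#) → Dec (w₂ ≡ 0#) → Goal
    go (no h) _ = generic (λ e → h (proj₁ e))
    go (yes _) (no h) = generic (λ e → h (proj₂ e))
    go (yes refl) (yes refl) = k , tuple
        (quotient-by-norm inv (combine₂ (- y₁) (- y₂) ω z₁ (solve 6 (λ y₁ y₂ w₁' w₂' y₁' y₂' → w₁' :* (y₁ :* y₁ :+ y₂ :* y₂) := (y₁ :* y₁' :+ y₂ :* y₂') :* κ 0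
          :+ (:- y₁) :* (κ 0 :* y₁' :+ κ 0 :* y₂' :- (w₁' :* y₁ :+ w₂' :* y₂) :- κ 0) :+ (:- y₂) :* (κ 0 :* y₂' :- κ 0 :* y₁' :+ (y₁ :* w₂' :- y₂ :* w₁') :- κ 0)) refl y₁ y₂ w₁' w₂' y₁' y₂')))
        (quotient-by-norm inv (combine₂ (- y₂) y₁ ω z₁ (solve 6 (λ y₁ y₂ w₁' w₂' y₁' y₂' → w₂' :* (y₁ :* y₁ :+ y₂ :* y₂) := (y₁ :* y₁' :+ y₂ :* y₂') :* κ 0
          :+ (:- y₂) :* (κ 0 :* y₁' :+ κ 0 :* y₂' :- (w₁' :* y₁ :+ w₂' :* y₂) :- κ 0) :+ y₁ :* (κ 0 :* y₂' :- κ 0 :* y₁' :+ (y₁ :* w₂' :- y₂ :* w₁') :- κ 0)) refl y₁ y₂ w₁' w₂' y₁' y₂')))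
        (proportional₁ inv z₂)
        (proportional₂ inv z₂)
      where
      inv : (y₁ * y₁ + y₂ * y₂) * (y₁ * y₁ + y₂ * y₂) ⁻¹ ≡ 1#
      inv = *-inverse _ (sum-of-squares≢0 (λ { (refl , refl) → a≢0 refl }))
      k = (y₁ * y₁' + y₂ * y₂') * (y₁ * y₁ + y₂ * y₂) ⁻¹

  untwist : F → F → F⁴ → F⁴
  untwist θ τ (w₁ , w₂ , y₁ , y₂) = (w₁ - τ * y₁) - θ * (w₂ - τ * y₂) + θ * θ * y₂ , y₁ - θ * y₂ - θ * θ * (w₂ - τ * y₂) , w₂ - τ * y₂ , y₂

  untwist-twistˣ : ∀ θ τ z → untwist θ τ (twistˣ θ τ z) ≡ z
  untwist-twistˣ θ τ (p , q , r , s) = tuple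
    (solve 6 (λ θ τ p q r s → let η = q :+ θ :* s :+ θ :* θ :* r in (p :+ θ :* r :- θ :* θ :* s :+ τ :* η :- τ :* η) :- θ :* (r :+ τ :* s :- τ :* s) :+ θ :* θ :* s := p) refl θ τ p q r s)
    (solve 5 (λ θ τ q r s → q :+ θ :* s :+ θ :* θ :* r :- θ :* s :- θ :* θ :* (r :+ τ :* s :- τ :* s) := q) refl θ τ q r s)
    (solve 3 (λ τ r s → r :+ τ :* s :- τ :* s := r) refl τ r s) refl

  untwist-linear : ∀ θ τ β u t v → untwist θ τ (scale-add β u t v) ≡ scale-add β (untwist θ τ u) t (untwist θ τ v)
  untwist-linear θ τ β (a , b , c , d) t (a' , b' , c' , d') = tuple
    (trans (solve 7 (λ θ τ β w₁ w₂ y₁ y₂ → (β :* w₁ :- τ :* (β :* y₁)) :- θ :* (β :* w₂ :- τ :* (β :* y₂)) :+ θ :* θ :* (β :* y₂) := β :* ((w₁ :- τ :* y₁) :- θ :* (w₂ :- τ :* y₂) :+ θ :* θ :* y₂)) refl θ τ β (a + t * a') (b + t * b') (c + t * c') (d + t * d'))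
      (cong (β *_) (split a b c d a' b' c' d')))
    (second b c d b' c' d')
    (solve 7 (λ τ β t b d b' d' → β :* (b :+ t :* b') :- τ :* (β :* (d :+ t :* d')) := β :* ((b :- τ :* d) :+ t :* (b' :- τ :* d'))) refl τ β t b d b' d')
    refl
    where
    split : ∀ a b c d a' b' c' d' → ((a + t * a') - τ * (c + t * c')) - θ * ((b + t * b') - τ * (d + t * d')) + θ * θ * (d + t * d')
      ≡ ((a - τ * c) - θ * (b - τ * d) + θ * θ * d) + t * ((a' - τ * c') - θ * (b' - τ * d') + θ * θ * d')
    split a b c d a' b' c' d' = solve 11 (λ θ τ t a b c d a' b' c' d' → ((a :+ t :* a') :- τ :* (c :+ t :* c')) :- θ :* ((b :+ t :* b') :- τ :* (d :+ t :* d')) :+ θ :* θ :* (d :+ t :* d')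
      := ((a :- τ :* c) :- θ :* (b :- τ :* d) :+ θ :* θ :* d) :+ t :* ((a' :- τ :* c') :- θ :* (b' :- τ :* d') :+ θ :* θ :* d')) refl θ τ t a b c d a' b' c' d'
    second : ∀ b c d b' c' d' → β * (c + t * c') - θ * (β * (d + t * d')) - θ * θ * (β * (b + t * b') - τ * (β * (d + t * d')))
      ≡ β * ((c - θ * d - θ * θ * (b - τ * d)) + t * (c' - θ * d' - θ * θ * (b' - τ * d')))
    second b c d b' c' d' = solve 10 (λ θ τ β t b c d b' c' d' → β :* (c :+ t :* c') :- θ :* (β :* (d :+ t :* d')) :- θ :* θ :* (β :* (b :+ t :* b') :- τ :* (β :* (d :+ t :* d')))
      := β :* ((c :- θ :* d :- θ :* θ :* (b :- τ :* d)) :+ t :* (c' :- θ :* d' :- θ :* θ :* (b' :- τ :* d')))) refl θ τ β t b c d b' c' d'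

-- Orthogonal pairs of vectors as crossings of null lines in general position.

module RichLines (𝔽 : FiniteField) where
  open FieldTheory 𝔽
  open import Data.Nat using (_≤_; _<_)
  open Polynomials 𝔽
  open Interpolation 𝔽
  open Surfaces 𝔽
  open NullLines 𝔽
  open CrossingLines 𝔽
  open Twisting 𝔽

  crossing : F⁴ → F⁴ → F³
  crossing a@(w₁ , w₂ , y₁ , y₂) b@(w₁' , w₂' , y₁' , y₂') = (y₁ * w₂' - y₁' * w₂) * i , (y₁' * w₁ - y₁ * w₁') * i , (y₂' * w₁ - y₂ * w₁') * i
    where i = wedge a b ⁻¹

  -- Four equations for three unknowns: `crossing` solves three of them by Cramer's rule, and the
  -- vanishing of the symplectic form is the compatibility condition for the fourth.
  on-crossingˡ : ∀ a b → wedge a b ≢ 0# → symplectic a b ≡ 0# → On a (crossing a b)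
  on-crossingˡ a@(w₁ , w₂ , y₁ , y₂) b@(w₁' , w₂' , y₁' , y₂') h ω =
    combine₁ y₁ (*-inverse _ h) (solve 7 (λ i w₁ w₂ y₁ w₁' w₂' y₁' → (y₁ :* w₂' :- y₁' :* w₂) :* i :* w₁ :+ (y₁' :* w₁ :- y₁ :* w₁') :* i :* w₂
      := y₁ :+ y₁ :* ((w₁ :* w₂' :- w₂ :* w₁') :* i :- κ 1)) refl (wedge a b ⁻¹) w₁ w₂ y₁ w₁' w₂' y₁') ,
    combine₂ y₂ (w₁ * wedge a b ⁻¹) (*-inverse _ h) ω (solve 9 (λ i w₁ w₂ y₁ y₂ w₁' w₂' y₁' y₂' → (y₁' :* w₁ :- y₁ :* w₁') :* i :* w₁ :+ (y₂' :* w₁ :- y₂ :* w₁') :* i :* w₂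
      := y₂ :+ y₂ :* ((w₁ :* w₂' :- w₂ :* w₁') :* i :- κ 1) :+ w₁ :* i :* (w₁ :* y₁' :+ w₂ :* y₂' :- (w₁' :* y₁ :+ w₂' :* y₂) :- κ 0)) refl (wedge a b ⁻¹) w₁ w₂ y₁ y₂ w₁' w₂' y₁' y₂')

  on-crossingʳ : ∀ a b → wedge a b ≢ 0# → symplectic a b ≡ 0# → On b (crossing a b)
  on-crossingʳ a@(w₁ , w₂ , y₁ , y₂) b@(w₁' , w₂' , y₁' , y₂') h ω =
    combine₁ y₁' (*-inverse _ h) (solve 7 (λ i w₁ w₂ y₁ w₁' w₂' y₁' → (y₁ :* w₂' :- y₁' :* w₂) :* i :* w₁' :+ (y₁' :* w₁ :- y₁ :* w₁') :* i :* w₂'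
      := y₁' :+ y₁' :* ((w₁ :* w₂' :- w₂ :* w₁') :* i :- κ 1)) refl (wedge a b ⁻¹) w₁ w₂ y₁ w₁' w₂' y₁') ,
    combine₂ y₂' (w₁' * wedge a b ⁻¹) (*-inverse _ h) ω (solve 9 (λ i w₁ w₂ y₁ y₂ w₁' w₂' y₁' y₂' → (y₁' :* w₁ :- y₁ :* w₁') :* i :* w₁' :+ (y₂' :* w₁ :- y₂ :* w₁') :* i :* w₂'
      := y₂' :+ y₂' :* ((w₁ :* w₂' :- w₂ :* w₁') :* i :- κ 1) :+ w₁' :* i :* (w₁ :* y₁' :+ w₂ :* y₂' :- (w₁' :* y₁ :+ w₂' :* y₂) :- κ 0)) refl (wedge a b ⁻¹) w₁ w₂ y₁ y₂ w₁' w₂' y₁' y₂')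

  on-symplectic : ∀ a b S → On a S → On b S → symplectic a b ≡ 0#
  on-symplectic (w₁ , w₂ , _ , _) (w₁' , w₂' , _ , _) (a , b , c) (refl , refl) (refl , refl) =
    solve 7 (λ w₁ w₂ w₁' w₂' a b c → w₁ :* (a :* w₁' :+ b :* w₂') :+ w₂ :* (b :* w₁' :+ c :* w₂') :- (w₁' :* (a :* w₁ :+ b :* w₂) :+ w₂' :* (b :* w₁ :+ c :* w₂)) := κ 0) refl w₁ w₂ w₁' w₂' a b c

  -- If the w-parts were proportional, then y = S w would make the y-parts proportional with the
  -- same factor.
  on-wedge : ∀ a b S → a ≢ 0⁴ → ¬ Parallel a b → On a S → On b S → wedge a b ≢ 0#
  on-wedge (w₁ , w₂ , _ , _) (w₁' , w₂' , _ , _) (a , b , c) a≢0 np (refl , refl) (refl , refl) z = np (k , tuple e₁ e₂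
      (trans (cong₂ (λ x y → a * x + b * y) e₁ e₂) (solve 5 (λ a b k x y → a :* (k :* x) :+ b :* (k :* y) := k :* (a :* x :+ b :* y)) refl a b k w₁ w₂))
      (trans (cong₂ (λ x y → b * x + c * y) e₁ e₂) (solve 5 (λ a b k x y → a :* (k :* x) :+ b :* (k :* y) := k :* (a :* x :+ b :* y)) refl b c k w₁ w₂)))
    where
    n = w₁ * w₁ + w₂ * w₂
    inv : n * n ⁻¹ ≡ 1#
    inv = *-inverse n (sum-of-squares≢0 (λ { (refl , refl) → a≢0 (tuple refl refl (z₂ a b) (z₂ b c)) }))
      where
      z₂ : ∀ a b → a * 0# + b * 0# ≡ 0#
      z₂ a b = solve 2 (λ a b → a :* κ 0 :+ b :* κ 0 := κ 0) refl a b
    k = (w₁ * w₁' + w₂ * w₂') * n ⁻¹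
    e₁ : w₁' ≡ k * w₁
    e₁ = proportional₁ inv z
    e₂ : w₂' ≡ k * w₂
    e₂ = proportional₂ inv z

  on-unique : ∀ a b S S' → a ≢ 0⁴ → ¬ Parallel a b → On a S → On b S → On a S' → On b S' → S ≡ S'
  on-unique α@(w₁ , w₂ , y₁ , y₂) β@(w₁' , w₂' , y₁' , y₂') S@(a , b , c) S'@(a' , b' , c') a≢0 np oa@(e₁ , e₂) ob@(f₁ , f₂) (e₁' , e₂') (f₁' , f₂') =
    cong₂ _,_ (*-cancelˡ δ≢0 (elim w₂' w₂ e₁ e₁' f₁ f₁'))
      (cong₂ _,_ (*-cancelˡ δ≢0 (elim w₂' w₂ e₂ e₂' f₂ f₂')) (*-cancelˡ δ≢0 (elim' e₂ e₂' f₂ f₂')))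
    where
    δ≢0 : wedge α β ≢ 0#
    δ≢0 = on-wedge α β S a≢0 np oa ob
    elim : ∀ v₂' v₂ {x y x' y' p q} → x * w₁ + y * v₂ ≡ p → x' * w₁ + y' * v₂ ≡ p → x * w₁' + y * v₂' ≡ q → x' * w₁' + y' * v₂' ≡ q → (w₁ * v₂' - v₂ * w₁') * x ≡ (w₁ * v₂' - v₂ * w₁') * x'
    elim v₂' v₂ {x} {y} {x'} {y'} e e' f f' = combine₂ v₂' (- v₂) (trans e (sym e')) (trans f (sym f'))
      (solve 8 (λ w₁ w₂ w₁' w₂' x y x' y' → (w₁ :* w₂' :- w₂ :* w₁') :* x := (w₁ :* w₂' :- w₂ :* w₁') :* x'
        :+ w₂' :* ((x :* w₁ :+ y :* w₂) :- (x' :* w₁ :+ y' :* w₂)) :+ (:- w₂) :* ((x :* w₁' :+ y :* w₂') :- (x' :* w₁' :+ y' :* w₂'))) refl w₁ v₂ w₁' v₂' x y x' y')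
    elim' : ∀ {x y x' y' p q} → x * w₁ + y * w₂ ≡ p → x' * w₁ + y' * w₂ ≡ p → x * w₁' + y * w₂' ≡ q → x' * w₁' + y' * w₂' ≡ q → (w₁ * w₂' - w₂ * w₁') * y ≡ (w₁ * w₂' - w₂ * w₁') * y'
    elim' {x} {y} {x'} {y'} e e' f f' = combine₂ (- w₁') w₁ (trans e (sym e')) (trans f (sym f'))
      (solve 8 (λ w₁ w₂ w₁' w₂' x y x' y' → (w₁ :* w₂' :- w₂ :* w₁') :* y := (w₁ :* w₂' :- w₂ :* w₁') :* y'
        :+ (:- w₁') :* ((x :* w₁ :+ y :* w₂) :- (x' :* w₁ :+ y' :* w₂)) :+ w₁ :* ((x :* w₁' :+ y :* w₂') :- (x' :* w₁' :+ y' :* w₂'))) refl w₁ w₂ w₁' w₂' x y x' y')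

  direction-wedge : ∀ a b → direction a ∧ direction b ≡ wedge a b
  direction-wedge (w₁ , w₂ , _) (w₁' , w₂' , _) = solve 4 (λ w₁ w₂ w₁' w₂' → w₂ :* (:- w₁') :- (:- w₁) :* w₂' := w₁ :* w₂' :- w₂ :* w₁') refl w₁ w₂ w₁' w₂'

  scale-0 : ∀ a → scale 0# a ≡ 0⁴
  scale-0 (a , b , c , d) = tuple (zeroˡ a) (zeroˡ b) (zeroˡ c) (zeroˡ d)

  -- Stated through multiples because only two consequences matter: k = 0 keeps nonzero vectors
  -- nonzero, and general k keeps independent vectors independent.
  Linear-injective : (F⁴ → F⁴) → Set
  Linear-injective f = ∀ k a b → f b ≡ scale k (f a) → b ≡ scale k a

  injective-≢0 : ∀ {f} → Linear-injective f → ∀ {a} → a ≢ 0⁴ → f a ≢ 0⁴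
  injective-≢0 h {a} a≢0 e = a≢0 (trans (h 0# a a (trans e (sym (scale-0 _)))) (scale-0 a))

  injective-parallel : ∀ {f} → Linear-injective f → ∀ {a b} → ¬ Parallel a b → ¬ Parallel (f a) (f b)
  injective-parallel h {a} {b} np (k , e) = np (k , h k a b e)

  injective-∘ : ∀ {f g} → Linear-injective f → Linear-injective g → Linear-injective (λ a → f (g a))
  injective-∘ hf hg k a b e = hg k a b (hf k _ _ e)

  chart-injective : ∀ τ → Linear-injective (chart τ)
  chart-injective τ k (a , b , c , d) (a' , b' , c' , d') e = tuple
      (combine₂ 1# (- τ) (cong proj₁ e) (cong (λ z → proj₁ (proj₂ (proj₂ z))) e) (solve 6 (λ τ k a c a' c' → a' := k :* a :+ κ 1 :* ((a' :+ τ :* c') :- k :* (a :+ τ :* c)) :+ (:- τ) :* (c' :- k :* c)) refl τ k a c a' c'))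
      (combine₂ 1# (- τ) (cong (λ z → proj₁ (proj₂ z)) e) (cong (λ z → proj₂ (proj₂ (proj₂ z))) e) (solve 6 (λ τ k a c a' c' → a' := k :* a :+ κ 1 :* ((a' :+ τ :* c') :- k :* (a :+ τ :* c)) :+ (:- τ) :* (c' :- k :* c)) refl τ k b d b' d'))
      (cong (λ z → proj₁ (proj₂ (proj₂ z))) e) (cong (λ z → proj₂ (proj₂ (proj₂ z))) e)

  shear-injective : ∀ θ → Linear-injective (shear θ)
  shear-injective θ k (p , q , r , s) (p' , q' , r' , s') e = tuple
      (combine₃ 1# (- θ) (θ * θ) (cong proj₁ e) er es (solve 8 (λ θ k p r s p' r' s' → p' := k :* p :+ κ 1 :* ((p' :+ θ :* r' :- θ :* θ :* s') :- k :* (p :+ θ :* r :- θ :* θ :* s)) :+ (:- θ) :* (r' :- k :* r) :+ θ :* θ :* (s' :- k :* s)) refl θ k p r s p' r' s'))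
      (combine₃ 1# (- θ) (- (θ * θ)) (cong (λ z → proj₁ (proj₂ z)) e) es er (solve 8 (λ θ k p r s p' r' s' → p' := k :* p :+ κ 1 :* ((p' :+ θ :* s' :+ θ :* θ :* r') :- k :* (p :+ θ :* s :+ θ :* θ :* r)) :+ (:- θ) :* (s' :- k :* s) :+ (:- (θ :* θ)) :* (r' :- k :* r)) refl θ k q r s q' r' s'))
      er es
    where
    er : r' ≡ k * r
    er = cong (λ z → proj₁ (proj₂ (proj₂ z))) e
    es : s' ≡ k * s
    es = cong (λ z → proj₂ (proj₂ (proj₂ z))) e

  left-injective : Linear-injective left
  left-injective k (p , q , r , s) _ e = tuple (cong proj₁ e) (cong (λ z → proj₁ (proj₂ (proj₂ z))) e) (cong (λ z → proj₁ (proj₂ z)) e) (cong (λ z → proj₂ (proj₂ (proj₂ z))) e)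

  right-injective : Linear-injective right
  right-injective k (p , q , r , s) (p' , q' , r' , s') e = tuple (neg (cong (λ z → proj₂ (proj₂ (proj₂ z))) e)) (neg (cong (λ z → proj₁ (proj₂ z)) e)) (cong (λ z → proj₁ (proj₂ (proj₂ z))) e) (cong proj₁ e)
    where
    neg : ∀ {x y} → - x ≡ k * - y → x ≡ k * y
    neg {x} {y} e = combine₁ (- 1#) e (solve 3 (λ k x y → x := k :* y :+ (:- κ 1) :* (:- x :- k :* :- y)) refl k x y)

  record Pairs : Set₁ where
    field
      I : Set
      _≟ᴵ_ : DecidableEquality I
      Z : List I
      unique-Z : Unique Z
      zx zy : I → F⁴
      zx≢0 : ∀ {i} → i ∈ Z → zx i ≢ 0⁴
      zy≢0 : ∀ {i} → i ∈ Z → zy i ≢ 0⁴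
      independent-x : ∀ {i i'} → i ∈ Z → i' ∈ Z → i ≢ i' → ¬ Parallel (zx i) (zx i')
      independent-y : ∀ {i i'} → i ∈ Z → i' ∈ Z → i ≢ i' → ¬ Parallel (zy i) (zy i')
      G : I → I → Set
      G? : ∀ i j → Dec (G i j)
      G-pairing : ∀ {i j} → G i j → pairing (zx i) (zy j) ≡ 0#

  module RichPairs (𝓟 : Pairs) where
    open Pairs 𝓟
    n : ℕ
    n = length Z

    sum-G : ℕ
    sum-G = ∑ Z (λ i → ∑ Z (λ j → 𝟙 (G? i j)))

    shear-cost : (I → F⁴) → F → ℕ
    shear-cost z θ = ∑ Z (λ i → ∑ Z (λ i' → 𝟙 (¬? (i ≟ᴵ i') ×-dec (horner (family (z i) (z i')) θ ≟ 0#))))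

    -- For distinct indices `family` is a nonzero polynomial of degree at most 4, hence each pair
    -- meets for at most four values of θ.
    shear-total : ∀ z → (∀ {i} → i ∈ Z → z i ≢ 0⁴) → (∀ {i i'} → i ∈ Z → i' ∈ Z → i ≢ i' → ¬ Parallel (z i) (z i')) →
      ∑ elements (shear-cost z) ≤ n ℕ.* (n ℕ.* 4)
    shear-total z z≢0 independent = begin
      ∑ elements (shear-cost z) ≡⟨ trans (∑-swap elements Z _) (∑-cong Z (λ _ → ∑-swap elements Z _)) ⟩
      ∑ Z (λ i → ∑ Z (λ i' → ∑ elements (λ θ → 𝟙 (¬? (i ≟ᴵ i') ×-dec (horner (family (z i) (z i')) θ ≟ 0#))))) ≤⟨ ∑-≤-const Z (n ℕ.* 4) (λ i∈ → ∑-≤-const Z 4 (λ i'∈ → few i∈ i'∈)) ⟩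
      n ℕ.* (n ℕ.* 4) ∎
      where
      open ≤-Reasoning
      few : ∀ {i i'} → i ∈ Z → i' ∈ Z → ∑ elements (λ θ → 𝟙 (¬? (i ≟ᴵ i') ×-dec (horner (family (z i) (z i')) θ ≟ 0#))) ≤ 4
      few {i} {i'} i∈ i'∈ with i ≟ᴵ i'
      ... | yes _ = ≤-trans (≤-reflexive (∑-zero elements)) z≤n
      ... | no i≢i' = ≤-trans (∑-mono elements (λ {θ} _ → 𝟙-mono (yes i≢i' ×-dec (horner (family (z i) (z i')) θ ≟ 0#)) (horner (family (z i) (z i')) θ ≟ 0#) proj₂))
        (root-count 4 (family (z i) (z i')) ≤-refl (≤-trans (s≤s (s≤s (s≤s (s≤s (s≤s z≤n))))) order≥7) (λ zs → independent i∈ i'∈ i≢i' (family-parallel _ _ (z≢0 i∈) zs)))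

    module Sheared (θ : F) where
      ax ay : I → F⁴
      ax i = left (shear θ (zx i))
      ay i = right (shear θ (zy i))

      -- The vectors `ay j` are pairwise independent, so each `ax i` is parallel to at most one of
      -- them.
      parallel-count : ∑ Z (λ i → ∑ Z (λ j → 𝟙 (parallel? (ax i) (ay j)))) ≤ n
      parallel-count = ≤-trans (∑-≤-const Z 1 (λ {i} i∈ → ∑-at-most-one (λ j → parallel? (ax i) (ay j)) unique-Z (same i∈))) (≤-reflexive (ℕₚ.*-identityʳ n))
        where
        ay-injective = injective-∘ right-injective (shear-injective θ)
        transfer : ∀ a b c → b ≢ 0⁴ → Parallel a b → Parallel a c → Parallel b c
        transfer a b c b≢0 (k , refl) (k' , refl) = k' * k ⁻¹ , tuple (rescale _) (rescale _) (rescale _) (rescale _)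
          where
          k≢0 : k ≢ 0#
          k≢0 refl = b≢0 (scale-0 a)
          rescale : ∀ x → k' * x ≡ k' * k ⁻¹ * (k * x)
          rescale x = combine₁ (- (k' * x)) (*-inverse k k≢0) (solve 4 (λ k k' i x → k' :* x := k' :* i :* (k :* x) :+ (:- (k' :* x)) :* (k :* i :- κ 1)) refl k k' (k ⁻¹) x)
        same : ∀ {i j j'} → i ∈ Z → j ∈ Z → j' ∈ Z → Parallel (ax i) (ay j) → Parallel (ax i) (ay j') → j ≡ j'
        same {i} {j} {j'} i∈ j∈ j'∈ p p' with j ≟ᴵ j'
        ... | yes e = e
        ... | no j≢j' = ⊥-elim (injective-parallel ay-injective (independent-y j∈ j'∈ j≢j') (transfer (ax i) (ay j) (ay j') (injective-≢0 ay-injective (zy≢0 j∈)) p p'))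

      pairing-sheared : ∀ i j → symplectic (ax i) (ay j) ≡ pairing (zx i) (zy j)
      pairing-sheared i j = trans (sym (symplectic-chart 0# (ax i) (ay j))) (symplectic-twist θ 0# (zx i) (zy j))

      Flat? : ∀ i j τ → Dec ((G i j × ¬ Parallel (ax i) (ay j)) × horner (chart-wedge (ax i) (ay j)) τ ≡ 0#)
      Flat? i j τ = (G? i j ×-dec ¬? (parallel? (ax i) (ay j))) ×-dec (horner (chart-wedge (ax i) (ay j)) τ ≟ 0#)

      chart-cost : F → ℕ
      chart-cost τ = ∑ Z (λ i → ∑ Z (λ j → 𝟙 (Flat? i j τ)))

      -- An independent orthogonal pair fails to meet at a finite point only at the roots of a
      -- nonzero quadratic polynomial in τ.
      chart-total : ∑ elements chart-cost ≤ n ℕ.* (n ℕ.* 2)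
      chart-total = begin
        ∑ elements chart-cost ≡⟨ trans (∑-swap elements Z _) (∑-cong Z (λ _ → ∑-swap elements Z _)) ⟩
        ∑ Z (λ i → ∑ Z (λ j → ∑ elements (λ τ → 𝟙 (Flat? i j τ)))) ≤⟨ ∑-≤-const Z (n ℕ.* 2) (λ i∈ → ∑-≤-const Z 2 (λ j∈ → few i∈ j∈)) ⟩
        n ℕ.* (n ℕ.* 2) ∎
        where
        open ≤-Reasoning
        few : ∀ {i j} → i ∈ Z → j ∈ Z → ∑ elements (λ τ → 𝟙 (Flat? i j τ)) ≤ 2
        few {i} {j} i∈ j∈ with G? i j ×-dec ¬? (parallel? (ax i) (ay j))
        ... | no _ = ≤-trans (≤-reflexive (∑-zero elements)) z≤n
        ... | yes gp@(g , np) = ≤-trans (∑-mono elements (λ {τ} _ → 𝟙-mono (yes gp ×-dec (horner (chart-wedge (ax i) (ay j)) τ ≟ 0#)) (horner (chart-wedge (ax i) (ay j)) τ ≟ 0#) proj₂))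
          (root-count 2 (chart-wedge (ax i) (ay j)) ≤-refl (≤-trans (s≤s (s≤s (s≤s z≤n))) order≥7)
            (λ zs → np (chart-wedge-parallel (ax i) (ay j) (injective-≢0 (injective-∘ left-injective (shear-injective θ)) (zx≢0 i∈)) (trans (pairing-sheared i j) (G-pairing g)) zs)))

      module Charted (τ : F) where
        px py : I → F⁴
        px i = chart τ (ax i)
        py i = chart τ (ay i)

        px-injective : Linear-injective (twistˣ θ τ)
        px-injective = injective-∘ (chart-injective τ) (injective-∘ left-injective (shear-injective θ))
        py-injective : Linear-injective (twistʸ θ τ)
        py-injective = injective-∘ (chart-injective τ) (injective-∘ right-injective (shear-injective θ))

        on? : ∀ a S → Dec (On a S)
        on? (w₁ , w₂ , y₁ , y₂) (a , b , c) = (a * w₁ + b * w₂ ≟ y₁) ×-dec (b * w₁ + c * w₂ ≟ y₂)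

        cross : I → I → F³
        cross i j = crossing (px i) (py j)

        points-unique : Unique points
        points-unique = Uniqueₚ.cartesianProduct⁺ elements-unique (Uniqueₚ.cartesianProduct⁺ elements-unique elements-unique)

        module Conc' = Concurrency _≟ᴵ_ Z unique-Z points points-unique
          (λ i S → On (px i) S) (λ i S → On (py i) S) (λ i → on? (px i)) (λ i → on? (py i))
          (λ i i' → horner (family (zx i) (zx i')) θ ≡ 0#) (λ i i' → horner (family (zy i) (zy i')) θ ≡ 0#) (λ i i' → horner (family (zx i) (zx i')) θ ≟ 0#) (λ i i' → horner (family (zy i) (zy i')) θ ≟ 0#)
          (λ i∈ i'∈ _ _ i≢i' → on-unique _ _ _ _ (injective-≢0 px-injective (zx≢0 i∈)) (injective-parallel px-injective (independent-x i∈ i'∈ i≢i')))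
          (λ {i} {i'} {S} o o' → trans (sym (symplectic-left θ τ (zx i) (zx i'))) (on-symplectic _ _ S o o'))
          (λ i∈ i'∈ _ _ i≢i' → on-unique _ _ _ _ (injective-≢0 py-injective (zy≢0 i∈)) (injective-parallel py-injective (independent-y i∈ i'∈ i≢i')))
          (λ {i} {i'} {S} o o' → trans (solve 1 (λ x → x := :- (:- x)) refl _) (trans (cong -_ (trans (sym (symplectic-right θ τ (zy i) (zy i'))) (on-symplectic _ _ S o o'))) (solve 0 (:- κ 0 := κ 0) refl)))

        Alone : (I → F⁴) → I → F³ → Set
        Alone p i S = All (λ i' → On (p i') S → i' ≡ i) Z

        alone? : ∀ p i S → Dec (Alone p i S)
        alone? p i S = All.all? (λ i' → on? (p i') S →-dec (i' ≟ᴵ i)) Z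

        not-alone : ∀ p i S → ¬ Alone p i S → Σ I λ i' → i' ∈ Z × i' ≢ i × On (p i') S
        not-alone p i S h with search (λ i' → on? (p i') S →-dec (i' ≟ᴵ i)) Z
        ... | inj₁ all = ⊥-elim (h all)
        ... | inj₂ (i' , i'∈ , ¬imp) with on? (p i') S
        ...   | yes o = i' , i'∈ , (λ e → ¬imp (λ _ → e)) , o
        ...   | no ¬o = ⊥-elim (¬imp (λ o → ⊥-elim (¬o o)))

        Simple : I → I → Set
        Simple i j = Alone px i (cross i j) × Alone py j (cross i j)
        simple? : ∀ i j → Dec (Simple i j)
        simple? i j = alone? px i (cross i j) ×-dec alone? py j (cross i j)

        R C : I → I → Set
        R i j = (G i j × wedge (px i) (py j) ≢ 0#) × Simple i j
        C i j = (G i j × wedge (px i) (py j) ≢ 0#) × ¬ Simple i j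
        crossed? : ∀ i j → Dec (G i j × wedge (px i) (py j) ≢ 0#)
        crossed? i j = G? i j ×-dec ¬? (wedge (px i) (py j) ≟ 0#)
        R? : ∀ i j → Dec (R i j)
        R? i j = crossed? i j ×-dec simple? i j
        C? : ∀ i j → Dec (C i j)
        C? i j = crossed? i j ×-dec ¬? (simple? i j)

        on-x : ∀ {i j} → G i j × wedge (px i) (py j) ≢ 0# → On (px i) (cross i j)
        on-x {i} {j} (g , h) = on-crossingˡ (px i) (py j) h (trans (symplectic-twist θ τ (zx i) (zy j)) (G-pairing g))
        on-y : ∀ {i j} → G i j × wedge (px i) (py j) ≢ 0# → On (py j) (cross i j)
        on-y {i} {j} (g , h) = on-crossingʳ (px i) (py j) h (trans (symplectic-twist θ τ (zx i) (zy j)) (G-pairing g))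

        concurrent : ∑ Z (λ i → ∑ Z (λ j → 𝟙 (C? i j))) ≤ shear-cost zx θ ℕ.+ shear-cost zy θ
        concurrent = Conc'.concurrent-pairs C C? (λ {i} {j} i∈ j∈ (gw , ns) → cross i j , points-complete (cross i j) , on-x gw , on-y gw , multiple i∈ j∈ gw ns)
          where
          multiple : ∀ {i j} → i ∈ Z → j ∈ Z → G i j × wedge (px i) (py j) ≢ 0# → ¬ Simple i j → Conc'.Multiple (cross i j)
          multiple {i} {j} i∈ j∈ gw ns with alone? px i (cross i j)
          ... | no na = let (i' , i'∈ , ne , o) = not-alone px i (cross i j) na in inj₁ (∑-two (λ l → on? (px l) (cross i j)) i'∈ i∈ ne o (on-x gw))
          ... | yes al = let (j' , j'∈ , ne , o) = not-alone py j (cross i j) (λ al' → ns (al , al')) in inj₂ (∑-two (λ l → on? (py l) (cross i j)) j'∈ j∈ ne o (on-y gw))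

        -- The four fates of an orthogonal pair: a simple crossing, proportional vectors, no finite
        -- crossing in the chart τ, or a crossing lying on a third line.
        split : ∀ i j → 𝟙 (G? i j) ≤ 𝟙 (R? i j) ℕ.+ 𝟙 (parallel? (ax i) (ay j)) ℕ.+ 𝟙 (Flat? i j τ) ℕ.+ 𝟙 (C? i j)
        split i j = 𝟙-≤ (G? i j) λ g → cases g (parallel? (ax i) (ay j)) (wedge (px i) (py j) ≟ 0#) (simple? i j)
          where
          total = 𝟙 (R? i j) ℕ.+ 𝟙 (parallel? (ax i) (ay j)) ℕ.+ 𝟙 (Flat? i j τ) ℕ.+ 𝟙 (C? i j)
          a = 𝟙 (R? i j)
          b = 𝟙 (parallel? (ax i) (ay j))
          c = 𝟙 (Flat? i j τ)
          d = 𝟙 (C? i j)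
          cases : G i j → Dec (Parallel (ax i) (ay j)) → Dec (wedge (px i) (py j) ≡ 0#) → Dec (Simple i j) → 1 ≤ total
          cases g (yes p) _ _ = ≤-trans (≤-trans (≤-reflexive (sym (𝟙-yes (parallel? (ax i) (ay j)) p))) (m≤n+m b a)) (≤-trans (m≤m+n (a ℕ.+ b) c) (m≤m+n _ d))
          cases g (no np) (yes z) _ = ≤-trans (≤-trans (≤-reflexive (sym (𝟙-yes (Flat? i j τ) ((g , np) , trans (sym (wedge-chart τ (ax i) (ay j))) z)))) (m≤n+m c (a ℕ.+ b))) (m≤m+n _ d)
          cases g (no np) (no nz) (yes sm) = ≤-trans (≤-trans (≤-reflexive (sym (𝟙-yes (R? i j) ((g , nz) , sm)))) (m≤m+n a b)) (≤-trans (m≤m+n (a ℕ.+ b) c) (m≤m+n _ d))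
          cases g (no np) (no nz) (no ns) = ≤-trans (≤-reflexive (sym (𝟙-yes (C? i j) ((g , nz) , ns)))) (m≤n+m d (a ℕ.+ b ℕ.+ c))

        sum-split : sum-G ≤ ∑ Z (λ i → ∑ Z (λ j → 𝟙 (R? i j))) ℕ.+ n ℕ.+ chart-cost τ ℕ.+ (shear-cost zx θ ℕ.+ shear-cost zy θ)
        sum-split = begin
          sum-G ≤⟨ ∑-mono Z (λ {i} _ → ∑-mono Z (λ {j} _ → split i j)) ⟩
          ∑ Z (λ i → ∑ Z (λ j → 𝟙 (R? i j) ℕ.+ 𝟙 (parallel? (ax i) (ay j)) ℕ.+ 𝟙 (Flat? i j τ) ℕ.+ 𝟙 (C? i j)))
            ≡⟨ trans (∑-cong Z (λ {i} _ → ∑-+₄ Z (λ j → 𝟙 (R? i j)) (λ j → 𝟙 (parallel? (ax i) (ay j))) (λ j → 𝟙 (Flat? i j τ)) (λ j → 𝟙 (C? i j))))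
                 (∑-+₄ Z (λ i → ∑ Z (λ j → 𝟙 (R? i j))) (λ i → ∑ Z (λ j → 𝟙 (parallel? (ax i) (ay j)))) (λ i → ∑ Z (λ j → 𝟙 (Flat? i j τ))) (λ i → ∑ Z (λ j → 𝟙 (C? i j)))) ⟩
          ∑ Z (λ i → ∑ Z (λ j → 𝟙 (R? i j))) ℕ.+ ∑ Z (λ i → ∑ Z (λ j → 𝟙 (parallel? (ax i) (ay j)))) ℕ.+ chart-cost τ ℕ.+ ∑ Z (λ i → ∑ Z (λ j → 𝟙 (C? i j)))
            ≤⟨ +-mono-≤ (+-monoˡ-≤ (chart-cost τ) (+-monoʳ-≤ (∑ Z (λ i → ∑ Z (λ j → 𝟙 (R? i j)))) parallel-count)) concurrent ⟩
          ∑ Z (λ i → ∑ Z (λ j → 𝟙 (R? i j))) ℕ.+ n ℕ.+ chart-cost τ ℕ.+ (shear-cost zx θ ℕ.+ shear-cost zy θ) ∎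
          where open ≤-Reasoning

        configuration : ∀ {s} → Pruning.Pruned R R? s Z Z → Configuration s
        configuration pr = record
          { I = I ; Xs = xs' ; Ys = ys' ; Xs-unique = unique-x unique-Z ; Ys-unique = unique-y unique-Z ; px = px ; py = py ; R = R ; R? = R? ; cross = cross
          ; transversal = λ {i} {j} ((_ , h) , _) e → h (trans (sym (direction-wedge (px i) (py j))) e)
          ; on-x = λ (gw , _) → on-x gw ; on-y = λ (gw , _) → on-y gw
          ; separated-x = λ { {i} {i'} {j} i∈ i'∈ (_ , al , _) (gw' , _) e → sym (All.lookup al (sub-x i'∈) (subst (On (px i')) (sym e) (on-x gw'))) }
          ; separated-y = λ { {i} {j} {j'} j∈ j'∈ (_ , _ , al) (gw' , _) e → sym (All.lookup al (sub-y j'∈) (subst (On (py j')) (sym e) (on-y gw'))) }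
          ; degree-x = degree-x ; degree-y = degree-y ; origin = proj₁ member ; origin∈ = proj₂ member }
          where open Pruning.Pruned pr

    Rich : ℕ → Set
    Rich k = Σ I λ j → j ∈ Z × Σ F⁴ λ u → Σ F⁴ λ v → Σ (List I) λ is → Unique is × k ≤ length is ×
      All (λ i → i ∈ Z × G i j × Σ F λ β → Σ F λ t → β ≢ 0# × zx i ≡ scale-add β u t v) is

    -- The point-plane incidence bound of Rudnev for the symplectic pairing.
    rich : ∀ e k → let δ = box-degree e ; M = crossing-degree e ; s = M ℕ.+ k in
      (n ℕ.+ n) ℕ.* δ < e ℕ.* (e ℕ.* (e ℕ.* 1)) → 9 ℕ.+ M ≤ order →
      order ℕ.* n ℕ.+ 10 ℕ.* (n ℕ.* n) ℕ.+ order ℕ.* (s ℕ.* (n ℕ.+ n)) < order ℕ.* sum-G → Rich k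
    -- Both parameters are chosen below average, θ first because the cost of τ depends on it. The
    -- losses 4 n² + 4 n² + 2 n², each divided by p, make up the term with 10.
    rich e k few M≤order many with ∑-average elements (λ θ → shear-cost zx θ ℕ.+ shear-cost zy θ) (≤-trans (s≤s z≤n) order≥7)
    ... | θ , _ , θ-cheap with ∑-average elements (Sheared.chart-cost θ) (≤-trans (s≤s z≤n) order≥7)
    ... | τ , _ , τ-cheap = result (regulus (configuration pruned) e few' (m≤m+n M k) M≤order)
      where
      δ = box-degree e
      M = crossing-degree e
      -- `M` crossings per line are needed by the degree argument, and δ ≤ M of the lines may be
      -- lost in `regulus`; `k` remain.
      s = M ℕ.+ k
      open Sheared θ
      open Charted τ
      cost = shear-cost zx θ ℕ.+ shear-cost zy θ
      sum-R = ∑ Z (λ i → ∑ Z (λ j → 𝟙 (R? i j)))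
      sum-R-large : s ℕ.* (n ℕ.+ n) < sum-R
      sum-R-large = ℕₚ.*-cancelˡ-< order _ _ (ℕₚ.+-cancelˡ-< (order ℕ.* n ℕ.+ 10 ℕ.* (n ℕ.* n)) _ _ (begin-strict
        order ℕ.* n ℕ.+ 10 ℕ.* (n ℕ.* n) ℕ.+ order ℕ.* (s ℕ.* (n ℕ.+ n)) <⟨ many ⟩
        order ℕ.* sum-G ≤⟨ *-monoʳ-≤ order sum-split ⟩
        order ℕ.* (sum-R ℕ.+ n ℕ.+ chart-cost τ ℕ.+ cost) ≡⟨ expand order sum-R n (chart-cost τ) cost ⟩
        order ℕ.* sum-R ℕ.+ order ℕ.* n ℕ.+ (order ℕ.* chart-cost τ ℕ.+ order ℕ.* cost)
          ≤⟨ +-monoʳ-≤ (order ℕ.* sum-R ℕ.+ order ℕ.* n) (+-mono-≤ (≤-trans τ-cheap chart-total)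
               (≤-trans θ-cheap (≤-trans (≤-reflexive (∑-+ elements (shear-cost zx) (shear-cost zy))) (+-mono-≤ (shear-total zx zx≢0 independent-x) (shear-total zy zy≢0 independent-y))))) ⟩
        order ℕ.* sum-R ℕ.+ order ℕ.* n ℕ.+ (n ℕ.* (n ℕ.* 2) ℕ.+ (n ℕ.* (n ℕ.* 4) ℕ.+ n ℕ.* (n ℕ.* 4))) ≡⟨ collect (order ℕ.* sum-R) (order ℕ.* n) n ⟩
        order ℕ.* n ℕ.+ 10 ℕ.* (n ℕ.* n) ℕ.+ order ℕ.* sum-R ∎))
        where
        open ≤-Reasoning
        expand : ∀ p a b c d → p ℕ.* (a ℕ.+ b ℕ.+ c ℕ.+ d) ≡ p ℕ.* a ℕ.+ p ℕ.* b ℕ.+ (p ℕ.* c ℕ.+ p ℕ.* d)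
        expand = solve-∀
        collect : ∀ a b n → a ℕ.+ b ℕ.+ (n ℕ.* (n ℕ.* 2) ℕ.+ (n ℕ.* (n ℕ.* 4) ℕ.+ n ℕ.* (n ℕ.* 4))) ≡ b ℕ.+ 10 ℕ.* (n ℕ.* n) ℕ.+ a
        collect = solve-∀
      pruned : Pruning.Pruned R R? s Z Z
      pruned = Pruning.prune R R? s (n ℕ.+ n) Z Z ≤-refl sum-R-large
      open Pruning.Pruned pruned using (shorter-x; shorter-y; sub-x; sub-y)
      few' : (length (Pruning.Pruned.xs' pruned) ℕ.+ length (Pruning.Pruned.ys' pruned)) ℕ.* δ < e ℕ.* (e ℕ.* (e ℕ.* 1))
      few' = ≤-<-trans (*-monoˡ-≤ δ (+-mono-≤ shorter-x shorter-y)) few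
      result : _ → Rich k
      result (j , j∈ , u , v , is , unique , many' , all) = j , sub-y j∈ , untwist θ τ u , untwist θ τ v , is , unique ,
        ℕₚ.+-cancelˡ-≤ δ _ _ (≤-trans (+-monoˡ-≤ k (≤-trans (n≤1+n δ) (m≤n+m (1 ℕ.+ δ) (δ ℕ.+ δ ℕ.+ δ ℕ.+ δ)))) many') ,
        All.map (λ (i∈ , ((g , _) , _) , β , t , β≢0 , e) → sub-x i∈ , g , β , t , β≢0 ,
          trans (sym (untwist-twistˣ θ τ _)) (trans (cong (untwist θ τ) e) (untwist-linear θ τ β u t v))) all

-- Circles, bisectors and reflections in the plane K.

module PlaneGeometry (𝔽 : FiniteField) where
  open FieldTheory 𝔽
  open import Data.Nat using (_≤_; _<_)
  open Surfaces 𝔽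
  open NullLines 𝔽
  open CrossingLines 𝔽
  open Twisting 𝔽
  open RichLines 𝔽

  0² : F²
  0² = 0# , 0#

  infixl 6 _⊖_
  _⊖_ : F² → F² → F²
  (a , b) ⊖ (c , d) = a - c , b - d

  infixl 7 _∙_ _⊛_
  _∙_ : F² → F² → F
  (a , b) ∙ (c , d) = a * c + b * d

  _⊛_ : F² → F² → F²
  (a , b) ⊛ (c , d) = a * c - b * d , a * d + b * c

  conj : F² → F²
  conj (a , b) = a , - b

  norm : F² → F
  norm z = z ∙ z

  dist : F² → F² → F
  dist a b = norm (a ⊖ b)

  _≟²_ : DecidableEquality F²
  (a , b) ≟² (c , d) with a ≟ c | b ≟ d
  ... | yes refl | yes refl = yes refl
  ... | no n | _ = no (λ { refl → n refl })
  ... | yes _ | no n = no (λ { refl → n refl })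

  norm≡0 : ∀ z → norm z ≡ 0# → z ≡ 0²
  norm≡0 (a , b) e = cong₂ _,_ (proj₁ (sq+sq≡0 e)) (proj₂ (sq+sq≡0 e))

  norm≢0 : ∀ z → z ≢ 0² → norm z ≢ 0#
  norm≢0 z h e = h (norm≡0 z e)

  ⊖≡0 : ∀ a b → a ⊖ b ≡ 0² → a ≡ b
  ⊖≡0 (a , b) (c , d) e = cong₂ _,_ (≡-by-difference (cong proj₁ e)) (≡-by-difference (cong proj₂ e))

  dist≡0 : ∀ a b → dist a b ≡ 0# → a ≡ b
  dist≡0 a b e = ⊖≡0 a b (norm≡0 (a ⊖ b) e)

  norm-⊛ : ∀ a b → norm (a ⊛ b) ≡ norm a * norm b
  norm-⊛ (a , b) (c , d) = solve 4 (λ a b c d → (a :* c :- b :* d) :* (a :* c :- b :* d) :+ (a :* d :+ b :* c) :* (a :* d :+ b :* c) := (a :* a :+ b :* b) :* (c :* c :+ d :* d)) refl a b c d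

  ⊛-≡0 : ∀ a b → b ≢ 0² → a ⊛ b ≡ 0² → a ≡ 0²
  ⊛-≡0 a b h e = norm≡0 a (*-cancelˡ-0 (norm≢0 b h) (trans (*-comm _ _) (trans (sym (norm-⊛ a b)) (trans (cong norm e) (solve 0 (κ 0 :* κ 0 :+ κ 0 :* κ 0 := κ 0) refl)))))

  -- On isotropic lines all distances vanish; there are none because -1 is not a square.
  collinear-cocircular : ∀ m h a b c d → m ≢ 0² → m ∙ b ≡ h → m ∙ c ≡ h → m ∙ d ≡ h → dist a b ≡ dist a c → dist a b ≡ dist a d →
    b ≢ c → b ≢ d → c ≢ d → ⊥
  collinear-cocircular m@(m₁ , m₂) h a@(a₁ , a₂) b@(b₁ , b₂) c@(c₁ , c₂) d@(d₁ , d₂) m≢0 mb mc md ac ad b≢c b≢d c≢d = finish (no-zero-divisors vanish)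
    where
    u₁ = c₁ - b₁
    u₂ = c₂ - b₂
    v₁ = d₁ - b₁
    v₂ = d₂ - b₂
    mu : m₁ * u₁ + m₂ * u₂ ≡ 0#
    mu = combine₂ 1# (- 1#) mc mb (solve 7 (λ m₁ m₂ h b₁ b₂ c₁ c₂ → m₁ :* (c₁ :- b₁) :+ m₂ :* (c₂ :- b₂) := κ 0 :+ κ 1 :* (m₁ :* c₁ :+ m₂ :* c₂ :- h) :+ (:- κ 1) :* (m₁ :* b₁ :+ m₂ :* b₂ :- h)) refl m₁ m₂ h b₁ b₂ c₁ c₂)
    mv : m₁ * v₁ + m₂ * v₂ ≡ 0#
    mv = combine₂ 1# (- 1#) md mb (solve 7 (λ m₁ m₂ h b₁ b₂ c₁ c₂ → m₁ :* (c₁ :- b₁) :+ m₂ :* (c₂ :- b₂) := κ 0 :+ κ 1 :* (m₁ :* c₁ :+ m₂ :* c₂ :- h) :+ (:- κ 1) :* (m₁ :* b₁ :+ m₂ :* b₂ :- h)) refl m₁ m₂ h b₁ b₂ d₁ d₂)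
    wedge≡0 : u₁ * v₂ - u₂ * v₁ ≡ 0#
    wedge≡0 = *-cancelˡ-0 (norm≢0 m m≢0) (combine₂ (m₁ * v₂ - m₂ * v₁) (m₂ * u₁ - m₁ * u₂) mu mv (solve 6 (λ m₁ m₂ u₁ u₂ v₁ v₂ → (m₁ :* m₁ :+ m₂ :* m₂) :* (u₁ :* v₂ :- u₂ :* v₁)
      := κ 0 :+ (m₁ :* v₂ :- m₂ :* v₁) :* (m₁ :* u₁ :+ m₂ :* u₂ :- κ 0) :+ (m₂ :* u₁ :- m₁ :* u₂) :* (m₁ :* v₁ :+ m₂ :* v₂ :- κ 0)) refl m₁ m₂ u₁ u₂ v₁ v₂))
    n = u₁ * u₁ + u₂ * u₂
    n≢0 : n ≢ 0#
    n≢0 e = b≢c (sym (⊖≡0 c b (norm≡0 (u₁ , u₂) e)))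
    inv : n * n ⁻¹ ≡ 1#
    inv = *-inverse n n≢0
    k = (u₁ * v₁ + u₂ * v₂) * n ⁻¹
    ev₁ : v₁ ≡ k * u₁
    ev₁ = proportional₁ inv wedge≡0
    ev₂ : v₂ ≡ k * u₂
    ev₂ = proportional₂ inv wedge≡0
    f₁ = b₁ - a₁
    f₂ = b₂ - a₂
    chord : ∀ x₁ x₂ → dist a b ≡ dist a (x₁ , x₂) → 2# * (f₁ * (x₁ - b₁) + f₂ * (x₂ - b₂)) + ((x₁ - b₁) * (x₁ - b₁) + (x₂ - b₂) * (x₂ - b₂)) ≡ 0#
    chord x₁ x₂ e = combine₁ (- 1#) e (solve 6 (λ a₁ a₂ b₁ b₂ x₁ x₂ → κ 2 :* ((b₁ :- a₁) :* (x₁ :- b₁) :+ (b₂ :- a₂) :* (x₂ :- b₂)) :+ ((x₁ :- b₁) :* (x₁ :- b₁) :+ (x₂ :- b₂) :* (x₂ :- b₂))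
      := κ 0 :+ (:- κ 1) :* (((a₁ :- b₁) :* (a₁ :- b₁) :+ (a₂ :- b₂) :* (a₂ :- b₂)) :- ((a₁ :- x₁) :* (a₁ :- x₁) :+ (a₂ :- x₂) :* (a₂ :- x₂)))) refl a₁ a₂ b₁ b₂ x₁ x₂)
    cu : 2# * (f₁ * u₁ + f₂ * u₂) + n ≡ 0#
    cu = chord c₁ c₂ ac
    cv : 2# * (f₁ * (k * u₁) + f₂ * (k * u₂)) + (k * u₁ * (k * u₁) + k * u₂ * (k * u₂)) ≡ 0#
    cv = trans (cong₂ (λ x y → 2# * (f₁ * x + f₂ * y) + (x * x + y * y)) (sym ev₁) (sym ev₂)) (chord d₁ d₂ ad)
    vanish : k * (k - 1#) ≡ 0#
    vanish = *-cancelˡ-0 n≢0 (combine₂ 1# (- k) cv cu (solve 5 (λ k f₁ f₂ u₁ u₂ → (u₁ :* u₁ :+ u₂ :* u₂) :* (k :* (k :- κ 1))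
      := κ 0 :+ κ 1 :* (κ 2 :* (f₁ :* (k :* u₁) :+ f₂ :* (k :* u₂)) :+ (k :* u₁ :* (k :* u₁) :+ k :* u₂ :* (k :* u₂)) :- κ 0) :+ (:- k) :* (κ 2 :* (f₁ :* u₁ :+ f₂ :* u₂) :+ (u₁ :* u₁ :+ u₂ :* u₂) :- κ 0)) refl k f₁ f₂ u₁ u₂))
    finish : k ≡ 0# ⊎ k - 1# ≡ 0# → ⊥
    finish (inj₁ z) = b≢d (sym (⊖≡0 d b (cong₂ _,_ (trans ev₁ (trans (cong (_* u₁) z) (zeroˡ u₁))) (trans ev₂ (trans (cong (_* u₂) z) (zeroˡ u₂))))))
    finish (inj₂ z) = c≢d (cong₂ _,_ (shift (trans ev₁ (trans (cong (_* u₁) (≡-by-difference z)) (*-identityˡ u₁)))) (shift (trans ev₂ (trans (cong (_* u₂) (≡-by-difference z)) (*-identityˡ u₂)))))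
      where
      shift : ∀ {x y z} → x - z ≡ y - z → y ≡ x
      shift {x} {y} {z} e = combine₁ (- 1#) e (solve 3 (λ x y z → y := x :+ (:- κ 1) :* ((x :- z) :- (y :- z))) refl x y z)

  -- The common points lie on the radical axis, so they are collinear and cocircular.
  two-circles : ∀ b b' c d e → b ≢ b' → dist b c ≡ dist b d → dist b c ≡ dist b e → dist b' c ≡ dist b' d → dist b' c ≡ dist b' e → c ≢ d → c ≢ e → d ≢ e → ⊥
  two-circles b@(b₁ , b₂) b'@(b₁' , b₂') c d e b≢b' cd ce cd' ce' = collinear-cocircular (b ⊖ b') ((b ⊖ b') ∙ c) b c d e (λ z → b≢b' (⊖≡0 b b' z)) refl (axis c d cd cd') (axis c e ce ce') cd ce
    where
    axis : ∀ c d → dist b c ≡ dist b d → dist b' c ≡ dist b' d → (b ⊖ b') ∙ d ≡ (b ⊖ b') ∙ c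
    axis (c₁ , c₂) (d₁ , d₂) h h' = *-cancelˡ 2≢0 (combine₂ 1# (- 1#) h h' (solve 8 (λ b₁ b₂ b₁' b₂' c₁ c₂ d₁ d₂ → κ 2 :* ((b₁ :- b₁') :* d₁ :+ (b₂ :- b₂') :* d₂)
      := κ 2 :* ((b₁ :- b₁') :* c₁ :+ (b₂ :- b₂') :* c₂)
        :+ κ 1 :* (((b₁ :- c₁) :* (b₁ :- c₁) :+ (b₂ :- c₂) :* (b₂ :- c₂)) :- ((b₁ :- d₁) :* (b₁ :- d₁) :+ (b₂ :- d₂) :* (b₂ :- d₂)))
        :+ (:- κ 1) :* (((b₁' :- c₁) :* (b₁' :- c₁) :+ (b₂' :- c₂) :* (b₂' :- c₂)) :- ((b₁' :- d₁) :* (b₁' :- d₁) :+ (b₂' :- d₂) :* (b₂' :- d₂)))) refl b₁ b₂ b₁' b₂' c₁ c₂ d₁ d₂))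

  -- Generalized circles α |z|² + β₁ x + β₂ y + γ = 0.
  Circle : Set
  Circle = F × F² × F

  circle-value : Circle → F² → F
  circle-value (α , β , γ) z = α * norm z + β ∙ z + γ

  OnCircle : Circle → F² → Set
  OnCircle Γ z = circle-value Γ z ≡ 0#

  Nondegenerate : Circle → Set
  Nondegenerate (α , β , γ) = ¬ (α ≡ 0# × β ≡ 0²)

  Centred : Circle → F² → Set
  Centred (α , (β₁ , β₂) , γ) (a₁ , a₂) = α ≢ 0# × β₁ + 2# * α * a₁ ≡ 0# × β₂ + 2# * α * a₂ ≡ 0#

  -- Subtracting α times the equation of distances from that of Γ leaves a linear form with normal β
  -- + 2 α a, constant on the three points. A nonzero normal would make them collinear and
  -- cocircular; a zero normal says that a is the centre.
  equidistant⇒centred : ∀ Γ a b c d → Nondegenerate Γ → OnCircle Γ b → OnCircle Γ c → OnCircle Γ d → dist a b ≡ dist a c → dist a b ≡ dist a d →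
    b ≢ c → b ≢ d → c ≢ d → Centred Γ a
  equidistant⇒centred Γ@(α , β@(β₁ , β₂) , γ) a@(a₁ , a₂) b c d nd ob oc od ac ad b≢c b≢d c≢d with (β₁ + 2# * α * a₁ , β₂ + 2# * α * a₂) ≟² 0²
  ... | no h = ⊥-elim (collinear-cocircular m (m ∙ b) a b c d h refl (level c oc ac) (level d od ad) ac ad b≢c b≢d c≢d)
    where
    m = (β₁ + 2# * α * a₁ , β₂ + 2# * α * a₂)
    level : ∀ c → OnCircle Γ c → dist a b ≡ dist a c → m ∙ c ≡ m ∙ b
    level c@(c₁ , c₂) oc ac = combine₃ 1# (- 1#) α oc ob ac (solve 10 (λ α β₁ β₂ γ a₁ a₂ b₁ b₂ c₁ c₂ → (β₁ :+ κ 2 :* α :* a₁) :* c₁ :+ (β₂ :+ κ 2 :* α :* a₂) :* c₂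
      := (β₁ :+ κ 2 :* α :* a₁) :* b₁ :+ (β₂ :+ κ 2 :* α :* a₂) :* b₂
        :+ κ 1 :* (α :* (c₁ :* c₁ :+ c₂ :* c₂) :+ (β₁ :* c₁ :+ β₂ :* c₂) :+ γ :- κ 0) :+ (:- κ 1) :* (α :* (b₁ :* b₁ :+ b₂ :* b₂) :+ (β₁ :* b₁ :+ β₂ :* b₂) :+ γ :- κ 0)
        :+ α :* (((a₁ :- b₁) :* (a₁ :- b₁) :+ (a₂ :- b₂) :* (a₂ :- b₂)) :- ((a₁ :- c₁) :* (a₁ :- c₁) :+ (a₂ :- c₂) :* (a₂ :- c₂)))) refl α β₁ β₂ γ a₁ a₂ (proj₁ b) (proj₂ b) c₁ c₂)
  ... | yes z = α≢0 , cong proj₁ z , cong proj₂ z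
    where
    α≢0 : α ≢ 0#
    α≢0 refl = nd (refl , cong₂ _,_ (trans (solve 2 (λ β a → β := β :+ κ 2 :* κ 0 :* a) refl β₁ a₁) (cong proj₁ z)) (trans (solve 2 (λ β a → β := β :+ κ 2 :* κ 0 :* a) refl β₂ a₂) (cong proj₂ z)))

  centred-unique : ∀ Γ a a' → Centred Γ a → Centred Γ a' → a ≡ a'
  centred-unique (α , (β₁ , β₂) , γ) (a₁ , a₂) (a₁' , a₂') (α≢0 , e₁ , e₂) (_ , e₁' , e₂') = cong₂ _,_ (same e₁ e₁') (same e₂ e₂')
    where
    same : ∀ {β a a'} → β + 2# * α * a ≡ 0# → β + 2# * α * a' ≡ 0# → a ≡ a'
    same {β} {a} {a'} e e' = *-cancelˡ (*-≢0 2≢0 α≢0) (combine₂ 1# (- 1#) e e' (solve 4 (λ α β a a' → κ 2 :* α :* a := κ 2 :* α :* a' :+ κ 1 :* (β :+ κ 2 :* α :* a :- κ 0) :+ (:- κ 1) :* (β :+ κ 2 :* α :* a' :- κ 0)) refl α β a a'))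

  circle-scale : ∀ k α β₁ β₂ γ α' β₁' β₂' γ' → α' ≡ k * α → β₁' ≡ k * β₁ → β₂' ≡ k * β₂ → ∀ b z → OnCircle (α , (β₁ , β₂) , γ) b → OnCircle (α' , (β₁' , β₂') , γ') b →
    OnCircle (α , (β₁ , β₂) , γ) z → OnCircle (α' , (β₁' , β₂') , γ') z
  circle-scale k α β₁ β₂ γ _ _ _ γ' refl refl refl (b₁ , b₂) (z₁ , z₂) ob ob' oz = combine₃ k (- k) 1# oz ob ob'
    (solve 10 (λ k α β₁ β₂ γ γ' b₁ b₂ z₁ z₂ → k :* α :* (z₁ :* z₁ :+ z₂ :* z₂) :+ (k :* β₁ :* z₁ :+ k :* β₂ :* z₂) :+ γ'
      := κ 0 :+ k :* (α :* (z₁ :* z₁ :+ z₂ :* z₂) :+ (β₁ :* z₁ :+ β₂ :* z₂) :+ γ :- κ 0) :+ (:- k) :* (α :* (b₁ :* b₁ :+ b₂ :* b₂) :+ (β₁ :* b₁ :+ β₂ :* b₂) :+ γ :- κ 0)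
        :+ κ 1 :* (k :* α :* (b₁ :* b₁ :+ b₂ :* b₂) :+ (k :* β₁ :* b₁ :+ k :* β₂ :* b₂) :+ γ' :- κ 0)) refl k α β₁ β₂ γ γ' b₁ b₂ z₁ z₂)

  HasCentre : Circle → Set
  HasCentre Γ = Σ F² λ a → Centred Γ a × (∀ b c → OnCircle Γ b → OnCircle Γ c → dist a b ≡ dist a c)

  centre : ∀ Γ → proj₁ Γ ≢ 0# → HasCentre Γ
  centre (α , (β₁ , β₂) , γ) α≢0 = (a₁ , a₂) , (α≢0 , half β₁ , half β₂) , equidistant
    where
    i = (2# * α) ⁻¹
    inv : 2# * α * i ≡ 1#
    inv = *-inverse _ (*-≢0 2≢0 α≢0)
    a₁ = - (β₁ * i)
    a₂ = - (β₂ * i)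
    half : ∀ β → β + 2# * α * - (β * i) ≡ 0#
    half β = combine₁ (- β) inv (solve 3 (λ α β i → β :+ κ 2 :* α :* :- (β :* i) := κ 0 :+ (:- β) :* (κ 2 :* α :* i :- κ 1)) refl α β i)
    equidistant : ∀ b c → OnCircle (α , (β₁ , β₂) , γ) b → OnCircle (α , (β₁ , β₂) , γ) c → dist (a₁ , a₂) b ≡ dist (a₁ , a₂) c
    equidistant (b₁ , b₂) (c₁ , c₂) ob oc = *-cancelˡ α≢0 (combine₃ 1# (- 1#) (β₁ * (b₁ - c₁) + β₂ * (b₂ - c₂)) ob oc inv
      (solve 9 (λ α β₁ β₂ γ i b₁ b₂ c₁ c₂ → let a₁ = :- (β₁ :* i) ; a₂ = :- (β₂ :* i) in
        α :* ((a₁ :- b₁) :* (a₁ :- b₁) :+ (a₂ :- b₂) :* (a₂ :- b₂)) := α :* ((a₁ :- c₁) :* (a₁ :- c₁) :+ (a₂ :- c₂) :* (a₂ :- c₂))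
          :+ κ 1 :* (α :* (b₁ :* b₁ :+ b₂ :* b₂) :+ (β₁ :* b₁ :+ β₂ :* b₂) :+ γ :- κ 0) :+ (:- κ 1) :* (α :* (c₁ :* c₁ :+ c₂ :* c₂) :+ (β₁ :* c₁ :+ β₂ :* c₂) :+ γ :- κ 0)
          :+ (β₁ :* (b₁ :- c₁) :+ β₂ :* (b₂ :- c₂)) :* (κ 2 :* α :* i :- κ 1)) refl α β₁ β₂ γ i b₁ b₂ c₁ c₂))

  -- The centre of a proper circle is equidistant from the three points, hence the centre of the
  -- other as well; the equations then agree up to a factor and a constant, and the constant is
  -- fixed by b. This also rules out a line with a circle. For two lines both normals are orthogonal
  -- to c - b.
  three-points : ∀ Γ Γ' b c d → Nondegenerate Γ → Nondegenerate Γ' → OnCircle Γ b → OnCircle Γ c → OnCircle Γ d → OnCircle Γ' b → OnCircle Γ' c → OnCircle Γ' d →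
    b ≢ c → b ≢ d → c ≢ d → ∀ z → OnCircle Γ z → OnCircle Γ' z
  three-points Γ@(α , (β₁ , β₂) , γ) Γ'@(α' , (β₁' , β₂') , γ') b c d nd nd' ob oc od ob' oc' od' b≢c b≢d c≢d z oz = go (α ≟ 0#) (α' ≟ 0#)
    where
    go : Dec (α ≡ 0#) → Dec (α' ≡ 0#) → OnCircle Γ' z
    go (no α≢0) _ = from (centre Γ α≢0)
      where
      from' : ∀ a → Centred Γ a → Centred Γ' a → OnCircle Γ' z
      from : HasCentre Γ → OnCircle Γ' z
      from (a , ca , eq) = from' a ca (equidistant⇒centred Γ' a b c d nd' ob' oc' od' (eq b c ob oc) (eq b d ob od) b≢c b≢d c≢d)
      inv : α * α ⁻¹ ≡ 1#
      inv = *-inverse α α≢0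
      kα : α' ≡ α' * α ⁻¹ * α
      kα = combine₁ (- α') inv (solve 3 (λ α α' i → α' := α' :* i :* α :+ (:- α') :* (α :* i :- κ 1)) refl α α' (α ⁻¹))
      kβ : ∀ {β β' a} → β + 2# * α * a ≡ 0# → β' + 2# * α' * a ≡ 0# → β' ≡ α' * α ⁻¹ * β
      kβ {β} {β'} {a} e e' = combine₃ 1# (- (α' * α ⁻¹)) (2# * α' * a) e' e inv (solve 6 (λ α α' i β β' a → β' := α' :* i :* β :+ κ 1 :* (β' :+ κ 2 :* α' :* a :- κ 0) :+ (:- (α' :* i)) :* (β :+ κ 2 :* α :* a :- κ 0) :+ κ 2 :* α' :* a :* (α :* i :- κ 1)) refl α α' (α ⁻¹) β β' a)
      from' a@(a₁ , a₂) (_ , e₁ , e₂) (_ , e₁' , e₂') = circle-scale (α' * α ⁻¹) α β₁ β₂ γ α' β₁' β₂' γ' kα (kβ e₁ e₁') (kβ e₂ e₂') b z ob ob' oz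
    go (yes α≡0) (no α'≢0) = from (centre Γ' α'≢0)
      where
      from : HasCentre Γ' → OnCircle Γ' z
      from (a , _ , eq) = ⊥-elim (proj₁ (equidistant⇒centred Γ a b c d nd ob oc od (eq b c ob' oc') (eq b d ob' od') b≢c b≢d c≢d) α≡0)
    go (yes refl) (yes refl) = circle-scale k 0# β₁ β₂ γ 0# β₁' β₂' γ' (sym (zeroʳ k)) e₁ e₂ b z ob ob' oz
      where
      u₁ = proj₁ c - proj₁ b
      u₂ = proj₂ c - proj₂ b
      perp : ∀ β₁ β₂ γ → OnCircle (0# , (β₁ , β₂) , γ) b → OnCircle (0# , (β₁ , β₂) , γ) c → β₁ * u₁ + β₂ * u₂ ≡ 0#
      perp β₁ β₂ γ ob oc = combine₂ 1# (- 1#) oc ob (solve 7 (λ β₁ β₂ γ b₁ b₂ c₁ c₂ → β₁ :* (c₁ :- b₁) :+ β₂ :* (c₂ :- b₂) := κ 0 :+ κ 1 :* (κ 0 :* (c₁ :* c₁ :+ c₂ :* c₂) :+ (β₁ :* c₁ :+ β₂ :* c₂) :+ γ :- κ 0)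
        :+ (:- κ 1) :* (κ 0 :* (b₁ :* b₁ :+ b₂ :* b₂) :+ (β₁ :* b₁ :+ β₂ :* b₂) :+ γ :- κ 0)) refl β₁ β₂ γ (proj₁ b) (proj₂ b) (proj₁ c) (proj₂ c))
      n = β₁ * β₁ + β₂ * β₂
      inv : n * n ⁻¹ ≡ 1#
      inv = *-inverse n (norm≢0 (β₁ , β₂) (λ e → nd (refl , e)))
      k = (β₁ * β₁' + β₂ * β₂') * n ⁻¹
      wedge≡0 : β₁ * β₂' - β₂ * β₁' ≡ 0#
      wedge≡0 = *-cancelˡ-0 (norm≢0 (u₁ , u₂) (λ e → b≢c (sym (⊖≡0 c b e)))) (combine₂ (β₂' * u₁ - β₁' * u₂) (β₁ * u₂ - β₂ * u₁) (perp β₁ β₂ γ ob oc) (perp β₁' β₂' γ' ob' oc')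
        (solve 6 (λ β₁ β₂ β₁' β₂' u₁ u₂ → (u₁ :* u₁ :+ u₂ :* u₂) :* (β₁ :* β₂' :- β₂ :* β₁') := κ 0 :+ (β₂' :* u₁ :- β₁' :* u₂) :* (β₁ :* u₁ :+ β₂ :* u₂ :- κ 0) :+ (β₁ :* u₂ :- β₂ :* u₁) :* (β₁' :* u₁ :+ β₂' :* u₂ :- κ 0)) refl β₁ β₂ β₁' β₂' u₁ u₂))
      e₁ : β₁' ≡ k * β₁
      e₁ = proportional₁ inv wedge≡0
      e₂ : β₂' ≡ k * β₂
      e₂ = proportional₂ inv wedge≡0

  -- Lines m · z = h with the normal m normalized to (1 , μ) or (0 , 1).
  Line : Set
  Line = F² × F

  bisector : F² → F² → Line
  bisector b@(b₁ , b₂) c@(c₁ , c₂) with b₁ - c₁ ≟ 0#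
  ... | no _ = (1# , (b₂ - c₂) * (b₁ - c₁) ⁻¹) , (norm b - norm c) * (2# * (b₁ - c₁)) ⁻¹
  ... | yes _ = (0# , 1#) , (norm b - norm c) * (2# * (b₂ - c₂)) ⁻¹

  record BisectorScale (b c : F²) : Set where
    constructor bisector-scale
    field
      factor : F
      factor≢0 : factor ≢ 0#
      scale₁ : proj₁ b - proj₁ c ≡ factor * proj₁ (proj₁ (bisector b c))
      scale₂ : proj₂ b - proj₂ c ≡ factor * proj₂ (proj₁ (bisector b c))
      offset : norm b - norm c ≡ 2# * factor * proj₂ (bisector b c)

  bisector-spec : ∀ b c → b ≢ c → BisectorScale b c
  bisector-spec b@(b₁ , b₂) c@(c₁ , c₂) b≢c with b₁ - c₁ ≟ 0# in eq
  ... | no h = bisector-scale (b₁ - c₁) h (s₁ eq) (s₂ eq) (s₃ eq)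
    where
    inv₁ : (b₁ - c₁) * (b₁ - c₁) ⁻¹ ≡ 1#
    inv₁ = *-inverse _ h
    inv₂ : 2# * (b₁ - c₁) * (2# * (b₁ - c₁)) ⁻¹ ≡ 1#
    inv₂ = *-inverse _ (*-≢0 2≢0 h)
    s₁ : (b₁ - c₁ ≟ 0#) ≡ no h → b₁ - c₁ ≡ (b₁ - c₁) * proj₁ (proj₁ (bisector b c))
    s₁ eq rewrite eq = sym (*-identityʳ _)
    s₂ : (b₁ - c₁ ≟ 0#) ≡ no h → b₂ - c₂ ≡ (b₁ - c₁) * proj₂ (proj₁ (bisector b c))
    s₂ eq rewrite eq = combine₁ (- (b₂ - c₂)) inv₁ (solve 3 (λ v₁ v₂ i → v₂ := v₁ :* (v₂ :* i) :+ (:- v₂) :* (v₁ :* i :- κ 1)) refl (b₁ - c₁) (b₂ - c₂) ((b₁ - c₁) ⁻¹))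
    s₃ : (b₁ - c₁ ≟ 0#) ≡ no h → norm b - norm c ≡ 2# * (b₁ - c₁) * proj₂ (bisector b c)
    s₃ eq rewrite eq = combine₁ (- (norm b - norm c)) inv₂ (solve 3 (λ v k i → k := v :* (k :* i) :+ (:- k) :* (v :* i :- κ 1)) refl (2# * (b₁ - c₁)) (norm b - norm c) ((2# * (b₁ - c₁)) ⁻¹))
  ... | yes z = bisector-scale (b₂ - c₂) h (s₁ eq) (s₂ eq) (s₃ eq)
    where
    h : b₂ - c₂ ≢ 0#
    h e = b≢c (⊖≡0 b c (cong₂ _,_ z e))
    inv₂ : 2# * (b₂ - c₂) * (2# * (b₂ - c₂)) ⁻¹ ≡ 1#
    inv₂ = *-inverse _ (*-≢0 2≢0 h)
    s₁ : (b₁ - c₁ ≟ 0#) ≡ yes z → b₁ - c₁ ≡ (b₂ - c₂) * proj₁ (proj₁ (bisector b c))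
    s₁ eq rewrite eq = trans z (sym (zeroʳ _))
    s₂ : (b₁ - c₁ ≟ 0#) ≡ yes z → b₂ - c₂ ≡ (b₂ - c₂) * proj₂ (proj₁ (bisector b c))
    s₂ eq rewrite eq = sym (*-identityʳ _)
    s₃ : (b₁ - c₁ ≟ 0#) ≡ yes z → norm b - norm c ≡ 2# * (b₂ - c₂) * proj₂ (bisector b c)
    s₃ eq rewrite eq = combine₁ (- (norm b - norm c)) inv₂ (solve 3 (λ v k i → k := v :* (k :* i) :+ (:- k) :* (v :* i :- κ 1)) refl (2# * (b₂ - c₂)) (norm b - norm c) ((2# * (b₂ - c₂)) ⁻¹))

  OnLine : Line → F² → Set
  OnLine (m , h) a = m ∙ a ≡ h

  equidistant⇒on-bisector : ∀ a b c → b ≢ c → dist a b ≡ dist a c → OnLine (bisector b c) a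
  equidistant⇒on-bisector a@(a₁ , a₂) b@(b₁ , b₂) c@(c₁ , c₂) b≢c e = from (bisector-spec b c b≢c)
    where
    m₁ = proj₁ (proj₁ (bisector b c))
    m₂ = proj₂ (proj₁ (bisector b c))
    from : BisectorScale b c → OnLine (bisector b c) a
    from (bisector-scale k k≢0 s₁ s₂ s₃) = *-cancelˡ (*-≢0 2≢0 k≢0) (trans
      (solve 5 (λ k m₁ m₂ a₁ a₂ → κ 2 :* k :* (m₁ :* a₁ :+ m₂ :* a₂) := κ 2 :* (k :* m₁ :* a₁ :+ k :* m₂ :* a₂)) refl k m₁ m₂ a₁ a₂)
      (trans (cong₂ (λ x y → 2# * (x * a₁ + y * a₂)) (sym s₁) (sym s₂)) (trans
        (combine₁ (- 1#) e (solve 6 (λ a₁ a₂ b₁ b₂ c₁ c₂ → κ 2 :* ((b₁ :- c₁) :* a₁ :+ (b₂ :- c₂) :* a₂) := (b₁ :* b₁ :+ b₂ :* b₂) :- (c₁ :* c₁ :+ c₂ :* c₂)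
          :+ (:- κ 1) :* (((a₁ :- b₁) :* (a₁ :- b₁) :+ (a₂ :- b₂) :* (a₂ :- b₂)) :- ((a₁ :- c₁) :* (a₁ :- c₁) :+ (a₂ :- c₂) :* (a₂ :- c₂)))) refl a₁ a₂ b₁ b₂ c₁ c₂)) s₃)))

  record SameAxis (b c b' c' : F²) : Set where
    constructor same-axis
    field
      ratio : F
      same₁ : proj₁ b' - proj₁ c' ≡ ratio * (proj₁ b - proj₁ c)
      same₂ : proj₂ b' - proj₂ c' ≡ ratio * (proj₂ b - proj₂ c)
      same-offset : norm b' - norm c' ≡ ratio * (norm b - norm c)

  bisector-same : ∀ b c b' c' → b ≢ c → b' ≢ c' → bisector b c ≡ bisector b' c' → SameAxis b c b' c'
  bisector-same b c b' c' b≢c b'≢c' e = from (bisector-spec b c b≢c) (bisector-spec b' c' b'≢c')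
    where
    from : BisectorScale b c → BisectorScale b' c' → SameAxis b c b' c'
    from (bisector-scale k k≢0 s₁ s₂ s₃) (bisector-scale k' _ s₁' s₂' s₃') = same-axis (k' * k ⁻¹)
      (ratio s₁ (trans s₁' (cong (λ l → k' * proj₁ (proj₁ l)) (sym e)))) (ratio s₂ (trans s₂' (cong (λ l → k' * proj₂ (proj₁ l)) (sym e))))
      (ratio {2# * proj₂ (bisector b c)} (trans s₃ (swap k)) (trans s₃' (trans (cong (λ l → 2# * k' * proj₂ l) (sym e)) (swap k'))))
      where
      swap : ∀ k {h} → 2# * k * h ≡ k * (2# * h)
      swap k {h} = solve 2 (λ k h → κ 2 :* k :* h := k :* (κ 2 :* h)) refl k h
      ratio : ∀ {m x x'} → x ≡ k * m → x' ≡ k' * m → x' ≡ k' * k ⁻¹ * x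
      ratio {m} {x} {x'} e e' = combine₃ 1# (- (k' * k ⁻¹)) (- (k' * m)) e' e (*-inverse k k≢0) (solve 6 (λ k k' i m x x' → x' := k' :* i :* x :+ κ 1 :* (x' :- k' :* m) :+ (:- (k' :* i)) :* (x :- k :* m)
          :+ (:- (k' :* m)) :* (k :* i :- κ 1)) refl k k' (k ⁻¹) m x x')

  -- Writing b - c' = μ (b - c), the common offset gives μ² = μ; μ = 0 would mean c' = b.
  bisector-injective : ∀ b c c' → b ≢ c → b ≢ c' → bisector b c ≡ bisector b c' → c ≡ c'
  bisector-injective b@(b₁ , b₂) c@(c₁ , c₂) c'@(c₁' , c₂') b≢c b≢c' e = from (bisector-same b c b c' b≢c b≢c' e)
   where
   from : SameAxis b c b c' → c ≡ c'
   from (same-axis μ e₁ e₂ e₃) = finish (no-zero-divisors vanish)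
    where
    v₁ = b₁ - c₁
    v₂ = b₂ - c₂
    n≢0 : norm (b ⊖ c) ≢ 0#
    n≢0 z = b≢c (dist≡0 b c z)
    vanish : μ * (μ - 1#) ≡ 0#
    vanish = *-cancelˡ-0 n≢0 (combine₃ (2# * b₁ - ((b₁ - c₁') + μ * v₁)) (2# * b₂ - ((b₂ - c₂') + μ * v₂)) (- 1#) e₁ e₂ e₃
      (solve 7 (λ μ b₁ b₂ c₁ c₂ c₁' c₂' → let v₁ = b₁ :- c₁ ; v₂ = b₂ :- c₂ in (v₁ :* v₁ :+ v₂ :* v₂) :* (μ :* (μ :- κ 1)) := κ 0
        :+ (κ 2 :* b₁ :- ((b₁ :- c₁') :+ μ :* v₁)) :* (b₁ :- c₁' :- μ :* v₁) :+ (κ 2 :* b₂ :- ((b₂ :- c₂') :+ μ :* v₂)) :* (b₂ :- c₂' :- μ :* v₂)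
        :+ (:- κ 1) :* ((b₁ :* b₁ :+ b₂ :* b₂) :- (c₁' :* c₁' :+ c₂' :* c₂') :- μ :* ((b₁ :* b₁ :+ b₂ :* b₂) :- (c₁ :* c₁ :+ c₂ :* c₂)))) refl μ b₁ b₂ c₁ c₂ c₁' c₂'))
    finish : μ ≡ 0# ⊎ μ - 1# ≡ 0# → c ≡ c'
    finish (inj₁ refl) = ⊥-elim (b≢c' (⊖≡0 b c' (cong₂ _,_ (trans e₁ (zeroˡ _)) (trans e₂ (zeroˡ _)))))
    finish (inj₂ z) = cong₂ _,_ (shift (trans e₁ (trans (cong (_* v₁) (≡-by-difference z)) (*-identityˡ v₁)))) (shift (trans e₂ (trans (cong (_* v₂) (≡-by-difference z)) (*-identityˡ v₂))))
      where
      shift : ∀ {x y z} → z - x ≡ z - y → y ≡ x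
      shift {x} {y} {z} e = combine₁ 1# e (solve 3 (λ x y z → y := x :+ κ 1 :* ((z :- x) :- (z :- y))) refl x y z)

  -- The reflection exchanging b and c also exchanges b' and c': the segments U = b' - b and U' = c' - c are mirror images.
  record Mirror (b c b' c' : F²) : Set where
    constructor mirror
    field
      normal : ((proj₁ b' - proj₁ b) + (proj₁ c' - proj₁ c)) * (proj₁ b - proj₁ c) + ((proj₂ b' - proj₂ b) + (proj₂ c' - proj₂ c)) * (proj₂ b - proj₂ c) ≡ 0#
      tangential : ((proj₁ b' - proj₁ b) - (proj₁ c' - proj₁ c)) * (proj₂ b - proj₂ c) - ((proj₂ b' - proj₂ b) - (proj₂ c' - proj₂ c)) * (proj₁ b - proj₁ c) ≡ 0#
      same-length : dist b b' ≡ dist c c'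

  mirrored : ∀ b c b' c' → b ≢ c → b' ≢ c' → bisector b c ≡ bisector b' c' → Mirror b c b' c'
  mirrored b@(b₁ , b₂) c@(c₁ , c₂) b'@(b₁' , b₂') c'@(c₁' , c₂') b≢c b'≢c' e = from (bisector-same b' c' b c b'≢c' b≢c (sym e))
   where
   from : SameAxis b' c' b c → Mirror b c b' c'
   from (same-axis μ e₁ e₂ e₃) = mirror normal tangential same-length
    where
    normal : ((b₁' - b₁) + (c₁' - c₁)) * (b₁ - c₁) + ((b₂' - b₂) + (c₂' - c₂)) * (b₂ - c₂) ≡ 0#
    normal = combine₃ (b₁' + c₁') (b₂' + c₂') (- 1#) e₁ e₂ e₃ (solve 9 (λ μ b₁ b₂ c₁ c₂ b₁' b₂' c₁' c₂' →
      ((b₁' :- b₁) :+ (c₁' :- c₁)) :* (b₁ :- c₁) :+ ((b₂' :- b₂) :+ (c₂' :- c₂)) :* (b₂ :- c₂) := κ 0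
        :+ (b₁' :+ c₁') :* (b₁ :- c₁ :- μ :* (b₁' :- c₁')) :+ (b₂' :+ c₂') :* (b₂ :- c₂ :- μ :* (b₂' :- c₂'))
        :+ (:- κ 1) :* ((b₁ :* b₁ :+ b₂ :* b₂) :- (c₁ :* c₁ :+ c₂ :* c₂) :- μ :* ((b₁' :* b₁' :+ b₂' :* b₂') :- (c₁' :* c₁' :+ c₂' :* c₂')))) refl μ b₁ b₂ c₁ c₂ b₁' b₂' c₁' c₂')
    tangential : ((b₁' - b₁) - (c₁' - c₁)) * (b₂ - c₂) - ((b₂' - b₂) - (c₂' - c₂)) * (b₁ - c₁) ≡ 0#
    tangential = combine₂ (- (b₂' - c₂')) (b₁' - c₁') e₁ e₂ (solve 9 (λ μ b₁ b₂ c₁ c₂ b₁' b₂' c₁' c₂' →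
      ((b₁' :- b₁) :- (c₁' :- c₁)) :* (b₂ :- c₂) :- ((b₂' :- b₂) :- (c₂' :- c₂)) :* (b₁ :- c₁) := κ 0
        :+ (:- (b₂' :- c₂')) :* (b₁ :- c₁ :- μ :* (b₁' :- c₁')) :+ (b₁' :- c₁') :* (b₂ :- c₂ :- μ :* (b₂' :- c₂'))) refl μ b₁ b₂ c₁ c₂ b₁' b₂' c₁' c₂')
    -- U - U' is parallel to b - c, which is orthogonal to U + U'.
    same-length : dist b b' ≡ dist c c'
    same-length = ≡-by-difference (*-cancelˡ-0 n≢0 (combine₂ N (- T) normal tangential (solve 8 (λ b₁ b₂ c₁ c₂ b₁' b₂' c₁' c₂' →
      let v₁ = b₁ :- c₁ ; v₂ = b₂ :- c₂ ; U₁ = b₁' :- b₁ ; U₂ = b₂' :- b₂ ; V₁ = c₁' :- c₁ ; V₂ = c₂' :- c₂ in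
      (v₁ :* v₁ :+ v₂ :* v₂) :* (((b₁ :- b₁') :* (b₁ :- b₁') :+ (b₂ :- b₂') :* (b₂ :- b₂')) :- ((c₁ :- c₁') :* (c₁ :- c₁') :+ (c₂ :- c₂') :* (c₂ :- c₂'))) := κ 0
        :+ ((U₁ :- V₁) :* v₁ :+ (U₂ :- V₂) :* v₂) :* ((U₁ :+ V₁) :* v₁ :+ (U₂ :+ V₂) :* v₂ :- κ 0)
        :+ (:- ((U₂ :+ V₂) :* v₁ :- (U₁ :+ V₁) :* v₂)) :* ((U₁ :- V₁) :* v₂ :- (U₂ :- V₂) :* v₁ :- κ 0)) refl b₁ b₂ c₁ c₂ b₁' b₂' c₁' c₂')))
      where
      n≢0 : norm (b ⊖ c) ≢ 0#
      n≢0 z = b≢c (dist≡0 b c z)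
      N = ((b₁' - b₁) - (c₁' - c₁)) * (b₁ - c₁) + ((b₂' - b₂) - (c₂' - c₂)) * (b₂ - c₂)
      T = ((b₂' - b₂) + (c₂' - c₂)) * (b₁ - c₁) - ((b₁' - b₁) + (c₁' - c₁)) * (b₂ - c₂)

  -- A square root, up to a real factor, of U / conj U₀ for segments of equal length.
  halfway : F² → F² → F²
  halfway (a , b) (c , d) with (a + c , b + d) ≟² 0²
  ... | no _ = a + c , b + d
  ... | yes _ = - b , a

  halfway≢0 : ∀ U₀ U → norm U₀ ≢ 0# → halfway U₀ U ≢ 0²
  halfway≢0 (a , b) (c , d) h e with (a + c , b + d) ≟² 0²
  ... | no n = n e
  ... | yes _ = h (trans (cong₂ (λ x y → x * x + y * y) (cong proj₂ e) b≡0) (solve 0 (κ 0 :* κ 0 :+ κ 0 :* κ 0 := κ 0) refl))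
    where
    b≡0 : b ≡ 0#
    b≡0 = trans (solve 1 (λ b → b := :- (:- b)) refl b) (trans (cong -_ (cong proj₁ e)) (solve 0 (:- κ 0 := κ 0) refl))

  -- For w = U₀ + U both sides equal |U|² + U₀ conj(U), as the lengths agree. This w is useless when
  -- U = - U₀, where w = i U₀ takes its place.
  halfway-spec : ∀ U₀ U → norm U ≡ norm U₀ → halfway U₀ U ⊛ conj U ≡ conj (halfway U₀ U) ⊛ U₀
  halfway-spec (a , b) (c , d) e with (a + c , b + d) ≟² 0²
  ... | no _ = cong₂ _,_
      (combine₁ 1# e (solve 4 (λ a b c d → (a :+ c) :* c :- (b :+ d) :* :- d := (a :+ c) :* a :- (:- (b :+ d)) :* b :+ κ 1 :* ((c :* c :+ d :* d) :- (a :* a :+ b :* b))) refl a b c d))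
      (solve 4 (λ a b c d → (a :+ c) :* :- d :+ (b :+ d) :* c := (a :+ c) :* b :+ (:- (b :+ d)) :* a) refl a b c d)
  ... | yes z = cong₂ _,_
      (combine₂ (- b) a (cong proj₁ z) (cong proj₂ z) (solve 4 (λ a b c d → (:- b) :* c :- a :* :- d := (:- b) :* a :- (:- a) :* b :+ (:- b) :* (a :+ c :- κ 0) :+ a :* (b :+ d :- κ 0)) refl a b c d))
      (combine₂ a b (cong proj₁ z) (cong proj₂ z) (solve 4 (λ a b c d → (:- b) :* :- d :+ a :* c := (:- b) :* b :+ (:- a) :* a :+ a :* (a :+ c :- κ 0) :+ b :* (b :+ d :- κ 0)) refl a b c d))

  -- The segment from b with halfway vector w, as a point of K².
  encode : F² → F² → F⁴
  encode (w₁ , w₂) (b₁ , b₂) = w₁ , - w₂ , b₁ * w₁ + b₂ * w₂ , b₂ * w₁ - b₁ * w₂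

  turn : F² → F⁴ → F⁴
  turn (a , b) (p , q , r , s) = a * p - b * q , a * q + b * p , a * r - b * s , a * s + b * r

  -- `encode w b` is (conj(w) , b conj(w)), so the K-determinant of two such vectors factors through
  -- b' - b; `turn` multiplies both coordinates by U₀.
  pairing-encode : ∀ U₀ w b w' b' → pairing (encode w b) (turn U₀ (encode w' b')) ≡
    proj₁ ((U₀ ⊛ (b' ⊖ b)) ⊛ (conj w ⊛ conj w'))
  pairing-encode (a , a') (w₁ , w₂) (b₁ , b₂) (w₁' , w₂') (b₁' , b₂') = solve 10 (λ a a' w₁ w₂ b₁ b₂ w₁' w₂' b₁' b₂' →
    let p = w₁ ; q = :- w₂ ; r = b₁ :* w₁ :+ b₂ :* w₂ ; s = b₂ :* w₁ :- b₁ :* w₂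
        p° = w₁' ; q° = :- w₂' ; r° = b₁' :* w₁' :+ b₂' :* w₂' ; s° = b₂' :* w₁' :- b₁' :* w₂'
        p' = a :* p° :- a' :* q° ; q' = a :* q° :+ a' :* p° ; r' = a :* r° :- a' :* s° ; s' = a :* s° :+ a' :* r°
        x = a :* (b₁' :- b₁) :- a' :* (b₂' :- b₂) ; y = a :* (b₂' :- b₂) :+ a' :* (b₁' :- b₁)
        z = w₁ :* w₁' :- (:- w₂) :* (:- w₂') ; t = w₁ :* (:- w₂') :+ (:- w₂) :* w₁' in
    (p :* r' :- q :* s') :- (r :* p' :- s :* q') := x :* z :- y :* t) refl a a' w₁ w₂ b₁ b₂ w₁' w₂' b₁' b₂'

unique-length : ∀ {A : Set} (xs ys : List A) → Unique xs → (∀ {x} → x ∈ xs → x ∈ ys) → length xs ℕ.≤ length ys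
unique-length [] ys _ _ = z≤n
unique-length (x ∷ xs) ys (n ∷ u) sub = from (extract' (sub (here refl)))
  where
  extract' : ∀ {x ys} → x ∈ ys → Σ (List _) λ r → length ys ≡ suc (length r) × (∀ {y} → y ∈ ys → x ≢ y → y ∈ r)
  extract' {ys = _ ∷ ys} (here refl) = ys , refl , λ { (here e) ne → ⊥-elim (ne (sym e)) ; (there i) _ → i }
  extract' {ys = y ∷ ys} (there i) = let (r , l , f) = extract' i in y ∷ r , cong suc l , λ { (here e) _ → here e ; (there j) ne → there (f j ne) }
  from : (Σ (List _) λ r → length ys ≡ suc (length r) × (∀ {y} → y ∈ ys → x ≢ y → y ∈ r)) → suc (length xs) ℕ.≤ length ys
  from (r , l , f) = ≤-trans (s≤s (unique-length xs r u (λ i → f (sub (there i)) (All.lookup n i)))) (≤-reflexive (sym l))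

-- Segments of equal length as vectors, and the circles belonging to reguli.

module Segments (𝔽 : FiniteField) where
  open FieldTheory 𝔽
  open import Data.Nat using (_≤_; _<_)
  open Surfaces 𝔽
  open NullLines 𝔽
  open CrossingLines 𝔽
  open Twisting 𝔽
  open RichLines 𝔽
  open PlaneGeometry 𝔽

  -- With v = b - c, the number X = U₀ v conj(w) conj(w') equals w conj(w') v conj(U), and its
  -- conjugate equals w conj(w') conj(v) U'. Reflection gives v conj(U) + conj(v) U' = 0, so X is
  -- purely imaginary.
  mirror-pairing : ∀ U₀ w w' b c b' c' → Mirror b c b' c' → w ⊛ conj (b' ⊖ b) ≡ conj w ⊛ U₀ → w' ⊛ conj (c' ⊖ c) ≡ conj w' ⊛ U₀ →
    pairing (encode w' c) (turn U₀ (encode w b)) ≡ 0#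
  mirror-pairing U₀@(a , a') w@(w₁ , w₂) w'@(x₁ , x₂) b@(b₁ , b₂) c@(c₁ , c₂) b'@(b₁' , b₂') c'@(c₁' , c₂') (mirror normal tangential _) e e' =
    trans (pairing-encode U₀ w' c w b) (*-cancelˡ-0 2≢0 (real-part a a' w₁ w₂ x₁ x₂ (b₁ - c₁) (b₂ - c₂) (b₁' - b₁) (b₂' - b₂) (c₁' - c₁) (c₂' - c₂)
      normal tangential (cong proj₁ e) (cong proj₂ e) (cong proj₁ e') (cong proj₂ e')))
    where
    -- Twice the real part of U₀ v w̄ w̄', reduced with w Ū = w̄ U₀, w' Ū' = w̄' U₀ and v Ū + v̄ U' = 0.
    real-part : ∀ a a' w₁ w₂ x₁ x₂ v₁ v₂ U₁ U₂ V₁ V₂ →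
      (U₁ + V₁) * v₁ + (U₂ + V₂) * v₂ ≡ 0# → (U₁ - V₁) * v₂ - (U₂ - V₂) * v₁ ≡ 0# →
      w₁ * U₁ - w₂ * - U₂ ≡ w₁ * a - (- w₂) * a' → w₁ * - U₂ + w₂ * U₁ ≡ w₁ * a' + (- w₂) * a →
      x₁ * V₁ - x₂ * - V₂ ≡ x₁ * a - (- x₂) * a' → x₁ * - V₂ + x₂ * V₁ ≡ x₁ * a' + (- x₂) * a →
      2# * ((a * v₁ - a' * v₂) * (x₁ * w₁ - (- x₂) * (- w₂)) - (a * v₂ + a' * v₁) * (x₁ * (- w₂) + (- x₂) * w₁)) ≡ 0#
    real-part a a' w₁ w₂ x₁ x₂ v₁ v₂ U₁ U₂ V₁ V₂ h₁ h₂ h₃ h₄ h₅ h₆ =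
      combine₃ (w₁ * x₁ + w₂ * x₂) (- (w₂ * x₁ - w₁ * x₂)) (- (v₁ * x₁ + v₂ * x₂)) h₁ h₂ h₃
        (combine₃ (v₂ * x₁ - v₁ * x₂) (- (w₁ * v₁ + w₂ * v₂)) (- (w₂ * v₁ - w₁ * v₂)) h₄ h₅ h₆
          (solve 12 (λ a a' w₁ w₂ x₁ x₂ v₁ v₂ U₁ U₂ V₁ V₂ →
            κ 2 :* ((a :* v₁ :- a' :* v₂) :* (x₁ :* w₁ :- (:- x₂) :* (:- w₂)) :- (a :* v₂ :+ a' :* v₁) :* (x₁ :* (:- w₂) :+ (:- x₂) :* w₁))
            := κ 0 :+ (w₁ :* x₁ :+ w₂ :* x₂) :* ((U₁ :+ V₁) :* v₁ :+ (U₂ :+ V₂) :* v₂ :- κ 0)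
              :+ (:- (w₂ :* x₁ :- w₁ :* x₂)) :* ((U₁ :- V₁) :* v₂ :- (U₂ :- V₂) :* v₁ :- κ 0)
              :+ (:- (v₁ :* x₁ :+ v₂ :* x₂)) :* (w₁ :* U₁ :- w₂ :* :- U₂ :- (w₁ :* a :- (:- w₂) :* a'))
              :+ (v₂ :* x₁ :- v₁ :* x₂) :* (w₁ :* :- U₂ :+ w₂ :* U₁ :- (w₁ :* a' :+ (:- w₂) :* a))
              :+ (:- (w₁ :* v₁ :+ w₂ :* v₂)) :* (x₁ :* V₁ :- x₂ :* :- V₂ :- (x₁ :* a :- (:- x₂) :* a'))
              :+ (:- (w₂ :* v₁ :- w₁ :* v₂)) :* (x₁ :* :- V₂ :+ x₂ :* V₁ :- (x₁ :* a' :+ (:- x₂) :* a))) refl a a' w₁ w₂ x₁ x₂ v₁ v₂ U₁ U₂ V₁ V₂))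

  turn-injective : ∀ U₀ → norm U₀ ≢ 0# → Linear-injective (turn U₀)
  turn-injective (a , b) h k (p , q , r , s) (p' , q' , r' , s') e = tuple
      (first (cong proj₁ e) (cong (λ z → proj₁ (proj₂ z)) e)) (second (cong proj₁ e) (cong (λ z → proj₁ (proj₂ z)) e))
      (first (cong (λ z → proj₁ (proj₂ (proj₂ z))) e) (cong (λ z → proj₂ (proj₂ (proj₂ z))) e)) (second (cong (λ z → proj₁ (proj₂ (proj₂ z))) e) (cong (λ z → proj₂ (proj₂ (proj₂ z))) e))
    where
    first : ∀ {p q p' q'} → a * p' - b * q' ≡ k * (a * p - b * q) → a * q' + b * p' ≡ k * (a * q + b * p) → p' ≡ k * p
    first {p} {q} {p'} {q'} e e' = *-cancelˡ h (combine₂ a b e e' (solve 7 (λ a b k p q p' q' → (a :* a :+ b :* b) :* p' := (a :* a :+ b :* b) :* (k :* p)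
      :+ a :* (a :* p' :- b :* q' :- k :* (a :* p :- b :* q)) :+ b :* (a :* q' :+ b :* p' :- k :* (a :* q :+ b :* p))) refl a b k p q p' q'))
    second : ∀ {p q p' q'} → a * p' - b * q' ≡ k * (a * p - b * q) → a * q' + b * p' ≡ k * (a * q + b * p) → q' ≡ k * q
    second {p} {q} {p'} {q'} e e' = *-cancelˡ h (combine₂ (- b) a e e' (solve 7 (λ a b k p q p' q' → (a :* a :+ b :* b) :* q' := (a :* a :+ b :* b) :* (k :* q)
      :+ (:- b) :* (a :* p' :- b :* q' :- k :* (a :* p :- b :* q)) :+ a :* (a :* q' :+ b :* p' :- k :* (a :* q :+ b :* p))) refl a b k p q p' q'))

  encode≢0 : ∀ w b → w ≢ 0² → encode w b ≢ 0⁴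
  encode≢0 (w₁ , w₂) b h e = h (cong₂ _,_ (cong proj₁ e) (trans (solve 1 (λ x → x := :- (:- x)) refl w₂) (trans (cong -_ (cong (λ z → proj₁ (proj₂ z)) e)) (solve 0 (:- κ 0 := κ 0) refl))))

  -- The starting point is the quotient of the two K-coordinates, and w up to a real factor
  -- determines conj(U) = conj(w) U₀ / w.
  encode-parallel : ∀ U₀ b c b' c' → norm U₀ ≢ 0# → norm (b' ⊖ b) ≡ norm U₀ → norm (c' ⊖ c) ≡ norm U₀ →
    Parallel (encode (halfway U₀ (b' ⊖ b)) b) (encode (halfway U₀ (c' ⊖ c)) c) → (b , b') ≡ (c , c')
  encode-parallel U₀ b@(b₁ , b₂) c@(c₁ , c₂) b'@(b₁' , b₂') c'@(c₁' , c₂') h hb hc (k , e) =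
    from (halfway U₀ (b' ⊖ b)) (halfway U₀ (c' ⊖ c)) (halfway≢0 U₀ (c' ⊖ c) h) (halfway-spec U₀ (b' ⊖ b) hb) (halfway-spec U₀ (c' ⊖ c) hc) e
    where
    from : ∀ w w' → w' ≢ 0² → w ⊛ conj (b' ⊖ b) ≡ conj w ⊛ U₀ → w' ⊛ conj (c' ⊖ c) ≡ conj w' ⊛ U₀ → encode w' c ≡ scale k (encode w b) → (b , b') ≡ (c , c')
    from (w₁ , w₂) (x₁ , x₂) w'≢0 s s' e = cong₂ _,_ b≡c (⊖≡0 b' c' (cong₂ _,_ (trans shift₁ (proj₁ UV)) (trans shift₂ (proj₂ UV))))
      where
      e₁ : x₁ ≡ k * w₁
      e₁ = cong proj₁ e
      e₂ : x₂ ≡ k * w₂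
      e₂ = combine₁ (- 1#) (cong (λ z → proj₁ (proj₂ z)) e) (solve 3 (λ k x w → x := k :* w :+ (:- κ 1) :* (:- x :- k :* :- w)) refl k x₂ w₂)
      n≢0 : norm (x₁ , x₂) ≢ 0#
      n≢0 = norm≢0 _ w'≢0
      d₁ : (c₁ - b₁) * x₁ + (c₂ - b₂) * x₂ ≡ 0#
      d₁ = combine₃ 1# (- b₁) (- b₂) (cong (λ z → proj₁ (proj₂ (proj₂ z))) e) e₁ e₂ (solve 9 (λ k b₁ b₂ c₁ c₂ w₁ w₂ x₁ x₂ → (c₁ :- b₁) :* x₁ :+ (c₂ :- b₂) :* x₂ := κ 0
        :+ κ 1 :* (c₁ :* x₁ :+ c₂ :* x₂ :- k :* (b₁ :* w₁ :+ b₂ :* w₂)) :+ (:- b₁) :* (x₁ :- k :* w₁) :+ (:- b₂) :* (x₂ :- k :* w₂)) refl k b₁ b₂ c₁ c₂ w₁ w₂ x₁ x₂)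
      d₂ : (c₂ - b₂) * x₁ - (c₁ - b₁) * x₂ ≡ 0#
      d₂ = combine₃ 1# (- b₂) b₁ (cong (λ z → proj₂ (proj₂ (proj₂ z))) e) e₁ e₂ (solve 9 (λ k b₁ b₂ c₁ c₂ w₁ w₂ x₁ x₂ → (c₂ :- b₂) :* x₁ :- (c₁ :- b₁) :* x₂ := κ 0
        :+ κ 1 :* (c₂ :* x₁ :- c₁ :* x₂ :- k :* (b₂ :* w₁ :- b₁ :* w₂)) :+ (:- b₂) :* (x₁ :- k :* w₁) :+ b₁ :* (x₂ :- k :* w₂)) refl k b₁ b₂ c₁ c₂ w₁ w₂ x₁ x₂)
      kill : ∀ u v → u * x₁ + v * x₂ ≡ 0# → v * x₁ - u * x₂ ≡ 0# → u ≡ 0# × v ≡ 0#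
      kill u v p q = *-cancelˡ-0 n≢0 (combine₂ x₁ (- x₂) p q (solve 4 (λ u v x y → (x :* x :+ y :* y) :* u := κ 0 :+ x :* (u :* x :+ v :* y :- κ 0) :+ (:- y) :* (v :* x :- u :* y :- κ 0)) refl u v x₁ x₂))
        , *-cancelˡ-0 n≢0 (combine₂ x₂ x₁ p q (solve 4 (λ u v x y → (x :* x :+ y :* y) :* v := κ 0 :+ y :* (u :* x :+ v :* y :- κ 0) :+ x :* (v :* x :- u :* y :- κ 0)) refl u v x₁ x₂))
      cb : c₁ - b₁ ≡ 0# × c₂ - b₂ ≡ 0#
      cb = kill (c₁ - b₁) (c₂ - b₂) d₁ d₂
      b≡c : b ≡ c
      b≡c = sym (cong₂ _,_ (≡-by-difference (proj₁ cb)) (≡-by-difference (proj₂ cb)))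
      U₁ = b₁' - b₁
      U₂ = b₂' - b₂
      V₁ = c₁' - c₁
      V₂ = c₂' - c₂
      a₁ = proj₁ U₀
      a₂ = proj₂ U₀
      -- Multiplying the equation of w by k turns it into the equation of w' with U in place of U'.
      p₁ : (U₁ - V₁) * x₁ + (U₂ - V₂) * x₂ ≡ 0#
      p₁ = combine₂ k (- 1#) (cong proj₁ s) (cong proj₁ s') (trans (cong₂ (λ x y → (U₁ - V₁) * x + (U₂ - V₂) * y) e₁ e₂)
        (trans (solve 9 (λ k w₁ w₂ U₁ U₂ V₁ V₂ a₁ a₂ → (U₁ :- V₁) :* (k :* w₁) :+ (U₂ :- V₂) :* (k :* w₂) := κ 0 :+ k :* (w₁ :* U₁ :- w₂ :* :- U₂ :- (w₁ :* a₁ :- (:- w₂) :* a₂))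
          :+ (:- κ 1) :* ((k :* w₁) :* V₁ :- (k :* w₂) :* :- V₂ :- ((k :* w₁) :* a₁ :- (:- (k :* w₂)) :* a₂))) refl k w₁ w₂ U₁ U₂ V₁ V₂ a₁ a₂)
          (cong₂ (λ x y → 0# + k * (w₁ * U₁ - w₂ * - U₂ - (w₁ * a₁ - (- w₂) * a₂)) + (- 1#) * (x * V₁ - y * - V₂ - (x * a₁ - (- y) * a₂))) (sym e₁) (sym e₂))))
      p₂ : (U₂ - V₂) * x₁ - (U₁ - V₁) * x₂ ≡ 0#
      p₂ = combine₂ (- k) 1# (cong proj₂ s) (cong proj₂ s') (trans (cong₂ (λ x y → (U₂ - V₂) * x - (U₁ - V₁) * y) e₁ e₂)
        (trans (solve 9 (λ k w₁ w₂ U₁ U₂ V₁ V₂ a₁ a₂ → (U₂ :- V₂) :* (k :* w₁) :- (U₁ :- V₁) :* (k :* w₂) := κ 0 :+ (:- k) :* (w₁ :* :- U₂ :+ w₂ :* U₁ :- (w₁ :* a₂ :+ (:- w₂) :* a₁))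
          :+ κ 1 :* ((k :* w₁) :* :- V₂ :+ (k :* w₂) :* V₁ :- ((k :* w₁) :* a₂ :+ (:- (k :* w₂)) :* a₁))) refl k w₁ w₂ U₁ U₂ V₁ V₂ a₁ a₂)
          (cong₂ (λ x y → 0# + (- k) * (w₁ * - U₂ + w₂ * U₁ - (w₁ * a₂ + (- w₂) * a₁)) + 1# * (x * - V₂ + y * V₁ - (x * a₂ + (- y) * a₁))) (sym e₁) (sym e₂))))
      UV : U₁ - V₁ ≡ 0# × U₂ - V₂ ≡ 0#
      UV = kill (U₁ - V₁) (U₂ - V₂) p₁ p₂
      shift₁ : b₁' - c₁' ≡ U₁ - V₁
      shift₁ = combine₁ (- 1#) (proj₁ cb) (solve 4 (λ b c b' c' → b' :- c' := (b' :- b) :- (c' :- c) :+ (:- κ 1) :* (c :- b :- κ 0)) refl b₁ c₁ b₁' c₁')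
      shift₂ : b₂' - c₂' ≡ U₂ - V₂
      shift₂ = combine₁ (- 1#) (proj₂ cb) (solve 4 (λ b c b' c' → b' :- c' := (b' :- b) :- (c' :- c) :+ (:- κ 1) :* (c :- b :- κ 0)) refl b₂ c₂ b₂' c₂')

  -- For u = (u₁ , u₂) in K², the value u₂ - c u₁; the circle of u and v consists of the c for which
  -- the values at u and v have a real ratio.
  defect : F⁴ → F² → F²
  defect (p , q , r , s) (c₁ , c₂) = r - (c₁ * p - c₂ * q) , s - (c₁ * q + c₂ * p)

  circle : F⁴ → F⁴ → Circle
  circle (p , q , r , s) (p' , q' , r' , s') = q * p' - p * q' , (- (s * p' - r * q') - (q * r' - p * s') , (r * p' + s * q') - (p * r' + q * s')) , s * r' - r * s'

  circle-defect : ∀ u v c → circle-value (circle u v) c ≡ proj₂ (defect u c) * proj₁ (defect v c) - proj₁ (defect u c) * proj₂ (defect v c)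
  circle-defect (p , q , r , s) (p' , q' , r' , s') (c₁ , c₂) = solve 10 (λ p q r s p' q' r' s' c₁ c₂ →
    (q :* p' :- p :* q') :* (c₁ :* c₁ :+ c₂ :* c₂) :+ ((:- (s :* p' :- r :* q') :- (q :* r' :- p :* s')) :* c₁ :+ ((r :* p' :+ s :* q') :- (p :* r' :+ q :* s')) :* c₂) :+ (s :* r' :- r :* s')
    := (s :- (c₁ :* q :+ c₂ :* p)) :* (r' :- (c₁ :* p' :- c₂ :* q')) :- (r :- (c₁ :* p :- c₂ :* q)) :* (s' :- (c₁ :* q' :+ c₂ :* p'))) refl p q r s p' q' r' s' c₁ c₂

  -- An encoded segment has defect 0 at its own starting point, so the defects P of u and Q of v
  -- there satisfy P + t Q = 0 with t real.
  on-circle : ∀ u v w c β t → β ≢ 0# → encode w c ≡ scale-add β u t v → OnCircle (circle u v) c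
  on-circle u@(p , q , r , s) v@(p' , q' , r' , s') w@(w₁ , w₂) c@(c₁ , c₂) β t β≢0 e = trans (circle-defect u v c)
    (combine₂ Q₁ (- Q₂) second first (solve 5 (λ t P₁ P₂ Q₁ Q₂ → P₂ :* Q₁ :- P₁ :* Q₂ := κ 0 :+ Q₁ :* (P₂ :+ t :* Q₂ :- κ 0) :+ (:- Q₂) :* (P₁ :+ t :* Q₁ :- κ 0)) refl t P₁ P₂ Q₁ Q₂))
    where
    P₁ = proj₁ (defect u c)
    P₂ = proj₂ (defect u c)
    Q₁ = proj₁ (defect v c)
    Q₂ = proj₂ (defect v c)
    ew₁ : w₁ ≡ β * (p + t * p')
    ew₁ = cong proj₁ e
    ew₂ : - w₂ ≡ β * (q + t * q')
    ew₂ = cong (λ z → proj₁ (proj₂ z)) e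
    first : P₁ + t * Q₁ ≡ 0#
    first = *-cancelˡ-0 β≢0 (combine₃ (- 1#) c₁ (- c₂) (cong (λ z → proj₁ (proj₂ (proj₂ z))) e) ew₁ ew₂ (solve 12 (λ β t p q r p' q' r' w₁ w₂ c₁ c₂ →
      β :* (r :- (c₁ :* p :- c₂ :* q) :+ t :* (r' :- (c₁ :* p' :- c₂ :* q'))) := κ 0 :+ (:- κ 1) :* (c₁ :* w₁ :+ c₂ :* w₂ :- β :* (r :+ t :* r')) :+ c₁ :* (w₁ :- β :* (p :+ t :* p')) :+ (:- c₂) :* (:- w₂ :- β :* (q :+ t :* q'))) refl β t p q r p' q' r' w₁ w₂ c₁ c₂))
    second : P₂ + t * Q₂ ≡ 0#
    second = *-cancelˡ-0 β≢0 (combine₃ (- 1#) c₂ c₁ (cong (λ z → proj₂ (proj₂ (proj₂ z))) e) ew₁ ew₂ (solve 12 (λ β t p q s p' q' s' w₁ w₂ c₁ c₂ →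
      β :* (s :- (c₁ :* q :+ c₂ :* p) :+ t :* (s' :- (c₁ :* q' :+ c₂ :* p'))) := κ 0 :+ (:- κ 1) :* (c₂ :* w₁ :- c₁ :* w₂ :- β :* (s :+ t :* s')) :+ c₂ :* (w₁ :- β :* (p :+ t :* p')) :+ c₁ :* (:- w₂ :- β :* (q :+ t :* q'))) refl β t p q s p' q' s' w₁ w₂ c₁ c₂))

  pairing-defect : ∀ u U₀ w b → pairing u (turn U₀ (encode w b)) ≡ - proj₁ ((U₀ ⊛ conj w) ⊛ defect u b)
  pairing-defect (p , q , r , s) (a , a') (w₁ , w₂) (b₁ , b₂) = solve 10 (λ p q r s a a' w₁ w₂ b₁ b₂ →
    let x = w₁ ; y = :- w₂ ; z = b₁ :* w₁ :+ b₂ :* w₂ ; t = b₂ :* w₁ :- b₁ :* w₂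
        x' = a :* x :- a' :* y ; y' = a :* y :+ a' :* x ; z' = a :* z :- a' :* t ; t' = a :* t :+ a' :* z in
    (p :* z' :- q :* t') :- (r :* x' :- s :* y') := :- ((a :* w₁ :- a' :* :- w₂) :* (r :- (b₁ :* p :- b₂ :* q)) :- (a :* :- w₂ :+ a' :* w₁) :* (s :- (b₁ :* q :+ b₂ :* p)))) refl p q r s a a' w₁ w₂ b₁ b₂

  -- Multiplied by U₀ conj(w), the defects of u and v at b are both purely imaginary, so they are
  -- linearly dependent over F. Thus the starting point on the other side of the reflections lies on
  -- the same circle.
  orthogonal-on-circle : ∀ u v U₀ w b → norm U₀ ≢ 0# → w ≢ 0² → pairing u (turn U₀ (encode w b)) ≡ 0# → pairing v (turn U₀ (encode w b)) ≡ 0# → OnCircle (circle u v) b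
  orthogonal-on-circle u v U₀@(a , a') w@(w₁ , w₂) b h w≢0 eu ev = trans (circle-defect u v b) (from (U₀ ⊛ conj w) k≢0 (defect u b) (defect v b) (real u eu) (real v ev))
    where
    k≢0 : norm (U₀ ⊛ conj w) ≢ 0#
    k≢0 z = *-≢0 h (norm≢0 w w≢0) (trans (cong (norm U₀ *_) (solve 2 (λ w₁ w₂ → w₁ :* w₁ :+ w₂ :* w₂ := w₁ :* w₁ :+ (:- w₂) :* :- w₂) refl w₁ w₂)) (trans (sym (norm-⊛ U₀ (conj w))) z))
    real : ∀ u → pairing u (turn U₀ (encode w b)) ≡ 0# → proj₁ ((U₀ ⊛ conj w) ⊛ defect u b) ≡ 0#
    real u e = trans (solve 1 (λ x → x := :- (:- x)) refl _) (trans (cong -_ (trans (sym (pairing-defect u U₀ w b)) e)) (solve 0 (:- κ 0 := κ 0) refl))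
    from : ∀ k → norm k ≢ 0# → ∀ P Q → proj₁ (k ⊛ P) ≡ 0# → proj₁ (k ⊛ Q) ≡ 0# → proj₂ P * proj₁ Q - proj₁ P * proj₂ Q ≡ 0#
    from (k₁ , k₂) n (P₁ , P₂) (Q₁ , Q₂) eP eQ = *-cancelˡ-0 n (combine₂ (- (k₁ * Q₂ + k₂ * Q₁)) (k₁ * P₂ + k₂ * P₁) eP eQ (solve 6 (λ k₁ k₂ P₁ P₂ Q₁ Q₂ →
      (k₁ :* k₁ :+ k₂ :* k₂) :* (P₂ :* Q₁ :- P₁ :* Q₂) := κ 0 :+ (:- (k₁ :* Q₂ :+ k₂ :* Q₁)) :* (k₁ :* P₁ :- k₂ :* P₂ :- κ 0) :+ (k₁ :* P₂ :+ k₂ :* P₁) :* (k₁ :* Q₁ :- k₂ :* Q₂ :- κ 0)) refl k₁ k₂ P₁ P₂ Q₁ Q₂))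

  pairing-linear : ∀ β u t v z → pairing (scale-add β u t v) z ≡ β * (pairing u z + t * pairing v z)
  pairing-linear β (p , q , r , s) t (p' , q' , r' , s') (x , y , z , w) = solve 14 (λ β t p q r s p' q' r' s' x y z w →
    (β :* (p :+ t :* p') :* z :- β :* (q :+ t :* q') :* w) :- (β :* (r :+ t :* r') :* x :- β :* (s :+ t :* s') :* y)
    := β :* ((p :* z :- q :* w) :- (r :* x :- s :* y) :+ t :* ((p' :* z :- q' :* w) :- (r' :* x :- s' :* y)))) refl β t p q r s p' q' r' s' x y z w

  both-orthogonal : ∀ u v z β t β' t' → β ≢ 0# → β' ≢ 0# → t ≢ t' → pairing (scale-add β u t v) z ≡ 0# → pairing (scale-add β' u t' v) z ≡ 0# → pairing u z ≡ 0# × pairing v z ≡ 0#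
  both-orthogonal u v z β t β' t' β≢0 β'≢0 t≢t' e e' = pu , pv
    where
    x = pairing u z
    y = pairing v z
    l : x + t * y ≡ 0#
    l = *-cancelˡ-0 β≢0 (trans (sym (pairing-linear β u t v z)) e)
    l' : x + t' * y ≡ 0#
    l' = *-cancelˡ-0 β'≢0 (trans (sym (pairing-linear β' u t' v z)) e')
    pv : y ≡ 0#
    pv = *-cancelˡ-0 (difference≢0 t≢t') (combine₂ 1# (- 1#) l l' (solve 4 (λ t t' x y → (t :- t') :* y := κ 0 :+ κ 1 :* (x :+ t :* y :- κ 0) :+ (:- κ 1) :* (x :+ t' :* y :- κ 0)) refl t t' x y))
    pu : x ≡ 0#
    pu = combine₂ 1# (- t) l pv (solve 3 (λ t x y → x := κ 0 :+ κ 1 :* (x :+ t :* y :- κ 0) :+ (:- t) :* (y :- κ 0)) refl t x y)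

  -- If the circle were degenerate then u and v would be K-dependent.
  circle-nondegenerate : ∀ u v w c β t w' c' β' t' → encode w c ≡ scale-add β u t v → encode w' c' ≡ scale-add β' u t' v → w ≢ 0² → w' ≢ 0² → c ≢ c' → Nondegenerate (circle u v)
  circle-nondegenerate u@(p , q , r , s) v@(p' , q' , r' , s') w@(w₁ , w₂) c@(c₁ , c₂) β t w'@(x₁ , x₂) c'@(c₁' , c₂') β' t' e e' w≢0 w'≢0 c≢c' (α≡0 , β≡0) =
    c≢c' (⊖≡0 c c' (⊛-≡0 (c ⊖ c') (conj w ⊛ conj w') conj≢0 (cong₂ _,_ re im)))
    where
    δ₁ = pairing u v
    δ₂ = pairing u (turn (0# , 1#) v)
    -- The discriminant |β|² - 4 α γ of the circle is the norm of the K-determinant of u and v, with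
    -- real part δ₁ and imaginary part - δ₂. So α = 0 and β = 0 kill the determinant.
    disc : δ₁ * δ₁ + δ₂ * δ₂ ≡ 0#
    disc = combine₃ (proj₁ (proj₁ (proj₂ (circle u v)))) (proj₂ (proj₁ (proj₂ (circle u v)))) (- (2# * 2# * proj₂ (proj₂ (circle u v)))) (cong proj₁ β≡0) (cong proj₂ β≡0) α≡0
      (solve 8 (λ p q r s p' q' r' s' →
        let α = q :* p' :- p :* q' ; β₁ = :- (s :* p' :- r :* q') :- (q :* r' :- p :* s') ; β₂ = (r :* p' :+ s :* q') :- (p :* r' :+ q :* s') ; γ = s :* r' :- r :* s'
            p″ = κ 0 :* p' :- κ 1 :* q' ; q″ = κ 0 :* q' :+ κ 1 :* p' ; r″ = κ 0 :* r' :- κ 1 :* s' ; s″ = κ 0 :* s' :+ κ 1 :* r'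
            δ₁ = (p :* r' :- q :* s') :- (r :* p' :- s :* q') ; δ₂ = (p :* r″ :- q :* s″) :- (r :* p″ :- s :* q″) in
        δ₁ :* δ₁ :+ δ₂ :* δ₂ := κ 0 :+ β₁ :* (β₁ :- κ 0) :+ β₂ :* (β₂ :- κ 0) :+ (:- (κ 2 :* κ 2 :* γ)) :* (α :- κ 0)) refl p q r s p' q' r' s')
    conj≢0 : conj w ⊛ conj w' ≢ 0²
    conj≢0 z = w≢0 (conj-0 (⊛-≡0 (conj w) (conj w') (λ y → w'≢0 (conj-0 y)) z))
      where
      conj-0 : ∀ {w} → conj w ≡ 0² → w ≡ 0²
      conj-0 {a , b} e = cong₂ _,_ (cong proj₁ e) (trans (solve 1 (λ x → x := :- (:- x)) refl b) (trans (cong -_ (cong proj₂ e)) (solve 0 (:- κ 0 := κ 0) refl)))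
    antisym : ∀ a b → pairing a b ≡ - pairing b a
    antisym (p , q , r , s) (p' , q' , r' , s') = solve 8 (λ p q r s p' q' r' s' → (p :* r' :- q :* s') :- (r :* p' :- s :* q') := :- ((p' :* r :- q' :* s) :- (r' :* p :- s' :* q))) refl p q r s p' q' r' s'
    turn-swap : ∀ a b → pairing a (turn (0# , 1#) b) ≡ - pairing b (turn (0# , 1#) a)
    turn-swap (p , q , r , s) (p' , q' , r' , s') = solve 8 (λ p q r s p' q' r' s' →
       (p :* (κ 0 :* r' :- κ 1 :* s') :- q :* (κ 0 :* s' :+ κ 1 :* r')) :- (r :* (κ 0 :* p' :- κ 1 :* q') :- s :* (κ 0 :* q' :+ κ 1 :* p'))
       := :- ((p' :* (κ 0 :* r :- κ 1 :* s) :- q' :* (κ 0 :* s :+ κ 1 :* r)) :- (r' :* (κ 0 :* p :- κ 1 :* q) :- s' :* (κ 0 :* q :+ κ 1 :* p)))) refl p q r s p' q' r' s'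
    self : ∀ a → pairing a a ≡ 0#
    self (p , q , r , s) = solve 4 (λ p q r s → (p :* r :- q :* s) :- (r :* p :- s :* q) := κ 0) refl p q r s
    turn-self : ∀ a → pairing a (turn (0# , 1#) a) ≡ 0#
    turn-self (p , q , r , s) = solve 4 (λ p q r s → (p :* (κ 0 :* r :- κ 1 :* s) :- q :* (κ 0 :* s :+ κ 1 :* r)) :- (r :* (κ 0 :* p :- κ 1 :* q) :- s :* (κ 0 :* q :+ κ 1 :* p)) := κ 0) refl p q r s
    δ₁≡0 : δ₁ ≡ 0#
    δ₁≡0 = proj₁ (sq+sq≡0 disc)
    δ₂≡0 : δ₂ ≡ 0#
    δ₂≡0 = proj₂ (sq+sq≡0 disc)
    -- An alternating form that vanishes on u, v vanishes on their span. Applied to the real and the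
    -- imaginary part of the determinant it gives (c - c') conj(w) conj(w') = 0.
    isotropic : (f : F⁴ → F⁴ → F) → (∀ β u t v z → f (scale-add β u t v) z ≡ β * (f u z + t * f v z)) → (∀ a b → f a b ≡ - f b a) → (∀ a → f a a ≡ 0#) → f u v ≡ 0# →
      f (scale-add β u t v) (scale-add β' u t' v) ≡ 0#
    isotropic f linear anti alt z = trans (linear β u t v _) (trans (cong₂ (λ x y → β * (x + t * y))
        (trans (anti u _) (cong -_ (trans (linear β' u t' v u) (cong₂ (λ x y → β' * (x + t' * y)) (alt u) (trans (anti v u) (cong -_ z))))))
        (trans (anti v _) (cong -_ (trans (linear β' u t' v v) (cong₂ (λ x y → β' * (x + t' * y)) z (alt v))))))
      (solve 4 (λ β t β' t' → β :* (:- (β' :* (κ 0 :+ t' :* :- κ 0)) :+ t :* (:- (β' :* (κ 0 :+ t' :* κ 0)))) := κ 0) refl β t β' t'))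
    det-re : ∀ w c w' c' → pairing (encode w c) (encode w' c') ≡ - proj₁ ((c ⊖ c') ⊛ (conj w ⊛ conj w'))
    det-re (w₁ , w₂) (c₁ , c₂) (x₁ , x₂) (c₁' , c₂') = solve 8 (λ w₁ w₂ c₁ c₂ x₁ x₂ c₁' c₂' →
      (w₁ :* (c₁' :* x₁ :+ c₂' :* x₂) :- (:- w₂) :* (c₂' :* x₁ :- c₁' :* x₂)) :- ((c₁ :* w₁ :+ c₂ :* w₂) :* x₁ :- (c₂ :* w₁ :- c₁ :* w₂) :* :- x₂)
      := :- ((c₁ :- c₁') :* (w₁ :* x₁ :- (:- w₂) :* :- x₂) :- (c₂ :- c₂') :* (w₁ :* :- x₂ :+ (:- w₂) :* x₁))) refl w₁ w₂ c₁ c₂ x₁ x₂ c₁' c₂'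
    det-im : ∀ w c w' c' → pairing (encode w c) (turn (0# , 1#) (encode w' c')) ≡ proj₂ ((c ⊖ c') ⊛ (conj w ⊛ conj w'))
    det-im (w₁ , w₂) (c₁ , c₂) (x₁ , x₂) (c₁' , c₂') = solve 8 (λ w₁ w₂ c₁ c₂ x₁ x₂ c₁' c₂' →
      let p = x₁ ; q = :- x₂ ; r = c₁' :* x₁ :+ c₂' :* x₂ ; s = c₂' :* x₁ :- c₁' :* x₂ in
      (w₁ :* (κ 0 :* r :- κ 1 :* s) :- (:- w₂) :* (κ 0 :* s :+ κ 1 :* r)) :- ((c₁ :* w₁ :+ c₂ :* w₂) :* (κ 0 :* p :- κ 1 :* q) :- (c₂ :* w₁ :- c₁ :* w₂) :* (κ 0 :* q :+ κ 1 :* p))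
      := (c₁ :- c₁') :* (w₁ :* :- x₂ :+ (:- w₂) :* x₁) :+ (c₂ :- c₂') :* (w₁ :* x₁ :- (:- w₂) :* :- x₂)) refl w₁ w₂ c₁ c₂ x₁ x₂ c₁' c₂'
    re : proj₁ ((c ⊖ c') ⊛ (conj w ⊛ conj w')) ≡ 0#
    re = trans (solve 1 (λ x → x := :- (:- x)) refl _) (trans (cong -_ (trans (sym (det-re w c w' c')) (trans (cong₂ pairing e e') (isotropic pairing pairing-linear antisym self δ₁≡0)))) (solve 0 (:- κ 0 := κ 0) refl))
    im : proj₂ ((c ⊖ c') ⊛ (conj w ⊛ conj w')) ≡ 0#
    im = trans (sym (det-im w c w' c')) (trans (cong₂ (λ x y → pairing x (turn (0# , 1#) y)) e e')
      (isotropic (λ a b → pairing a (turn (0# , 1#) b)) (λ β u t v z → pairing-linear β u t v (turn (0# , 1#) z)) turn-swap turn-self δ₂≡0))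

  Segment : Set
  Segment = F² × F²

  _≟ˢ_ : DecidableEquality Segment
  _≟ˢ_ = ≡-dec _≟²_ _≟²_

  _≟ˡ_ : DecidableEquality Line
  _≟ˡ_ = ≡-dec _≟²_ _≟_

  dist-sym : ∀ a b → dist a b ≡ dist b a
  dist-sym (a , b) (c , d) = solve 4 (λ a b c d → (a :- c) :* (a :- c) :+ (b :- d) :* (b :- d) := (c :- a) :* (c :- a) :+ (d :- b) :* (d :- b)) refl a b c d

  scale-add-parallel : ∀ β u t v β' t' → β ≢ 0# → t ≡ t' → Parallel (scale-add β u t v) (scale-add β' u t' v)
  scale-add-parallel β (a , b , c , d) t (a' , b' , c' , d') β' .t β≢0 refl = β' * β ⁻¹ , tuple (z a a') (z b b') (z c c') (z d d')
    where
    z : ∀ a a' → β' * (a + t * a') ≡ β' * β ⁻¹ * (β * (a + t * a'))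
    z a a' = combine₁ (- (β' * (a + t * a'))) (*-inverse β β≢0) (solve 4 (λ β β' i x → β' :* x := β' :* i :* (β :* x) :+ (:- (β' :* x)) :* (β :* i :- κ 1)) refl β β' (β ⁻¹) (a + t * a'))

  count-circle : Circle → List F² → ℕ
  count-circle Γ B = ∑ B (λ z → 𝟙 (circle-value Γ z ≟ 0#))

  module _ (B : List F²) (Good : F² → F² → Set) (good? : ∀ b c → Dec (Good b c)) where
    -- `Good` is required only for the starting points: these are the points that end up on the
    -- circle of a regulus.
    Edge : Segment → Segment → Set
    Edge i j = (proj₁ j ≢ proj₁ i × proj₂ j ≢ proj₂ i) × (bisector (proj₁ j) (proj₁ i) ≡ bisector (proj₂ j) (proj₂ i) × Good (proj₁ j) (proj₁ i))

    edge? : ∀ i j → Dec (Edge i j)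
    edge? i j = (¬? (proj₁ j ≟² proj₁ i) ×-dec ¬? (proj₂ j ≟² proj₂ i)) ×-dec ((bisector (proj₁ j) (proj₁ i) ≟ˡ bisector (proj₂ j) (proj₂ i)) ×-dec good? (proj₁ j) (proj₁ i))

    segments : F → List Segment
    segments ρ = filter (λ i → dist (proj₁ i) (proj₂ i) ≟ ρ) (cartesianProduct B B)

    edges : F → ℕ
    edges ρ = ∑ (segments ρ) (λ i → ∑ (segments ρ) (λ j → 𝟙 (edge? i j)))

    module _ (unique-B : Unique B) (K : ℕ) (2≤K : 2 ≤ K)
        (good : ∀ {b c} → b ∈ B → c ∈ B → Good b c → ∀ Γ → Nondegenerate Γ → OnCircle Γ b → OnCircle Γ c → ¬ (K ≤ count-circle Γ B))
        (ρ : F) (ρ≢0 : ρ ≢ 0#) where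
      private
        Z = segments ρ
        n = length Z
        unique-Z : Unique Z
        unique-Z = Uniqueₚ.filter⁺ (λ i → dist (proj₁ i) (proj₂ i) ≟ ρ) (Uniqueₚ.cartesianProduct⁺ unique-B unique-B)
        in-Z : ∀ {i} → i ∈ Z → (proj₁ i ∈ B × proj₂ i ∈ B) × dist (proj₁ i) (proj₂ i) ≡ ρ
        in-Z i∈ = let (a , b) = ∈-filter⁻ (λ i → dist (proj₁ i) (proj₂ i) ≟ ρ) {xs = cartesianProduct B B} i∈ in ∈-cartesianProduct⁻ B B a , b

        module Based (U₀ : F²) (norm-U₀ : norm U₀ ≡ ρ) where
          U₀≢0 : norm U₀ ≢ 0#
          U₀≢0 z = ρ≢0 (trans (sym norm-U₀) z)
          W : Segment → F²
          W i = halfway U₀ (proj₂ i ⊖ proj₁ i)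
          W≢0 : ∀ i → W i ≢ 0²
          W≢0 i = halfway≢0 U₀ (proj₂ i ⊖ proj₁ i) U₀≢0
          zx zy : Segment → F⁴
          zx i = encode (W i) (proj₁ i)
          zy i = turn U₀ (zx i)
          Length : Segment → Set
          Length i = norm (proj₂ i ⊖ proj₁ i) ≡ norm U₀
          length-Z : ∀ {i} → i ∈ Z → Length i
          length-Z {i} i∈ = trans (dist-sym (proj₂ i) (proj₁ i)) (trans (proj₂ (in-Z i∈)) (sym norm-U₀))
          G : Segment → Segment → Set
          G i j = Edge i j × (Length i × Length j)
          G? : ∀ i j → Dec (G i j)
          G? i j = edge? i j ×-dec ((norm (proj₂ i ⊖ proj₁ i) ≟ norm U₀) ×-dec (norm (proj₂ j ⊖ proj₁ j) ≟ norm U₀))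
          orthogonal : ∀ {i j} → G i j → pairing (zx i) (zy j) ≡ 0#
          orthogonal {i} {j} (((n₁ , n₂) , (e , _)) , (li , lj)) = mirror-pairing U₀ (W j) (W i) (proj₁ j) (proj₁ i) (proj₂ j) (proj₂ i)
            (mirrored (proj₁ j) (proj₁ i) (proj₂ j) (proj₂ i) n₁ n₂ e) (halfway-spec U₀ (proj₂ j ⊖ proj₁ j) lj) (halfway-spec U₀ (proj₂ i ⊖ proj₁ i) li)
          independent : ∀ {i i'} → i ∈ Z → i' ∈ Z → i ≢ i' → ¬ Parallel (zx i) (zx i')
          independent {i} {i'} i∈ i'∈ i≢i' p = i≢i' (encode-parallel U₀ (proj₁ i) (proj₁ i') (proj₂ i) (proj₂ i') U₀≢0 (length-Z i∈) (length-Z i'∈) p)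
          pairs : Pairs
          pairs = record
            { I = Segment ; _≟ᴵ_ = _≟ˢ_ ; Z = Z ; unique-Z = unique-Z ; zx = zx ; zy = zy
            ; zx≢0 = λ {i} _ → encode≢0 (W i) (proj₁ i) (W≢0 i)
            ; zy≢0 = λ {i} _ → injective-≢0 (turn-injective U₀ U₀≢0) (encode≢0 (W i) (proj₁ i) (W≢0 i))
            ; independent-x = independent ; independent-y = λ i∈ i'∈ ne → injective-parallel (turn-injective U₀ U₀≢0) (independent i∈ i'∈ ne)
            ; G = G ; G? = G? ; G-pairing = orthogonal }

          -- The starting points of the segments in a rich regulus lie on its circle, together with
          -- that of the segment j orthogonal to all of them. They are distinct because a reflection
          -- determines the end point. So the circle has at least K points of B and contains a good
          -- pair.
          not-rich : ¬ RichPairs.Rich pairs K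
          not-rich (j , j∈ , u , v , [] , _ , many , _) = absurd (≤-trans 2≤K many)
            where
            absurd : ¬ (2 ≤ 0)
            absurd ()
          not-rich (j , j∈ , u , v , _ ∷ [] , _ , many , _) = absurd (≤-trans 2≤K many)
            where
            absurd : ¬ (2 ≤ 1)
            absurd (s≤s ())
          not-rich (j , j∈ , u , v , is@(i ∷ i' ∷ _) , is-unique@((i≢i' ∷ _) ∷ _) , many , all@((i∈ , g , β , t , β≢0 , e) ∷ (i'∈ , g' , β' , t' , β'≢0 , e') ∷ _)) =
              good (proj₁ (proj₁ (in-Z j∈))) (proj₁ (proj₁ (in-Z i∈))) (proj₂ (proj₂ (proj₁ g))) Γ nondegenerate (orthogonal-on-circle u v U₀ (W j) (proj₁ j) U₀≢0 (W≢0 j) (proj₁ orth) (proj₂ orth))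
                (on-circle u v (W i) (proj₁ i) β t β≢0 e) (≤-trans many (≤-trans (≤-reflexive (sym (Listₚ.length-map proj₁ is))) counted))
            where
            Γ = circle u v
            starts-distinct : ∀ {i i'} → G i j → G i' j → proj₁ i ≡ proj₁ i' → i ≡ i'
            starts-distinct {b , b'} {.b , b″} (((_ , n₁) , (e , _)) , _) (((_ , n₂) , (e' , _)) , _) refl = cong (b ,_) (bisector-injective (proj₂ j) b' b″ n₁ n₂ (trans (sym e) e'))
            c≢c' : proj₁ i ≢ proj₁ i'
            c≢c' q = i≢i' (starts-distinct g g' q)
            t≢t' : t ≢ t'
            t≢t' q = independent i∈ i'∈ i≢i' (subst₂ Parallel (sym e) (sym e') (scale-add-parallel β u t v β' t' β≢0 q))
            orth = both-orthogonal u v (zy j) β t β' t' β≢0 β'≢0 t≢t' (trans (cong (λ z → pairing z (zy j)) (sym e)) (orthogonal g)) (trans (cong (λ z → pairing z (zy j)) (sym e')) (orthogonal g'))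
            nondegenerate : Nondegenerate Γ
            nondegenerate = circle-nondegenerate u v (W i) (proj₁ i) β t (W i') (proj₁ i') β' t' e e' (W≢0 i) (W≢0 i') c≢c'
            unique-starts : Unique (map proj₁ is)
            unique-starts = unique-map proj₁ is is-unique (λ a b → starts-distinct (proj₁ (proj₂ (All.lookup all a))) (proj₁ (proj₂ (All.lookup all b))))
            counted : length (map proj₁ is) ≤ count-circle Γ B
            counted = ≤-trans (unique-length (map proj₁ is) (filter (λ z → circle-value Γ z ≟ 0#) B) unique-starts (λ a → located (∈-map⁻ proj₁ a)))
                (≤-reflexive (length-filter-∑ (λ z → circle-value Γ z ≟ 0#) B))
              where
              located : ∀ {c} → Σ Segment (λ i → i ∈ is × c ≡ proj₁ i) → c ∈ filter (λ z → circle-value Γ z ≟ 0#) B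
              located (i , a , refl) = let (i∈ , _ , β , t , β≢0 , e) = All.lookup all a in
                ∈-filter⁺ (λ z → circle-value Γ z ≟ 0#) (proj₁ (proj₁ (in-Z i∈))) (on-circle u v (W i) (proj₁ i) β t β≢0 e)

      edges-bound : ∀ e → let δ = box-degree e ; M = crossing-degree e ; n = length (segments ρ) in
        (n ℕ.+ n) ℕ.* δ < e ℕ.* (e ℕ.* (e ℕ.* 1)) → 9 ℕ.+ M ≤ order →
        order ℕ.* edges ρ ≤ order ℕ.* n ℕ.+ 10 ℕ.* (n ℕ.* n) ℕ.+ order ℕ.* ((M ℕ.+ K) ℕ.* (n ℕ.+ n))
      edges-bound e few M≤order = from (members? Z)
        where
        members? : ∀ xs → xs ≡ [] ⊎ Σ Segment (_∈ xs)
        members? [] = inj₁ refl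
        members? (x ∷ xs) = inj₂ (x , here refl)
        δ = box-degree e
        M = crossing-degree e
        from : Z ≡ [] ⊎ Σ Segment (_∈ Z) → order ℕ.* edges ρ ≤ order ℕ.* n ℕ.+ 10 ℕ.* (n ℕ.* n) ℕ.+ order ℕ.* ((M ℕ.+ K) ℕ.* (n ℕ.+ n))
        from (inj₁ empty) = ≤-trans (≤-reflexive (trans (cong (λ Z → order ℕ.* ∑ Z (λ i → ∑ Z (λ j → 𝟙 (edge? i j)))) empty) (ℕₚ.*-zeroʳ order))) z≤n
        -- Any segment of the given length can serve as the reference vector U₀.
        from (inj₂ (s₀ , s₀∈)) = ≤-trans (*-monoʳ-≤ order same) (≮⇒≥ (λ many → not-rich (RichPairs.rich pairs e K few M≤order many)))
          where
          open Based (proj₂ s₀ ⊖ proj₁ s₀) (trans (dist-sym (proj₂ s₀) (proj₁ s₀)) (proj₂ (in-Z s₀∈)))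
          same : edges ρ ≤ RichPairs.sum-G pairs
          same = ∑-mono Z (λ {i} i∈ → ∑-mono Z (λ {j} j∈ → 𝟙-mono (edge? i j) (G? i j) (λ d → d , (length-Z i∈ , length-Z j∈))))

-- The p² + p lines of the plane.

module LinesOfPlane (𝔽 : FiniteField) where
  open FieldTheory 𝔽
  open import Data.Nat using (_≤_; _<_)
  open Surfaces 𝔽
  open PlaneGeometry 𝔽
  open Segments 𝔽

  sloped : F × F → Line
  sloped (μ , h) = (1# , μ) , h

  level : F → Line
  level h = (0# , 1#) , h

  all-lines : List Line
  all-lines = map sloped (cartesianProduct elements elements) ++ map level elements

  bisector∈ : ∀ b c → bisector b c ∈ all-lines
  bisector∈ b@(b₁ , b₂) c@(c₁ , c₂) with b₁ - c₁ ≟ 0#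
  ... | no _ = ∈-++⁺ˡ (∈-map⁺ sloped (∈-cartesianProduct⁺ (elements-complete _) (elements-complete _)))
  ... | yes _ = ∈-++⁺ʳ (map sloped (cartesianProduct elements elements)) (∈-map⁺ level (elements-complete _))

  lines-unique : Unique all-lines
  lines-unique = Uniqueₚ.++⁺ (Uniqueₚ.map⁺ (λ { refl → refl }) (Uniqueₚ.cartesianProduct⁺ elements-unique elements-unique)) (Uniqueₚ.map⁺ (λ { refl → refl }) elements-unique)
    (λ (i , j) → disjoint (∈-map⁻ sloped i) (∈-map⁻ level j))
    where
    disjoint : ∀ {l} → (Σ (F × F) λ x → x ∈ cartesianProduct elements elements × l ≡ sloped x) → (Σ F λ h → h ∈ elements × l ≡ level h) → ⊥
    disjoint (_ , _ , refl) (_ , _ , e) = 1≢0 (cong (λ l → proj₁ (proj₁ l)) e)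

  length-lines : length all-lines ≡ order ℕ.* order ℕ.+ order
  length-lines = trans (Listₚ.length-++ (map sloped (cartesianProduct elements elements)))
    (cong₂ ℕ._+_ (trans (Listₚ.length-map sloped (cartesianProduct elements elements)) (trans (length-product elements elements) refl)) (Listₚ.length-map level elements))
    where
    length-product : ∀ (xs ys : List F) → length (cartesianProduct xs ys) ≡ length xs ℕ.* length ys
    length-product [] ys = refl
    length-product (x ∷ xs) ys = trans (Listₚ.length-++ (map (x ,_) ys)) (cong₂ ℕ._+_ (Listₚ.length-map (x ,_) ys) (length-product xs ys))

  on-line? : ∀ l a → Dec (OnLine l a)
  on-line? (m , h) a = m ∙ a ≟ h

  lines-through : ∀ a → ∑ all-lines (λ l → 𝟙 (on-line? l a)) ≡ order ℕ.+ 1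
  lines-through a@(a₁ , a₂) = trans (∑-++ (map sloped (cartesianProduct elements elements)) (map level elements) _)
    (cong₂ ℕ._+_ (trans (∑-map sloped (cartesianProduct elements elements) (λ l → 𝟙 (on-line? l a))) (trans (∑-cartesianProduct elements elements _) (trans (∑-cong elements (λ {μ} _ → one ((1# , μ) ∙ a))) (trans (∑-const elements 1) (ℕₚ.*-identityʳ order)))))
      (trans (∑-map level elements (λ l → 𝟙 (on-line? l a))) (one ((0# , 1#) ∙ a))))
    where
    one : ∀ x → ∑ elements (λ h → 𝟙 (x ≟ h)) ≡ 1
    one x = ∑-exactly-one (λ h → x ≟ h) elements-unique (elements-complete x) refl (λ _ e → e)

  two-points-one-line : ∀ {a a' l l'} → l ∈ all-lines → l' ∈ all-lines → a ≢ a' → OnLine l a → OnLine l a' → OnLine l' a → OnLine l' a' → l ≡ l'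
  two-points-one-line {a₁ , a₂} {a₁' , a₂'} l∈ l'∈ a≢a' = go (shape l∈) (shape l'∈)
    where
    Shape : Line → Set
    Shape l = (Σ F λ μ → Σ F λ h → l ≡ sloped (μ , h)) ⊎ (Σ F λ h → l ≡ level h)
    shape : ∀ {l} → l ∈ all-lines → Shape l
    shape i with ∈-++⁻ (map sloped (cartesianProduct elements elements)) i
    ... | inj₁ j = let ((μ , h) , _ , e) = ∈-map⁻ sloped j in inj₁ (μ , h , e)
    ... | inj₂ j = let (h , _ , e) = ∈-map⁻ level j in inj₂ (h , e)
    level-eq : ∀ {h} → 0# * a₁ + 1# * a₂ ≡ h → 0# * a₁' + 1# * a₂' ≡ h → a₂ ≡ a₂'
    level-eq e e' = trans (solve 2 (λ x y → y := κ 0 :* x :+ κ 1 :* y) refl a₁ a₂) (trans e (trans (sym e') (solve 2 (λ x y → κ 0 :* x :+ κ 1 :* y := y) refl a₁' a₂')))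
    sloped-eq : ∀ {μ h} → 1# * a₁ + μ * a₂ ≡ h → 1# * a₁' + μ * a₂' ≡ h → a₂ ≡ a₂' → a₁ ≡ a₁'
    sloped-eq {μ} {h} e e' q = combine₃ 1# (- 1#) (- μ) e e' q (solve 6 (λ x x' y y' μ h → x := x' :+ κ 1 :* (κ 1 :* x :+ μ :* y :- h) :+ (:- κ 1) :* (κ 1 :* x' :+ μ :* y' :- h) :+ (:- μ) :* (y :- y')) refl a₁ a₁' a₂ a₂' μ h)
    separate : ∀ {μ h} → 1# * a₁ + μ * a₂ ≡ h → 1# * a₁' + μ * a₂' ≡ h → a₂ ≢ a₂'
    separate e e' q = a≢a' (cong₂ _,_ (sloped-eq e e' q) q)
    go : ∀ {l l'} → Shape l → Shape l' → OnLine l (a₁ , a₂) → OnLine l (a₁' , a₂') → OnLine l' (a₁ , a₂) → OnLine l' (a₁' , a₂') → l ≡ l'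
    go (inj₁ (μ , h , refl)) (inj₁ (μ' , h' , refl)) o₁ o₂ o₃ o₄ = cong₂ (λ μ h → sloped (μ , h)) μ≡ (trans (sym o₁) (trans (cong (λ μ → 1# * a₁ + μ * a₂) μ≡) o₃))
      where
      μ≡ : μ ≡ μ'
      μ≡ = *-cancelˡ (difference≢0 (separate o₁ o₂)) (combine₂ 1# (- 1#) (trans o₁ (sym o₂)) (trans o₃ (sym o₄))
        (solve 6 (λ x x' y y' μ μ' → (y :- y') :* μ := (y :- y') :* μ' :+ κ 1 :* (κ 1 :* x :+ μ :* y :- (κ 1 :* x' :+ μ :* y')) :+ (:- κ 1) :* (κ 1 :* x :+ μ' :* y :- (κ 1 :* x' :+ μ' :* y'))) refl a₁ a₁' a₂ a₂' μ μ'))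
    go (inj₁ (μ , h , refl)) (inj₂ (h' , refl)) o₁ o₂ o₃ o₄ = ⊥-elim (separate o₁ o₂ (level-eq o₃ o₄))
    go (inj₂ (h , refl)) (inj₁ (μ' , h' , refl)) o₁ o₂ o₃ o₄ = ⊥-elim (separate o₃ o₄ (level-eq o₁ o₂))
    go (inj₂ (h , refl)) (inj₂ (h' , refl)) o₁ o₂ o₃ o₄ = cong level (trans (sym o₁) o₃)

-- Pins: products on the paraboloid as distances.

module Inversion (𝔽 : FiniteField) where
  open FieldTheory 𝔽
  open import Data.Nat using (_≤_; _<_)
  open Surfaces 𝔽
  open PlaneGeometry 𝔽

  pin : F² → F²
  pin (b₁ , b₂) = k * b₁ , k * b₂
    where
    k = - ((norm (b₁ , b₂)) ⁻¹ * 2# ⁻¹)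

  paraboloid-product : F² → F² → F
  paraboloid-product b c = b ∙ c + norm b * norm c

  dist-pin : ∀ b c → b ≢ 0² → dist (pin b) c ≡ norm (pin b) + norm b ⁻¹ * paraboloid-product b c
  dist-pin b@(b₁ , b₂) c@(c₁ , c₂) b≢0 = combine₂ (- norm c) (norm b ⁻¹ * (b ∙ c)) (*-inverse (norm b) (norm≢0 b b≢0)) (*-inverse 2# 2≢0)
    (solve 6 (λ b₁ b₂ c₁ c₂ h t →
      let n = b₁ :* b₁ :+ b₂ :* b₂ ; k = :- (h :* t) ; m = c₁ :* c₁ :+ c₂ :* c₂ ; s = b₁ :* c₁ :+ b₂ :* c₂ in
      (k :* b₁ :- c₁) :* (k :* b₁ :- c₁) :+ (k :* b₂ :- c₂) :* (k :* b₂ :- c₂)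
        := k :* b₁ :* (k :* b₁) :+ k :* b₂ :* (k :* b₂) :+ h :* (s :+ n :* m) :+ (:- m) :* (n :* h :- κ 1) :+ h :* s :* (κ 2 :* t :- κ 1))
      refl b₁ b₂ c₁ c₂ (norm b ⁻¹) (2# ⁻¹))

  norm-pin : ∀ b → b ≢ 0² → 2# * 2# * norm (pin b) * norm b ≡ 1#
  norm-pin b@(b₁ , b₂) b≢0 = trans (solve 4 (λ b₁ b₂ h t → let n = b₁ :* b₁ :+ b₂ :* b₂ ; k = :- (h :* t) in
      κ 2 :* κ 2 :* (k :* b₁ :* (k :* b₁) :+ k :* b₂ :* (k :* b₂)) :* n := n :* h :* (n :* h) :* (κ 2 :* t :* (κ 2 :* t))) refl b₁ b₂ (norm b ⁻¹) (2# ⁻¹))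
    (trans (cong₂ (λ x y → x * x * (y * y)) (*-inverse (norm b) (norm≢0 b b≢0)) (*-inverse 2# 2≢0)) (solve 0 (κ 1 :* κ 1 :* (κ 1 :* κ 1) := κ 1) refl))

  pin-recover : ∀ h t n b → n * h ≡ 1# → 2# * t ≡ 1# → 2# * n * (- (h * t) * b) ≡ - b
  pin-recover h t n b e e' = trans (solve 4 (λ h t n b → κ 2 :* n :* (:- (h :* t) :* b) := :- (n :* h :* (κ 2 :* t) :* b)) refl h t n b)
    (trans (cong₂ (λ x y → - (x * y * b)) e e') (solve 1 (λ b → :- (κ 1 :* κ 1 :* b) := :- b) refl b))

  neg-injective : ∀ {x y} → - x ≡ - y → x ≡ y
  neg-injective {x} {y} e = combine₁ (- 1#) e (solve 2 (λ x y → x := y :+ (:- κ 1) :* (:- x :- (:- y))) refl x y)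

  -- `pin` is an inversion: 4 |pin b|² |b|² = 1, so the pin determines |b|² and then b.
  pin-injective : ∀ b b' → b ≢ 0² → b' ≢ 0² → pin b ≡ pin b' → b ≡ b'
  pin-injective b@(b₁ , b₂) b'@(b₁' , b₂') b≢0 b'≢0 e = cong₂ _,_ (same b₁ b₁' (cong proj₁ e)) (same b₂ b₂' (cong proj₂ e))
    where
    q = 2# * 2# * norm (pin b)
    q≢0 : q ≢ 0#
    q≢0 q≡0 = 1≢0 (trans (sym (norm-pin b b≢0)) (trans (cong (_* norm b) q≡0) (zeroˡ _)))
    norms : norm b ≡ norm b'
    norms = *-cancelˡ q≢0 (trans (norm-pin b b≢0) (sym (trans (cong (λ z → 2# * 2# * norm z * norm b') e) (norm-pin b' b'≢0))))
    same : ∀ x x' → - (norm b ⁻¹ * 2# ⁻¹) * x ≡ - (norm b' ⁻¹ * 2# ⁻¹) * x' → x ≡ x'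
    same x x' h = neg-injective (trans (sym (pin-recover _ _ (norm b) x (*-inverse (norm b) (norm≢0 b b≢0)) (*-inverse 2# 2≢0)))
      (trans (cong₂ (λ n z → 2# * n * z) norms h) (pin-recover _ _ (norm b') x' (*-inverse (norm b') (norm≢0 b' b'≢0)) (*-inverse 2# 2≢0))))

  dist-pin-cong : ∀ b c c' → b ≢ 0² → paraboloid-product b c ≡ paraboloid-product b c' → dist (pin b) c ≡ dist (pin b) c'
  dist-pin-cong b c c' b≢0 e = trans (dist-pin b c b≢0) (trans (cong (λ z → norm (pin b) + norm b ⁻¹ * z) e) (sym (dist-pin b c' b≢0)))

-- Counting estimates.

module Estimates where
  open import Data.Nat hiding (_≟_)
  open import Data.Nat.Properties hiding (_≟_)
  open +-*-Solver using (solve; _:=_; _:+_; _:*_; _:^_; con)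
  open ≤-Reasoning

  squared-difference : ∀ x y → (x ∸ y) * (x ∸ y) + 2 * (x * y) ≤ x * x + y * y
  squared-difference x y with ≤-total y x
  ... | inj₂ x≤y rewrite m≤n⇒m∸n≡0 x≤y = 2ab≤a²+b² x y
  ... | inj₁ y≤x = ≤-reflexive (subst (λ z → (x ∸ y) * (x ∸ y) + 2 * (z * y) ≡ z * z + y * y) (m+[n∸m]≡n y≤x) (eq y (x ∸ y)))
    where
    eq : ∀ y d → d * d + 2 * ((y + d) * y) ≡ (y + d) * (y + d) + y * y
    eq = solve-∀

  predecessor-squared : ∀ i u → i * i ≤ i + u → (i ∸ 1) * (i ∸ 1) ≤ u
  predecessor-squared zero u _ = z≤n
  predecessor-squared (suc k) u h = ≤-trans (*-monoʳ-≤ k (n≤1+n k)) (+-cancelˡ-≤ (suc k) _ _ h)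

  filter-ext : ∀ {A : Set} {P Q : A → Set} (P? : Decidable P) (Q? : Decidable Q) xs → (∀ {x} → x ∈ xs → P x → Q x) → (∀ {x} → x ∈ xs → Q x → P x) → filter P? xs ≡ filter Q? xs
  filter-ext P? Q? [] f g = refl
  filter-ext P? Q? (x ∷ xs) f g with P? x | Q? x
  ... | yes _ | yes _ = cong (x ∷_) (filter-ext P? Q? xs (λ i → f (there i)) (λ i → g (there i)))
  ... | no _ | no _ = filter-ext P? Q? xs (λ i → f (there i)) (λ i → g (there i))
  ... | yes p | no ¬q = ⊥-elim (¬q (f (here refl) p))
  ... | no ¬p | yes q = ⊥-elim (¬p (g (here refl) q))

  -- For M circles with at least K of N points each and I incidences. As M ≤ I / K, the term 2 N M²
  -- is at most 2 N I² / K² ≤ I² / 2, which is absorbed on the left.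
  incidence-arithmetic : ∀ K N I M → 0 < K → 4 * N ≤ K * K → K * M ≤ I → I * I ≤ N * (I + 2 * (M * M)) → I ≤ 2 * N
  incidence-arithmetic K@(suc _) N zero M _ _ _ _ = z≤n
  incidence-arithmetic K@(suc _) N I@(suc _) M _ 4N≤K² KM≤I h = *-cancelˡ-≤ (K * K * I) (+-cancelʳ-≤ (K * K * (I * I)) _ _ (begin
      K * K * I * I + K * K * (I * I) ≡⟨ e₁ (K * K) I ⟩
      2 * (K * K) * (I * I) ≤⟨ *-monoʳ-≤ (2 * (K * K)) h ⟩
      2 * (K * K) * (N * (I + 2 * (M * M))) ≡⟨ e₂ K N I M ⟩
      K * K * I * (2 * N) + 4 * N * (K * M * (K * M)) ≤⟨ +-monoʳ-≤ (K * K * I * (2 * N)) (*-mono-≤ 4N≤K² (*-mono-≤ KM≤I KM≤I)) ⟩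
      K * K * I * (2 * N) + K * K * (I * I) ∎))
    where
    e₁ : ∀ k i → k * i * i + k * (i * i) ≡ 2 * k * (i * i)
    e₁ = solve-∀
    e₂ : ∀ K N I M → 2 * (K * K) * (N * (I + 2 * (M * M))) ≡ K * K * I * (2 * N) + 4 * N * (K * M * (K * M))
    e₂ = solve-∀

  -- Rich circles and the isosceles triples they account for.

  module Counting (𝔽 : FiniteField) where
    open FiniteField 𝔽 using (F; _≟_; 0#; 1#; elements; elements-unique; elements-complete; order)
    open Surfaces 𝔽 using (F²)
    open PlaneGeometry 𝔽
    open Segments 𝔽

    circles : List Circle
    circles = cartesianProduct elements (cartesianProduct (cartesianProduct elements elements) elements)

    circles-complete : ∀ Γ → Γ ∈ circles
    circles-complete (α , (β₁ , β₂) , γ) = ∈-cartesianProduct⁺ (elements-complete α) (∈-cartesianProduct⁺ (∈-cartesianProduct⁺ (elements-complete β₁) (elements-complete β₂)) (elements-complete γ))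

    nondegenerate? : ∀ Γ → Dec (Nondegenerate Γ)
    nondegenerate? (α , β , γ) = ¬? ((α ≟ 0#) ×-dec (β ≟² 0²))

    on? : ∀ Γ z → Dec (OnCircle Γ z)
    on? Γ z = circle-value Γ z ≟ 0#

    open DecMembership _≟²_ using (_∈?_)

    module _ (B : List F²) (unique-B : Unique B) where
      private N = length B

      section : Circle → List F²
      section Γ = filter (on? Γ) B

      length-section : ∀ Γ → length (section Γ) ≡ count-circle Γ B
      length-section Γ = length-filter-∑ (on? Γ) B

      isosceles : List F² → ℕ
      isosceles A = ∑ A (λ a → ∑ B (λ b → ∑ B (λ c → 𝟙 (dist a b ≟ dist a c))))

      module _ (K : ℕ) (3≤K : 3 ≤ K) (4N≤K² : 4 * N ≤ K * K) where
        rich? : ∀ Γ → Dec (Nondegenerate Γ × K ≤ length (section Γ))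
        rich? Γ = nondegenerate? Γ ×-dec (K ≤? length (section Γ))

        -- Proportional equations cut out the same points, so rich circles are represented by their
        -- sets of points, without repetition. By `three-points` two entries then share at most two
        -- points.
        sections : List (List F²)
        sections = deduplicate (Listₚ.≡-dec _≟²_) (map section (filter rich? circles))

        unique-sections : Unique sections
        unique-sections = DecUniqueₚ.deduplicate-! (Listₚ.≡-dec _≟²_) (map section (filter rich? circles))

        section-circle : ∀ {S} → S ∈ sections → Σ Circle λ Γ → S ≡ section Γ × Nondegenerate Γ × K ≤ length (section Γ)
        section-circle i with ∈-map⁻ section (∈-deduplicate⁻ (Listₚ.≡-dec _≟²_) (map section (filter rich? circles)) i)
        ... | Γ , j , e = Γ , e , proj₂ (∈-filter⁻ rich? {xs = circles} j)

        circle-section : ∀ Γ → Nondegenerate Γ → K ≤ length (section Γ) → section Γ ∈ sections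
        circle-section Γ nd l = ∈-deduplicate⁺ (Listₚ.≡-dec _≟²_) (∈-map⁺ section (∈-filter⁺ rich? (circles-complete Γ) (nd , l)))

        Bad : F² → F² → Set
        Bad b c = Any (λ S → b ∈ S × c ∈ S) sections

        bad? : ∀ b c → Dec (Bad b c)
        bad? b c = Any.any? (λ S → (b ∈? S) ×-dec (c ∈? S)) sections

        incidences : ℕ
        incidences = ∑ sections length

        length-as-sum : ∀ {S} → S ∈ sections → ∑ B (λ b → 𝟙 (b ∈? S)) ≡ length S
        length-as-sum {S} i with section-circle i
        ... | Γ , refl , _ = trans (∑-cong B (λ {b} b∈ → 𝟙-cong (b ∈? section Γ) (on? Γ b) (λ j → proj₂ (∈-filter⁻ (on? Γ) {xs = B} j)) (λ o → ∈-filter⁺ (on? Γ) b∈ o)))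
          (sym (length-section Γ))

        common : ∀ {S S'} → S ∈ sections → S' ∈ sections → S ≢ S' → ∑ B (λ b → 𝟙 ((b ∈? S) ×-dec (b ∈? S'))) ≤ 2
        common {S} {S'} i i' S≢S' = from (section-circle i) (section-circle i')
          where
          from : (Σ Circle λ Γ → S ≡ section Γ × Nondegenerate Γ × K ≤ length (section Γ)) → (Σ Circle λ Γ → S' ≡ section Γ × Nondegenerate Γ × K ≤ length (section Γ)) → ∑ B (λ b → 𝟙 ((b ∈? S) ×-dec (b ∈? S'))) ≤ 2
          from (Γ , refl , nd , _) (Γ' , refl , nd' , _) = ∑-at-most-two (λ b → (b ∈? S) ×-dec (b ∈? S')) unique-B three
            where
            on : ∀ {Γ b} → b ∈ section Γ → OnCircle Γ b
            on {Γ} j = proj₂ (∈-filter⁻ (on? Γ) {xs = B} j)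
            three : ∀ {x y z} → x ∈ B → y ∈ B → z ∈ B → x ∈ S × x ∈ S' → y ∈ S × y ∈ S' → z ∈ S × z ∈ S' → x ≢ y → x ≢ z → y ≢ z → ⊥
            three {x} {y} {z} _ _ _ (x∈ , x∈') (y∈ , y∈') (z∈ , z∈') x≢y x≢z y≢z = S≢S' (filter-ext (on? Γ) (on? Γ') B
              (λ {w} _ → three-points Γ Γ' x y z nd nd' (on {Γ} x∈) (on {Γ} y∈) (on {Γ} z∈) (on {Γ'} x∈') (on {Γ'} y∈') (on {Γ'} z∈') x≢y x≢z y≢z w)
              (λ {w} _ → three-points Γ' Γ x y z nd' nd (on {Γ'} x∈') (on {Γ'} y∈') (on {Γ'} z∈') (on {Γ} x∈) (on {Γ} y∈) (on {Γ} z∈) x≢y x≢z y≢z w))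

        incidences≤2N : incidences ≤ 2 * N
        incidences≤2N = incidence-arithmetic K N incidences M (≤-trans (s≤s z≤n) 3≤K) 4N≤K²
            (≤-trans (≤-reflexive (trans (*-comm K M) (sym (∑-const sections K)))) (∑-mono sections (λ {S} i → rich-length i)))
            (begin
              incidences * incidences ≡⟨ cong₂ _*_ by-points by-points ⟩
              ∑ B degree * ∑ B degree ≤⟨ square-∑ B degree ⟩
              N * ∑ B (λ b → degree b * degree b) ≤⟨ *-monoʳ-≤ N second-moment ⟩
              N * (incidences + 2 * (M * M)) ∎)
          where
          M = length sections
          degree : F² → ℕ
          degree b = ∑ sections (λ S → 𝟙 (b ∈? S))
          rich-length : ∀ {S} → S ∈ sections → K ≤ length S
          rich-length i with section-circle i
          ... | Γ , refl , _ , l = l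
          by-points : incidences ≡ ∑ B degree
          by-points = trans (∑-cong sections (λ i → sym (length-as-sum i))) (∑-swap sections B _)
          𝟙-× : ∀ {P Q : Set} (p : Dec P) (q : Dec Q) → 𝟙 p * 𝟙 q ≡ 𝟙 (p ×-dec q)
          𝟙-× (yes _) (yes _) = refl
          𝟙-× (yes _) (no _) = refl
          𝟙-× (no _) _ = refl
          shared : ∀ {S S'} → S ∈ sections → S' ∈ sections → ∑ B (λ b → 𝟙 (b ∈? S) * 𝟙 (b ∈? S')) ≤ 𝟙 (Listₚ.≡-dec _≟²_ S S') * length S + 2
          shared {S} {S'} i i' with Listₚ.≡-dec _≟²_ S S'
          ... | yes refl = ≤-trans (≤-reflexive (trans (∑-cong B (λ {b} _ → 𝟙-square (b ∈? S))) (trans (length-as-sum i) (sym (+-identityʳ _))))) (m≤m+n _ 2)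
          ... | no ne = ≤-trans (≤-reflexive (∑-cong B (λ {b} _ → 𝟙-× (b ∈? S) (b ∈? S')))) (common i i' ne)
          second-moment : ∑ B (λ b → degree b * degree b) ≤ incidences + 2 * (M * M)
          second-moment = begin
            ∑ B (λ b → degree b * degree b) ≡⟨ ∑-cong B (λ _ → ∑-*-∑ sections sections _ _) ⟩
            ∑ B (λ b → ∑ sections (λ S → ∑ sections (λ S' → 𝟙 (b ∈? S) * 𝟙 (b ∈? S')))) ≡⟨ trans (∑-swap B sections _) (∑-cong sections (λ _ → ∑-swap B sections _)) ⟩
            ∑ sections (λ S → ∑ sections (λ S' → ∑ B (λ b → 𝟙 (b ∈? S) * 𝟙 (b ∈? S')))) ≤⟨ ∑-mono sections (λ i → ∑-mono sections (λ i' → shared i i')) ⟩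
            ∑ sections (λ S → ∑ sections (λ S' → 𝟙 (Listₚ.≡-dec _≟²_ S S') * length S + 2)) ≡⟨ trans (∑-cong sections (λ _ → ∑-+ sections _ _)) (∑-+ sections _ _) ⟩
            ∑ sections (λ S → ∑ sections (λ S' → 𝟙 (Listₚ.≡-dec _≟²_ S S') * length S)) + ∑ sections (λ S → ∑ sections (λ _ → 2))
              ≤⟨ +-mono-≤ (∑-mono sections (λ {S} _ → ≤-trans (≤-reflexive (∑-*ʳ sections (length S) _)) (≤-trans (*-monoˡ-≤ (length S) (∑-at-most-one (λ S' → Listₚ.≡-dec _≟²_ S S') unique-sections (λ _ _ p q → trans (sym p) q))) (≤-reflexive (*-identityˡ _)))))
                  (≤-reflexive (trans (∑-cong sections (λ _ → ∑-const sections 2)) (trans (∑-const sections (M * 2)) (reorder M)))) ⟩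
            incidences + 2 * (M * M) ∎
            where
            reorder : ∀ M → M * (M * 2) ≡ 2 * (M * M)
            reorder = solve-∀

        Good : F² → F² → Set
        Good b c = ¬ Bad b c

        good? : ∀ b c → Dec (Good b c)
        good? b c = ¬? (bad? b c)

        good-property : ∀ {b c} → b ∈ B → c ∈ B → Good b c → ∀ Γ → Nondegenerate Γ → OnCircle Γ b → OnCircle Γ c → ¬ (K ≤ count-circle Γ B)
        good-property b∈ c∈ g Γ nd ob oc l = g (Any.map (λ { refl → ∈-filter⁺ (on? Γ) b∈ ob , ∈-filter⁺ (on? Γ) c∈ oc }) (circle-section Γ nd (≤-trans l (≤-reflexive (sym (length-section Γ))))))

        centred? : ∀ Γ a → Dec (Centred Γ a)
        centred? (α , (β₁ , β₂) , γ) (a₁ , a₂) = ¬? (α ≟ 0#) ×-dec ((_ ≟ 0#) ×-dec (_ ≟ 0#))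

        -- The apexes `A` are arbitrary: the estimate is used for the pins and for `B` itself.
        module Pins (A : List F²) (unique-A : Unique A) (length-A : length A ≡ N) where
          Equal : F² → F² → F² → Set
          Equal a b c = b ≢ c × dist a b ≡ dist a c
          equal? : ∀ a b c → Dec (Equal a b c)
          equal? a b c = ¬? (b ≟² c) ×-dec (dist a b ≟ dist a c)

          bad-triples good-triples : ℕ
          bad-triples = ∑ A (λ a → ∑ B (λ b → ∑ B (λ c → 𝟙 (bad? b c ×-dec equal? a b c))))
          good-triples = ∑ A (λ a → ∑ B (λ b → ∑ B (λ c → 𝟙 (good? b c ×-dec equal? a b c))))

          isosceles-split : isosceles A ≤ N * N + bad-triples + good-triples
          isosceles-split = begin
            isosceles A ≤⟨ ∑-mono A (λ {a} _ → ∑-mono B (λ {b} _ → ∑-mono B (λ {c} _ → split a b c))) ⟩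
            ∑ A (λ a → ∑ B (λ b → ∑ B (λ c → 𝟙 (b ≟² c) + 𝟙 (bad? b c ×-dec equal? a b c) + 𝟙 (good? b c ×-dec equal? a b c))))
              ≡⟨ ∑-cong A (λ {a} _ → ∑-cong B (λ {b} _ → ∑-+₃ B (λ c → 𝟙 (b ≟² c)) (λ c → 𝟙 (bad? b c ×-dec equal? a b c)) (λ c → 𝟙 (good? b c ×-dec equal? a b c)))) ⟩
            _ ≡⟨ ∑-cong A (λ {a} _ → ∑-+₃ B (λ b → ∑ B (λ c → 𝟙 (b ≟² c))) (λ b → ∑ B (λ c → 𝟙 (bad? b c ×-dec equal? a b c))) (λ b → ∑ B (λ c → 𝟙 (good? b c ×-dec equal? a b c)))) ⟩
            _ ≡⟨ ∑-+₃ A (λ a → ∑ B (λ b → ∑ B (λ c → 𝟙 (b ≟² c)))) (λ a → ∑ B (λ b → ∑ B (λ c → 𝟙 (bad? b c ×-dec equal? a b c)))) (λ a → ∑ B (λ b → ∑ B (λ c → 𝟙 (good? b c ×-dec equal? a b c)))) ⟩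
            ∑ A (λ a → ∑ B (λ b → ∑ B (λ c → 𝟙 (b ≟² c)))) + bad-triples + good-triples
              ≤⟨ +-monoˡ-≤ good-triples (+-monoˡ-≤ bad-triples (≤-trans (∑-≤-const A (N * 1) (λ _ → ∑-≤-const B 1 (λ {b} _ → ∑-at-most-one (λ c → b ≟² c) unique-B (λ _ _ p q → trans (sym p) q)))) (≤-reflexive (cong₂ _*_ length-A (*-identityʳ N))))) ⟩
            N * N + bad-triples + good-triples ∎
            where
            ∑-+₃ : ∀ (xs : List F²) (f g h : F² → ℕ) → ∑ xs (λ x → f x + g x + h x) ≡ ∑ xs f + ∑ xs g + ∑ xs h
            ∑-+₃ xs f g h = trans (∑-+ xs (λ x → f x + g x) h) (cong (_+ ∑ xs h) (∑-+ xs f g))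
            split : ∀ a b c → 𝟙 (dist a b ≟ dist a c) ≤ 𝟙 (b ≟² c) + 𝟙 (bad? b c ×-dec equal? a b c) + 𝟙 (good? b c ×-dec equal? a b c)
            split a b c = 𝟙-≤ (dist a b ≟ dist a c) (λ e → cases e (b ≟² c) (bad? b c))
              where
              x = 𝟙 (b ≟² c)
              y = 𝟙 (bad? b c ×-dec equal? a b c)
              z = 𝟙 (good? b c ×-dec equal? a b c)
              cases : dist a b ≡ dist a c → Dec (b ≡ c) → Dec (Bad b c) → 1 ≤ x + y + z
              cases e (yes q) _ = ≤-trans (≤-reflexive (sym (𝟙-yes (b ≟² c) q))) (≤-trans (m≤m+n x y) (m≤m+n (x + y) z))
              cases e (no q) (yes bd) = ≤-trans (≤-reflexive (sym (𝟙-yes (bad? b c ×-dec equal? a b c) (bd , q , e)))) (≤-trans (m≤n+m y x) (m≤m+n (x + y) z))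
              cases e (no q) (no gd) = ≤-trans (≤-reflexive (sym (𝟙-yes (good? b c ×-dec equal? a b c) (gd , q , e)))) (m≤n+m z (x + y))

          -- Fix a rich section S and b in S. If the apex is not its centre, at most one other point
          -- of S is equidistant; the centre is a single apex and costs at most N. So S contributes
          -- at most 2 N times its length, and the lengths add up to at most 2 N.
          bad-triples≤4N² : bad-triples ≤ 4 * (N * N)
          bad-triples≤4N² = begin
            bad-triples ≤⟨ ∑-mono A (λ {a} _ → ∑-mono B (λ {b} _ → ∑-mono B (λ {c} _ → located a b c))) ⟩
            ∑ A (λ a → ∑ B (λ b → ∑ B (λ c → ∑ sections (λ S → 𝟙 (b ∈? S) * 𝟙 ((c ∈? S) ×-dec equal? a b c)))))
              ≡⟨ trans (∑-cong A (λ _ → trans (∑-cong B (λ _ → ∑-swap B sections _)) (∑-swap B sections _))) (∑-swap A sections _) ⟩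
            ∑ sections (λ S → ∑ A (λ a → ∑ B (λ b → ∑ B (λ c → 𝟙 (b ∈? S) * 𝟙 ((c ∈? S) ×-dec equal? a b c))))) ≤⟨ ∑-mono sections per-section ⟩
            ∑ sections (λ S → length S * (2 * N)) ≡⟨ ∑-*ʳ sections (2 * N) length ⟩
            incidences * (2 * N) ≤⟨ *-monoˡ-≤ (2 * N) incidences≤2N ⟩
            2 * N * (2 * N) ≡⟨ square N ⟩
            4 * (N * N) ∎
            where
            square : ∀ N → 2 * N * (2 * N) ≡ 4 * (N * N)
            square = solve-∀
            located : ∀ a b c → 𝟙 (bad? b c ×-dec equal? a b c) ≤ ∑ sections (λ S → 𝟙 (b ∈? S) * 𝟙 ((c ∈? S) ×-dec equal? a b c))
            located a b c = 𝟙-≤ (bad? b c ×-dec equal? a b c) (λ (bd , e) → from (find bd) e)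
              where
              from : (Σ (List F²) λ S → S ∈ sections × (b ∈ S × c ∈ S)) → Equal a b c → 1 ≤ ∑ sections (λ S → 𝟙 (b ∈? S) * 𝟙 ((c ∈? S) ×-dec equal? a b c))
              from (S , S∈ , b∈ , c∈) e = ≤-trans (≤-reflexive (sym (cong₂ _*_ (𝟙-yes (b ∈? S) b∈) (𝟙-yes ((c ∈? S) ×-dec equal? a b c) (c∈ , e)))))
                (term≤∑ (λ S → 𝟙 (b ∈? S) * 𝟙 ((c ∈? S) ×-dec equal? a b c)) S∈)
            per-section : ∀ {S} → S ∈ sections → ∑ A (λ a → ∑ B (λ b → ∑ B (λ c → 𝟙 (b ∈? S) * 𝟙 ((c ∈? S) ×-dec equal? a b c)))) ≤ length S * (2 * N)
            per-section {S} S∈ = from (section-circle S∈)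
              where
              from : (Σ Circle λ Γ → S ≡ section Γ × Nondegenerate Γ × K ≤ length (section Γ)) → ∑ A (λ a → ∑ B (λ b → ∑ B (λ c → 𝟙 (b ∈? S) * 𝟙 ((c ∈? S) ×-dec equal? a b c)))) ≤ length S * (2 * N)
              from (Γ , S≡ , nd , _) = begin
                ∑ A (λ a → ∑ B (λ b → ∑ B (λ c → 𝟙 (b ∈? S) * 𝟙 ((c ∈? S) ×-dec equal? a b c)))) ≤⟨ ∑-mono A (λ {a} _ → ∑-mono B (λ {b} b∈B → per-point a b b∈B)) ⟩
                ∑ A (λ a → ∑ B (λ b → 𝟙 (b ∈? S) * (1 + 𝟙 (centred? Γ a) * N))) ≡⟨ ∑-cong A (λ {a} _ → trans (∑-*ʳ B (1 + 𝟙 (centred? Γ a) * N) _) (cong (_* (1 + 𝟙 (centred? Γ a) * N)) (length-as-sum S∈))) ⟩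
                ∑ A (λ a → length S * (1 + 𝟙 (centred? Γ a) * N)) ≡⟨ trans (∑-*ˡ A (length S) _) (cong (length S *_) (trans (∑-+ A (λ _ → 1) _) (cong₂ _+_ (trans (∑-const A 1) (trans (*-identityʳ _) length-A)) (∑-*ʳ A N (λ a → 𝟙 (centred? Γ a)))))) ⟩
                length S * (N + ∑ A (λ a → 𝟙 (centred? Γ a)) * N) ≤⟨ *-monoʳ-≤ (length S) (+-monoʳ-≤ N (*-monoˡ-≤ N (∑-at-most-one (centred? Γ) unique-A (λ _ _ → centred-unique Γ _ _)))) ⟩
                length S * (N + 1 * N) ∎
                where
                on : ∀ {b} → b ∈ S → OnCircle Γ b
                on j = proj₂ (∈-filter⁻ (on? Γ) {xs = B} (subst (_ ∈_) S≡ j))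
                per-point : ∀ a b → b ∈ B → ∑ B (λ c → 𝟙 (b ∈? S) * 𝟙 ((c ∈? S) ×-dec equal? a b c)) ≤ 𝟙 (b ∈? S) * (1 + 𝟙 (centred? Γ a) * N)
                per-point a b b∈B = ≤-trans (≤-reflexive (∑-*ˡ B (𝟙 (b ∈? S)) _)) (count (b ∈? S))
                  where
                  count : (d : Dec (b ∈ S)) → 𝟙 d * ∑ B (λ c → 𝟙 ((c ∈? S) ×-dec equal? a b c)) ≤ 𝟙 d * (1 + 𝟙 (centred? Γ a) * N)
                  count (no _) = z≤n
                  count (yes b∈) = *-monoʳ-≤ 1 (by-centre (centred? Γ a))
                    where
                    by-centre : (d : Dec (Centred Γ a)) → ∑ B (λ c → 𝟙 ((c ∈? S) ×-dec equal? a b c)) ≤ 1 + 𝟙 d * N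
                    by-centre (yes _) = ≤-trans (≤-trans (∑-≤-const B 1 (λ {c} _ → 𝟙≤1 ((c ∈? S) ×-dec equal? a b c))) (≤-reflexive (trans (*-identityʳ N) (sym (+-identityʳ N))))) (n≤1+n _)
                    by-centre (no nc) = ≤-trans (∑-at-most-one (λ c → (c ∈? S) ×-dec equal? a b c) unique-B same) (m≤m+n 1 0)
                      where
                      same : ∀ {c d} → c ∈ B → d ∈ B → c ∈ S × Equal a b c → d ∈ S × Equal a b d → c ≡ d
                      same {c} {d} _ _ (c∈ , b≢c , ec) (d∈ , b≢d , ed) with c ≟² d
                      ... | yes e = e
                      ... | no c≢d = ⊥-elim (nc (equidistant⇒centred Γ a b c d nd (on b∈) (on c∈) (on d∈) ec ed b≢c b≢d c≢d))

  -- Incidences of apexes with weighted bisectors.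

  module BisectorWeights (𝔽 : FiniteField) where
    open FieldTheory 𝔽 using (F; _≟_; order)
    open Surfaces 𝔽 using (F²)
    open PlaneGeometry 𝔽
    open Segments 𝔽
    open LinesOfPlane 𝔽

    module _ (B : List F²) (gd : F² → F² → Set) (gd? : ∀ b c → Dec (gd b c)) (gd⇒≢ : ∀ {b c} → gd b c → b ≢ c) where
      private N = length B

      weight : Line → ℕ
      weight l = ∑ B (λ b → ∑ B (λ c → 𝟙 (gd? b c ×-dec (bisector b c ≟ˡ l))))

      bisector-energy : ℕ
      bisector-energy = ∑ all-lines (λ l → weight l * weight l)

      weight-total : ∑ all-lines weight ≤ N * N
      weight-total = begin
        ∑ all-lines weight ≡⟨ trans (∑-swap all-lines B _) (∑-cong B (λ _ → ∑-swap all-lines B _)) ⟩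
        ∑ B (λ b → ∑ B (λ c → ∑ all-lines (λ l → 𝟙 (gd? b c ×-dec (bisector b c ≟ˡ l))))) ≤⟨ ∑-≤-const B (N * 1) (λ {b} _ → ∑-≤-const B 1 (λ {c} _ → ∑-at-most-one (λ l → gd? b c ×-dec (bisector b c ≟ˡ l)) lines-unique (λ _ _ (_ , p) (_ , q) → trans (sym p) q))) ⟩
        N * (N * 1) ≡⟨ cong (N *_) (*-identityʳ N) ⟩
        N * N ∎

      module _ (A : List F²) (unique-A : Unique A) (length-A : length A ≡ N) where
        good-sum : ℕ
        good-sum = ∑ A (λ a → ∑ B (λ b → ∑ B (λ c → 𝟙 (gd? b c ×-dec (dist a b ≟ dist a c)))))

        private
          module P = Pencil _≟²_ A unique-A all-lines lines-unique (λ a l → OnLine l a) (λ a l → on-line? l a) (λ _ _ → ⊤) (λ _ _ → yes tt)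
            (λ _ _ l∈ l'∈ a≢a' → two-points-one-line l∈ l'∈ a≢a') (λ _ _ → tt)
          pins : Line → ℕ
          pins = P.multiplicity

          excess-total : ∑ all-lines P.excess ≤ N * N
          excess-total = ≤-trans P.total-excess (≤-trans (∑-≤-const A (length A * 1) (λ {a} _ → ∑-≤-const A 1 (λ {a'} _ → 𝟙≤1 (¬? (a ≟² a') ×-dec yes tt))))
            (≤-reflexive (trans (cong (length A *_) (*-identityʳ _)) (cong₂ _*_ length-A length-A))))

          pins-total : ∑ all-lines pins ≡ N * (order + 1)
          pins-total = trans (∑-swap all-lines A _) (trans (∑-cong A (λ {a} _ → lines-through a)) (trans (∑-const A (order + 1)) (cong (_* (order + 1)) length-A)))

          good-sum≤ : good-sum ≤ ∑ all-lines (λ l → pins l * weight l)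
          good-sum≤ = begin
            good-sum ≤⟨ ∑-mono A (λ {a} _ → ∑-mono B (λ {b} _ → ∑-mono B (λ {c} _ → located a b c))) ⟩
            ∑ A (λ a → ∑ B (λ b → ∑ B (λ c → ∑ all-lines (λ l → 𝟙 (on-line? l a) * 𝟙 (gd? b c ×-dec (bisector b c ≟ˡ l))))))
              ≡⟨ trans (∑-cong A (λ _ → trans (∑-cong B (λ _ → ∑-swap B all-lines _)) (∑-swap B all-lines _))) (∑-swap A all-lines _) ⟩
            ∑ all-lines (λ l → ∑ A (λ a → ∑ B (λ b → ∑ B (λ c → 𝟙 (on-line? l a) * 𝟙 (gd? b c ×-dec (bisector b c ≟ˡ l))))))
              ≡⟨ ∑-cong all-lines (λ {l} _ → trans (∑-cong A (λ {a} _ → trans (∑-cong B (λ _ → ∑-*ˡ B (𝟙 (on-line? l a)) _)) (∑-*ˡ B (𝟙 (on-line? l a)) _))) (∑-*ʳ A (weight l) (λ a → 𝟙 (on-line? l a)))) ⟩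
            ∑ all-lines (λ l → pins l * weight l) ∎
            where
            located : ∀ a b c → 𝟙 (gd? b c ×-dec (dist a b ≟ dist a c)) ≤ ∑ all-lines (λ l → 𝟙 (on-line? l a) * 𝟙 (gd? b c ×-dec (bisector b c ≟ˡ l)))
            located a b c = 𝟙-≤ (gd? b c ×-dec (dist a b ≟ dist a c)) (λ (g , e) →
              ≤-trans (≤-reflexive (sym (cong₂ _*_ (𝟙-yes (on-line? (bisector b c) a) (equidistant⇒on-bisector a b c (gd⇒≢ g) e)) (𝟙-yes (gd? b c ×-dec (bisector b c ≟ˡ bisector b c)) (g , refl)))))
                (term≤∑ (λ l → 𝟙 (on-line? l a) * 𝟙 (gd? b c ×-dec (bisector b c ≟ˡ l))) (bisector∈ b c)))

          -- x l is the part of the scaled pin count of l in excess of the constant r.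
          split-bound : ∀ (r : ℕ) (m : ℕ) (x : Line → ℕ) → (∀ l → m * pins l ≤ r + x l) →
            m * good-sum ≤ r * (N * N) + ∑ all-lines (λ l → x l * weight l)
          split-bound r m x h = begin
            m * good-sum ≤⟨ *-monoʳ-≤ m good-sum≤ ⟩
            m * ∑ all-lines (λ l → pins l * weight l) ≡⟨ trans (sym (∑-*ˡ all-lines m _)) (∑-cong all-lines (λ {l} _ → sym (*-assoc m (pins l) (weight l)))) ⟩
            ∑ all-lines (λ l → m * pins l * weight l) ≤⟨ ∑-mono all-lines (λ {l} _ → ≤-trans (*-monoˡ-≤ (weight l) (h l)) (≤-reflexive (*-distribʳ-+ (weight l) r (x l)))) ⟩
            ∑ all-lines (λ l → r * weight l + x l * weight l) ≡⟨ trans (∑-+ all-lines _ _) (cong (_+ ∑ all-lines (λ l → x l * weight l)) (∑-*ˡ all-lines r weight)) ⟩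
            r * ∑ all-lines weight + ∑ all-lines (λ l → x l * weight l) ≤⟨ +-monoˡ-≤ _ (*-monoʳ-≤ r weight-total) ⟩
            r * (N * N) + ∑ all-lines (λ l → x l * weight l) ∎

        -- The first apex on each line costs at most the total weight N². For the others, (pins -
        -- 1)² is at most the number of ordered pairs of distinct apexes on the line, and each pair
        -- lies on at most one line.
        small-bound : Σ ℕ λ V → good-sum ≤ N * N + V × V * V ≤ N * N * bisector-energy
        small-bound = ∑ all-lines (λ l → (pins l ∸ 1) * weight l) ,
          ≤-trans (≤-reflexive (sym (*-identityˡ good-sum))) (≤-trans (split-bound 1 1 (λ l → pins l ∸ 1) (λ l → ≤-trans (≤-reflexive (*-identityˡ (pins l))) (m≤n+m∸n (pins l) 1))) (≤-reflexive (cong (_+ ∑ all-lines (λ l → (pins l ∸ 1) * weight l)) (*-identityˡ (N * N))))) ,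
          ≤-trans (cauchy-schwarz all-lines (λ l → pins l ∸ 1) weight) (*-monoˡ-≤ bisector-energy
            (≤-trans (∑-mono all-lines (λ {l} _ → predecessor-squared (pins l) (P.excess l) (P.square-multiplicity l))) excess-total))

        -- With p + 1 lines through each point and p² + p lines in all, the average number of apexes
        -- on a line is exactly N / p. The average gives the main term, and V is the weighted sum of
        -- the positive parts of the deviations, scaled by p.
        large-bound : Σ ℕ λ V → order * good-sum ≤ N * (N * N) + V × V * V ≤ order * order * (N * (order + 1)) * bisector-energy
        large-bound = ∑ all-lines (λ l → x l * weight l) , split-bound N order x (λ l → m≤n+m∸n (order * pins l) N) ,
          ≤-trans (cauchy-schwarz all-lines x weight) (*-monoˡ-≤ bisector-energy variance)
          where
          x : Line → ℕ
          x l = order * pins l ∸ N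
          p : ℕ
          p = order
          s : ℕ
          s = N * (p + 1)
          variance : ∑ all-lines (λ l → x l * x l) ≤ p * p * s
          variance = +-cancelʳ-≤ (2 * (p * s * N)) _ _ (begin
            ∑ all-lines (λ l → x l * x l) + 2 * (p * s * N) ≡⟨ cong (∑ all-lines (λ l → x l * x l) +_) first-moment ⟨
            ∑ all-lines (λ l → x l * x l) + ∑ all-lines (λ l → 2 * (p * pins l * N)) ≡⟨ ∑-+ all-lines _ _ ⟨
            ∑ all-lines (λ l → x l * x l + 2 * (p * pins l * N)) ≤⟨ ∑-mono all-lines (λ {l} _ → squared-difference (p * pins l) N) ⟩
            ∑ all-lines (λ l → p * pins l * (p * pins l) + N * N) ≡⟨ ∑-+ all-lines _ _ ⟩
            ∑ all-lines (λ l → p * pins l * (p * pins l)) + ∑ all-lines (λ _ → N * N) ≤⟨ +-mono-≤ second-moment (≤-reflexive (trans (∑-const all-lines (N * N)) (cong (_* (N * N)) length-lines))) ⟩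
            p * p * (s + N * N) + (p * p + p) * (N * N) ≡⟨ balance p N ⟩
            p * p * s + 2 * (p * s * N) ∸ p * (N * N) ≤⟨ m∸n≤m _ (p * (N * N)) ⟩
            p * p * s + 2 * (p * s * N) ∎)
            where
            first-moment : ∑ all-lines (λ l → 2 * (p * pins l * N)) ≡ 2 * (p * s * N)
            first-moment = trans (∑-*ˡ all-lines 2 _) (cong (2 *_) (trans (∑-*ʳ all-lines N _) (cong (_* N) (trans (∑-*ˡ all-lines p pins) (cong (p *_) pins-total)))))
            regroup : ∀ p i → p * i * (p * i) ≡ p * p * (i * i)
            regroup = solve-∀
            second-moment : ∑ all-lines (λ l → p * pins l * (p * pins l)) ≤ p * p * (s + N * N)
            second-moment = begin
              ∑ all-lines (λ l → p * pins l * (p * pins l)) ≡⟨ trans (∑-cong all-lines (λ {l} _ → regroup p (pins l))) (∑-*ˡ all-lines (p * p) _) ⟩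
              p * p * ∑ all-lines (λ l → pins l * pins l) ≤⟨ *-monoʳ-≤ (p * p) (∑-mono all-lines (λ {l} _ → P.square-multiplicity l)) ⟩
              p * p * ∑ all-lines (λ l → pins l + P.excess l) ≡⟨ cong (p * p *_) (∑-+ all-lines pins P.excess) ⟩
              p * p * (∑ all-lines pins + ∑ all-lines P.excess) ≤⟨ *-monoʳ-≤ (p * p) (+-mono-≤ (≤-reflexive pins-total) excess-total) ⟩
              p * p * (s + N * N) ∎
            balance : ∀ p N → let s = N * (p + 1) in p * p * (s + N * N) + (p * p + p) * (N * N) ≡ p * p * s + 2 * (p * s * N) ∸ p * (N * N)
            balance p N = trans (sym (m+n∸n≡m _ (p * (N * N)))) (cong (_∸ p * (N * N)) (poly p N))
              where
              poly : ∀ p N → let s = N * (p + 1) in p * p * (s + N * N) + (p * p + p) * (N * N) + p * (N * N) ≡ p * p * s + 2 * (p * s * N)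
              poly = solve-∀

  record SquareRoot (n : ℕ) : Set where
    constructor square-root
    field
      root : ℕ
      below : root * root ≤ n
      above : n < suc root * suc root

  √ : ∀ n → SquareRoot n
  √ zero = square-root 0 z≤n (s≤s z≤n)
  √ (suc n) with √ n
  ... | square-root k b a with suc k * suc k ≤? suc n
  ...   | yes l = square-root (suc k) l (≤-trans (s≤s a) (≤-trans (m≤m+n _ (2 * suc k)) (≤-reflexive (next (suc k)))))
    where
    next : ∀ k → suc (k * k) + 2 * k ≡ suc k * suc k
    next = solve-∀
  ...   | no l = square-root k (m≤n⇒m≤1+n b) (≰⇒> l)

  -- Fits interpolation for 2 n lines: the degree bound is at most 4 e, so there are at most 8 n e <
  -- e³ conditions.
  side : ℕ → ℕ
  side n = suc (SquareRoot.root (√ (8 * n)))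

  side-above : ∀ n → 8 * n < side n * side n
  side-above n = SquareRoot.above (√ (8 * n))

  -- The factor n keeps the inequality valid at n = 0, where the side is 1.
  side-below : ∀ n → n * (side n * side n) ≤ 32 * (n * n)
  side-below zero = z≤n
  side-below n@(suc m) = from (√ (8 * n))
    where
    from : (r : SquareRoot (8 * n)) → n * (suc (SquareRoot.root r) * suc (SquareRoot.root r)) ≤ 32 * (n * n)
    from (square-root zero b a) = ⊥-elim (<⇒≱ a (≤-trans (s≤s z≤n) (m≤n*m n 8)))
    from (square-root k@(suc k') b a) = begin
      n * (suc k * suc k) ≤⟨ *-monoʳ-≤ n (*-mono-≤ {suc k} {2 * k} 1+k≤2k 1+k≤2k) ⟩
      n * (2 * k * (2 * k)) ≡⟨ cong (n *_) (e₁ k) ⟩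
      n * (4 * (k * k)) ≤⟨ *-monoʳ-≤ n (*-monoʳ-≤ 4 b) ⟩
      n * (4 * (8 * n)) ≡⟨ e₂ n ⟩
      32 * (n * n) ∎
      where
      1+k≤2k : suc k ≤ 2 * k
      1+k≤2k = ≤-trans (≤-reflexive (+-comm 1 k)) (+-monoʳ-≤ k (s≤s z≤n))
      e₁ : ∀ k → 2 * k * (2 * k) ≡ 4 * (k * k)
      e₁ = solve-∀
      e₂ : ∀ n → n * (4 * (8 * n)) ≡ 32 * (n * n)
      e₂ = solve-∀

  weighted-cauchy-schwarz : ∀ {A : Set} (xs : List A) (w e : A → ℕ) →
    ∑ xs (λ x → w x * e x) * ∑ xs (λ x → w x * e x) ≤ ∑ xs w * ∑ xs (λ x → w x * (e x * e x))
  weighted-cauchy-schwarz xs w e = *-cancelˡ-≤ 2 (begin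
    2 * (∑ xs we * ∑ xs we) ≡⟨ cong (2 *_) (∑-*-∑ xs xs we we) ⟩
    2 * ∑ xs (λ x → ∑ xs (λ y → we x * we y)) ≡⟨ trans (sym (∑-*ˡ xs 2 _)) (∑-cong xs (λ _ → sym (∑-*ˡ xs 2 _))) ⟩
    ∑ xs (λ x → ∑ xs (λ y → 2 * (we x * we y))) ≤⟨ ∑-mono xs (λ {x} _ → ∑-mono xs (λ {y} _ → pointwise (w x) (w y) (e x) (e y))) ⟩
    ∑ xs (λ x → ∑ xs (λ y → wee x * w y + w x * wee y)) ≡⟨ trans (∑-cong xs (λ _ → ∑-+ xs _ _)) (∑-+ xs _ _) ⟩
    ∑ xs (λ x → ∑ xs (λ y → wee x * w y)) + ∑ xs (λ x → ∑ xs (λ y → w x * wee y)) ≡⟨ cong₂ _+_ (sym (∑-*-∑ xs xs wee w)) (sym (∑-*-∑ xs xs w wee)) ⟩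
    ∑ xs wee * ∑ xs w + ∑ xs w * ∑ xs wee ≡⟨ double (∑ xs w) (∑ xs wee) ⟩
    2 * (∑ xs w * ∑ xs wee) ∎)
    where
    we = λ x → w x * e x
    wee = λ x → w x * (e x * e x)
    double : ∀ a b → b * a + a * b ≡ 2 * (a * b)
    double = solve-∀
    f₁ : ∀ w v a b → 2 * (w * a * (v * b)) ≡ w * v * (2 * (a * b))
    f₁ = solve-∀
    f₂ : ∀ w v a b → w * v * (a * a + b * b) ≡ w * (a * a) * v + w * (v * (b * b))
    f₂ = solve-∀
    pointwise : ∀ w v a b → 2 * (w * a * (v * b)) ≤ w * (a * a) * v + w * (v * (b * b))
    pointwise w v a b = ≤-trans (≤-reflexive (f₁ w v a b)) (≤-trans (*-monoʳ-≤ (w * v) (2ab≤a²+b² a b)) (≤-reflexive (f₂ w v a b)))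

  -- `crossing-degree e` is 15 e + 6, so doubling gives 30 n e + 12 n. Another n comes from the
  -- first term, and 10 n² ≤ n e p adds one n e, whence 13 + 31 = 44.
  edge-arithmetic : ∀ p n e K E → 0 < p → 1 ≤ e → 8 * n < e * e → 30 * e ≤ p →
    let δ = box-degree e ; M = crossing-degree e in
    p * E ≤ p * n + 10 * (n * n) + p * ((M + K) * (n + n)) → E ≤ 44 * (n * e) + 2 * K * n
  edge-arithmetic p@(suc _) n e K E _ 1≤e 8n<e² 30e≤p h = *-cancelˡ-≤ p (begin
    p * E ≤⟨ h ⟩
    p * n + 10 * (n * n) + p * ((M + K) * (n + n)) ≤⟨ +-monoˡ-≤ _ (+-monoʳ-≤ (p * n) ten) ⟩
    p * n + n * (e * p) + p * ((M + K) * (n + n)) ≡⟨ e₁ p n e K ⟩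
    p * (13 * (n * 1) + 31 * (n * e) + 2 * K * n) ≤⟨ *-monoʳ-≤ p (+-monoˡ-≤ (2 * K * n) (+-monoˡ-≤ (31 * (n * e)) (*-monoʳ-≤ 13 (*-monoʳ-≤ n 1≤e)))) ⟩
    p * (13 * (n * e) + 31 * (n * e) + 2 * K * n) ≡⟨ cong (p *_) (cong (_+ 2 * K * n) (sym (*-distribʳ-+ (n * e) 13 31))) ⟩
    p * (44 * (n * e) + 2 * K * n) ∎)
    where
    δ = box-degree e
    M = crossing-degree e
    e₁ : ∀ p n e K → let δ = e + (e + (e + 1)) ; M = δ + δ + δ + δ + (1 + δ) in
      p * n + n * (e * p) + p * ((M + K) * (n + n)) ≡ p * (13 * (n * 1) + 31 * (n * e) + 2 * K * n)
    e₁ = solve-∀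
    e₂ : ∀ n → 10 * (n * n) + 6 * (n * n) ≡ n * (2 * (8 * n))
    e₂ = solve-∀
    e₃ : ∀ e → 2 * (e * e) ≡ e * (2 * e)
    e₃ = solve-∀
    ten : 10 * (n * n) ≤ n * (e * p)
    ten = begin
      10 * (n * n) ≤⟨ m≤m+n _ (6 * (n * n)) ⟩
      10 * (n * n) + 6 * (n * n) ≡⟨ e₂ n ⟩
      n * (2 * (8 * n)) ≤⟨ *-monoʳ-≤ n (*-monoʳ-≤ 2 (<⇒≤ 8n<e²)) ⟩
      n * (2 * (e * e)) ≡⟨ cong (n *_) (e₃ e) ⟩
      n * (e * (2 * e)) ≤⟨ *-monoʳ-≤ n (*-monoʳ-≤ e (≤-trans (*-monoˡ-≤ e {2} {30} (s≤s (s≤s z≤n))) 30e≤p)) ⟩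
      n * (e * p) ∎

  -- The energy of the bisectors, length by length.

  module BisectorEnergy (𝔽 : FiniteField) where
    open FieldTheory 𝔽 using (F; 0#; _≟_; elements; elements-complete; elements-unique; order; order≥7)
    open Surfaces 𝔽 using (F²)
    open PlaneGeometry 𝔽
    open Segments 𝔽
    open LinesOfPlane 𝔽
    open BisectorWeights 𝔽
    open Counting 𝔽 using (isosceles)

    fibre-squares : ∀ {A : Set} (B : List A) (f : A → F) →
      ∑ elements (λ t → ∑ B (λ c → 𝟙 (f c ≟ t)) * ∑ B (λ c → 𝟙 (f c ≟ t))) ≤ ∑ B (λ c → ∑ B (λ c' → 𝟙 (f c ≟ f c')))
    fibre-squares B f = begin
      ∑ elements (λ t → row t * row t) ≡⟨ ∑-cong elements (λ _ → ∑-*-∑ B B _ _) ⟩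
      ∑ elements (λ t → ∑ B (λ c → ∑ B (λ c' → 𝟙 (f c ≟ t) * 𝟙 (f c' ≟ t)))) ≡⟨ trans (∑-swap elements B _) (∑-cong B (λ _ → ∑-swap elements B _)) ⟩
      ∑ B (λ c → ∑ B (λ c' → ∑ elements (λ t → 𝟙 (f c ≟ t) * 𝟙 (f c' ≟ t)))) ≤⟨ ∑-mono B (λ {c} _ → ∑-mono B (λ {c'} _ → once c c')) ⟩
      ∑ B (λ c → ∑ B (λ c' → 𝟙 (f c ≟ f c'))) ∎
      where
      row : F → ℕ
      row t = ∑ B (λ c → 𝟙 (f c ≟ t))
      common : ∀ c c' t (d : Dec (f c ≡ t)) → 𝟙 d * 𝟙 (f c' ≟ t) ≤ 𝟙 d * 𝟙 (f c ≟ f c')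
      common c c' t (no _) = z≤n
      common c c' t (yes e) = *-monoʳ-≤ 1 (𝟙-mono (f c' ≟ t) (f c ≟ f c') (λ e' → trans e (sym e')))
      once : ∀ c c' → ∑ elements (λ t → 𝟙 (f c ≟ t) * 𝟙 (f c' ≟ t)) ≤ 𝟙 (f c ≟ f c')
      once c c' = begin
        ∑ elements (λ t → 𝟙 (f c ≟ t) * 𝟙 (f c' ≟ t)) ≤⟨ ∑-mono elements (λ {t} _ → common c c' t (f c ≟ t)) ⟩
        ∑ elements (λ t → 𝟙 (f c ≟ t) * 𝟙 (f c ≟ f c')) ≡⟨ ∑-*ʳ elements (𝟙 (f c ≟ f c')) _ ⟩
        ∑ elements (λ t → 𝟙 (f c ≟ t)) * 𝟙 (f c ≟ f c') ≤⟨ *-monoˡ-≤ _ (∑-at-most-one (λ t → f c ≟ t) elements-unique (λ _ _ p q → trans (sym p) q)) ⟩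
        1 * 𝟙 (f c ≟ f c') ≡⟨ *-identityˡ _ ⟩
        𝟙 (f c ≟ f c') ∎

    module _ (B : List F²) (unique-B : Unique B) (Good : F² → F² → Set) (good? : ∀ b c → Dec (Good b c)) where
      private N = length B

      gd : F² → F² → Set
      gd b c = Good b c × b ≢ c

      gd? : ∀ b c → Dec (gd b c)
      gd? b c = good? b c ×-dec ¬? (b ≟² c)

      Q : ℕ
      Q = bisector-energy B gd gd? proj₂

      n : F → ℕ
      n ρ = length (segments B Good good? ρ)

      private
        PP : List Segment
        PP = cartesianProduct B B

        length-PP : ∑ PP (λ _ → 1) ≡ N * N
        length-PP = trans (∑-cartesianProduct B B _) (trans (∑-cong B (λ _ → ∑-const B 1)) (trans (∑-const B (N * 1)) (cong (N *_) (*-identityʳ N))))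

        d : F → Segment → ℕ
        d ρ i = 𝟙 (dist (proj₁ i) (proj₂ i) ≟ ρ)

        n-sum : ∀ ρ → n ρ ≡ ∑ B (λ b → ∑ B (λ c → 𝟙 (dist b c ≟ ρ)))
        n-sum ρ = trans (length-filter-∑ (λ i → dist (proj₁ i) (proj₂ i) ≟ ρ) PP) (∑-cartesianProduct B B (d ρ))

      n-total : ∑ elements n ≤ N * N
      n-total = begin
        ∑ elements n ≡⟨ ∑-cong elements (λ {ρ} _ → length-filter-∑ (λ i → dist (proj₁ i) (proj₂ i) ≟ ρ) PP) ⟩
        ∑ elements (λ ρ → ∑ PP (d ρ)) ≡⟨ ∑-swap elements PP d ⟩
        ∑ PP (λ i → ∑ elements (λ ρ → d ρ i)) ≤⟨ ∑-mono PP (λ {i} _ → ∑-at-most-one (λ ρ → dist (proj₁ i) (proj₂ i) ≟ ρ) elements-unique (λ _ _ p q → trans (sym p) q)) ⟩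
        ∑ PP (λ _ → 1) ≡⟨ length-PP ⟩
        N * N ∎

      private
        𝟙-×-≤ : ∀ {P Q R : Set} (p : Dec P) (q : Dec Q) (r : Dec R) → (P → Q → R) → 𝟙 p * 𝟙 q ≤ 𝟙 r
        𝟙-×-≤ p q r h = 𝟙*-≤ p (λ x → 𝟙-mono q r (h x))

      -- Cauchy-Schwarz over the starting points: two segments of one length from the same point are
      -- an isosceles triple with apex in B. This is where the estimate refers back to itself.
      n²-total : ∑ elements (λ ρ → n ρ * n ρ) ≤ N * isosceles B unique-B B
      n²-total = begin
        ∑ elements (λ ρ → n ρ * n ρ) ≤⟨ ∑-mono elements (λ {ρ} _ → ≤-trans (≤-reflexive (cong₂ _*_ (n-sum ρ) (n-sum ρ))) (square-∑ B (λ b → ∑ B (λ c → 𝟙 (dist b c ≟ ρ))))) ⟩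
        ∑ elements (λ ρ → N * ∑ B (λ b → row ρ b * row ρ b)) ≡⟨ trans (∑-*ˡ elements N _) (cong (N *_) (∑-swap elements B _)) ⟩
        N * ∑ B (λ b → ∑ elements (λ ρ → row ρ b * row ρ b)) ≤⟨ *-monoʳ-≤ N (∑-mono B (λ {b} _ → fibre-squares B (dist b))) ⟩
        N * isosceles B unique-B B ∎
        where
        row : F → F² → ℕ
        row ρ b = ∑ B (λ c → 𝟙 (dist b c ≟ ρ))

      -- Cauchy-Schwarz over the end points: circles of the same radius about different points share
      -- at most two points. With n ρ ≤ N² this makes n ρ of order at most N^(3/2), which keeps the
      -- polynomial degrees below p.
      n²≤ : ∀ ρ → n ρ * n ρ ≤ N * (n ρ + 2 * (N * N))
      n²≤ ρ = begin
        n ρ * n ρ ≡⟨ cong₂ _*_ swapped swapped ⟩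
        ∑ B column * ∑ B column ≤⟨ square-∑ B column ⟩
        N * ∑ B (λ c → column c * column c) ≤⟨ *-monoʳ-≤ N bound ⟩
        N * (n ρ + 2 * (N * N)) ∎
        where
        column : F² → ℕ
        column c = ∑ B (λ b → 𝟙 (dist b c ≟ ρ))
        swapped : n ρ ≡ ∑ B column
        swapped = trans (n-sum ρ) (∑-swap B B _)
        common : ∀ b b' → ∑ B (λ c → 𝟙 (dist b c ≟ ρ) * 𝟙 (dist b' c ≟ ρ)) ≤ 𝟙 (b ≟² b') * ∑ B (λ c → 𝟙 (dist b c ≟ ρ)) + 2
        common b b' with b ≟² b'
        ... | yes refl = ≤-trans (≤-reflexive (trans (∑-cong B (λ {c} _ → 𝟙-square (dist b c ≟ ρ))) (sym (+-identityʳ _)))) (m≤m+n _ 2)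
        ... | no b≢b' = ≤-trans (∑-mono B (λ {c} _ → 𝟙-×-≤ (dist b c ≟ ρ) (dist b' c ≟ ρ) ((dist b c ≟ ρ) ×-dec (dist b' c ≟ ρ)) _,_))
            (∑-at-most-two (λ c → (dist b c ≟ ρ) ×-dec (dist b' c ≟ ρ)) unique-B
              (λ {x} {y} {z} _ _ _ (p , p') (q , q') (r , r') → two-circles b b' x y z b≢b' (trans p (sym q)) (trans p (sym r)) (trans p' (sym q')) (trans p' (sym r'))))
        bound : ∑ B (λ c → column c * column c) ≤ n ρ + 2 * (N * N)
        bound = begin
          ∑ B (λ c → column c * column c) ≡⟨ ∑-cong B (λ _ → ∑-*-∑ B B _ _) ⟩
          ∑ B (λ c → ∑ B (λ b → ∑ B (λ b' → 𝟙 (dist b c ≟ ρ) * 𝟙 (dist b' c ≟ ρ)))) ≡⟨ trans (∑-swap B B _) (∑-cong B (λ _ → ∑-swap B B _)) ⟩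
          ∑ B (λ b → ∑ B (λ b' → ∑ B (λ c → 𝟙 (dist b c ≟ ρ) * 𝟙 (dist b' c ≟ ρ)))) ≤⟨ ∑-mono B (λ {b} _ → ∑-mono B (λ {b'} _ → common b b')) ⟩
          ∑ B (λ b → ∑ B (λ b' → 𝟙 (b ≟² b') * ∑ B (λ c → 𝟙 (dist b c ≟ ρ)) + 2)) ≡⟨ trans (∑-cong B (λ _ → ∑-+ B _ _)) (∑-+ B _ _) ⟩
          ∑ B (λ b → ∑ B (λ b' → 𝟙 (b ≟² b') * ∑ B (λ c → 𝟙 (dist b c ≟ ρ)))) + ∑ B (λ b → ∑ B (λ _ → 2))
            ≤⟨ +-mono-≤ (∑-mono B (λ {b} _ → ≤-trans (≤-reflexive (∑-*ʳ B (∑ B (λ c → 𝟙 (dist b c ≟ ρ))) _))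
                  (≤-trans (*-monoˡ-≤ _ (∑-at-most-one (λ b' → b ≟² b') unique-B (λ _ _ p q → trans (sym p) q))) (≤-reflexive (*-identityˡ _)))))
                (≤-reflexive (trans (∑-cong B (λ _ → ∑-const B 2)) (trans (∑-const B (N * 2)) (reorder N)))) ⟩
          ∑ B (λ b → ∑ B (λ c → 𝟙 (dist b c ≟ ρ))) + 2 * (N * N) ≡⟨ cong (_+ 2 * (N * N)) (n-sum ρ) ⟨
          n ρ + 2 * (N * N) ∎
          where
          reorder : ∀ N → N * (N * 2) ≡ 2 * (N * N)
          reorder = solve-∀

      -- Length 0 is exceptional for the encoding, but by anisotropy its segments are single points.
      edges-zero : edges B Good good? 0# ≤ N * N
      edges-zero = ≤-trans (∑-≤-const Z (length Z * 1) (λ {i} _ → ∑-≤-const Z 1 (λ {j} _ → 𝟙≤1 (edge? B Good good? i j))))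
        (≤-trans (≤-reflexive (cong (length Z *_) (*-identityʳ _))) (*-mono-≤ few few))
        where
        Z = segments B Good good? 0#
        few : n 0# ≤ N
        few = ≤-trans (≤-reflexive (n-sum 0#)) (≤-trans (∑-≤-const B 1 (λ {b} _ → ∑-at-most-one (λ c → dist b c ≟ 0#) unique-B (λ {x} {y} _ _ p q → trans (sym (dist≡0 b x p)) (dist≡0 b y q)))) (≤-reflexive (*-identityʳ N)))

      -- Two pairs (b , c) and (b' , c') with the same bisector are regrouped as the segments (b ,
      -- b') and (c , c'); the reflection exchanges them, so they have the same length.
      Q≤edges : Q ≤ ∑ elements (edges B Good good?)
      Q≤edges = begin
        Q ≡⟨ ∑-cong all-lines (λ {l} _ → cong₂ _*_ (as-pairs l) (as-pairs l)) ⟩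
        ∑ all-lines (λ l → ∑ PP (w l) * ∑ PP (w l)) ≡⟨ ∑-cong all-lines (λ {l} _ → ∑-*-∑ PP PP (w l) (w l)) ⟩
        ∑ all-lines (λ l → ∑ PP (λ x → ∑ PP (λ y → w l x * w l y))) ≡⟨ trans (∑-swap all-lines PP _) (∑-cong PP (λ _ → ∑-swap all-lines PP _)) ⟩
        ∑ PP (λ x → ∑ PP (λ y → ∑ all-lines (λ l → w l x * w l y))) ≤⟨ ∑-mono PP (λ {x} _ → ∑-mono PP (λ {y} _ → same x y)) ⟩
        ∑ PP (λ x → ∑ PP (λ y → 𝟙 (common? x y))) ≡⟨ trans (∑-cong PP (λ _ → ∑-cartesianProduct B B _)) (∑-cartesianProduct B B _) ⟩
        ∑ B (λ b → ∑ B (λ c → ∑ B (λ b' → ∑ B (λ c' → 𝟙 (common? (b , c) (b' , c')))))) ≡⟨ ∑-cong B (λ _ → ∑-swap B B _) ⟩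
        ∑ B (λ b → ∑ B (λ b' → ∑ B (λ c → ∑ B (λ c' → 𝟙 (common? (b , c) (b' , c')))))) ≡⟨ trans (∑-cong PP (λ _ → ∑-cartesianProduct B B _)) (∑-cartesianProduct B B _) ⟨
        ∑ PP (λ j → ∑ PP (λ i → 𝟙 (common? (proj₁ j , proj₁ i) (proj₂ j , proj₂ i)))) ≤⟨ ∑-mono PP (λ {j} _ → ∑-mono PP (λ {i} _ → by-length i j)) ⟩
        ∑ PP (λ j → ∑ PP (λ i → ∑ elements (λ ρ → d ρ i * (d ρ j * 𝟙 (edge? B Good good? i j))))) ≡⟨ trans (∑-swap PP PP _) (trans (∑-cong PP (λ _ → ∑-swap PP elements _)) (∑-swap PP elements _)) ⟩
        ∑ elements (λ ρ → ∑ PP (λ i → ∑ PP (λ j → d ρ i * (d ρ j * 𝟙 (edge? B Good good? i j))))) ≡⟨ ∑-cong elements (λ {ρ} _ → sym (filtered ρ)) ⟩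
        ∑ elements (edges B Good good?) ∎
        where
        on? : ∀ l (x : Segment) → Dec (gd (proj₁ x) (proj₂ x) × bisector (proj₁ x) (proj₂ x) ≡ l)
        on? l x = gd? (proj₁ x) (proj₂ x) ×-dec (bisector (proj₁ x) (proj₂ x) ≟ˡ l)
        w : Line → Segment → ℕ
        w l x = 𝟙 (on? l x)
        as-pairs : ∀ l → weight B gd gd? proj₂ l ≡ ∑ PP (w l)
        as-pairs l = sym (∑-cartesianProduct B B (w l))
        Common : Segment → Segment → Set
        Common x y = (gd (proj₁ x) (proj₂ x) × gd (proj₁ y) (proj₂ y)) × bisector (proj₁ x) (proj₂ x) ≡ bisector (proj₁ y) (proj₂ y)
        common? : ∀ x y → Dec (Common x y)
        common? x y = (gd? (proj₁ x) (proj₂ x) ×-dec gd? (proj₁ y) (proj₂ y)) ×-dec (bisector (proj₁ x) (proj₂ x) ≟ˡ bisector (proj₁ y) (proj₂ y))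
        same : ∀ x y → ∑ all-lines (λ l → w l x * w l y) ≤ 𝟙 (common? x y)
        same x y = begin
          ∑ all-lines (λ l → w l x * w l y) ≤⟨ ∑-mono all-lines (λ {l} _ → pointwise l) ⟩
          ∑ all-lines (λ l → w l x * 𝟙 (common? x y)) ≡⟨ ∑-*ʳ all-lines (𝟙 (common? x y)) _ ⟩
          ∑ all-lines (λ l → w l x) * 𝟙 (common? x y) ≤⟨ *-monoˡ-≤ _ (∑-at-most-one (λ l → on? l x) lines-unique (λ _ _ (_ , p) (_ , q) → trans (sym p) q)) ⟩
          1 * 𝟙 (common? x y) ≡⟨ *-identityˡ _ ⟩
          𝟙 (common? x y) ∎
          where
          pointwise : ∀ l → w l x * w l y ≤ w l x * 𝟙 (common? x y)
          pointwise l = 𝟙*-≤ (on? l x) (λ (g , e) → ≤-trans (𝟙-mono (on? l y) (common? x y) (λ (g' , e') → (g , g') , trans e (sym e')))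
            (≤-reflexive (sym (trans (cong (_* 𝟙 (common? x y)) (𝟙-yes (on? l x) (g , e))) (*-identityˡ _)))))
        by-length : ∀ i j → 𝟙 (common? (proj₁ j , proj₁ i) (proj₂ j , proj₂ i)) ≤ ∑ elements (λ ρ → d ρ i * (d ρ j * 𝟙 (edge? B Good good? i j)))
        by-length i j = 𝟙-≤ (common? (proj₁ j , proj₁ i) (proj₂ j , proj₂ i)) (λ (((g , ne) , (_ , ne')) , e) →
          let ρ = dist (proj₁ i) (proj₂ i) in
          ≤-trans (≤-reflexive (sym (cong₂ _*_ (𝟙-yes (dist (proj₁ i) (proj₂ i) ≟ ρ) refl)
              (cong₂ _*_ (𝟙-yes (dist (proj₁ j) (proj₂ j) ≟ ρ) (Mirror.same-length (mirrored (proj₁ j) (proj₁ i) (proj₂ j) (proj₂ i) ne ne' e)))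
                (𝟙-yes (edge? B Good good? i j) ((ne , ne') , (e , g)))))))
            (term≤∑ (λ ρ → d ρ i * (d ρ j * 𝟙 (edge? B Good good? i j))) (elements-complete ρ)))
        filtered : ∀ ρ → edges B Good good? ρ ≡ ∑ PP (λ i → ∑ PP (λ j → d ρ i * (d ρ j * 𝟙 (edge? B Good good? i j))))
        filtered ρ = trans (∑-filter (λ i → dist (proj₁ i) (proj₂ i) ≟ ρ) PP _) (∑-cong PP (λ {i} _ →
          trans (cong (d ρ i *_) (∑-filter (λ i → dist (proj₁ i) (proj₂ i) ≟ ρ) PP _)) (sym (∑-*ˡ PP (d ρ i) _))))

      module _ (K : ℕ) (2≤K : 2 ≤ K)
          (good : ∀ {b c} → b ∈ B → c ∈ B → Good b c → ∀ Γ → Nondegenerate Γ → OnCircle Γ b → OnCircle Γ c → ¬ (K ≤ count-circle Γ B))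
          (small : ∀ ρ → 30 * side (n ρ) ≤ order) where

        Y : ℕ
        Y = ∑ elements (λ ρ → n ρ * side (n ρ))

        Y²≤ : Y * Y ≤ N * N * (32 * (N * isosceles B unique-B B))
        Y²≤ = ≤-trans (weighted-cauchy-schwarz elements n (λ ρ → side (n ρ))) (*-mono-≤ n-total
          (≤-trans (∑-mono elements (λ {ρ} _ → side-below (n ρ))) (≤-trans (≤-reflexive (∑-*ˡ elements 32 _)) (*-monoʳ-≤ 32 n²-total))))

        Q≤ : Q ≤ N * N + 44 * Y + 2 * K * (N * N)
        Q≤ = begin
          Q ≤⟨ Q≤edges ⟩
          ∑ elements (edges B Good good?) ≤⟨ ∑-mono elements (λ {ρ} _ → per-length ρ (0# ≟ ρ)) ⟩
          ∑ elements (λ ρ → 𝟙 (0# ≟ ρ) * (N * N) + (44 * (n ρ * side (n ρ)) + 2 * K * n ρ))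
            ≡⟨ trans (∑-+ elements _ _) (cong₂ _+_ (∑-*ʳ elements (N * N) _) (trans (∑-+ elements _ _) (cong₂ _+_ (∑-*ˡ elements 44 _) (∑-*ˡ elements (2 * K) n)))) ⟩
          ∑ elements (λ ρ → 𝟙 (0# ≟ ρ)) * (N * N) + (44 * Y + 2 * K * ∑ elements n)
            ≤⟨ +-mono-≤ (≤-trans (*-monoˡ-≤ (N * N) (∑-at-most-one (λ ρ → 0# ≟ ρ) elements-unique (λ _ _ p q → trans (sym p) q))) (≤-reflexive (*-identityˡ _)))
                (+-monoʳ-≤ (44 * Y) (*-monoʳ-≤ (2 * K) n-total)) ⟩
          N * N + (44 * Y + 2 * K * (N * N)) ≡⟨ +-assoc (N * N) _ _ ⟨
          N * N + 44 * Y + 2 * K * (N * N) ∎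
          where
          generic : ∀ ρ → ρ ≢ 0# → edges B Good good? ρ ≤ 44 * (n ρ * side (n ρ)) + 2 * K * n ρ
          generic ρ ρ≢0 = edge-arithmetic order (n ρ) e K (edges B Good good? ρ) (≤-trans (s≤s z≤n) order≥7) (s≤s z≤n) (side-above (n ρ)) (small ρ)
              (edges-bound B Good good? unique-B K 2≤K good ρ ρ≢0 e few M≤order)
            where
            e = side (n ρ)
            δ = box-degree e
            M = crossing-degree e
            δ≤4e : δ ≤ 4 * e
            δ≤4e = +-monoʳ-≤ e (+-monoʳ-≤ e (+-monoʳ-≤ e (≤-trans (s≤s z≤n) (≤-reflexive (sym (+-identityʳ e))))))
            few : (n ρ + n ρ) * δ < e * (e * (e * 1))
            few = begin-strict
              (n ρ + n ρ) * δ ≤⟨ *-monoʳ-≤ (n ρ + n ρ) δ≤4e ⟩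
              (n ρ + n ρ) * (4 * e) ≡⟨ r₁ (n ρ) e ⟩
              8 * n ρ * e <⟨ *-monoˡ-< e (side-above (n ρ)) ⟩
              e * e * e ≡⟨ r₂ e ⟩
              e * (e * (e * 1)) ∎
              where
              r₁ : ∀ n e → (n + n) * (4 * e) ≡ 8 * n * e
              r₁ = solve-∀
              r₂ : ∀ e → e * e * e ≡ e * (e * (e * 1))
              r₂ = solve-∀
            M≤order : 9 + M ≤ order
            M≤order = begin
              9 + M ≡⟨ r₃ e ⟩
              15 * 1 + 15 * e ≤⟨ +-monoˡ-≤ (15 * e) (*-monoʳ-≤ 15 {1} {e} (s≤s z≤n)) ⟩
              15 * e + 15 * e ≡⟨ *-distribʳ-+ e 15 15 ⟨
              30 * e ≤⟨ small ρ ⟩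
              order ∎
              where
              r₃ : ∀ e → let δ = e + (e + (e + 1)) in 9 + (δ + δ + δ + δ + (1 + δ)) ≡ 15 * 1 + 15 * e
              r₃ = solve-∀
          per-length : ∀ ρ (z : Dec (0# ≡ ρ)) → edges B Good good? ρ ≤ 𝟙 z * (N * N) + (44 * (n ρ * side (n ρ)) + 2 * K * n ρ)
          per-length ρ (yes refl) = ≤-trans edges-zero (≤-trans (≤-reflexive (sym (*-identityˡ _))) (m≤m+n _ _))
          per-length ρ (no ne) = generic ρ (λ e → ne (sym e))

  -- Arithmetic of the exponents.

  root-≤ : ∀ k {m n} .{{_ : NonZero k}} → m ^ k ≤ n ^ k → m ≤ n
  root-≤ k h = ≮⇒≥ (λ l → <⇒≱ (^-monoˡ-< k l) h)

  sum-split : ∀ {x} a b → x ≤ a + b → x ≤ 2 * a ⊎ x ≤ 2 * b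
  sum-split {x} a b h with ≤-total a b
  ... | inj₁ l = inj₂ (≤-trans h (≤-trans (+-monoˡ-≤ b l) (≤-reflexive (cong (b +_) (sym (+-identityʳ b))))))
  ... | inj₂ l = inj₁ (≤-trans h (≤-trans (+-monoʳ-≤ a l) (≤-reflexive (cong (a +_) (sym (+-identityʳ a))))))

  rescale : ∀ c j k X → j * k ≡ c → j * (k * X) ≡ c * X
  rescale _ j k X refl = sym (*-assoc j k X)

  square-split : ∀ {T} V k m X → T ≤ 2 * V → V * V ≤ k * X → 4 * k ≤ m → T * T ≤ m * X
  square-split {T} V k m X h v l = begin
    T * T ≤⟨ *-mono-≤ h h ⟩
    2 * V * (2 * V) ≡⟨ e₁ V ⟩
    4 * (V * V) ≤⟨ *-monoʳ-≤ 4 v ⟩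
    4 * (k * X) ≡⟨ *-assoc 4 k X ⟨
    4 * k * X ≤⟨ *-monoˡ-≤ X l ⟩
    m * X ∎
    where
    e₁ : ∀ V → 2 * V * (2 * V) ≡ 4 * (V * V)
    e₁ = solve-∀

  -- T⁴ ≤ k² N⁴ Y² ≤ 32 k² N⁷ T, and one factor T cancels.
  cubeʸ : ∀ k N T Y → T * T ≤ k * (N * N * Y) → Y * Y ≤ N * N * (32 * (N * T)) → T ^ 3 ≤ 32 * (k * k) * N ^ 7
  cubeʸ k N zero Y _ _ = z≤n
  cubeʸ k N T@(suc _) Y h y = *-cancelˡ-≤ T (begin
    T * T ^ 3 ≡⟨ e₁ T ⟩
    T * T * (T * T) ≤⟨ *-mono-≤ h h ⟩
    k * (N * N * Y) * (k * (N * N * Y)) ≡⟨ e₂ k N Y ⟩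
    k * k * N ^ 4 * (Y * Y) ≤⟨ *-monoʳ-≤ (k * k * N ^ 4) y ⟩
    k * k * N ^ 4 * (N * N * (32 * (N * T))) ≡⟨ e₃ k N T ⟩
    T * (32 * (k * k) * N ^ 7) ∎)
    where
    e₁ : ∀ T → T * T ^ 3 ≡ T * T * (T * T)
    e₁ = solve 1 (λ T → T :* T :^ 3 := T :* T :* (T :* T)) refl
    e₂ : ∀ k N Y → k * (N * N * Y) * (k * (N * N * Y)) ≡ k * k * N ^ 4 * (Y * Y)
    e₂ = solve 3 (λ k N Y → k :* (N :* N :* Y) :* (k :* (N :* N :* Y)) := k :* k :* N :^ 4 :* (Y :* Y)) refl
    e₃ : ∀ k N T → k * k * N ^ 4 * (N * N * (32 * (N * T))) ≡ T * (32 * (k * k) * N ^ 7)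
    e₃ = solve 3 (λ k N T → k :* k :* N :^ 4 :* (N :* N :* (con 32 :* (N :* T))) := T :* (con 32 :* (k :* k) :* N :^ 7)) refl

  -- T⁴ ≤ 16 k² N⁹ suffices after division by T when T ≥ N²; for T ≤ N² the bound holds anyway.
  cubeᵏ : ∀ k N T K → 1 ≤ N → K * K ≤ 16 * N → T * T ≤ k * (K * N ^ 4) → T ^ 3 ≤ (1 + 16 * (k * k)) * N ^ 7
  cubeᵏ k N@(suc _) T K 1≤N K² h with ≤-total T (N * N)
  ... | inj₁ l = begin
    T ^ 3 ≤⟨ ^-monoˡ-≤ 3 l ⟩
    (N * N) ^ 3 ≡⟨ e₁ N ⟩
    N ^ 6 ≤⟨ m≤n*m (N ^ 6) N ⟩
    N ^ 7 ≤⟨ m≤m+n _ _ ⟩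
    (1 + 16 * (k * k)) * N ^ 7 ∎
    where
    e₁ : ∀ N → (N * N) ^ 3 ≡ N ^ 6
    e₁ = solve 1 (λ N → (N :* N) :^ 3 := N :^ 6) refl
  ... | inj₂ l = *-cancelˡ-≤ (N * N) (begin
    N * N * T ^ 3 ≤⟨ *-monoˡ-≤ (T ^ 3) l ⟩
    T * T ^ 3 ≡⟨ e₁ T ⟩
    T * T * (T * T) ≤⟨ *-mono-≤ h h ⟩
    k * (K * N ^ 4) * (k * (K * N ^ 4)) ≡⟨ e₂ k K N ⟩
    k * k * N ^ 8 * (K * K) ≤⟨ *-monoʳ-≤ (k * k * N ^ 8) K² ⟩
    k * k * N ^ 8 * (16 * N) ≡⟨ e₃ k N ⟩
    N * N * (16 * (k * k) * N ^ 7) ≤⟨ *-monoʳ-≤ (N * N) (*-monoˡ-≤ (N ^ 7) (n≤1+n (16 * (k * k)))) ⟩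
    N * N * ((1 + 16 * (k * k)) * N ^ 7) ∎)
    where
    e₁ : ∀ T → T * T ^ 3 ≡ T * T * (T * T)
    e₁ = solve 1 (λ T → T :* T :^ 3 := T :* T :* (T :* T)) refl
    e₂ : ∀ k K N → k * (K * N ^ 4) * (k * (K * N ^ 4)) ≡ k * k * N ^ 8 * (K * K)
    e₂ = solve 3 (λ k K N → k :* (K :* N :^ 4) :* (k :* (K :* N :^ 4)) := k :* k :* N :^ 8 :* (K :* K)) refl
    e₃ : ∀ k N → k * k * N ^ 8 * (16 * N) ≡ N * N * (16 * (k * k) * N ^ 7)
    e₃ = solve 2 (λ k N → k :* k :* N :^ 8 :* (con 16 :* N) := N :* N :* (con 16 :* (k :* k) :* N :^ 7)) refl

  -- As before T³ ≤ 32 k² p² N⁵; then (p T)³ ≤ 32 k² p⁵ N⁵, and p⁵ ≤ N⁴ is exactly what turns this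
  -- into N⁹.
  denseʸ : ∀ k c p N T Y → p ^ 5 ≤ N ^ 4 → 32 * (k * k) ≤ c ^ 3 → T * T ≤ k * (p * N * Y) → Y * Y ≤ N * N * (32 * (N * T)) → p * T ≤ c * N ^ 3
  denseʸ k c p N zero Y _ _ _ _ = ≤-trans (≤-reflexive (*-zeroʳ p)) z≤n
  denseʸ k c p N T@(suc _) Y dense c³ h y = root-≤ 3 (begin
    (p * T) ^ 3 ≡⟨ e₀ p T ⟩
    p ^ 3 * T ^ 3 ≤⟨ *-monoʳ-≤ (p ^ 3) cube ⟩
    p ^ 3 * (32 * (k * k) * (p ^ 2 * N ^ 5)) ≡⟨ e₄ k p N ⟩
    32 * (k * k) * (p ^ 5 * N ^ 5) ≤⟨ *-mono-≤ c³ (*-monoˡ-≤ (N ^ 5) dense) ⟩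
    c ^ 3 * (N ^ 4 * N ^ 5) ≡⟨ e₅ c N ⟩
    (c * N ^ 3) ^ 3 ∎)
    where
    e₀ : ∀ p T → (p * T) ^ 3 ≡ p ^ 3 * T ^ 3
    e₀ = solve 2 (λ p T → (p :* T) :^ 3 := p :^ 3 :* T :^ 3) refl
    e₁ : ∀ T → T * T ^ 3 ≡ T * T * (T * T)
    e₁ = solve 1 (λ T → T :* T :^ 3 := T :* T :* (T :* T)) refl
    e₂ : ∀ k p N Y → k * (p * N * Y) * (k * (p * N * Y)) ≡ k * k * (p ^ 2 * N ^ 2) * (Y * Y)
    e₂ = solve 4 (λ k p N Y → k :* (p :* N :* Y) :* (k :* (p :* N :* Y)) := k :* k :* (p :^ 2 :* N :^ 2) :* (Y :* Y)) refl
    e₃ : ∀ k p N T → k * k * (p ^ 2 * N ^ 2) * (N * N * (32 * (N * T))) ≡ T * (32 * (k * k) * (p ^ 2 * N ^ 5))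
    e₃ = solve 4 (λ k p N T → k :* k :* (p :^ 2 :* N :^ 2) :* (N :* N :* (con 32 :* (N :* T))) := T :* (con 32 :* (k :* k) :* (p :^ 2 :* N :^ 5))) refl
    e₄ : ∀ k p N → p ^ 3 * (32 * (k * k) * (p ^ 2 * N ^ 5)) ≡ 32 * (k * k) * (p ^ 5 * N ^ 5)
    e₄ = solve 3 (λ k p N → p :^ 3 :* (con 32 :* (k :* k) :* (p :^ 2 :* N :^ 5)) := con 32 :* (k :* k) :* (p :^ 5 :* N :^ 5)) refl
    e₅ : ∀ c N → c ^ 3 * (N ^ 4 * N ^ 5) ≡ (c * N ^ 3) ^ 3
    e₅ = solve 2 (λ c N → c :^ 3 :* (N :^ 4 :* N :^ 5) := (c :* N :^ 3) :^ 3) refl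
    cube : T ^ 3 ≤ 32 * (k * k) * (p ^ 2 * N ^ 5)
    cube = *-cancelˡ-≤ T (begin
      T * T ^ 3 ≡⟨ e₁ T ⟩
      T * T * (T * T) ≤⟨ *-mono-≤ h h ⟩
      k * (p * N * Y) * (k * (p * N * Y)) ≡⟨ e₂ k p N Y ⟩
      k * k * (p ^ 2 * N ^ 2) * (Y * Y) ≤⟨ *-monoʳ-≤ (k * k * (p ^ 2 * N ^ 2)) y ⟩
      k * k * (p ^ 2 * N ^ 2) * (N * N * (32 * (N * T))) ≡⟨ e₃ k p N T ⟩
      T * (32 * (k * k) * (p ^ 2 * N ^ 5)) ∎)

  denseᵏ : ∀ k c p N T K → p ≤ N → p ^ 5 ≤ N ^ 4 → 16 * (k * k) ≤ c ^ 4 → K * K ≤ 16 * N → T * T ≤ k * (p * (K * N ^ 3)) → p * T ≤ c * N ^ 3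
  denseᵏ k c p N T K p≤N dense c⁴ K² h = root-≤ 4 (begin
    (p * T) ^ 4 ≡⟨ e₁ p T ⟩
    p ^ 4 * (T * T * (T * T)) ≤⟨ *-monoʳ-≤ (p ^ 4) (*-mono-≤ h h) ⟩
    p ^ 4 * (k * (p * (K * N ^ 3)) * (k * (p * (K * N ^ 3)))) ≡⟨ e₂ k p K N ⟩
    k * k * (p * p ^ 5 * N ^ 6) * (K * K) ≤⟨ *-mono-≤ (*-monoʳ-≤ (k * k) (*-monoˡ-≤ (N ^ 6) (*-mono-≤ p≤N dense))) K² ⟩
    k * k * (N * N ^ 4 * N ^ 6) * (16 * N) ≡⟨ e₃ k N ⟩
    16 * (k * k) * N ^ 12 ≤⟨ *-monoˡ-≤ (N ^ 12) c⁴ ⟩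
    c ^ 4 * N ^ 12 ≡⟨ e₄ c N ⟩
    (c * N ^ 3) ^ 4 ∎)
    where
    e₁ : ∀ p T → (p * T) ^ 4 ≡ p ^ 4 * (T * T * (T * T))
    e₁ = solve 2 (λ p T → (p :* T) :^ 4 := p :^ 4 :* (T :* T :* (T :* T))) refl
    e₂ : ∀ k p K N → p ^ 4 * (k * (p * (K * N ^ 3)) * (k * (p * (K * N ^ 3)))) ≡ k * k * (p * p ^ 5 * N ^ 6) * (K * K)
    e₂ = solve 4 (λ k p K N → p :^ 4 :* (k :* (p :* (K :* N :^ 3)) :* (k :* (p :* (K :* N :^ 3)))) := k :* k :* (p :* p :^ 5 :* N :^ 6) :* (K :* K)) refl
    e₃ : ∀ k N → k * k * (N * N ^ 4 * N ^ 6) * (16 * N) ≡ 16 * (k * k) * N ^ 12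
    e₃ = solve 2 (λ k N → k :* k :* (N :* N :^ 4 :* N :^ 6) :* (con 16 :* N) := con 16 :* (k :* k) :* N :^ 12) refl
    e₄ : ∀ c N → c ^ 4 * N ^ 12 ≡ (c * N ^ 3) ^ 4
    e₄ = solve 2 (λ c N → c :^ 4 :* N :^ 12 := (c :* N :^ 3) :^ 4) refl

  energy-split : ∀ N K Q Y → 1 ≤ K → Q ≤ N * N + 44 * Y + 2 * K * (N * N) → Q ≤ 6 * (K * (N * N)) ⊎ Q ≤ 88 * Y
  energy-split N K Q Y 1≤K h = from (sum-split (3 * (K * (N * N))) (44 * Y) (begin
      Q ≤⟨ h ⟩
      N * N + 44 * Y + 2 * K * (N * N) ≡⟨ e₁ (N * N) K (44 * Y) ⟩
      1 * (N * N) + 2 * K * (N * N) + 44 * Y ≤⟨ +-monoˡ-≤ (44 * Y) (+-monoˡ-≤ (2 * K * (N * N)) (*-monoˡ-≤ (N * N) 1≤K)) ⟩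
      K * (N * N) + 2 * K * (N * N) + 44 * Y ≡⟨ e₂ (N * N) K (44 * Y) ⟩
      3 * (K * (N * N)) + 44 * Y ∎))
    where
    e₁ : ∀ N K Y → N + Y + 2 * K * N ≡ 1 * N + 2 * K * N + Y
    e₁ = solve-∀
    e₂ : ∀ N K Y → K * N + 2 * K * N + Y ≡ 3 * (K * N) + Y
    e₂ = solve-∀
    from : Q ≤ 2 * (3 * (K * (N * N))) ⊎ Q ≤ 2 * (44 * Y) → Q ≤ 6 * (K * (N * N)) ⊎ Q ≤ 88 * Y
    from (inj₁ l) = inj₁ (≤-trans l (≤-reflexive (rescale 6 2 3 (K * (N * N)) refl)))
    from (inj₂ l) = inj₂ (≤-trans l (≤-reflexive (rescale 88 2 44 Y refl)))

  abstract
    -- The largest of the constants in the cases of `sparse-bound`. In 352 = 4 * 88 the 4 comes from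
    -- squaring T ≤ 2 V and 88 from Q ≤ 88 Y.
    cube-constant : ℕ
    cube-constant = 32 * (352 * 352)

    cube-constant≥ʸ : 32 * (352 * 352) ≤ cube-constant
    cube-constant≥ʸ = ≤-refl

    cube-constant≥ᵏ : 1 + 16 * (24 * 24) ≤ cube-constant
    cube-constant≥ᵏ = ≤ᵇ⇒≤ (1 + 16 * (24 * 24)) cube-constant _

    cube-constant≥ : 12 ^ 3 ≤ cube-constant
    cube-constant≥ = ≤ᵇ⇒≤ (12 ^ 3) cube-constant _

  sparse-bound : ∀ N K T Q Y V → 1 ≤ N → 1 ≤ K → K * K ≤ 16 * N → T ≤ 6 * (N * N) + V → V * V ≤ N * N * Q →
    Q ≤ N * N + 44 * Y + 2 * K * (N * N) → Y * Y ≤ N * N * (32 * (N * T)) → T ^ 3 ≤ cube-constant * N ^ 7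
  sparse-bound N@(suc _) K T Q Y V 1≤N 1≤K K² t v q y = outer (sum-split (6 * (N * N)) V t)
    where
    r₁ : ∀ N K → N * N * (6 * (K * (N * N))) ≡ 6 * (K * N ^ 4)
    r₁ = solve 2 (λ N K → N :* N :* (con 6 :* (K :* (N :* N))) := con 6 :* (K :* N :^ 4)) refl
    r₂ : ∀ N Y → N * N * (88 * Y) ≡ 88 * (N * N * Y)
    r₂ = solve-∀
    inner : T ≤ 2 * V → Q ≤ 6 * (K * (N * N)) ⊎ Q ≤ 88 * Y → T ^ 3 ≤ cube-constant * N ^ 7
    inner h (inj₁ l) = ≤-trans (cubeᵏ 24 N T K 1≤N K² (square-split {T} V 6 24 (K * N ^ 4) h (≤-trans v (≤-trans (*-monoʳ-≤ (N * N) l) (≤-reflexive (r₁ N K)))) ≤-refl))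
      (*-monoˡ-≤ (N ^ 7) cube-constant≥ᵏ)
    inner h (inj₂ l) = ≤-trans (cubeʸ 352 N T Y (square-split {T} V 88 352 (N * N * Y) h (≤-trans v (≤-trans (*-monoʳ-≤ (N * N) l) (≤-reflexive (r₂ N Y)))) ≤-refl) y) (*-monoˡ-≤ (N ^ 7) cube-constant≥ʸ)
    outer : T ≤ 2 * (6 * (N * N)) ⊎ T ≤ 2 * V → T ^ 3 ≤ cube-constant * N ^ 7
    outer (inj₂ h) = inner h (energy-split N K Q Y 1≤K q)
    outer (inj₁ h) = begin
      T ^ 3 ≤⟨ ^-monoˡ-≤ 3 (≤-trans h (≤-reflexive (rescale 12 2 6 (N * N) refl))) ⟩
      (12 * (N * N)) ^ 3 ≡⟨ r₄ 12 N ⟩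
      12 ^ 3 * N ^ 6 ≤⟨ *-mono-≤ cube-constant≥ (m≤n*m (N ^ 6) N) ⟩
      cube-constant * N ^ 7 ∎
      where
      r₄ : ∀ k N → (k * (N * N)) ^ 3 ≡ k ^ 3 * N ^ 6
      r₄ = solve 2 (λ k N → (k :* (N :* N)) :^ 3 := k :^ 3 :* N :^ 6) refl

  dense⇒≤ : ∀ p N → p ^ 5 ≤ N ^ 4 → p ≤ N
  dense⇒≤ zero N _ = z≤n
  dense⇒≤ p@(suc _) N h = root-≤ 4 (≤-trans (m≤n*m (p ^ 4) p) h)

  -- 252 is the least number whose cube is at least 32 * 704², as `denseʸ` requires. Here 704 = 4 *
  -- 176 and 176 = 2 * 88, the 2 coming from p + 1 ≤ 2 p.
  dense-bound : ∀ p N K T Q Y V G → p ^ 5 ≤ N ^ 4 → 1 ≤ p → 1 ≤ K → K * K ≤ 16 * N → T ≤ 5 * (N * N) + G → p * G ≤ N * (N * N) + V →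
    V * V ≤ p * p * (N * (p + 1)) * Q → Q ≤ N * N + 44 * Y + 2 * K * (N * N) → Y * Y ≤ N * N * (32 * (N * T)) → p * T ≤ 252 * N ^ 3
  dense-bound p@(suc p') N K T Q Y V G dense 1≤p 1≤K K² t g v q y = outer (sum-split (6 * N ^ 3) V (begin
      p * T ≤⟨ *-monoʳ-≤ p t ⟩
      p * (5 * (N * N) + G) ≡⟨ *-distribˡ-+ p (5 * (N * N)) G ⟩
      p * (5 * (N * N)) + p * G ≤⟨ +-mono-≤ (*-monoˡ-≤ (5 * (N * N)) (dense⇒≤ p N dense)) g ⟩
      N * (5 * (N * N)) + (N * (N * N) + V) ≡⟨ r₀ N V ⟩
      6 * N ^ 3 + V ∎))
    where
    r₀ : ∀ N V → N * (5 * (N * N)) + (N * (N * N) + V) ≡ 6 * N ^ 3 + V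
    r₀ = solve 2 (λ N V → N :* (con 5 :* (N :* N)) :+ (N :* (N :* N) :+ V) := con 6 :* N :^ 3 :+ V) refl
    r₁ : ∀ p N K → p * p * (2 * (p * N)) * (6 * (K * (N * N))) ≡ p * p * (12 * (p * (K * N ^ 3)))
    r₁ = solve 3 (λ p N K → p :* p :* (con 2 :* (p :* N)) :* (con 6 :* (K :* (N :* N))) := p :* p :* (con 12 :* (p :* (K :* N :^ 3)))) refl
    r₂ : ∀ p N Y → p * p * (2 * (p * N)) * (88 * Y) ≡ p * p * (176 * (p * N * Y))
    r₂ = solve-∀
    r₃ : ∀ p N → N * (p + p) ≡ 2 * (p * N)
    r₃ = solve-∀
    r₄ : ∀ p k X → p * p * (k * X) ≡ k * (p * p * X)
    r₄ = solve-∀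
    r₅ : ∀ p T → p * p * (T * T) ≡ p * T * (p * T)
    r₅ = solve-∀
    v' : V * V ≤ p * p * (2 * (p * N)) * Q
    v' = ≤-trans v (*-monoˡ-≤ Q (*-monoʳ-≤ (p * p) (≤-trans (*-monoʳ-≤ N (+-monoʳ-≤ p 1≤p)) (≤-reflexive (r₃ p N)))))
    squares : ∀ k X → p * T ≤ 2 * V → V * V ≤ p * p * (k * X) → T * T ≤ 4 * k * X
    squares k X h w = *-cancelˡ-≤ (p * p) (begin
      p * p * (T * T) ≡⟨ r₅ p T ⟩
      p * T * (p * T) ≤⟨ square-split {p * T} V k (4 * k) (p * p * X) h (≤-trans w (≤-reflexive (r₄ p k X))) ≤-refl ⟩
      4 * k * (p * p * X) ≡⟨ r₄ p (4 * k) X ⟨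
      p * p * (4 * k * X) ∎)
    inner : p * T ≤ 2 * V → Q ≤ 6 * (K * (N * N)) ⊎ Q ≤ 88 * Y → p * T ≤ 252 * N ^ 3
    inner h (inj₁ l) = denseᵏ 48 252 p N T K (dense⇒≤ p N dense) dense (≤ᵇ⇒≤ (16 * (48 * 48)) (252 ^ 4) _) K²
      (squares 12 (p * (K * N ^ 3)) h (≤-trans v' (≤-trans (*-monoʳ-≤ (p * p * (2 * (p * N))) l) (≤-reflexive (r₁ p N K)))))
    inner h (inj₂ l) = denseʸ 704 252 p N T Y dense (≤ᵇ⇒≤ (32 * (704 * 704)) (252 ^ 3) _)
      (squares 176 (p * N * Y) h (≤-trans v' (≤-trans (*-monoʳ-≤ (p * p * (2 * (p * N))) l) (≤-reflexive (r₂ p N Y))))) y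
    outer : p * T ≤ 2 * (6 * N ^ 3) ⊎ p * T ≤ 2 * V → p * T ≤ 252 * N ^ 3
    outer (inj₁ h) = ≤-trans h (≤-trans (≤-reflexive (rescale 12 2 6 (N ^ 3) refl)) (*-monoˡ-≤ (N ^ 3) (≤ᵇ⇒≤ 12 252 _)))
    outer (inj₂ h) = inner h (energy-split N K Q Y 1≤K q)

  -- p¹⁶ ≤ (3k²)⁴ N¹² ≤ 16³ (3k²)⁴ p¹⁵.
  small-order : ∀ k p n N → p * p ≤ k * n → n * n ≤ N * (n + 2 * (N * N)) → n ≤ N * N → N ^ 4 ≤ 16 * p ^ 5 → 1 ≤ p → p ≤ 16 ^ 3 * (3 * (k * k)) ^ 4
  small-order k p@(suc _) n N p² n² n≤ N⁴ _ = *-cancelˡ-≤ (p ^ 15) {{m^n≢0 p 15}} (begin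
    p ^ 15 * p ≡⟨ e₁ p ⟩
    (p * p * (p * p)) ^ 4 ≤⟨ ^-monoˡ-≤ 4 fourth ⟩
    (3 * (k * k) * N ^ 3) ^ 4 ≡⟨ e₂ (3 * (k * k)) N ⟩
    (3 * (k * k)) ^ 4 * (N ^ 4) ^ 3 ≤⟨ *-monoʳ-≤ ((3 * (k * k)) ^ 4) (^-monoˡ-≤ 3 N⁴) ⟩
    (3 * (k * k)) ^ 4 * (16 * p ^ 5) ^ 3 ≡⟨ e₃ ((3 * (k * k)) ^ 4) 16 p ⟩
    p ^ 15 * (16 ^ 3 * (3 * (k * k)) ^ 4) ∎)
    where
    e₁ : ∀ p → p ^ 15 * p ≡ (p * p * (p * p)) ^ 4
    e₁ = solve 1 (λ p → p :^ 15 :* p := (p :* p :* (p :* p)) :^ 4) refl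
    e₂ : ∀ c N → (c * N ^ 3) ^ 4 ≡ c ^ 4 * (N ^ 4) ^ 3
    e₂ = solve 2 (λ c N → (c :* N :^ 3) :^ 4 := c :^ 4 :* (N :^ 4) :^ 3) refl
    e₃ : ∀ c d p → c * (d * p ^ 5) ^ 3 ≡ p ^ 15 * (d ^ 3 * c)
    e₃ = solve 3 (λ c d p → c :* (d :* p :^ 5) :^ 3 := p :^ 15 :* (d :^ 3 :* c)) refl
    e₄ : ∀ k n → k * n * (k * n) ≡ k * k * (n * n)
    e₄ = solve-∀
    e₅ : ∀ k N → k * k * (N * (N * N + 2 * (N * N))) ≡ 3 * (k * k) * N ^ 3
    e₅ = solve 2 (λ k N → k :* k :* (N :* (N :* N :+ con 2 :* (N :* N))) := con 3 :* (k :* k) :* N :^ 3) refl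
    fourth : p * p * (p * p) ≤ 3 * (k * k) * N ^ 3
    fourth = begin
      p * p * (p * p) ≤⟨ *-mono-≤ p² p² ⟩
      k * n * (k * n) ≡⟨ e₄ k n ⟩
      k * k * (n * n) ≤⟨ *-monoʳ-≤ (k * k) (≤-trans n² (*-monoʳ-≤ N (+-monoˡ-≤ (2 * (N * N)) n≤))) ⟩
      k * k * (N * (N * N + 2 * (N * N))) ≡⟨ e₅ k N ⟩
      3 * (k * k) * N ^ 3 ∎

  abstract
    side-constant : ℕ
    side-constant = 900 * 32

    900*32≤side-constant : ∀ n → 900 * (32 * n) ≤ side-constant * n
    900*32≤side-constant n = ≤-reflexive (sym (*-assoc 900 32 n))

  -- The power is the bound of `small-order`; the summand 30 covers n = 0, where the side is 1.
  threshold : ℕ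
  threshold = 30 + 16 ^ 3 * (3 * (side-constant * side-constant)) ^ 4

  -- If 30 e exceeded p, then p² ≤ 900 e² ≤ 900 * 32 n. But n grows at most like N^(3/2), hence like
  -- p^(15/8), which bounds p.
  side-small : ∀ p n N e → threshold < p → n * n ≤ N * (n + 2 * (N * N)) → n ≤ N * N → N ^ 4 ≤ 16 * p ^ 5 → 1 ≤ n → n * (e * e) ≤ 32 * (n * n) → 30 * e ≤ p
  side-small p n@(suc _) N e large n² n≤ N⁴ _ e² = ≮⇒≥ (λ p<30e → <⇒≱ large (≤-trans
      (small-order side-constant p n N (p² (<⇒≤ p<30e)) n² n≤ N⁴ (≤-trans (s≤s z≤n) large)) (m≤n+m _ 30)))
    where
    e₁ : ∀ e → 30 * e * (30 * e) ≡ 900 * (e * e)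
    e₁ = solve-∀
    e₂ : ∀ n → 32 * (n * n) ≡ n * (32 * n)
    e₂ = solve-∀
    p² : p ≤ 30 * e → p * p ≤ side-constant * n
    p² h = begin
      p * p ≤⟨ *-mono-≤ h h ⟩
      30 * e * (30 * e) ≡⟨ e₁ e ⟩
      900 * (e * e) ≤⟨ *-monoʳ-≤ 900 (*-cancelˡ-≤ n (≤-trans e² (≤-reflexive (e₂ n)))) ⟩
      900 * (32 * n) ≤⟨ 900*32≤side-constant n ⟩
      side-constant * n ∎

  products-sparse-arithmetic : ∀ C N P T → 1 ≤ N → N * (N * N) ≤ P * T → T ^ 3 ≤ C * N ^ 7 → N * N ≤ C * P ^ 3
  products-sparse-arithmetic C N@(suc _) P T _ h t = *-cancelˡ-≤ (N ^ 7) {{m^n≢0 N 7}} (begin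
    N ^ 7 * (N * N) ≡⟨ e₁ N ⟩
    (N * (N * N)) ^ 3 ≤⟨ ^-monoˡ-≤ 3 h ⟩
    (P * T) ^ 3 ≡⟨ e₂ P T ⟩
    P ^ 3 * T ^ 3 ≤⟨ *-monoʳ-≤ (P ^ 3) t ⟩
    P ^ 3 * (C * N ^ 7) ≡⟨ e₃ (P ^ 3) C (N ^ 7) ⟩
    N ^ 7 * (C * P ^ 3) ∎)
    where
    e₁ : ∀ N → N ^ 7 * (N * N) ≡ (N * (N * N)) ^ 3
    e₁ = solve 1 (λ N → N :^ 7 :* (N :* N) := (N :* (N :* N)) :^ 3) refl
    e₂ : ∀ P T → (P * T) ^ 3 ≡ P ^ 3 * T ^ 3
    e₂ = solve 2 (λ P T → (P :* T) :^ 3 := P :^ 3 :* T :^ 3) refl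
    e₃ : ∀ P C N → P * (C * N) ≡ N * (C * P)
    e₃ = solve-∀

  products-dense-arithmetic : ∀ C p N P T → 1 ≤ N → N * (N * N) ≤ P * T → p * T ≤ C * N ^ 3 → p ≤ C * P
  products-dense-arithmetic C p N@(suc _) P T _ h t = *-cancelˡ-≤ (N ^ 3) {{m^n≢0 N 3}} (begin
    N ^ 3 * p ≡⟨ e₁ N p ⟩
    p * (N * (N * N)) ≤⟨ *-monoʳ-≤ p h ⟩
    p * (P * T) ≡⟨ e₂ p P T ⟩
    P * (p * T) ≤⟨ *-monoʳ-≤ P t ⟩
    P * (C * N ^ 3) ≡⟨ e₃ P C (N ^ 3) ⟩
    N ^ 3 * (C * P) ∎)
    where
    e₁ : ∀ N p → N ^ 3 * p ≡ p * (N * (N * N))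
    e₁ = solve 2 (λ N p → N :^ 3 :* p := p :* (N :* (N :* N))) refl
    e₂ : ∀ p P T → p * (P * T) ≡ P * (p * T)
    e₂ = solve-∀
    e₃ : ∀ P C N → P * (C * N) ≡ N * (C * P)
    e₃ = solve-∀

  -- A multiple of √N, large enough for `incidence-arithmetic` and small enough for the term K N² in
  -- the energy.
  richness : ℕ → ℕ
  richness N = 2 * suc (SquareRoot.root (√ N))

  richness-above : ∀ N → 4 * N ≤ richness N * richness N
  richness-above N = ≤-trans (*-monoʳ-≤ 4 (<⇒≤ (SquareRoot.above (√ N)))) (≤-reflexive (square (suc (SquareRoot.root (√ N)))))
    where
    square : ∀ r → 4 * (r * r) ≡ 2 * r * (2 * r)
    square = solve-∀

  root-positive : ∀ N → 1 ≤ N → 1 ≤ SquareRoot.root (√ N)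
  root-positive N 1≤N = from (√ N)
    where
    from : (r : SquareRoot N) → 1 ≤ SquareRoot.root r
    from (square-root zero _ a) = ⊥-elim (<⇒≱ a 1≤N)
    from (square-root (suc _) _ _) = s≤s z≤n

  richness-below : ∀ N → 1 ≤ N → richness N * richness N ≤ 16 * N
  richness-below N 1≤N = begin
    2 * suc r * (2 * suc r) ≤⟨ *-mono-≤ (*-monoʳ-≤ 2 1+r≤2r) (*-monoʳ-≤ 2 1+r≤2r) ⟩
    2 * (2 * r) * (2 * (2 * r)) ≡⟨ square r ⟩
    16 * (r * r) ≤⟨ *-monoʳ-≤ 16 (SquareRoot.below (√ N)) ⟩
    16 * N ∎
    where
    r = SquareRoot.root (√ N)
    square : ∀ r → 2 * (2 * r) * (2 * (2 * r)) ≡ 16 * (r * r)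
    square = solve-∀
    1+r≤2r : suc r ≤ 2 * r
    1+r≤2r = ≤-trans (≤-reflexive (+-comm 1 r)) (+-monoʳ-≤ r (≤-trans (root-positive N 1≤N) (≤-reflexive (sym (+-identityʳ r)))))

  -- From isosceles triples to the number of products.

  module ParaboloidProducts (𝔽 : FiniteField) where
    open FieldTheory 𝔽 using (F; _≟_; elements; elements-complete; elements-unique; order; order≥7)
    open Surfaces 𝔽 using (F²)
    open PlaneGeometry 𝔽
    open Segments 𝔽
    open LinesOfPlane 𝔽
    open Inversion 𝔽
    open Counting 𝔽
    open BisectorWeights 𝔽
    open BisectorEnergy 𝔽

    module _ (B : List F²) (unique-B : Unique B) (nonzero : ∀ {b} → b ∈ B → b ≢ 0²) where
      private N = length B

      pins : List F²
      pins = map pin B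

      pins-unique : Unique pins
      pins-unique = unique-map pin B unique-B (λ {x} {y} x∈ y∈ e → pin-injective x y (nonzero x∈) (nonzero y∈) e)

      -- `Hit` may be larger than the set of products of `B`, so that `B` can be a subset of the
      -- points whose products are counted.
      module _ (Hit : F → Set) (hit? : ∀ t → Dec (Hit t)) (hits : ∀ {b c} → b ∈ B → c ∈ B → Hit (paraboloid-product b c)) where
        Π : ℕ
        Π = ∑ elements (λ t → 𝟙 (hit? t))

        -- For each b the N products take at most Π values, so Cauchy-Schwarz gives N² / Π
        -- collisions, and by `dist-pin-cong` each is an isosceles triple with apex `pin b`.
        N³≤Π*isosceles : N * (N * N) ≤ Π * isosceles B unique-B pins
        N³≤Π*isosceles = begin
          N * (N * N) ≡⟨ ∑-const B (N * N) ⟨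
          ∑ B (λ _ → N * N) ≤⟨ ∑-mono B per-point ⟩
          ∑ B (λ b → Π * collisions b) ≡⟨ ∑-*ˡ B Π collisions ⟩
          Π * ∑ B collisions ≤⟨ *-monoʳ-≤ Π (∑-mono B (λ {b} b∈ → ∑-mono B (λ {c} _ → ∑-mono B (λ {c'} _ →
            𝟙-mono (paraboloid-product b c ≟ paraboloid-product b c') (dist (pin b) c ≟ dist (pin b) c')
              (dist-pin-cong b c c' (nonzero b∈)))))) ⟩
          Π * ∑ B (λ b → ∑ B (λ c → ∑ B (λ c' → 𝟙 (dist (pin b) c ≟ dist (pin b) c')))) ≡⟨ cong (Π *_) (∑-map pin B _) ⟨
          Π * isosceles B unique-B pins ∎
          where
          collisions : F² → ℕ
          collisions b = ∑ B (λ c → ∑ B (λ c' → 𝟙 (paraboloid-product b c ≟ paraboloid-product b c')))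
          per-point : ∀ {b} → b ∈ B → N * N ≤ Π * collisions b
          per-point {b} b∈ = begin
            N * N ≡⟨ cong₂ _*_ total total ⟩
            ∑ elements (λ t → 𝟙 (hit? t) * r t) * ∑ elements (λ t → 𝟙 (hit? t) * r t) ≤⟨ cauchy-schwarz elements (λ t → 𝟙 (hit? t)) r ⟩
            ∑ elements (λ t → 𝟙 (hit? t) * 𝟙 (hit? t)) * ∑ elements (λ t → r t * r t) ≤⟨ *-mono-≤ (≤-reflexive (∑-cong elements (λ {t} _ → 𝟙-square (hit? t)))) pairs ⟩
            Π * collisions b ∎
            where
            f : F² → F
            f = paraboloid-product b
            r : F → ℕ
            r t = ∑ B (λ c → 𝟙 (f c ≟ t))
            total : N ≡ ∑ elements (λ t → 𝟙 (hit? t) * r t)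
            total = begin-equality
              N ≡⟨ *-identityʳ N ⟨
              N * 1 ≡⟨ ∑-const B 1 ⟨
              ∑ B (λ _ → 1) ≡⟨ ∑-cong B (λ {c} c∈ → sym (∑-exactly-one (λ t → f c ≟ t) elements-unique (elements-complete (f c)) refl (λ _ e → e))) ⟩
              ∑ B (λ c → ∑ elements (λ t → 𝟙 (f c ≟ t))) ≡⟨ ∑-cong B (λ {c} c∈ → ∑-cong elements (λ {t} _ → absorb c∈ t (f c ≟ t))) ⟩
              ∑ B (λ c → ∑ elements (λ t → 𝟙 (hit? t) * 𝟙 (f c ≟ t))) ≡⟨ ∑-swap B elements _ ⟩
              ∑ elements (λ t → ∑ B (λ c → 𝟙 (hit? t) * 𝟙 (f c ≟ t))) ≡⟨ ∑-cong elements (λ {t} _ → ∑-*ˡ B (𝟙 (hit? t)) _) ⟩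
              ∑ elements (λ t → 𝟙 (hit? t) * r t) ∎
              where
              absorb : ∀ {c} → c ∈ B → ∀ t (d : Dec (f c ≡ t)) → 𝟙 d ≡ 𝟙 (hit? t) * 𝟙 d
              absorb c∈ t (no _) = sym (*-zeroʳ (𝟙 (hit? t)))
              absorb c∈ t (yes refl) = sym (trans (*-identityʳ _) (𝟙-yes (hit? t) (hits b∈ c∈)))
            pairs : ∑ elements (λ t → r t * r t) ≤ collisions b
            pairs = fibre-squares B f

        module _ (1≤N : 1 ≤ N) (N⁴≤16p⁵ : N ^ 4 ≤ 16 * order ^ 5) (large : threshold < order) where
          private
            K = richness N
            3≤K : 3 ≤ K
            3≤K = ≤-trans (n≤1+n 3) (*-monoʳ-≤ 2 {2} (s≤s (root-positive N 1≤N)))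
            1≤K : 1 ≤ K
            1≤K = ≤-trans (s≤s z≤n) 3≤K
            Gd = Good B unique-B K 3≤K (richness-above N)
            gd?' = good? B unique-B K 3≤K (richness-above N)
            T₀ = isosceles B unique-B B
            energy = Q B unique-B Gd gd?'
            nρ = n B unique-B Gd gd?'

            n≤N² : ∀ ρ → nρ ρ ≤ N * N
            n≤N² ρ = ≤-trans (term≤∑ nρ (elements-complete ρ)) (n-total B unique-B Gd gd?')

            small : ∀ ρ → 30 * side (nρ ρ) ≤ order
            small ρ = from (nρ ρ) (n²≤ B unique-B Gd gd?' ρ) (n≤N² ρ)
              where
              from : ∀ n → n * n ≤ N * (n + 2 * (N * N)) → n ≤ N * N → 30 * side n ≤ order
              from zero _ _ = ≤-trans (m≤m+n 30 _) (<⇒≤ large)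
              from n@(suc _) h h' = side-small order n N (side n) large h h' N⁴≤16p⁵ (s≤s z≤n) (side-below n)

            y : ℕ
            y = Y B unique-B Gd gd?' K (≤-trans (n≤1+n 2) 3≤K) (good-property B unique-B K 3≤K (richness-above N)) small

            y² : y * y ≤ N * N * (32 * (N * T₀))
            y² = Y²≤ B unique-B Gd gd?' K (≤-trans (n≤1+n 2) 3≤K) (good-property B unique-B K 3≤K (richness-above N)) small

            energy≤ : energy ≤ N * N + 44 * y + 2 * K * (N * N)
            energy≤ = Q≤ B unique-B Gd gd?' K (≤-trans (n≤1+n 2) 3≤K) (good-property B unique-B K 3≤K (richness-above N)) small

          -- `T₀≤T` closes the circle: Y is bounded through the triples with apex in B, and they
          -- must not outnumber those with apex in A. If they outnumber those of the pins, the
          -- choice A = B bounds both.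
          module _ (A : List F²) (unique-A : Unique A) (length-A : length A ≡ N) (T₀≤T : T₀ ≤ isosceles B unique-B A) where
            private
              module P = Pins B unique-B K 3≤K (richness-above N) A unique-A length-A
              T = isosceles B unique-B A
              G = good-sum B (gd B unique-B Gd gd?') (gd? B unique-B Gd gd?') proj₂ A unique-A length-A

              y²' : y * y ≤ N * N * (32 * (N * T))
              y²' = ≤-trans y² (*-monoʳ-≤ (N * N) (*-monoʳ-≤ 32 (*-monoʳ-≤ N T₀≤T)))

              good-triples≤G : P.good-triples ≤ G
              good-triples≤G = ∑-mono A (λ {a} _ → ∑-mono B (λ {b} _ → ∑-mono B (λ {c} _ →
                𝟙-mono (gd?' b c ×-dec P.equal? a b c) (gd? B unique-B Gd gd?' b c ×-dec (dist a b ≟ dist a c)) (λ (g , ne , e) → (g , ne) , e))))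

              T≤ : T ≤ 5 * (N * N) + G
              T≤ = begin
                T ≤⟨ P.isosceles-split ⟩
                N * N + P.bad-triples + P.good-triples ≤⟨ +-mono-≤ (+-monoʳ-≤ (N * N) P.bad-triples≤4N²) good-triples≤G ⟩
                5 * (N * N) + G ∎

            isosceles-sparse : T ^ 3 ≤ cube-constant * N ^ 7
            isosceles-sparse = from (small-bound B (gd B unique-B Gd gd?') (gd? B unique-B Gd gd?') proj₂ A unique-A length-A)
              where
              from : (Σ ℕ λ V → G ≤ N * N + V × V * V ≤ N * N * energy) → T ^ 3 ≤ cube-constant * N ^ 7
              from (V , g , v) = sparse-bound N K T energy y V 1≤N 1≤K (richness-below N 1≤N)
                (≤-trans T≤ (≤-trans (+-monoʳ-≤ (5 * (N * N)) g) (≤-reflexive (six (N * N) V)))) v energy≤ y²'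
                where
                six : ∀ M V → 5 * M + (M + V) ≡ 6 * M + V
                six = solve-∀

            isosceles-dense : order ^ 5 ≤ N ^ 4 → order * T ≤ 252 * N ^ 3
            isosceles-dense dense = from (large-bound B (gd B unique-B Gd gd?') (gd? B unique-B Gd gd?') proj₂ A unique-A length-A)
              where
              from : (Σ ℕ λ V → order * G ≤ N * (N * N) + V × V * V ≤ order * order * (N * (order + 1)) * energy) → order * T ≤ 252 * N ^ 3
              from (V , g , v) = dense-bound order N K T energy y V G dense (≤-trans (s≤s z≤n) order≥7) 1≤K (richness-below N 1≤N) T≤ g v energy≤ y²'

          private
            Tᴬ = isosceles B unique-B pins
            length-pins : length pins ≡ N
            length-pins = Listₚ.length-map pin B

          products-sparse : N * N ≤ cube-constant * Π ^ 3
          products-sparse = products-sparse-arithmetic cube-constant N Π Tᴬ 1≤N N³≤Π*isosceles (from (≤-total T₀ Tᴬ))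
            where
            from : T₀ ≤ Tᴬ ⊎ Tᴬ ≤ T₀ → Tᴬ ^ 3 ≤ cube-constant * N ^ 7
            from (inj₁ l) = isosceles-sparse pins pins-unique length-pins l
            from (inj₂ l) = ≤-trans (^-monoˡ-≤ 3 l) (isosceles-sparse B unique-B refl ≤-refl)

          products-dense : order ^ 5 ≤ N ^ 4 → order ≤ 252 * Π
          products-dense dense = products-dense-arithmetic 252 order N Π Tᴬ 1≤N N³≤Π*isosceles (from (≤-total T₀ Tᴬ))
            where
            from : T₀ ≤ Tᴬ ⊎ Tᴬ ≤ T₀ → order * Tᴬ ≤ 252 * N ^ 3
            from (inj₁ l) = isosceles-dense pins pins-unique length-pins l dense
            from (inj₂ l) = ≤-trans (*-monoʳ-≤ order l) (isosceles-dense B unique-B refl ≤-refl dense)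

  -- An integer approximation of p^(5/4).

  record QuarterPower (p : ℕ) : Set where
    constructor quarter-power
    field
      floor : ℕ
      floor-below : floor ^ 4 ≤ p ^ 5
      floor-above : p ^ 5 ≤ suc floor ^ 4

  quarter-power-of : ∀ p → QuarterPower p
  quarter-power-of p = from (√ (p ^ 5))
    where
    fourth : ∀ k → k ^ 4 ≡ k * k * (k * k)
    fourth = solve 1 (λ k → k :^ 4 := k :* k :* (k :* k)) refl
    from : SquareRoot (p ^ 5) → QuarterPower p
    from (square-root s s² s²<) = from' (√ s)
      where
      from' : SquareRoot s → QuarterPower p
      from' (square-root k k² k²<) = quarter-power k
        (begin k ^ 4 ≡⟨ fourth k ⟩ k * k * (k * k) ≤⟨ *-mono-≤ k² k² ⟩ s * s ≤⟨ s² ⟩ p ^ 5 ∎)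
        (begin p ^ 5 ≤⟨ <⇒≤ s²< ⟩ suc s * suc s ≤⟨ *-mono-≤ k²< k²< ⟩ suc k * suc k * (suc k * suc k) ≡⟨ fourth (suc k) ⟨ suc k ^ 4 ∎)

  module QuarterPowers {p : ℕ} (7≤p : 7 ≤ p) (q : QuarterPower p) where
    open QuarterPower q

    1≤floor : 1 ≤ floor
    1≤floor = from floor floor-above
      where
      from : ∀ k → p ^ 5 ≤ suc k ^ 4 → 1 ≤ k
      from zero h = ⊥-elim (<⇒≱ (≤-trans (s≤s (s≤s z≤n)) 7≤p) (root-≤ 5 {p} {1} h))
      from (suc _) _ = s≤s z≤n

    next≤ : suc floor ^ 4 ≤ 16 * p ^ 5
    next≤ = begin
      suc floor ^ 4 ≤⟨ ^-monoˡ-≤ 4 (≤-trans (+-monoˡ-≤ floor 1≤floor) (≤-reflexive (double floor))) ⟩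
      (2 * floor) ^ 4 ≡⟨ fourth floor ⟩
      16 * floor ^ 4 ≤⟨ *-monoʳ-≤ 16 floor-below ⟩
      16 * p ^ 5 ∎
      where
      double : ∀ k → k + k ≡ 2 * k
      double = solve-∀
      fourth : ∀ k → (2 * k) ^ 4 ≡ 16 * k ^ 4
      fourth = solve 1 (λ k → (con 2 :* k) :^ 4 := con 16 :* k :^ 4) refl

    -- 81 = 3⁴: three times `floor` leaves room for rounding up and for removing the origin.
    next≤size : ∀ {e m} → 81 * p ^ 5 ≤ e ^ 4 → e ≤ suc m → suc floor ≤ m
    next≤size {e} {m} h l = ≤-pred (begin
      2 + floor ≤⟨ +-monoˡ-≤ floor (*-monoʳ-≤ 2 1≤floor) ⟩
      2 * floor + floor ≡⟨ triple floor ⟩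
      3 * floor ≤⟨ root-≤ 4 {3 * floor} {e} (begin
        (3 * floor) ^ 4 ≡⟨ fourth floor ⟩
        81 * floor ^ 4 ≤⟨ *-monoʳ-≤ 81 floor-below ⟩
        81 * p ^ 5 ≤⟨ h ⟩
        e ^ 4 ∎) ⟩
      e ≤⟨ l ⟩
      suc m ∎)
      where
      triple : ∀ k → 2 * k + k ≡ 3 * k
      triple = solve-∀
      fourth : ∀ k → (3 * k) ^ 4 ≡ 81 * k ^ 4
      fourth = solve 1 (λ k → (con 3 :* k) :^ 4 := con 81 :* k :^ 4) refl

open Estimates

-- -1 is not a square modulo n ≡ 3 (mod 4).

module Descent where
  open import Data.Nat hiding (_≟_)
  open import Data.Nat.Properties hiding (_≟_)
  open import Data.Nat.DivMod using (_/_; m≡m%n+[m/n]*n; [m+kn]%n≡m%n)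
  open ≤-Reasoning

  even-or-odd : ∀ n → (Σ ℕ λ k → n ≡ 2 * k) ⊎ (Σ ℕ λ k → n ≡ suc (2 * k))
  even-or-odd zero = inj₁ (0 , refl)
  even-or-odd (suc n) with even-or-odd n
  ... | inj₁ (k , refl) = inj₂ (k , refl)
  ... | inj₂ (k , refl) = inj₁ (suc k , step k)
    where
    step : ∀ k → suc (suc (2 * k)) ≡ 2 * suc k
    step = solve-∀

  -- 3 is its own inverse modulo 4. The left side is x² + 1 for even x.
  residue-product : ∀ n m k → n % 4 ≡ 3 → 4 * k + 1 ≡ n * m → m % 4 ≡ 3
  residue-product n m k n≡3 e = cases (m % 4) (m%n<n m 4) (begin-equality
    (3 * (m % 4)) % 4 ≡⟨ cong (λ z → (z * (m % 4)) % 4) n≡3 ⟨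
    (n % 4 * (m % 4)) % 4 ≡⟨ %-distribˡ-* n m 4 ⟨
    (n * m) % 4 ≡⟨ cong (_% 4) e ⟨
    (4 * k + 1) % 4 ≡⟨ cong (_% 4) (trans (+-comm (4 * k) 1) (cong (1 +_) (*-comm 4 k))) ⟩
    (1 + k * 4) % 4 ≡⟨ [m+kn]%n≡m%n 1 k 4 ⟩
    1 ∎)
    where
    cases : ∀ r → r < 4 → (3 * r) % 4 ≡ 1 → r ≡ 3
    cases 0 _ ()
    cases 1 _ ()
    cases 2 _ ()
    cases 3 _ _ = refl
    cases (suc (suc (suc (suc _)))) (s≤s (s≤s (s≤s (s≤s ())))) _

  -- Descent: an even x < n with x² + 1 = n m forces m ≡ 3 (mod 4) and m < n.
  ¬∣x²+1 : ∀ n → n % 4 ≡ 3 → ∀ x → ¬ n ∣ x * x + 1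
  ¬∣x²+1 = <-rec _ λ n rec n≡3 x d → main n rec n≡3 x d
    where
    main : ∀ n → (∀ {m} → m < n → m % 4 ≡ 3 → ∀ x → ¬ m ∣ x * x + 1) → n % 4 ≡ 3 → ∀ x → ¬ n ∣ x * x + 1
    main zero rec () x d
    main n@(suc n-1) rec n≡3 x d = reduced (x % n) (m%n<n x n)
        (∣m+n∣m⇒∣n (subst (n ∣_) (trans (cong (λ z → z * z + 1) (m≡m%n+[m/n]*n x n)) (expand (x % n) (x / n) n)) d) (m∣m*n (2 * (x % n) * (x / n) + x / n * (x / n) * n)))
      where
      expand : ∀ r q n → (r + q * n) * (r + q * n) + 1 ≡ n * (2 * r * q + q * q * n) + (r * r + 1)
      expand = solve-∀
      reflect : ∀ r s → (r + s) * (r + s) + (r * r + 1) ≡ (r + s) * (2 * r) + (s * s + 1)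
      reflect = solve-∀
      even : ∀ k → 2 * k < n → n ∣ 2 * k * (2 * k) + 1 → ⊥
      even k k<n (divides m e) = rec {m} m<n (residue-product n m (k * k) n≡3 (trans (four k) (trans e (*-comm m n)))) (2 * k) (subst (m ∣_) (sym e) (m∣m*n n))
        where
        four : ∀ k → 4 * (k * k) + 1 ≡ 2 * k * (2 * k) + 1
        four = solve-∀
        m<n : m < n
        m<n = ≰⇒> (λ n≤m → <⇒≱ (begin-strict
          2 * k * (2 * k) + 1 ≤⟨ +-monoˡ-≤ 1 (*-mono-≤ (≤-pred k<n) (≤-pred k<n)) ⟩
          n-1 * n-1 + 1 <⟨ square n-1 1≤n-1 ⟩
          n * n ∎) (≤-trans (*-monoˡ-≤ n n≤m) (≤-reflexive (sym e))))
          where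
          1≤n-1 : 1 ≤ n-1
          1≤n-1 = go n-1 n≡3
            where
            go : ∀ j → suc j % 4 ≡ 3 → 1 ≤ j
            go zero ()
            go (suc _) _ = s≤s z≤n
          square : ∀ j → 1 ≤ j → j * j + 1 < suc j * suc j
          square j 1≤j = ≤-trans (+-monoʳ-≤ (suc (j * j)) (≤-trans 1≤j (m≤m+n j (j + 0)))) (≤-reflexive (sq j))
            where
            sq : ∀ j → suc (j * j) + 2 * j ≡ suc j * suc j
            sq = solve-∀
      reduced : ∀ r → r < n → n ∣ r * r + 1 → ⊥
      reduced r r<n d with even-or-odd r
      ... | inj₁ (k , refl) = even k r<n d
      -- As n is odd, n - r is even for odd r, and its square plus 1 is still divisible by n.
      ... | inj₂ (k , refl) with even-or-odd (n ∸ suc (2 * k))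
      ...   | inj₁ (j , e) = even j (≤-trans (s≤s (≤-reflexive (sym e))) (s≤s (m∸n≤m n-1 (2 * k))))
              (subst (λ z → n ∣ z * z + 1) e (∣m+n∣m⇒∣n {n} {n * (2 * o)} (subst (n ∣_) reflected (∣m∣n⇒∣m+n {n} (m∣m*n n) d)) (m∣m*n (2 * o))))
        where
        s = n ∸ suc (2 * k)
        o = suc (2 * k)
        n≡ : suc (2 * k) + s ≡ n
        n≡ = m+[n∸m]≡n (<⇒≤ r<n)
        reflected : n * n + (r * o + 1) ≡ n * (2 * o) + (s * s + 1)
        reflected = subst (λ z → z * z + (r * o + 1) ≡ z * (2 * o) + (s * s + 1)) n≡ (reflect o s)
      ...   | inj₂ (j , e) = ⊥-elim (even≢3 (suc (k + j)) (trans (cong (_% 4) (trans (both k j) (trans (cong (suc (2 * k) +_) (sym e)) (m+[n∸m]≡n (<⇒≤ r<n))))) n≡3))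
        where
        both : ∀ k j → 2 * suc (k + j) ≡ suc (2 * k) + suc (2 * j)
        both = solve-∀
        even≢3 : ∀ i → (2 * i) % 4 ≢ 3
        even≢3 i h = cases (i % 4) (m%n<n i 4) (trans (sym (%-distribˡ-* 2 i 4)) h)
          where
          cases : ∀ r → r < 4 → (2 * r) % 4 ≢ 3
          cases 0 _ ()
          cases 1 _ ()
          cases 2 _ ()
          cases 3 _ ()
          cases (suc (suc (suc (suc _)))) (s≤s (s≤s (s≤s (s≤s ())))) _

open Descent using (¬∣x²+1)

-- The field of residues modulo p.

module PrimeField (p : ℕ) .{{nonZero : NonZero p}} (p-prime : Prime p) (p≡3 : p % 4 ≡ 3) (7≤p : 7 ℕ.≤ p) where
  φ : ℕ → Fin p
  φ n = n mod p

  toℕ-φ : ∀ n → toℕ (φ n) ≡ n % p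
  toℕ-φ n = Finₚ.toℕ-fromℕ< _

  φ-cong : ∀ {m n} → m % p ≡ n % p → φ m ≡ φ n
  φ-cong {m} {n} e = Finₚ.toℕ-injective (trans (toℕ-φ m) (trans e (sym (toℕ-φ n))))

  φ-toℕ : ∀ x → φ (toℕ x) ≡ x
  φ-toℕ x = Finₚ.toℕ-injective (trans (toℕ-φ (toℕ x)) (m<n⇒m%n≡m (Finₚ.toℕ<n x)))

  infixl 6 _+_
  infixl 7 _*_
  _+_ _*_ : Fin p → Fin p → Fin p
  x + y = φ (toℕ x ℕ.+ toℕ y)
  x * y = φ (toℕ x ℕ.* toℕ y)

  -_ : Fin p → Fin p
  - x = φ (p ∸ toℕ x)

  0# 1# : Fin p
  0# = φ 0
  1# = φ 1

  φ-+ : ∀ m n → φ (m ℕ.+ n) ≡ φ m + φ n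
  φ-+ m n = φ-cong (trans (%-distribˡ-+ m n p) (cong₂ (λ a b → (a ℕ.+ b) % p) (sym (toℕ-φ m)) (sym (toℕ-φ n))))

  φ-* : ∀ m n → φ (m ℕ.* n) ≡ φ m * φ n
  φ-* m n = φ-cong (trans (%-distribˡ-* m n p) (cong₂ (λ a b → (a ℕ.* b) % p) (sym (toℕ-φ m)) (sym (toℕ-φ n))))

  φ-+ˡ : ∀ m y → φ (m ℕ.+ toℕ y) ≡ φ m + y
  φ-+ˡ m y = trans (φ-+ m (toℕ y)) (cong (φ m +_) (φ-toℕ y))

  φ-+ʳ : ∀ x n → φ (toℕ x ℕ.+ n) ≡ x + φ n
  φ-+ʳ x n = trans (φ-+ (toℕ x) n) (cong (_+ φ n) (φ-toℕ x))

  φ-*ˡ : ∀ m y → φ (m ℕ.* toℕ y) ≡ φ m * y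
  φ-*ˡ m y = trans (φ-* m (toℕ y)) (cong (φ m *_) (φ-toℕ y))

  φ-*ʳ : ∀ x n → φ (toℕ x ℕ.* n) ≡ x * φ n
  φ-*ʳ x n = trans (φ-* (toℕ x) n) (cong (_* φ n) (φ-toℕ x))

  toℕ-0# : toℕ 0# ≡ 0
  toℕ-0# = trans (toℕ-φ 0) (n∣m⇒m%n≡0 0 p (divides 0 refl))

  φ-multiple : ∀ {n} → p ∣ n → φ n ≡ 0#
  φ-multiple {n} d = Finₚ.toℕ-injective (trans (toℕ-φ n) (trans (n∣m⇒m%n≡0 n p d) (sym toℕ-0#)))

  φ-≡0 : ∀ n → φ n ≡ 0# → p ∣ n
  φ-≡0 n e = m%n≡0⇒n∣m n p (trans (sym (toℕ-φ n)) (trans (cong toℕ e) toℕ-0#))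

  +-comm : ∀ x y → x + y ≡ y + x
  +-comm x y = cong φ (ℕₚ.+-comm (toℕ x) (toℕ y))

  *-comm : ∀ x y → x * y ≡ y * x
  *-comm x y = cong φ (ℕₚ.*-comm (toℕ x) (toℕ y))

  +-assoc : ∀ x y z → (x + y) + z ≡ x + (y + z)
  +-assoc x y z = trans (sym (φ-+ˡ (toℕ x ℕ.+ toℕ y) z)) (trans (cong φ (ℕₚ.+-assoc (toℕ x) (toℕ y) (toℕ z))) (φ-+ʳ x (toℕ y ℕ.+ toℕ z)))

  *-assoc : ∀ x y z → (x * y) * z ≡ x * (y * z)
  *-assoc x y z = trans (sym (φ-*ˡ (toℕ x ℕ.* toℕ y) z)) (trans (cong φ (ℕₚ.*-assoc (toℕ x) (toℕ y) (toℕ z))) (φ-*ʳ x (toℕ y ℕ.* toℕ z)))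

  +-identityˡ : ∀ x → 0# + x ≡ x
  +-identityˡ x = trans (sym (φ-+ˡ 0 x)) (φ-toℕ x)

  *-identityˡ : ∀ x → 1# * x ≡ x
  *-identityˡ x = trans (sym (φ-*ˡ 1 x)) (trans (cong φ (ℕₚ.*-identityˡ (toℕ x))) (φ-toℕ x))

  -‿inverseˡ : ∀ x → - x + x ≡ 0#
  -‿inverseˡ x = trans (sym (φ-+ˡ (p ∸ toℕ x) x)) (trans (cong φ (m∸n+n≡m (<⇒≤ (Finₚ.toℕ<n x)))) (φ-multiple (divides 1 (sym (ℕₚ.*-identityˡ p)))))

  distribˡ : ∀ x y z → x * (y + z) ≡ x * y + x * z
  distribˡ x y z = trans (sym (φ-*ʳ x (toℕ y ℕ.+ toℕ z))) (trans (cong φ (ℕₚ.*-distribˡ-+ (toℕ x) (toℕ y) (toℕ z))) (φ-+ (toℕ x ℕ.* toℕ y) (toℕ x ℕ.* toℕ z)))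

  isCommutativeRing : IsCommutativeRing _≡_ _+_ _*_ -_ 0# 1#
  isCommutativeRing = record
    { isRing = record
      { +-isAbelianGroup = record
        { isGroup = record
          { isMonoid = record
            { isSemigroup = record { isMagma = record { isEquivalence = isEquivalence ; ∙-cong = cong₂ _+_ } ; assoc = +-assoc }
            ; identity = +-identityˡ , λ x → trans (+-comm x 0#) (+-identityˡ x) }
          ; inverse = -‿inverseˡ , λ x → trans (+-comm x (- x)) (-‿inverseˡ x)
          ; ⁻¹-cong = cong -_ }
        ; comm = +-comm }
      ; *-cong = cong₂ _*_
      ; *-assoc = *-assoc
      ; *-identity = *-identityˡ , λ x → trans (*-comm x 1#) (*-identityˡ x)
      ; distrib = distribˡ , λ x y z → trans (*-comm (y + z) x) (trans (distribˡ x y z) (cong₂ _+_ (*-comm x y) (*-comm x z))) }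
    ; *-comm = *-comm }

  private
    R : CommutativeRing _ _
    R = record { isCommutativeRing = isCommutativeRing }
    open RingProperties (CommutativeRing.ring R) using (-‿distribʳ-*)
    open SemiringMult (CommutativeRing.semiring R) using (1+×) renaming (_×_ to _·_)

  Inverse : Fin p → Set
  Inverse x = Σ (Fin p) λ y → x ≢ 0# → x * y ≡ 1#

  inverse : ∀ x → Inverse x
  inverse x with x Finₚ.≟ 0#
  ... | yes x≡0 = 0# , λ x≢0 → ⊥-elim (x≢0 x≡0)
  ... | no x≢0 = from (coprime-Bézout (prime⇒coprime p-prime {{ℕ.≢-nonZero toℕ≢0}} (Finₚ.toℕ<n x)))
    where
    toℕ≢0 : toℕ x ≢ 0
    toℕ≢0 e = x≢0 (trans (sym (φ-toℕ x)) (cong φ e))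
    from : Bézout.Identity 1 p (toℕ x) → Inverse x
    from (Bézout.+- a b e) = - φ b , λ _ → trans (sym (-‿distribʳ-* x (φ b)))
      (sym (GroupProperties.inverseˡ-unique (CommutativeRing.+-group R) 1# (x * φ b)
        (trans (cong (1# +_) (sym (trans (cong φ (ℕₚ.*-comm b (toℕ x))) (φ-*ʳ x b)))) (trans (sym (φ-+ 1 (b ℕ.* toℕ x))) (trans (cong φ e) (φ-multiple (n∣m*n a)))))))
    from (Bézout.-+ a b e) = φ b , λ _ → trans (sym (φ-*ʳ x b)) (trans (cong φ (trans (ℕₚ.*-comm (toℕ x) b) (sym e)))
      (trans (φ-+ 1 (a ℕ.* p)) (trans (cong (1# +_) (φ-multiple (n∣m*n a))) (trans (+-comm 1# 0#) (+-identityˡ 1#)))))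

  ·-φ : ∀ n → n · 1# ≡ φ n
  ·-φ zero = refl
  ·-φ (suc n) = trans (1+× n 1#) (trans (cong (1# +_) (·-φ n)) (sym (φ-+ 1 n)))

  x²+1≢0 : ∀ x → x * x + 1# ≢ 0#
  x²+1≢0 x e = ¬∣x²+1 p p≡3 (toℕ x) (φ-≡0 _ (trans (φ-+ (toℕ x ℕ.* toℕ x) 1) e))

  -- For x ≠ 0 the quotient y / x would be a square root of -1.
  anisotropic : ∀ x y → x * x + y * y ≡ 0# → x ≡ 0#
  anisotropic x y e with x Finₚ.≟ 0#
  ... | yes x≡0 = x≡0
  ... | no x≢0 = ⊥-elim (x²+1≢0 (y * i) (begin
    y * i * (y * i) + 1# ≡⟨ cong (y * i * (y * i) +_) (trans (cong₂ _*_ xi≡1 xi≡1) (*-identityˡ 1#)) ⟨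
    y * i * (y * i) + x * i * (x * i) ≡⟨ +-comm (y * i * (y * i)) (x * i * (x * i)) ⟩
    x * i * (x * i) + y * i * (y * i) ≡⟨ cong₂ _+_ (square x) (square y) ⟩
    i * i * (x * x) + i * i * (y * y) ≡⟨ distribˡ (i * i) _ _ ⟨
    i * i * (x * x + y * y) ≡⟨ cong (i * i *_) e ⟩
    i * i * 0# ≡⟨ CommutativeRing.zeroʳ R (i * i) ⟩
    0# ∎))
    where
    open ≡-Reasoning
    i = proj₁ (inverse x)
    xi≡1 : x * i ≡ 1#
    xi≡1 = proj₂ (inverse x) x≢0
    square : ∀ z → z * i * (z * i) ≡ i * i * (z * z)
    square z = trans (cong₂ _*_ (*-comm z i) (*-comm z i)) (trans (*-assoc i z (i * z)) (trans (cong (i *_) (trans (sym (*-assoc z i z)) (trans (cong (_* z) (*-comm z i)) (*-assoc i z z)))) (sym (*-assoc i i (z * z)))))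

  𝔽ₚ : FiniteField
  𝔽ₚ = record
    { F = Fin p ; _+_ = _+_ ; _*_ = _*_ ; -_ = -_ ; 0# = 0# ; 1# = 1#
    ; isCommutativeRing = isCommutativeRing
    ; _≟_ = Finₚ._≟_
    ; _⁻¹ = λ x → proj₁ (inverse x)
    ; *-inverse = λ x → proj₂ (inverse x)
    ; elements = allFin p
    ; elements-complete = ∈-allFin
    ; elements-unique = Uniqueₚ.allFin⁺ p
    ; characteristic = λ n 0<n n<p e → <⇒≢ 0<n (sym (trans (sym (m<n⇒m%n≡m (≤-trans n<p (≤-reflexive length-allFin))))
        (trans (sym (toℕ-φ n)) (trans (cong toℕ (trans (sym (·-φ n)) e)) toℕ-0#))))
    ; anisotropic = anisotropic
    ; order≥7 = ≤-trans 7≤p (≤-reflexive (sym length-allFin)) }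
    where
    length-allFin : length (allFin p) ≡ p
    length-allFin = Listₚ.length-tabulate {n = p} (λ i → i)

-- Points of the paraboloid as points of the plane.

module OnParaboloid (p : ℕ) .{{nonZero : NonZero p}} (p-prime : Prime p) (p≡3 : p % 4 ≡ 3) (large : threshold ℕ.< p) where
  7≤p : 7 ℕ.≤ p
  7≤p = ≤-trans (m≤m+n 7 _) (<⇒≤ large)
  open PrimeField p p-prime p≡3 7≤p using (𝔽ₚ; φ-toℕ; φ-cong; φ-+; toℕ-0#; 0#; +-identityˡ) renaming (_+_ to _+ₚ_; _*_ to _*ₚ_)
  open PlaneGeometry 𝔽ₚ using (0²; _≟²_; norm)
  open ParaboloidProducts 𝔽ₚ using (Π; products-sparse; products-dense)
  open Inversion 𝔽ₚ using (paraboloid-product)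

  open FieldTheory 𝔽ₚ using (zeroˡ)

  planar : Pt p → Fin p × Fin p
  planar (x₁ , x₂ , _) = x₁ , x₂

  third : ∀ x → InP3 p x → proj₂ (proj₂ x) ≡ norm (planar x)
  third (x₁ , x₂ , x₃) h = trans (sym (φ-toℕ x₃)) (trans (φ-cong (trans (cong (_% p) h) (m%n%n≡m%n _ p))) (φ-+ (toℕ x₁ ℕ.* toℕ x₁) (toℕ x₂ ℕ.* toℕ x₂)))

  planar-injective : ∀ x y → InP3 p x → InP3 p y → planar x ≡ planar y → x ≡ y
  planar-injective x@(x₁ , x₂ , x₃) y@(y₁ , y₂ , y₃) hx hy e = cong₂ _,_ (cong proj₁ e) (cong₂ _,_ (cong proj₂ e) (trans (third x hx) (trans (cong norm e) (sym (third y hy)))))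

  dot-planar : ∀ x y → InP3 p x → InP3 p y → dot p x y ≡ paraboloid-product (planar x) (planar y)
  dot-planar x@(x₁ , x₂ , x₃) y@(y₁ , y₂ , y₃) hx hy =
    trans (φ-+ (toℕ x₁ ℕ.* toℕ y₁ ℕ.+ toℕ x₂ ℕ.* toℕ y₂) (toℕ x₃ ℕ.* toℕ y₃))
      (cong₂ _+ₚ_ (φ-+ (toℕ x₁ ℕ.* toℕ y₁) (toℕ x₂ ℕ.* toℕ y₂)) (cong₂ _*ₚ_ (third x hx) (third y hy)))

  module _ (E : List (Pt p)) (unique-E : Unique E) (on-P : All (InP3 p) E) where
    Origin : Pt p → Set
    Origin x = planar x ≡ 0²

    origin? : ∀ x → Dec (Origin x)
    origin? x = planar x ≟² 0²

    punctured : List (Pt p)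
    punctured = filter (λ x → ¬? (origin? x)) E

    -- The origin has no pin and is removed; it is one point, as the planar part determines a point
    -- of the paraboloid.
    E≤1+punctured : length E ℕ.≤ suc (length punctured)
    E≤1+punctured = begin
      length E ≡⟨ ℕₚ.*-identityʳ _ ⟨
      length E ℕ.* 1 ≡⟨ ∑-const E 1 ⟨
      ∑ E (λ _ → 1) ≤⟨ ∑-mono E (λ {x} _ → one (origin? x)) ⟩
      ∑ E (λ x → 𝟙 (origin? x) ℕ.+ 𝟙 (¬? (origin? x))) ≡⟨ ∑-+ E _ _ ⟩
      ∑ E (λ x → 𝟙 (origin? x)) ℕ.+ ∑ E (λ x → 𝟙 (¬? (origin? x))) ≤⟨ +-mono-≤
        (∑-at-most-one origin? unique-E (λ {x} {y} x∈ y∈ ox oy → planar-injective x y (All.lookup on-P x∈) (All.lookup on-P y∈) (trans ox (sym oy))))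
        (≤-reflexive (sym (length-filter-∑ (λ x → ¬? (origin? x)) E))) ⟩
      suc (length punctured) ∎
      where
      open ≤-Reasoning
      one : ∀ {P : Set} (d : Dec P) → 1 ℕ.≤ 𝟙 d ℕ.+ 𝟙 (¬? d)
      one (yes _) = s≤s z≤n
      one (no _) = s≤s z≤n

    offPlane⇒punctured : 1 ℕ.≤ length (offPlane E) → 1 ℕ.≤ length punctured
    offPlane⇒punctured h = from (offPlane E) refl h
      where
      nonempty : ∀ {x} → x ∈ punctured → 1 ℕ.≤ length punctured
      nonempty {x} i = some punctured i
        where
        some : ∀ xs → x ∈ xs → 1 ℕ.≤ length xs
        some (_ ∷ _) _ = s≤s z≤n
      from : ∀ xs → xs ≡ offPlane E → 1 ℕ.≤ length xs → 1 ℕ.≤ length punctured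
      from (x ∷ xs) e _ = nonempty {x} (∈-filter⁺ (λ x → ¬? (origin? x)) (proj₁ x∈) (λ o → proj₂ x∈ (flat o)))
        where
        x∈ : x ∈ E × toℕ (proj₂ (proj₂ x)) ≢ 0
        x∈ = ∈-filter⁻ (λ x → ¬? (toℕ (proj₂ (proj₂ x)) ℕ.≟ 0)) {xs = E} (subst (x ∈_) e (here refl))
        flat : Origin x → toℕ (proj₂ (proj₂ x)) ≡ 0
        flat o = trans (cong toℕ (trans (third x (All.lookup on-P (proj₁ x∈))) (trans (cong norm o) (trans (cong₂ _+ₚ_ (zeroˡ 0#) (zeroˡ 0#)) (+-identityˡ 0#))))) toℕ-0#

    Hit : Fin p → Set
    Hit t = t ∈ products p E

    hit? : ∀ t → Dec (Hit t)
    hit? t = any? (λ s → t Finₚ.≟ s) (products p E)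

    -- Only the first `N` points are used, so that a large set can be cut down to about p^(5/4)
    -- points.
    module _ (N : ℕ) (N≤ : N ℕ.≤ length punctured) where
      private
        S = take N punctured
        S∈ : All (λ x → x ∈ E × ¬ Origin x) S
        S∈ = Allₚ.take⁺ N (All.tabulate (∈-filter⁻ (λ x → ¬? (origin? x))))
        B = map planar S
        length-B : length B ≡ N
        length-B = trans (Listₚ.length-map planar S) (trans (Listₚ.length-take N punctured) (m≤n⇒m⊓n≡m N≤))
        in-P : ∀ {x} → x ∈ S → InP3 p x
        in-P i = All.lookup on-P (proj₁ (All.lookup S∈ i))
        unique-B : Unique B
        unique-B = unique-map planar S (Uniqueₚ.take⁺ N (Uniqueₚ.filter⁺ (λ x → ¬? (origin? x)) unique-E)) (λ {x} {y} i j e → planar-injective x y (in-P i) (in-P j) e)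
        nonzero : ∀ {b} → b ∈ B → b ≢ 0²
        nonzero b∈ = from (∈-map⁻ planar b∈)
          where
          from : ∀ {b} → (∃ λ x → x ∈ S × b ≡ planar x) → b ≢ 0²
          from (x , i , refl) = proj₂ (All.lookup S∈ i)
        hits : ∀ {b c} → b ∈ B → c ∈ B → Hit (paraboloid-product b c)
        hits b∈ c∈ = from (∈-map⁻ planar b∈) (∈-map⁻ planar c∈)
          where
          from : ∀ {b c} → (∃ λ x → x ∈ S × b ≡ planar x) → (∃ λ y → y ∈ S × c ≡ planar y) → Hit (paraboloid-product b c)
          from (x , i , refl) (y , j , refl) = subst Hit (dot-planar x y (in-P i) (in-P j))
            (∈-concat⁺′ (∈-map⁺ (λ y → dot p x y) (proj₁ (All.lookup S∈ j))) (∈-map⁺ (λ x → map (λ y → dot p x y) E) (proj₁ (All.lookup S∈ i))))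
        order≡p : length (allFin p) ≡ p
        order≡p = Listₚ.length-tabulate {n = p} (λ i → i)
        Π≡ : Π B unique-B nonzero Hit hit? hits ≡ prodSetSize p E
        Π≡ = sym (length-filter-∑ hit? (allFin p))

      module _ (1≤N : 1 ℕ.≤ N) (N⁴≤ : N ^ 4 ℕ.≤ 16 ℕ.* p ^ 5) where
        private
          1≤ = subst (1 ℕ.≤_) (sym length-B) 1≤N
          bounded = subst₂ (λ n q → n ^ 4 ℕ.≤ 16 ℕ.* q ^ 5) (sym length-B) (sym order≡p) N⁴≤
          beyond = subst (threshold ℕ.<_) (sym order≡p) large

        sparse : N ℕ.* N ℕ.≤ cube-constant ℕ.* prodSetSize p E ^ 3
        sparse = subst₂ (λ n π → n ℕ.* n ℕ.≤ cube-constant ℕ.* π ^ 3) length-B Π≡ (products-sparse B unique-B nonzero Hit hit? hits 1≤ bounded beyond)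

        dense : p ^ 5 ℕ.≤ N ^ 4 → p ℕ.≤ 252 ℕ.* prodSetSize p E
        dense h = subst₂ (λ q π → q ℕ.≤ 252 ℕ.* π) order≡p Π≡
          (products-dense B unique-B nonzero Hit hit? hits 1≤ bounded beyond (subst₂ (λ q n → q ^ 5 ℕ.≤ n ^ 4) (sym order≡p) (sym length-B) h))

-- The two bounds with natural number constants.

module ProductSets where
  open import Data.Nat hiding (_≟_)
  open import Data.Nat.Properties hiding (_≟_)
  open +-*-Solver using (solve; _:=_; _:+_; _:*_; _:^_; con)
  open ≤-Reasoning

  ^4-unfold : ∀ C n → C * (C * (C * (C * n))) ≡ C ^ 4 * n
  ^4-unfold = solve 2 (λ C n → C :* (C :* (C :* (C :* n))) := C :^ 4 :* n) refl

  prodSetSize-positive : ∀ p .{{_ : NonZero p}} (E : List (Pt p)) → 1 ≤ length E → 1 ≤ prodSetSize p E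
  prodSetSize-positive p E@(x ∷ _) _ = ∈-length (∈-filter⁺ (λ t → any? (λ s → t Finₚ.≟ s) (products p E)) (∈-allFin (dot p x x))
    (∈-concat⁺′ (∈-map⁺ (dot p x) {x = x} {xs = E} (here refl)) (∈-map⁺ (λ x → map (dot p x) E) {x = x} {xs = E} (here refl))))

  -- Up to `threshold` a single product is enough; beyond it, `floor` + 1 points are kept and the
  -- dense estimate applies to them.
  dense-products : ∀ p .{{_ : NonZero p}} → Prime p → p % 4 ≡ 3 → (E : List (Pt p)) → Unique E → All (InP3 p) E →
    81 * p ^ 5 ≤ length E ^ 4 → p ≤ suc (252 + threshold) * prodSetSize p E
  dense-products p p-prime p≡3 E unique-E on-P h = from (≤-<-connex p threshold)
    where
    Π = prodSetSize p E
    nonempty : ∀ e → 81 * p ^ 5 ≤ e ^ 4 → 1 ≤ e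
    nonempty zero l = ⊥-elim (<⇒≱ (≤-trans (m^n>0 p 5) (m≤n*m (p ^ 5) 81)) l)
    nonempty (suc _) _ = s≤s z≤n
    from : p ≤ threshold ⊎ threshold < p → p ≤ suc (252 + threshold) * Π
    from (inj₁ l) = ≤-trans (≤-trans l (m≤n+m threshold 253)) (m≤m*n _ Π {{>-nonZero (prodSetSize-positive p E (nonempty (length E) h))}})
    from (inj₂ large) = ≤-trans (O.dense E unique-E on-P (suc floor) (next≤size h (O.E≤1+punctured E unique-E on-P)) (s≤s z≤n) next≤ floor-above)
        (*-monoˡ-≤ Π (m≤n⇒m≤1+n (m≤m+n 252 threshold)))
      where
      module O = OnParaboloid p p-prime p≡3 large
      open QuarterPower (quarter-power-of p)
      open QuarterPowers O.7≤p (quarter-power-of p)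

  -- One summand for each case of `sparse-products`: at most about p^(5/4) points apart from the
  -- origin, more than that, and p up to `threshold`.
  sparse-constant : ℕ → ℕ
  sparse-constant C = 4 * cube-constant + C ^ 2 * 252 ^ 3 + C ^ 4 * threshold ^ 5

  sparse-products : ∀ C p .{{_ : NonZero p}} → Prime p → p % 4 ≡ 3 → (E : List (Pt p)) → Unique E → All (InP3 p) E →
    length E ^ 4 ≤ C ^ 4 * p ^ 5 → (1 ≤ length E → 1 ≤ length (offPlane E)) → length E ^ 2 ≤ sparse-constant C * prodSetSize p E ^ 3
  sparse-products C p p-prime p≡3 [] _ _ _ _ = z≤n
  sparse-products C p p-prime p≡3 E@(_ ∷ _) unique-E on-P h off = from (≤-<-connex p threshold)
    where
    Π = prodSetSize p E
    e = length E
    X = 4 * cube-constant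
    Y = C ^ 2 * 252 ^ 3
    Z = C ^ 4 * threshold ^ 5
    from : p ≤ threshold ⊎ threshold < p → e ^ 2 ≤ sparse-constant C * Π ^ 3
    from (inj₁ l) = begin
      e ^ 2 ≤⟨ ^-monoʳ-≤ e {2} {4} (s≤s (s≤s z≤n)) ⟩
      e ^ 4 ≤⟨ h ⟩
      C ^ 4 * p ^ 5 ≤⟨ *-monoʳ-≤ (C ^ 4) (^-monoˡ-≤ 5 l) ⟩
      Z ≤⟨ m≤n+m Z (X + Y) ⟩
      sparse-constant C ≤⟨ m≤m*n _ (Π ^ 3) {{m^n≢0 Π 3 {{>-nonZero (prodSetSize-positive p E (s≤s z≤n))}}}} ⟩
      sparse-constant C * Π ^ 3 ∎
    from (inj₂ large) = split (≤-total (suc floor) m)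
      where
      module O = OnParaboloid p p-prime p≡3 large
      open QuarterPower (quarter-power-of p)
      open QuarterPowers O.7≤p (quarter-power-of p)
      m = length (O.punctured E unique-E on-P)
      1≤m : 1 ≤ m
      1≤m = O.offPlane⇒punctured E unique-E on-P (off (s≤s z≤n))
      split : suc floor ≤ m ⊎ m ≤ suc floor → e ^ 2 ≤ sparse-constant C * Π ^ 3
      -- The size bound gives e² ≤ C² p³, since p⁵ ≤ p⁶, and the dense estimate gives p ≤ 252 Π.
      split (inj₁ l) = begin
        e ^ 2 ≤⟨ root-≤ 2 {e ^ 2} {C ^ 2 * p ^ 3} (begin
          (e ^ 2) ^ 2 ≡⟨ r₁ e ⟩
          e ^ 4 ≤⟨ h ⟩
          C ^ 4 * p ^ 5 ≤⟨ *-monoʳ-≤ (C ^ 4) (^-monoʳ-≤ p {5} {6} (n≤1+n 5)) ⟩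
          C ^ 4 * p ^ 6 ≡⟨ r₂ C p ⟩
          (C ^ 2 * p ^ 3) ^ 2 ∎) ⟩
        C ^ 2 * p ^ 3 ≤⟨ *-monoʳ-≤ (C ^ 2) (^-monoˡ-≤ 3 (O.dense E unique-E on-P (suc floor) l (s≤s z≤n) next≤ floor-above)) ⟩
        C ^ 2 * (252 * Π) ^ 3 ≡⟨ r₃ (C ^ 2) 252 Π ⟩
        Y * Π ^ 3 ≤⟨ *-monoˡ-≤ (Π ^ 3) (≤-trans (m≤n+m Y X) (m≤m+n (X + Y) Z)) ⟩
        sparse-constant C * Π ^ 3 ∎
        where
        r₁ : ∀ e → (e ^ 2) ^ 2 ≡ e ^ 4
        r₁ = solve 1 (λ e → (e :^ 2) :^ 2 := e :^ 4) refl
        r₂ : ∀ C p → C ^ 4 * p ^ 6 ≡ (C ^ 2 * p ^ 3) ^ 2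
        r₂ = solve 2 (λ C p → C :^ 4 :* p :^ 6 := (C :^ 2 :* p :^ 3) :^ 2) refl
        r₃ : ∀ c d x → c * (d * x) ^ 3 ≡ c * d ^ 3 * x ^ 3
        r₃ = solve 3 (λ c d x → c :* (d :* x) :^ 3 := c :* d :^ 3 :* x :^ 3) refl
      split (inj₂ l) = begin
        e ^ 2 ≤⟨ ^-monoˡ-≤ 2 (begin e ≤⟨ O.E≤1+punctured E unique-E on-P ⟩ suc m ≤⟨ +-monoˡ-≤ m 1≤m ⟩ m + m ∎) ⟩
        (m + m) ^ 2 ≡⟨ r₁ m ⟩
        4 * (m * m) ≤⟨ *-monoʳ-≤ 4 (O.sparse E unique-E on-P m ≤-refl 1≤m (≤-trans (^-monoˡ-≤ 4 l) next≤)) ⟩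
        4 * (cube-constant * Π ^ 3) ≡⟨ *-assoc 4 cube-constant (Π ^ 3) ⟨
        X * Π ^ 3 ≤⟨ *-monoˡ-≤ (Π ^ 3) (≤-trans (m≤m+n X Y) (m≤m+n (X + Y) Z)) ⟩
        sparse-constant C * Π ^ 3 ∎
        where
        r₁ : ∀ m → (m + m) ^ 2 ≡ 4 * (m * m)
        r₁ = solve 1 (λ m → (m :+ m) :^ 2 := con 4 :* (m :* m)) refl

open ProductSets

-- Passage to rational constants.

open import Data.Rational using (ℚ; mkℚ; 0ℚ; toℚᵘ; Positive; nonNegative; _/_; *≤*) renaming (_<_ to _<ℚ_; _≤_ to _≤ℚ_; _*_ to _*ℚ_; positive to positiveℚ)
import Data.Rational.Properties as ℚₚ
open import Data.Rational.Unnormalised.Base as ℚᵘ using (ℚᵘ; mkℚᵘ; _≃_; *≡*)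
import Data.Rational.Unnormalised.Properties as ℚᵘₚ

ℕ→ℚ-value : ∀ n → toℚᵘ (ℕ→ℚ n) ≃ mkℚᵘ (pos n) 0
ℕ→ℚ-value n = ℚₚ.toℚᵘ-fromℚᵘ (mkℚᵘ (pos n) 0)

ℕ→ℚ-mono : ∀ {m n} → m ℕ.≤ n → ℕ→ℚ m ≤ℚ ℕ→ℚ n
ℕ→ℚ-mono {m} {n} h = ℚₚ.toℚᵘ-cancel-≤ (begin
  toℚᵘ (ℕ→ℚ m) ≃⟨ ℕ→ℚ-value m ⟩
  mkℚᵘ (pos m) 0 ≤⟨ ℚᵘ.*≤* (ℤₚ.*-monoʳ-≤-nonNeg (pos 1) (ℤ.+≤+ h)) ⟩
  mkℚᵘ (pos n) 0 ≃⟨ ℕ→ℚ-value n ⟨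
  toℚᵘ (ℕ→ℚ n) ∎)
  where open ℚᵘₚ.≤-Reasoning

ℕ→ℚ-cancel : ∀ {m n} → ℕ→ℚ m ≤ℚ ℕ→ℚ n → m ℕ.≤ n
ℕ→ℚ-cancel {m} {n} h = from (begin
  mkℚᵘ (pos m) 0 ≃⟨ ℕ→ℚ-value m ⟨
  toℚᵘ (ℕ→ℚ m) ≤⟨ ℚₚ.toℚᵘ-mono-≤ h ⟩
  toℚᵘ (ℕ→ℚ n) ≃⟨ ℕ→ℚ-value n ⟩
  mkℚᵘ (pos n) 0 ∎)
  where
  open ℚᵘₚ.≤-Reasoning
  from : mkℚᵘ (pos m) 0 ℚᵘ.≤ mkℚᵘ (pos n) 0 → m ℕ.≤ n
  from (ℚᵘ.*≤* l) = ℤₚ.drop‿+≤+ (ℤₚ.*-cancelʳ-≤-pos (pos m) (pos n) (pos 1) l)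

ℕ→ℚ-* : ∀ m n → ℕ→ℚ (m ℕ.* n) ≡ ℕ→ℚ m *ℚ ℕ→ℚ n
ℕ→ℚ-* m n = ℚₚ.toℚᵘ-injective (begin-equality
  toℚᵘ (ℕ→ℚ (m ℕ.* n)) ≃⟨ ℕ→ℚ-value (m ℕ.* n) ⟩
  mkℚᵘ (pos (m ℕ.* n)) 0 ≃⟨ *≡* (cong (ℤ._* pos 1) (ℤₚ.pos-* m n)) ⟩
  mkℚᵘ (pos m) 0 ℚᵘ.* mkℚᵘ (pos n) 0 ≃⟨ ℚᵘₚ.*-cong (ℕ→ℚ-value m) (ℕ→ℚ-value n) ⟨
  toℚᵘ (ℕ→ℚ m) ℚᵘ.* toℚᵘ (ℕ→ℚ n) ≃⟨ ℚₚ.toℚᵘ-homo-* (ℕ→ℚ m) (ℕ→ℚ n) ⟨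
  toℚᵘ (ℕ→ℚ m *ℚ ℕ→ℚ n) ∎)
  where open ℚᵘₚ.≤-Reasoning

ceiling : ∀ q → Σ ℕ λ C → q ≤ℚ ℕ→ℚ C
ceiling q@(mkℚ (pos m) d _) = m , ℚₚ.toℚᵘ-cancel-≤ (begin
  toℚᵘ q ≤⟨ ℚᵘ.*≤* (subst₂ ℤ._≤_ (ℤₚ.pos-* m 1) (ℤₚ.pos-* m (suc d)) (ℤ.+≤+ (*-monoʳ-≤ m (s≤s z≤n)))) ⟩
  mkℚᵘ (pos m) 0 ≃⟨ ℕ→ℚ-value m ⟨
  toℚᵘ (ℕ→ℚ m) ∎)
  where open ℚᵘₚ.≤-Reasoning
ceiling q@(mkℚ -[1+ m ] d _) = 0 , *≤* ℤ.-≤+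

ceiling-* : ∀ q C x n → 0ℚ <ℚ q → q ≤ℚ ℕ→ℚ C → x ≤ℚ ℕ→ℚ n → q *ℚ x ≤ℚ ℕ→ℚ (C ℕ.* n)
ceiling-* q C x n 0<q q≤C x≤n = begin
  q *ℚ x ≤⟨ ℚₚ.*-monoˡ-≤-nonNeg q {{ℚₚ.pos⇒nonNeg q {{positiveℚ 0<q}}}} x≤n ⟩
  q *ℚ ℕ→ℚ n ≤⟨ ℚₚ.*-monoʳ-≤-nonNeg (ℕ→ℚ n) {{nonNegative {p = ℕ→ℚ n} (ℕ→ℚ-mono {0} {n} z≤n)}} q≤C ⟩
  ℕ→ℚ C *ℚ ℕ→ℚ n ≡⟨ ℕ→ℚ-* C n ⟨
  ℕ→ℚ (C ℕ.* n) ∎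
  where open ℚₚ.≤-Reasoning

unit : ℕ → ℚ
unit d = pos 1 / suc d

unit-positive : ∀ d → Positive (unit d)
unit-positive d = ℚₚ.normalize-pos 1 (suc d)

unit-* : ∀ d x n → x ≤ℚ ℕ→ℚ (suc d ℕ.* n) → unit d *ℚ x ≤ℚ ℕ→ℚ n
unit-* d x n h = begin
  unit d *ℚ x ≤⟨ ℚₚ.*-monoˡ-≤-nonNeg (unit d) {{ℚₚ.pos⇒nonNeg (unit d) {{unit-positive d}}}} h ⟩
  unit d *ℚ ℕ→ℚ (suc d ℕ.* n) ≡⟨ ℚₚ.toℚᵘ-injective product ⟩
  ℕ→ℚ n ∎
  where
  open ℚₚ.≤-Reasoning
  product : toℚᵘ (unit d *ℚ ℕ→ℚ (suc d ℕ.* n)) ≃ toℚᵘ (ℕ→ℚ n)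
  product = ℚᵘₚ.≃-trans (ℚₚ.toℚᵘ-homo-* (unit d) (ℕ→ℚ (suc d ℕ.* n)))
    (ℚᵘₚ.≃-trans (ℚᵘₚ.*-cong (ℚₚ.toℚᵘ-fromℚᵘ (mkℚᵘ (pos 1) d)) (ℕ→ℚ-value (suc d ℕ.* n)))
    (ℚᵘₚ.≃-trans (*≡* (trans (cong (ℤ._* pos 1) (trans (ℤₚ.*-identityˡ _) (trans (cong pos (ℕₚ.*-comm (suc d) n)) (ℤₚ.pos-* n (suc d)))))
      (trans (ℤₚ.*-identityʳ _) (cong (pos n ℤ.*_) (cong pos (sym (ℕₚ.*-identityʳ (suc d)))))))) (ℚᵘₚ.≃-sym (ℕ→ℚ-value n))))

^4-* : ∀ q x → (q ^4) *ℚ x ≡ q *ℚ (q *ℚ (q *ℚ (q *ℚ x)))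
^4-* q x = trans (ℚₚ.*-assoc (q *ℚ q *ℚ q) q x) (trans (ℚₚ.*-assoc (q *ℚ q) q _) (ℚₚ.*-assoc q q _))

^3-* : ∀ q x → (q ^3) *ℚ x ≡ q *ℚ (q *ℚ (q *ℚ x))
^3-* q x = trans (ℚₚ.*-assoc (q *ℚ q) q x) (ℚₚ.*-assoc q q _)

positive-product : ∀ q n → 0ℚ <ℚ q → 1 ℕ.≤ n → ¬ (q *ℚ ℕ→ℚ n ≤ℚ 0ℚ)
positive-product q (suc n) 0<q _ h = ℚₚ.<-irrefl refl (begin-strict
  0ℚ ≡⟨ ℚₚ.*-zeroʳ q ⟨
  q *ℚ 0ℚ <⟨ ℚₚ.*-monoʳ-<-pos q {{positiveℚ 0<q}} (ℚₚ.positive⁻¹ (ℕ→ℚ (suc n)) {{ℚₚ.normalize-pos (suc n) 1}}) ⟩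
  q *ℚ ℕ→ℚ (suc n) ≤⟨ h ⟩
  0ℚ ∎)
  where open ℚₚ.≤-Reasoning

open import Data.Rational using (_<_; _≤_; _*_)

theorem1p4 :
    -- (1)
    (Σ ℚ λ C → Σ ℚ λ c → 0ℚ < C × 0ℚ < c ×
      ((p : ℕ) → .{{_ : NonZero p}} → Prime p → p % 4 ≡ 3 →
       (E : List (Pt p)) → Unique E → All (InP3 p) E →
       (C ^4) * ℕ→ℚ (p ^ 5) ≤ ℕ→ℚ (length E ^ 4) →
       c * ℕ→ℚ p ≤ ℕ→ℚ (prodSetSize p E)))
    ×
    -- (2)
    ((C₁ c₁ : ℚ) → 0ℚ < C₁ → 0ℚ < c₁ →
      Σ ℚ λ c₂ → 0ℚ < c₂ ×
      ((p : ℕ) → .{{_ : NonZero p}} → Prime p → p % 4 ≡ 3 →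
       (E : List (Pt p)) → Unique E → All (InP3 p) E →
       ℕ→ℚ (length E ^ 4) ≤ (C₁ ^4) * ℕ→ℚ (p ^ 5) →
       c₁ * ℕ→ℚ (length E) ≤ ℕ→ℚ (length (offPlane E)) →
       (c₂ ^3) * ℕ→ℚ (length E ^ 2) ≤ ℕ→ℚ (prodSetSize p E ^ 3)))
theorem1p4 = dense-case , λ C₁ c₁ 0<C₁ 0<c₁ → sparse-case C₁ c₁ 0<C₁ 0<c₁ (ceiling C₁)
  where
  -- The value of C: its fourth power is the 81 of `dense-products`.
  three = ℕ→ℚ 3
  0<three : 0ℚ < three
  0<three = ℚₚ.positive⁻¹ three

  dense-case : Σ ℚ λ C → Σ ℚ λ c → 0ℚ < C × 0ℚ < c ×
      ((p : ℕ) → .{{_ : NonZero p}} → Prime p → p % 4 ≡ 3 →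
       (E : List (Pt p)) → Unique E → All (InP3 p) E →
       (C ^4) * ℕ→ℚ (p ^ 5) ≤ ℕ→ℚ (length E ^ 4) →
       c * ℕ→ℚ p ≤ ℕ→ℚ (prodSetSize p E))
  dense-case = three , unit d , 0<three , ℚₚ.positive⁻¹ (unit d) {{unit-positive d}} , λ p p-prime p≡3 E unique-E on-P h →
    unit-* d (ℕ→ℚ p) (prodSetSize p E) (ℕ→ℚ-mono (dense-products p p-prime p≡3 E unique-E on-P (ℕ→ℚ-cancel (ℚₚ.≤-trans (ℚₚ.≤-reflexive (eighty-one (p ^ 5))) h))))
    where
    d = 252 ℕ.+ threshold
    eighty-one : ∀ n → ℕ→ℚ (81 ℕ.* n) ≡ (three ^4) * ℕ→ℚ n
    eighty-one n = ℕ→ℚ-* 81 n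

  sparse-case : (C₁ c₁ : ℚ) → 0ℚ < C₁ → 0ℚ < c₁ → (Σ ℕ λ C → C₁ ≤ ℕ→ℚ C) →
      Σ ℚ λ c₂ → 0ℚ < c₂ ×
      ((p : ℕ) → .{{_ : NonZero p}} → Prime p → p % 4 ≡ 3 →
       (E : List (Pt p)) → Unique E → All (InP3 p) E →
       ℕ→ℚ (length E ^ 4) ≤ (C₁ ^4) * ℕ→ℚ (p ^ 5) →
       c₁ * ℕ→ℚ (length E) ≤ ℕ→ℚ (length (offPlane E)) →
       (c₂ ^3) * ℕ→ℚ (length E ^ 2) ≤ ℕ→ℚ (prodSetSize p E ^ 3))
  sparse-case C₁ c₁ 0<C₁ 0<c₁ (C , C₁≤C) = c₂ , ℚₚ.positive⁻¹ c₂ {{unit-positive d}} , λ p p-prime p≡3 E unique-E on-P h off →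
    ℚₚ.≤-trans (ℚₚ.≤-reflexive (^3-* c₂ (ℕ→ℚ (length E ^ 2))))
      (cubed (prodSetSize p E ^ 3) (length E ^ 2) (sparse-products C p p-prime p≡3 E unique-E on-P
        (ℕ→ℚ-cancel (ℚₚ.≤-trans h (ℚₚ.≤-trans (ℚₚ.≤-reflexive (^4-* C₁ (ℕ→ℚ (p ^ 5)))) (fourth (p ^ 5)))))
        (λ l → nonempty (length (offPlane E)) (length E) l off)))
    where
    d = sparse-constant C
    c₂ = unit d
    -- As c₂ = 1 / (d + 1), the crude x ≤ d P ≤ (d + 1)³ P suffices, and no cube root of a constant
    -- is taken.
    cubed : ∀ P x → x ℕ.≤ d ℕ.* P → c₂ * (c₂ * (c₂ * ℕ→ℚ x)) ≤ ℕ→ℚ P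
    cubed P x h = unit-* d _ P (unit-* d _ (suc d ℕ.* P) (unit-* d (ℕ→ℚ x) (suc d ℕ.* (suc d ℕ.* P)) (ℕ→ℚ-mono
      (≤-trans h (*-mono-≤ (n≤1+n d) (≤-trans (m≤n*m P (suc d)) (m≤n*m (suc d ℕ.* P) (suc d))))))))
    fourth : ∀ n → C₁ * (C₁ * (C₁ * (C₁ * ℕ→ℚ n))) ≤ ℕ→ℚ (C ^ 4 ℕ.* n)
    fourth n = ℚₚ.≤-trans (up _ _ (up _ _ (up _ _ (up _ n ℚₚ.≤-refl)))) (ℚₚ.≤-reflexive (cong ℕ→ℚ (^4-unfold C n)))
      where
      up : ∀ x n → x ≤ ℕ→ℚ n → C₁ * x ≤ ℕ→ℚ (C ℕ.* n)
      up x n = ceiling-* C₁ C x n 0<C₁ C₁≤C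
    -- A positive proportion of points off the plane yields a point other than the origin.
    nonempty : ∀ o e → 1 ℕ.≤ e → c₁ * ℕ→ℚ e ≤ ℕ→ℚ o → 1 ℕ.≤ o
    nonempty zero e 1≤e h = ⊥-elim (positive-product c₁ e 0<c₁ 1≤e h)
    nonempty (suc _) _ _ _ = s≤s z≤n
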